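{- Let $2\le s\le k$ be integers. The following two statements hold. (1) There is an absolute constant $C>0$ such that, for edge density $c\in(0,1)$ (possibly depending on $n$), if we define $$\Upsilon_{P,1}(n,c,s,k) = \left(C\, c^{ -1}(1-c)^{ -1}\,(s\log k)\left(s\log n + \binom{k}{s}\log\log\binom{k}{s}\right)\right)^{\binom{k}{s}},$$ then the following holds. Let $A$ be a randomized algorithm for PARITY-$(k,s)$-CLIQUE with error probability less than $1/\Upsilon_{P,1}$ on hypergraphs drawn from $G(n,c,s)$. Then there exists an algorithm $B$ for PARITY-$(k,s)$-CLIQUE that has error probability less than $1/3$ on any hypergraph, such that $$T(B,n)\le \Upsilon_{P,1}\cdot\left(T(A,nk)+(nk)^s\right).$$ (2) There is an absolute constant $C>0$ such that, if we define $$\Upsilon_{P,2}(s,k) = \left(C s\log k\right)^{\binom{k}{s}},$$ then the following holds. Let $A$ be a randomized algorithm for PARITY-$(k,s)$-CLIQUE with error probability less than $1/\Upsilon_{P,2}$ on hypergraphs drawn from $G(n,1/2,s)$. Then there exists an algorithm $B$ for PARITY-$(k,s)$-CLIQUE that has error probability less than $1/3$ on any hypergraph, such that $$T(B,n)\le \Upsilon_{P,2}\cdot\left(T(A,nk)+(nk)^s\right).$$ The constants $C$ do not depend on $n,c,s,k$.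
   Context: An $s$-uniform hypergraph $G=(V(G),E(G))$ has hyperedge set $E(G)\subseteq\binom{V(G)}{s}$. A $k$-clique is a set $S\subset V(G)$ with $|S|=k$ and $\binom{S}{s}\subseteq E(G)$. PARITY-$(k,s)$-CLIQUE is the problem of computing the parity of the number of $k$-cliques of a given $s$-uniform hypergraph. $G(n,c,s)$ is the Erdős–Rényi distribution on $s$-uniform hypergraphs on $n$ vertices, in which each of the $\binom{n}{s}$ possible hyperedges is included independently with probability $c$. All algorithms are randomized, and each (possibly biased) coin flip has constant cost. $T(\mathcal A,\ell)$ denotes the worst-case runtime of algorithm $\mathcal A$ on $\ell$-vertex hypergraphs, assumed non-decreasing in $\ell$. Error probability on a distribution is over both the random input and the algorithm's random bits; error probability on any (worst-case) hypergraph is over the algorithm's random bits only. -}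

module Defs where

open import Algebra.Bundles using (CommutativeRing)
open import Algebra.Structures using (IsCommutativeRing)
import Algebra.Properties.Semiring.Exp as SemiringExp
import Algebra.Properties.Semiring.Mult as SemiringMult
open import Data.Bool.Base using (Bool; true; false; if_then_else_)
import Data.Bool.Properties as Bool
open import Data.Fin.Subset using (Subset; inside; outside; ∣_∣; _⊆_)
open import Data.Fin.Subset.Properties using (_⊆?_)
open import Data.List.Base as List using (List; []; _∷_; _++_; length; filter; head; drop)
open import Data.List.Relation.Unary.All using (All; all?)
open import Data.Maybe.Base using (Maybe; just; nothing)
import Data.Maybe.Properties as Maybe
open import Data.Nat.Base using (ℕ; zero; suc; _≤_; _∸_; _%_; _≡ᵇ_)
import Data.Nat.Base as ℕ
open import Data.Nat.Combinatorics using (_C_)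
import Data.Nat.Properties as ℕ
open import Data.Product.Base using (Σ; ∃; _×_; _,_; proj₁; proj₂)
open import Data.Sum.Base using (inj₁; inj₂)
import Data.Vec.Base as Vec
import Data.Vec.Properties as Vec
open import Level using (0ℓ)
open import Relation.Binary.Core using (Rel)
open import Relation.Binary.Definitions using (Cotransitive; DecidableEquality)
open import Relation.Binary.PropositionalEquality using (_≡_; _≢_; refl; cong)
import Relation.Binary.Reasoning.Setoid as SetoidReasoning
open import Relation.Binary.Structures using (IsStrictPartialOrder)
open import Relation.Nullary using (¬_; yes; no; does; ¬?; contradiction; _→-dec_)
import Relation.Unary as Unary

-- The library has no real numbers.  `Reals` is the usual constructive
-- axiomatisation of ℝ as a Cauchy-complete Archimedean ordered field (the
-- order is strict and cotransitive rather than decidable), together with the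
-- natural logarithm.  The last two axioms determine `log`: applied to inv x
-- they also give 1 - inv x ≤ log x.
record Reals : Set₁ where
  infix  4 _≈_ _<_ _≤ʳ_
  infixl 6 _+_ _-_
  infixl 7 _*_
  infix  8 -_
  field
    Carrier : Set
    _≈_ _<_ : Rel Carrier 0ℓ
    _+_ _*_ : Carrier → Carrier → Carrier
    -_      : Carrier → Carrier
    0# 1#   : Carrier
    isCommutativeRing    : IsCommutativeRing _≈_ _+_ _*_ -_ 0# 1#
    isStrictPartialOrder : IsStrictPartialOrder _≈_ _<_
    <-cotrans : Cotransitive _<_
    <-tight   : ∀ {x y} → ¬ x < y → ¬ y < x → x ≈ y
    0<1       : 0# < 1#
    +-monoˡ-< : ∀ z {x y} → x < y → x + z < y + z
    *-pos     : ∀ {x y} → 0# < x → 0# < y → 0# < x * y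
    inv       : ∀ x → 0# < x → Carrier
    inv-pos   : ∀ x (p : 0# < x) → 0# < inv x p
    *-inv     : ∀ x (p : 0# < x) → x * inv x p ≈ 1#

  commutativeRing : CommutativeRing 0ℓ 0ℓ
  commutativeRing = record { isCommutativeRing = isCommutativeRing }

  module R = CommutativeRing commutativeRing
  open SemiringExp R.semiring public using (_^_)
  open SemiringMult R.semiring using () renaming (_×_ to _·_)

  _-_ : Carrier → Carrier → Carrier
  x - y = x + (- y)

  _≤ʳ_ : Rel Carrier 0ℓ
  x ≤ʳ y = ¬ y < x

  ι : ℕ → Carrier
  ι n = n · 1#

  field
    archimedean : ∀ x → ∃ λ n → x < ι n
    complete    : (f : ℕ → Carrier) →
      (∀ ε → 0# < ε → ∃ λ N → ∀ m n → N ≤ m → N ≤ n → f m - f n < ε) →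
      ∃ λ l → ∀ ε → 0# < ε → ∃ λ N → ∀ n → N ≤ n → (f n - l < ε) × (l - f n < ε)
    log      : ∀ x → 0# < x → Carrier
    log-cong : ∀ {x y} (p : 0# < x) (q : 0# < y) → x ≈ y → log x p ≈ log y q
    log-*    : ∀ {x y} (p : 0# < x) (q : 0# < y) →
               log (x * y) (*-pos p q) ≈ log x p + log y q
    log-≤    : ∀ x (p : 0# < x) → log x p ≤ʳ x - 1#

module RealFacts (ℝ : Reals) where
  open Reals ℝ
  open IsStrictPartialOrder isStrictPartialOrder public
    using () renaming (trans to <-trans; <-respʳ-≈ to <-respʳ; <-respˡ-≈ to <-respˡ)

  x<y⇒0<y-x : ∀ {x y} → x < y → 0# < y - x
  x<y⇒0<y-x {x} x<y = <-respˡ (R.-‿inverseʳ x) (+-monoˡ-< (- x) x<y)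

  0<y-x⇒x<y : ∀ {x y} → 0# < y - x → x < y
  0<y-x⇒x<y {x} {y} h = <-respʳ eq (<-respˡ (R.+-identityˡ x) (+-monoˡ-< x h))
    where
    eq : y - x + x ≈ y
    eq = R.trans (R.+-assoc y (- x) x)
           (R.trans (R.+-congˡ (R.-‿inverseˡ x)) (R.+-identityʳ y))

  0<ι : ∀ n → 0# < ι (suc n)
  0<ι zero    = <-respʳ (R.sym (R.+-identityʳ 1#)) 0<1
  0<ι (suc n) = <-trans (0<ι n)
    (<-respʳ R.refl (<-respˡ (R.+-identityˡ (ι (suc n))) (+-monoˡ-< (ι (suc n)) 0<1)))

  1<ι : ∀ n → 1# < ι (suc (suc n))
  1<ι n = <-respʳ (R.+-comm (ι (suc n)) 1#)
            (<-respˡ (R.+-identityˡ 1#) (+-monoˡ-< 1# (0<ι n)))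

  log1≈0 : log 1# 0<1 ≈ 0#
  log1≈0 = begin
    l                ≈⟨ R.+-identityʳ l ⟨
    l + 0#           ≈⟨ R.+-congˡ (R.-‿inverseʳ l) ⟨
    l + (l - l)      ≈⟨ R.+-assoc l l (- l) ⟨
    l + l - l        ≈⟨ R.+-congʳ (log-* 0<1 0<1) ⟨
    log (1# * 1#) _ - l ≈⟨ R.+-congʳ (log-cong _ _ (R.*-identityˡ 1#)) ⟩
    l - l            ≈⟨ R.-‿inverseʳ l ⟩
    0#               ∎
    where
    open SetoidReasoning R.setoid
    l = log 1# 0<1

  log-pos : ∀ x (p : 0# < x) → 1# < x → 0# < log x p
  log-pos x p 1<x with <-cotrans y-1<0 (log y q)
    where
    y = inv x p
    q = inv-pos x p
    open SetoidReasoning R.setoid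
    open import Algebra.Properties.Ring R.ring using (-‿distribʳ-*)
    eq : y * (x - 1#) ≈ 1# - y
    eq = begin
      y * (x - 1#)         ≈⟨ R.distribˡ y x (- 1#) ⟩
      y * x + y * (- 1#)   ≈⟨ R.+-cong (R.trans (R.*-comm y x) (*-inv x p))
                                       (R.sym (-‿distribʳ-* y 1#)) ⟩
      1# - y * 1#          ≈⟨ R.+-congˡ (R.-‿cong (R.*-identityʳ y)) ⟩
      1# - y               ∎
    y<1 : y < 1#
    y<1 = 0<y-x⇒x<y (<-respʳ eq (*-pos q (x<y⇒0<y-x 1<x)))
    y-1<0 : y - 1# < 0#
    y-1<0 = <-respʳ (R.-‿inverseʳ 1#) (+-monoˡ-< (- 1#) y<1)
  ... | inj₁ h = contradiction h (log-≤ _ _)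
  ... | inj₂ h = <-respˡ eq (<-respʳ (R.+-identityˡ _) (+-monoˡ-< (log x p) h))
    where
    open SetoidReasoning R.setoid
    y = inv x p
    q = inv-pos x p
    eq : log y q + log x p ≈ 0#
    eq = begin
      log y q + log x p  ≈⟨ log-* q p ⟨
      log (y * x) _      ≈⟨ log-cong _ _ (R.trans (R.*-comm y x) (*-inv x p)) ⟩
      log 1# 0<1         ≈⟨ log1≈0 ⟩
      0#                 ∎

-- Hypergraphs and cliques

SizedSubset : ℕ → ℕ → Set
SizedSubset n s = Σ (Subset n) λ e → ∣ e ∣ ≡ s

_≟ˢ_ : ∀ {n s} → DecidableEquality (SizedSubset n s)
(e , refl) ≟ˢ (f , p) with Vec.≡-dec Bool._≟_ e f
... | no e≢f   = no λ eq → e≢f (cong proj₁ eq)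
(e , refl) ≟ˢ (.e , p) | yes refl
  rewrite ℕ.≡-irrelevant p refl = yes refl

-- Every s-subset of Fin n exactly once, in lexicographic order.
choose : ∀ n s → List (SizedSubset n s)
choose zero    zero    = (Vec.[] , refl) ∷ []
choose zero    (suc s) = []
choose (suc n) zero    = List.map (λ (e , p) → outside Vec.∷ e , p) (choose n zero)
choose (suc n) (suc s) =
  List.map (λ (e , p) → inside Vec.∷ e , cong suc p) (choose n s) ++
  List.map (λ (e , p) → outside Vec.∷ e , p) (choose n (suc s))

-- The edge set, as a decidable set of s-subsets of the vertex set Fin n.
Hypergraph : ℕ → ℕ → Set
Hypergraph n s = SizedSubset n s → Bool

IsClique : ∀ {n s k} → Hypergraph n s → SizedSubset n k → Set
IsClique {n} {s} G S = All (λ e → proj₁ e ⊆ proj₁ S → G e ≡ true) (choose n s)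

isClique? : ∀ {n s k} (G : Hypergraph n s) → Unary.Decidable (IsClique {k = k} G)
isClique? {n} {s} G S =
  all? (λ e → (proj₁ e ⊆? proj₁ S) →-dec (G e Bool.≟ true)) (choose n s)

cliqueCount : ∀ {n s} → ℕ → Hypergraph n s → ℕ
cliqueCount {n} k G = length (filter (isClique? G) (choose n k))

cliqueParity : ∀ {n s} → ℕ → Hypergraph n s → ℕ
cliqueParity k G = cliqueCount k G % 2

module Model (ℝ : Reals) where
  open Reals ℝ public
  open RealFacts ℝ

  record Prob : Set where
    field
      value : Carrier
      0<p   : 0# < value
      p<1   : value < 1#
  open Prob public

  -- Finite experiments: binary trees of independent coin flips.
  data Dist (A : Set) : Set where
    return : A → Dist A
    flip   : Prob → (heads tails : Dist A) → Dist A

  _>>=_ : ∀ {A B} → Dist A → (A → Dist B) → Dist B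
  return a   >>= f = f a
  flip p d e >>= f = flip p (d >>= f) (e >>= f)

  Pr : ∀ {A} {P : A → Set} → Unary.Decidable P → Dist A → Carrier
  Pr P? (return a)   = if does (P? a) then 1# else 0#
  Pr P? (flip p d e) = value p * Pr P? d + (1# - value p) * Pr P? e

  Surely : ∀ {A} → (A → Set) → Dist A → Set
  Surely P (return a)   = P a
  Surely P (flip p d e) = Surely P d × Surely P e

  -- G(n,c,s)
  erdősRényi : ∀ n → Prob → ∀ s → Dist (Hypergraph n s)
  erdősRényi n c s = sample (choose n s)
    where
    insert : SizedSubset n s → Hypergraph n s → Hypergraph n s
    insert e G f = if does (f ≟ˢ e) then true else G f
    sample : List (SizedSubset n s) → Dist (Hypergraph n s)
    sample []       = return λ _ → false
    sample (e ∷ es) = sample es >>= λ G → flip c (return (insert e G)) (return G)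

  -- An edge density depending on the number n of vertices, with an integer
  -- approximation of c⁻¹(1-c)⁻¹ up to an additive 2.  Machines receive that
  -- integer along with n and can flip coins of bias c(n): this is what it
  -- means for the density to be known to the algorithms, even when n ↦ c(n)
  -- is not computable.
  record Density : Set where
    field
      c        : ℕ → Prob
      scale    : ℕ → ℕ
    spread : ℕ → Carrier
    spread n = value (c n) * (1# - value (c n))
    field
      scale-lower : ∀ n → 1# < ι (scale n) * spread n
      scale-upper : ∀ n → ι (scale n) * spread n < 1# + ι 2 * spread n
  open Density public using (c; scale)

  -- Randomised random-access machines with unit-cost instructions, among them
  -- addition and truncated subtraction but not multiplication.  Registers are
  -- addressed by constants, the memory indirectly through registers.

  data Coin : Set where
    fixed   : Prob → Coin
    density : Coin

  Reg : Set
  Reg = ℕ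

  data Instr : Set where
    set      : Reg → ℕ → Instr
    add sub  : (dst x y : Reg) → Instr
    load     : (dst addr : Reg) → Instr
    store    : (addr src : Reg) → Instr
    jumpZero : Reg → (target : ℕ) → Instr
    toss     : (dst : Reg) → Coin → Instr
    halt     : Instr

  Program : Set
  Program = List Instr

  record Config : Set where
    constructor ⟨_,_,_⟩
    field
      pc       : ℕ
      reg mem  : ℕ → ℕ

  _[_≔_] : (ℕ → ℕ) → ℕ → ℕ → (ℕ → ℕ)
  (f [ i ≔ v ]) j = if j ≡ᵇ i then v else f j

  -- Run for at most t steps; `nothing` if the machine has not halted by then.
  -- Executing `halt` is a step, the output is register 0, and a program
  -- counter outside the program halts.
  exec : Prob → Program → (t : ℕ) → Config → Dist (Maybe ℕ)
  exec p P zero    _ = return nothing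
  exec p P (suc t) ⟨ pc , r , m ⟩ with head (drop pc P)
  ... | nothing             = return (just (r 0))
  ... | just halt           = return (just (r 0))
  ... | just (set d v)      = exec p P t ⟨ suc pc , r [ d ≔ v ] , m ⟩
  ... | just (add d x y)    = exec p P t ⟨ suc pc , r [ d ≔ r x ℕ.+ r y ] , m ⟩
  ... | just (sub d x y)    = exec p P t ⟨ suc pc , r [ d ≔ r x ∸ r y ] , m ⟩
  ... | just (load d a)     = exec p P t ⟨ suc pc , r [ d ≔ m (r a) ] , m ⟩
  ... | just (store a x)    = exec p P t ⟨ suc pc , r , m [ r a ≔ r x ] ⟩
  ... | just (jumpZero x l) =
    exec p P t ⟨ (if r x ≡ᵇ 0 then l else suc pc) , r , m ⟩
  ... | just (toss d coin)  =
    flip (bias coin) (exec p P t ⟨ suc pc , r [ d ≔ 1 ] , m ⟩)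
                     (exec p P t ⟨ suc pc , r [ d ≔ 0 ] , m ⟩)
    where
    bias : Coin → Prob
    bias (fixed q) = q
    bias density   = p

  -- Input: n in register 0, the density parameter in register 1, and in memory
  -- the characteristic vector of the edge set in lexicographic order of the
  -- s-subsets.
  initial : ∀ {n s} → Density → Hypergraph n s → Config
  initial {n} {s} D G = ⟨ 0 , ((λ _ → 0) [ 0 ≔ n ]) [ 1 ≔ scale D n ] , bits (choose n s) ⟩
    where
    bits : List (SizedSubset n s) → ℕ → ℕ
    bits []       _       = 0
    bits (e ∷ es) zero    = if G e then 1 else 0
    bits (e ∷ es) (suc i) = bits es i

  run : ∀ {n s} → Density → Program → (t : ℕ) → Hypergraph n s → Dist (Maybe ℕ)
  run {n} D P t G = exec (c D n) P t (initial D G)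

  HaltsWithin : Density → Program → (s n t : ℕ) → Set
  HaltsWithin D P s n t =
    (G : Hypergraph n s) → Surely (_≢ nothing) (run D P t G)

  -- A program together with its worst-case runtime T(·,n), over all inputs on
  -- n vertices and all outcomes of the coins.
  record Algorithm (D : Density) (s : ℕ) : Set where
    field
      program : Program
      T       : ℕ → ℕ
      halts   : ∀ n → HaltsWithin D program s n (T n)
      least   : ∀ n t → HaltsWithin D program s n t → T n ≤ t
  open Algorithm public using (program; T)

  NonDecreasing : (ℕ → ℕ) → Set
  NonDecreasing f = ∀ {m n} → m ≤ n → f m ≤ f n

  output : ∀ {D s n} → Algorithm D s → Hypergraph n s → Dist (Maybe ℕ)
  output {D} {n = n} A G = run D (program A) (T A n) G

  Wrong : ∀ {n s} → ℕ → Hypergraph n s × Maybe ℕ → Set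
  Wrong k (G , o) = o ≢ just (cliqueParity k G)

  wrong? : ∀ {n s} k → Unary.Decidable (Wrong {n} {s} k)
  wrong? k (G , o) = ¬? (Maybe.≡-dec ℕ._≟_ o (just (cliqueParity k G)))

  errorOn : ∀ {D s n} → Algorithm D s → (k : ℕ) → Hypergraph n s → Carrier
  errorOn A k G = Pr (wrong? k) (output A G >>= λ o → return (G , o))

  averageError : ∀ {D s} → Algorithm D s → (k n : ℕ) → Carrier
  averageError {D} {s} A k n =
    Pr (wrong? k) (erdősRényi n (c D n) s >>= λ G → output A G >>= λ o → return (G , o))

  -- x < 1/y, for positive y.
  infix 4 _<1/_
  _<1/_ : Carrier → Carrier → Set
  x <1/ y = x * y < 1#

  -- The value 0 at 0 is never relevant.
  logℕ : ℕ → Carrier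
  logℕ zero    = 0#
  logℕ (suc n) = log (ι (suc n)) (0<ι n)

  -- log log 1 is read as 0; it occurs for binomial coefficients k C k.
  loglogℕ : ℕ → Carrier
  loglogℕ zero          = 0#
  loglogℕ (suc zero)    = 0#
  loglogℕ (suc (suc n)) = log (logℕ (suc (suc n))) (log-pos _ _ (1<ι n))

  1/_ : Prob → Carrier
  1/ p = inv (value p) (0<p p)

  1/1-_ : Prob → Carrier
  1/1- p = inv (1# - value p) (x<y⇒0<y-x (p<1 p))

  Υ₁ : Carrier → ℕ → Prob → (s k : ℕ) → Carrier
  Υ₁ K n p s k =
    (K * 1/ p * 1/1- p * (ι s * logℕ k) *
      (ι s * logℕ n + ι (k C s) * loglogℕ (k C s))) ^ (k C s)

  Υ₂ : Carrier → (s k : ℕ) → Carrier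
  Υ₂ K s k = (K * ι s * logℕ k) ^ (k C s)

{-# OPTIONS --safe #-}
module Submission where

-- B runs A only on n vertices.  Cut the vertices into blocks of m = n / k
-- vertices, and for a tuple t of k among 2k blocks let x_t be the hypergraph
-- whose i-th block is a copy of block t_i of G; an s-set is an edge of x_t if
-- its image is an edge of G listed in decreasing order.  As a decreasing list,
-- every k-clique of G is the image of a rainbow k-set for exactly one t, so the
-- clique parity of G is the sum over t of the rainbow clique parities of x_t.
--
-- Every bit x_t(e) is split as the xor of a vector Y_e of even length L.  The
-- type of e is the list of its blocks; there are D = (k choose s) rainbow
-- types.  For every function a from rainbow types to coordinates, A is run on
-- H_a(e) = Y_e[a(type of e)].  Expanding a product of sums, the clique
-- parities of all H_a add up to the rainbow clique parity of x_t: the other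
-- k-sets miss a type and are counted an even number of times.
--
-- If a single coordinate of Y_e has the density of a c-coin up to a factor ρ,
-- H_a is dominated by ρ ^ N times G(n,c,s), where N is the number of s-sets.
-- If moreover Y_e has the wrong xor with probability at most φ, the error is at
-- most (2k)^k (N φ + L^D ρ^N ε).  For c = 1/2 take Y_e = (b, b xor x) with
-- ρ = 1 and φ = 0.  In general toss L c-coins, where L is a multiple of
-- s log n / (c (1 - c)), and start again while the parity is wrong: the parity
-- of the other L - 1 coins is almost uniform, so ρ^N ≤ 2.

open import Data.Nat.Base using (ℕ; _≤_)
open import Data.Product.Base using (∃; _×_)
open import Defs
import Data.Nat.Base as ℕ
open import Data.Bool.Base using (Bool; true; false; if_then_else_; _∧_; _∨_; _xor_; not)
import Data.Bool.Properties as Bool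
import Data.Empty
open import Data.List.Base as List using (List; []; _∷_; _++_; length; head; drop; map; foldr; downFrom; concatMap; replicate)
open import Data.List.Membership.Propositional using (_∈_; _∉_)
open import Data.List.Membership.Propositional.Properties using (∈-map⁺; ∈-map⁻; ∈-++⁺ˡ; ∈-++⁺ʳ; ∈-++⁻)
open import Data.List.Properties as List using (++-assoc; length-++; ++-identityʳ; map-∘; map-++; length-map; drop-all; length-downFrom)
open import Data.List.Relation.Unary.All as All using (All; []; _∷_; all?)
import Data.List.Relation.Unary.All.Properties as All
open import Data.List.Relation.Unary.AllPairs using ([]; _∷_)
open import Data.List.Relation.Unary.Any as Any using (Any; here; there)
open import Data.List.Relation.Unary.Unique.Propositional using (Unique)
import Data.List.Relation.Unary.Unique.Propositional.Properties as Unique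
open import Data.Maybe.Base using (Maybe; just; nothing)
import Data.Maybe.Properties as Maybe
open import Data.Nat.Base using (zero; suc; z≤n; s≤s; NonZero)
open import Data.Nat.Combinatorics using (_C_; nCk+nC[k+1]≡[n+1]C[k+1]; k>n⇒nCk≡0; nC1≡n; nCn≡1)
import Data.Nat.DivMod as DM
import Data.Nat.Properties as ℕ
open import Data.Nat.Tactic.RingSolver using (solve-∀)
open import Data.Product.Base using (Σ; _,_; proj₁; proj₂)
open import Data.Sum.Base using (_⊎_; inj₁; inj₂)
open import Data.Unit.Base using (⊤; tt)
open import Function.Base using (_∘_)
open import Relation.Binary.PropositionalEquality as ≡ using (_≡_; _≢_)
open import Relation.Nullary using (¬_; Dec; does; yes; no; contradiction; _×-dec_)
open import Level using (0ℓ)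
open import Relation.Binary.Bundles using (Preorder)
import Relation.Unary as Unary

module Discrete where
 open import Data.Bool.Base using (T)
 open import Data.Bool.Properties using (∨-conicalˡ; ∨-conicalʳ)
 open import Data.Fin.Subset using (Subset; inside; outside; ∣_∣; _⊆_)
 open import Data.Fin.Subset.Properties using (drop-∷-⊆; s⊆s; out⊆)
 open import Data.List.Base using (foldl; filter)
 open import Data.Nat.Base
 open import Data.Nat.DivMod using (_/_; _%_)
 open import Data.Nat.Divisibility using (divides-refl)
 open import Data.Nat.Properties
 open import Relation.Nullary.Decidable using (dec-true; dec-false)
 open import Data.Vec.Base as Vec using ([]; _∷_)
 open import Relation.Binary.PropositionalEquality

 -- Structured commands over registers and sixteen interleaved arrays

 ≡ᵇ-refl : ∀ n → (n ≡ᵇ n) ≡ true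
 ≡ᵇ-refl zero    = refl
 ≡ᵇ-refl (suc n) = ≡ᵇ-refl n

 ≡ᵇ-true : ∀ m n → (m ≡ᵇ n) ≡ true → m ≡ n
 ≡ᵇ-true zero    zero    _  = refl
 ≡ᵇ-true (suc m) (suc n) eq = cong suc (≡ᵇ-true m n eq)

 ≡ᵇ-false : ∀ {m n} → m ≢ n → (m ≡ᵇ n) ≡ false
 ≡ᵇ-false {m} {n} m≢n with m ≡ᵇ n in eq
 ... | true  = contradiction (≡ᵇ-true m n eq) m≢n
 ... | false = refl

 b2n : Bool → ℕ
 b2n b = if b then 1 else 0

 data Array : Set where
  aReg aMem input mulT image part qLast qKey qCode table vecs index : Array

 code : Array → ℕ
 code aReg  = 0
 code aMem  = 1
 code input = 2
 code mulT  = 3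
 code image = 4
 code part  = 5
 code qLast = 6
 code qKey  = 7
 code qCode = 8
 code table = 9
 code vecs  = 10
 code index = 11

 code<16 : ∀ a → code a < 16
 code<16 a = <ᵇ⇒< (code a) 16 (h a)
  where
  h : ∀ a → T (code a <ᵇ 16)
  h aReg  = tt
  h aMem  = tt
  h input = tt
  h mulT  = tt
  h image = tt
  h part  = tt
  h qLast = tt
  h qKey  = tt
  h qCode = tt
  h table = tt
  h vecs  = tt
  h index = tt

 data Op : Set where
  set          : (d v : ℕ) → Op
  mov          : (d x : ℕ) → Op
  add sub      : (d x y : ℕ) → Op
  ld           : Array → (d x : ℕ) → Op
  st           : Array → (x y : ℕ) → Op
  ldRaw stRaw  : (d x : ℕ) → Op

 record State : Set where
  constructor ⟪_,_⟫
  field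
    reg : ℕ → ℕ
    arr : ℕ → ℕ → ℕ
 open State public

 _⟦_,_⟧ : (ℕ → ℕ → ℕ) → ℕ → ℕ → ℕ → ℕ → ℕ → ℕ
 (A ⟦ c , x ⟧) v i y = if i ≡ᵇ c then (if y ≡ᵇ x then v else A i y) else A i y

 -- The cell y of the array with code i has the address y * 16 + i.
 rawSet : (ℕ → ℕ → ℕ) → ℕ → ℕ → ℕ → ℕ → ℕ
 rawSet A x v i y = if y * 16 + i ≡ᵇ x then v else A i y

 arrays≡ : ∀ i x c z → i < 16 → c < 16 → (x * 16 + i ≡ᵇ z * 16 + c) ≡ ((i ≡ᵇ c) ∧ (x ≡ᵇ z))
 arrays≡ i x c z i< c< with i ≡ᵇ c in e1 | x ≡ᵇ z in e2
 ... | true  | true  rewrite ≡ᵇ-true i c e1 | ≡ᵇ-true x z e2 = ≡ᵇ-refl (z * 16 + c)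
 ... | true  | false rewrite ≡ᵇ-true i c e1 =
  ≡ᵇ-false λ eq → contradiction (trans (sym e2)
    (trans (cong (_≡ᵇ z) (*-cancelʳ-≡ x z 16 (+-cancelʳ-≡ c (x * 16) (z * 16) eq))) (≡ᵇ-refl z))) λ ()
 ... | false | _ = ≡ᵇ-false λ eq → contradiction (trans (sym e1) (trans (cong (_≡ᵇ c) (go eq)) (≡ᵇ-refl c))) λ ()
  where
  low : ∀ j y → j < 16 → (y * 16 + j) % 16 ≡ j
  low j y j< = trans (cong (_% 16) (+-comm (y * 16) j)) (trans (DM.[m+kn]%n≡m%n j y 16) (DM.m<n⇒m%n≡m j<))
  go : x * 16 + i ≡ z * 16 + c → i ≡ c
  go eq = trans (sym (low i x i<)) (trans (cong (_% 16) eq) (low c z c<))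

 module Language (ℝ : Reals) where
  open Model ℝ using
    ( Dist; return; flip; _>>=_; Instr; Program; Coin; fixed; density
    ; ⟨_,_,_⟩; _[_≔_]; Config; Surely )
  open Instr

  >>=-assoc : ∀ {A B C : Set} (d : Dist A) (f : A → Dist B) (g : B → Dist C) →
              ((d >>= f) >>= g) ≡ (d >>= λ a → f a >>= g)
  >>=-assoc (return a)   f g = refl
  >>=-assoc (flip q d e) f g = cong₂ (flip q) (>>=-assoc d f g) (>>=-assoc e f g)

  >>=-identityʳ : ∀ {A : Set} (d : Dist A) → (d >>= return) ≡ d
  >>=-identityʳ (return a)   = refl
  >>=-identityʳ (flip q d e) = cong₂ (flip q) (>>=-identityʳ d) (>>=-identityʳ e)

  evalOp : Op → State → State
  evalOp (set d v)   ⟪ r , A ⟫ = ⟪ r [ d ≔ v ] , A ⟫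
  evalOp (mov d x)   ⟪ r , A ⟫ = ⟪ r [ d ≔ r x ] , A ⟫
  evalOp (add d x y) ⟪ r , A ⟫ = ⟪ r [ d ≔ r x + r y ] , A ⟫
  evalOp (sub d x y) ⟪ r , A ⟫ = ⟪ r [ d ≔ r x ∸ r y ] , A ⟫
  evalOp (ld a d x)  ⟪ r , A ⟫ = ⟪ r [ d ≔ A (code a) (r x) ] , A ⟫
  evalOp (st a x y)  ⟪ r , A ⟫ = ⟪ r , (A ⟦ code a , r x ⟧) (r y) ⟫
  evalOp (ldRaw d x) ⟪ r , A ⟫ = ⟪ r [ d ≔ A (r x % 16) (r x / 16) ] , A ⟫
  evalOp (stRaw x y) ⟪ r , A ⟫ = ⟪ r , rawSet A (r x) (r y) ⟫

  evalOps : List Op → State → State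
  evalOps []       σ = σ
  evalOps (o ∷ os) σ = evalOps os (evalOp o σ)

  -- Registers 0 and 1 of the machine are scratch space for address computations.
  compOp : Op → List Instr
  compOp (set d v)   = set (2 + d) v ∷ []
  compOp (mov d x)   = set 0 0 ∷ add (2 + d) (2 + x) 0 ∷ []
  compOp (add d x y) = add (2 + d) (2 + x) (2 + y) ∷ []
  compOp (sub d x y) = sub (2 + d) (2 + x) (2 + y) ∷ []
  compOp (ld a d x)  = add 0 (2 + x) (2 + x) ∷ add 0 0 0 ∷ add 0 0 0 ∷ add 0 0 0 ∷
                       set 1 (code a) ∷ add 0 0 1 ∷ load (2 + d) 0 ∷ []
  compOp (st a x y)  = add 0 (2 + x) (2 + x) ∷ add 0 0 0 ∷ add 0 0 0 ∷ add 0 0 0 ∷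
                       set 1 (code a) ∷ add 0 0 1 ∷ store 0 (2 + y) ∷ []
  compOp (ldRaw d x) = load (2 + d) (2 + x) ∷ []
  compOp (stRaw x y) = store (2 + x) (2 + y) ∷ []

  record Rel (σ : State) (r m : ℕ → ℕ) : Set where
    constructor rel⟨_,_⟩
    field
      regs≡ : ∀ i → r (2 + i) ≡ reg σ i
      mem≡  : ∀ i y → i < 16 → m (y * 16 + i) ≡ arr σ i y
  open Rel public

  record At (P : Program) (pc : ℕ) (is : List Instr) : Set where
    constructor _,_
    field
      rest : List Instr
      eq   : drop pc P ≡ is ++ rest

  drop-suc : ∀ {A : Set} n (xs : List A) → drop (suc n) xs ≡ drop 1 (drop n xs)
  drop-suc zero    xs       = refl
  drop-suc (suc n) []       = refl
  drop-suc (suc n) (x ∷ xs) = drop-suc n xs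

  fetch : ∀ {P pc i is} → At P pc (i ∷ is) → head (drop pc P) ≡ just i
  fetch (rest , eq) = cong head eq

  at-tail : ∀ {P pc i is} → At P pc (i ∷ is) → At P (suc pc) is
  at-tail {P} {pc} (rest , eq) = rest , trans (drop-suc pc P) (cong (drop 1) eq)

  at-head : ∀ {P pc} is {js} → At P pc (is ++ js) → At P pc is
  at-head is {js} (rest , eq) = js ++ rest , trans eq (++-assoc is js rest)

  at-++ : ∀ {P pc} is {js} → At P pc (is ++ js) → At P (length is + pc) js
  at-++ []       at = at
  at-++ {P} {pc} (i ∷ is) {js} at =
    subst (λ q → At P q js) (+-suc (length is) pc) (at-++ is (at-tail at))

  opEnd : Op → ℕ → ℕ
  opEnd o pc = length (compOp o) + pc

  upd-shift : ∀ (f g : ℕ → ℕ) → (∀ i → f (2 + i) ≡ g i) → ∀ d {v w} → v ≡ w →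
              ∀ i → (f [ 2 + d ≔ v ]) (2 + i) ≡ (g [ d ≔ w ]) i
  upd-shift f g h d eq i with i ≡ᵇ d
  ... | true  = eq
  ... | false = h i

  times16 : ∀ x c → ((((x + x) + (x + x)) + ((x + x) + (x + x)))
                  + (((x + x) + (x + x)) + ((x + x) + (x + x)))) + c ≡ x * 16 + c
  times16 = solve-∀

  upd-array : ∀ m A → (∀ i y → i < 16 → m (y * 16 + i) ≡ A i y) → ∀ c x v → c < 16 →
              ∀ i y → i < 16 → (m [ x * 16 + c ≔ v ]) (y * 16 + i) ≡ (A ⟦ c , x ⟧) v i y
  upd-array m A hm c x v c< i y i< rewrite arrays≡ i y c x i< c< with i ≡ᵇ c | y ≡ᵇ x
  ... | true  | true  = refl
  ... | true  | false = hm i y i<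
  ... | false | _     = hm i y i<

  upd-raw : ∀ m A → (∀ i y → i < 16 → m (y * 16 + i) ≡ A i y) → ∀ x v →
            ∀ i y → i < 16 → (m [ x ≔ v ]) (y * 16 + i) ≡ rawSet A x v i y
  upd-raw m A hm x v i y i< with y * 16 + i ≡ᵇ x
  ... | true  = refl
  ... | false = hm i y i<

  infixr 5 _⨾_
  data Cmd : Set where
    blk  : List Op → Cmd
    _⨾_  : Cmd → Cmd → Cmd
    loop : ℕ → Cmd → Cmd
    ifz  : ℕ → Cmd → Cmd → Cmd
    toss : ℕ → Cmd
    sim  : Program → Cmd

  opsEnd : List Op → ℕ → ℕ
  opsEnd []       pc = pc
  opsEnd (o ∷ os) pc = opsEnd os (opEnd o pc)

  compOps : List Op → List Instr
  compOps []       = []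
  compOps (o ∷ os) = compOp o ++ compOps os

  rNext rFresh : ℕ
  rNext  = 7
  rFresh = 14

  readReg : ℕ → ℕ → List Op
  readReg d x = set 0 x ∷ add 0 rFresh 0 ∷ ld aReg d 0 ∷ []

  writeReg : ℕ → List Op
  writeReg d = set 0 d ∷ add 0 rFresh 0 ∷ st aReg 0 1 ∷ set 0 (suc d) ∷ add rNext rNext 0 ∷ []

  simOps : Instr → List Op
  simOps (set d v)      = set 1 v ∷ writeReg d
  simOps (add d x y)    = readReg 1 x ++ readReg 2 y ++ add 1 1 2 ∷ writeReg d
  simOps (sub d x y)    = readReg 1 x ++ readReg 2 y ++ sub 1 1 2 ∷ writeReg d
  simOps (load d a)     = readReg 1 a ++ add 1 rFresh 1 ∷ ld aMem 1 1 ∷ writeReg d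
  simOps (store a x)    = readReg 1 a ++ readReg 2 x ++
                          add 3 rFresh 1 ∷ st aMem 3 2 ∷ set 0 1 ∷ add 1 1 0 ∷ add rNext rNext 1 ∷ []
  simOps (jumpZero x l) = readReg 1 x
  simOps (toss d q)     = writeReg d
  simOps halt           = []

  simInstr : (ℕ → ℕ) → ℕ → Instr → List Instr
  simInstr addr stop (jumpZero x l) = compOps (readReg 1 x) ++ jumpZero 3 (addr l) ∷ []
  simInstr addr stop (toss d q)     = toss 3 q ∷ compOps (writeReg d)
  simInstr addr stop halt           = set 0 0 ∷ jumpZero 0 stop ∷ []
  simInstr addr stop i              = compOps (simOps i)

  simLen : Instr → ℕ
  simLen i = length (simInstr (λ _ → 0) 0 i)

  simAddr : Program → ℕ → ℕ → ℕ
  simAddr []       l       pc = pc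
  simAddr (i ∷ is) zero    pc = pc
  simAddr (i ∷ is) (suc l) pc = simAddr is l (simLen i + pc)

  simStop : Program → ℕ → ℕ
  simStop []       pc = pc
  simStop (i ∷ is) pc = simStop is (simLen i + pc)

  simCode : (ℕ → ℕ) → ℕ → Program → List Instr
  simCode addr stop []       = []
  simCode addr stop (i ∷ is) = simInstr addr stop i ++ simCode addr stop is

  end : Cmd → ℕ → ℕ
  end (blk os)      pc = opsEnd os pc
  end (c₁ ⨾ c₂)     pc = end c₂ (end c₁ pc)
  end (loop r c)    pc = 2 + end c (3 + pc)
  end (ifz r c₁ c₂) pc = end c₁ (2 + end c₂ (1 + pc))
  end (toss d)      pc = 1 + pc
  end (sim A)       pc = simStop A pc

  compile : Cmd → ℕ → List Instr
  compile (blk os)      pc = compOps os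
  compile (c₁ ⨾ c₂)     pc = compile c₁ pc ++ compile c₂ (end c₁ pc)
  compile (loop r c)    pc =
    jumpZero (2 + r) (2 + end c (3 + pc)) ∷ set 0 1 ∷ sub (2 + r) (2 + r) 0 ∷
    compile c (3 + pc) ++ set 0 0 ∷ jumpZero 0 pc ∷ []
  compile (ifz r c₁ c₂) pc =
    jumpZero (2 + r) (2 + end c₂ (1 + pc)) ∷ compile c₂ (1 + pc) ++
    set 0 0 ∷ jumpZero 0 (end c₁ (2 + end c₂ (1 + pc))) ∷ compile c₁ (2 + end c₂ (1 + pc))
  compile (toss d)      pc = toss (2 + d) density ∷ []
  compile (sim A)       pc = simCode (λ l → simAddr A l pc) (simStop A pc) A

  opsEnd≡ : ∀ os pc → length (compOps os) + pc ≡ opsEnd os pc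
  opsEnd≡ []       pc = refl
  opsEnd≡ (o ∷ os) pc = trans (cong (_+ pc) (trans (length-++ (compOp o)) (+-comm (length (compOp o)) _)))
    (trans (+-assoc (length (compOps os)) _ pc) (opsEnd≡ os (opEnd o pc)))

  simLen≡ : ∀ addr stop i → length (simInstr addr stop i) ≡ simLen i
  simLen≡ addr stop (set d v)      = refl
  simLen≡ addr stop (add d x y)    = refl
  simLen≡ addr stop (sub d x y)    = refl
  simLen≡ addr stop (load d a)     = refl
  simLen≡ addr stop (store a x)    = refl
  simLen≡ addr stop (jumpZero x l) = refl
  simLen≡ addr stop (toss d q)     = refl
  simLen≡ addr stop halt           = refl

  length-++-+ : ∀ {A : Set} (xs ys : List A) pc → length (xs ++ ys) + pc ≡ length ys + (length xs + pc)
  length-++-+ xs ys pc = trans (cong (_+ pc) (trans (length-++ xs) (+-comm (length xs) _)))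
                               (+-assoc (length ys) (length xs) pc)

  simStop≡ : ∀ addr stop A pc → length (simCode addr stop A) + pc ≡ simStop A pc
  simStop≡ addr stop []       pc = refl
  simStop≡ addr stop (i ∷ is) pc =
    trans (length-++-+ (simInstr addr stop i) _ pc)
      (trans (cong (λ v → length (simCode addr stop is) + (v + pc)) (simLen≡ addr stop i))
        (simStop≡ addr stop is (simLen i + pc)))

  end≡ : ∀ c pc → length (compile c pc) + pc ≡ end c pc
  end≡ (blk os)      pc = opsEnd≡ os pc
  end≡ (c₁ ⨾ c₂)     pc = trans (length-++-+ (compile c₁ pc) _ pc)
    (trans (cong (length (compile c₂ (end c₁ pc)) +_) (end≡ c₁ pc)) (end≡ c₂ (end c₁ pc)))
  end≡ (loop r c)    pc = trans (cong (λ v → suc (suc (suc v))) (length-++-+ (compile c (3 + pc)) _ pc))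
    (cong (2 +_) (trans (lem (length (compile c (3 + pc))) pc) (end≡ c (3 + pc))))
    where
    lem : ∀ x y → 3 + (x + y) ≡ x + (3 + y)
    lem = solve-∀
  end≡ (ifz r c₁ c₂) pc = trans (cong suc (length-++-+ (compile c₂ (1 + pc)) _ pc))
    (trans (lem (length (compile c₁ (2 + end c₂ (1 + pc)))) (length (compile c₂ (1 + pc))) pc)
    (trans (cong (λ v → length (compile c₁ (2 + end c₂ (1 + pc))) + (2 + v)) (end≡ c₂ (1 + pc)))
      (end≡ c₁ (2 + end c₂ (1 + pc)))))
    where
    lem : ∀ x y z → suc (suc (suc x) + (y + z)) ≡ x + (2 + (y + (1 + z)))
    lem = solve-∀
  end≡ (toss d)      pc = refl
  end≡ (sim A)       pc = simStop≡ _ _ A pc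

  at-next : ∀ {P pc} c {js} → At P pc (compile c pc ++ js) → At P (end c pc) js
  at-next {P} {pc} c {js} at = subst (λ q → At P q js) (end≡ c pc) (at-++ (compile c pc) at)

  opW : Op → ℕ → Bool
  opW (set d v)   i = i ≡ᵇ d
  opW (mov d x)   i = i ≡ᵇ d
  opW (add d x y) i = i ≡ᵇ d
  opW (sub d x y) i = i ≡ᵇ d
  opW (ld a d x)  i = i ≡ᵇ d
  opW (st a x y)  i = false
  opW (ldRaw d x) i = i ≡ᵇ d
  opW (stRaw x y) i = false

  opsW : List Op → ℕ → Bool
  opsW []       i = false
  opsW (o ∷ os) i = opW o i ∨ opsW os i

  opWA : Op → ℕ → Bool
  opWA (st a x y)  c = c ≡ᵇ code a
  opWA (stRaw x y) c = true
  opWA _           c = false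

  opsWA : List Op → ℕ → Bool
  opsWA []       c = false
  opsWA (o ∷ os) c = opWA o c ∨ opsWA os c

  writesReg : Cmd → ℕ → Bool
  writesReg (blk os)      i = opsW os i
  writesReg (c₁ ⨾ c₂)     i = writesReg c₁ i ∨ writesReg c₂ i
  writesReg (loop r c)    i = (i ≡ᵇ r) ∨ writesReg c i
  writesReg (ifz r c₁ c₂) i = writesReg c₁ i ∨ writesReg c₂ i
  writesReg (toss d)      i = i ≡ᵇ d
  writesReg (sim A)       i = i <ᵇ 8

  writesArr : Cmd → ℕ → Bool
  writesArr (blk os)      c = opsWA os c
  writesArr (c₁ ⨾ c₂)     c = writesArr c₁ c ∨ writesArr c₂ c
  writesArr (loop r b)    c = writesArr b c
  writesArr (ifz r c₁ c₂) c = writesArr c₁ c ∨ writesArr c₂ c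
  writesArr (toss d)      c = false
  writesArr (sim A)       c = c <ᵇ 2

  record Frame (c : Cmd) (σ σ′ : State) : Set where
    constructor frame
    field
      regs   : ∀ i → writesReg c i ≡ false → reg σ′ i ≡ reg σ i
      arrays : ∀ i → writesArr c i ≡ false → ∀ y → arr σ′ i y ≡ arr σ i y
  open Frame public

  upd-other : ∀ (f : ℕ → ℕ) d v i → (i ≡ᵇ d) ≡ false → (f [ d ≔ v ]) i ≡ f i
  upd-other f d v i eq rewrite eq = refl

  opFrame : ∀ o σ i → opW o i ≡ false → reg (evalOp o σ) i ≡ reg σ i
  opFrame (set d v)   ⟪ r , A ⟫ i eq = upd-other r d _ i eq
  opFrame (mov d x)   ⟪ r , A ⟫ i eq = upd-other r d _ i eq
  opFrame (add d x y) ⟪ r , A ⟫ i eq = upd-other r d _ i eq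
  opFrame (sub d x y) ⟪ r , A ⟫ i eq = upd-other r d _ i eq
  opFrame (ld a d x)  ⟪ r , A ⟫ i eq = upd-other r d _ i eq
  opFrame (st a x y)  ⟪ r , A ⟫ i eq = refl
  opFrame (ldRaw d x) ⟪ r , A ⟫ i eq = upd-other r d _ i eq
  opFrame (stRaw x y) ⟪ r , A ⟫ i eq = refl

  opFrameA : ∀ o σ i → opWA o i ≡ false → ∀ y → arr (evalOp o σ) i y ≡ arr σ i y
  opFrameA (set d v)   σ i eq y = refl
  opFrameA (mov d x)   σ i eq y = refl
  opFrameA (add d x z) σ i eq y = refl
  opFrameA (sub d x z) σ i eq y = refl
  opFrameA (ld a d x)  σ i eq y = refl
  opFrameA (st a x z)  σ i eq y rewrite eq = refl
  opFrameA (ldRaw d x) σ i eq y = refl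

  blkFrame : ∀ os σ → Frame (blk os) σ (evalOps os σ)
  blkFrame []       σ = frame (λ _ _ → refl) (λ _ _ _ → refl)
  blkFrame (o ∷ os) σ = frame
    (λ i eq → trans (regs (blkFrame os (evalOp o σ)) i (∨-conicalʳ (opW o i) _ eq))
                    (opFrame o σ i (∨-conicalˡ _ _ eq)))
    (λ i eq y → trans (arrays (blkFrame os (evalOp o σ)) i (∨-conicalʳ (opWA o i) _ eq) y)
                      (opFrameA o σ i (∨-conicalˡ _ _ eq) y))

  repC : ℕ → Cmd → Cmd
  repC zero    c = blk []
  repC (suc n) c = c ⨾ repC n c

  sumTo : ℕ → (ℕ → ℕ) → ℕ
  sumTo zero    f = 0
  sumTo (suc n) f = f n + sumTo n f

  repC-reg : ∀ n c i → writesReg c i ≡ false → writesReg (repC n c) i ≡ false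
  repC-reg zero    c i eq = refl
  repC-reg (suc n) c i eq rewrite eq = repC-reg n c i eq

  repC-arr : ∀ n c i → writesArr c i ≡ false → writesArr (repC n c) i ≡ false
  repC-arr zero    c i eq = refl
  repC-arr (suc n) c i eq rewrite eq = repC-arr n c i eq

  frame-refl : ∀ {c σ} → Frame c σ σ
  frame-refl = frame (λ _ _ → refl) (λ _ _ _ → refl)

 module Compiler (ℝ : Reals) (p : Model.Prob ℝ) where
  open Model ℝ using
    ( Dist; return; flip; _>>=_; Instr; Program; Coin; fixed; density
    ; ⟨_,_,_⟩; exec; _[_≔_]; Config; Surely )
  open Instr
  open Language ℝ public

  record Halts (P : Program) (cfg : Config) (t : ℕ) (d : Dist (Maybe ℕ)) : Set where
    constructor halts
    field
      exec≡ : ∀ u → exec p P (t + u) cfg ≡ d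
  open Halts public

  Halts-weaken : ∀ {P cfg t t′ d} → t ≤ t′ → Halts P cfg t d → Halts P cfg t′ d
  Halts-weaken {P} {cfg} {t} {t′} t≤t′ h = halts λ u →
    trans (cong (λ v → exec p P v cfg) (eq u)) (exec≡ h (t′ ∸ t + u))
    where
    eq : ∀ u → t′ + u ≡ t + (t′ ∸ t + u)
    eq u = trans (cong (_+ u) (sym (m+[n∸m]≡n t≤t′))) (+-assoc t (t′ ∸ t) u)

  module _ {P : Program} {pc : ℕ} {r m : ℕ → ℕ} {t : ℕ} {d : Dist (Maybe ℕ)} where

    step-set : ∀ {x v is} → At P pc (set x v ∷ is) →
      Halts P ⟨ suc pc , r [ x ≔ v ] , m ⟩ t d → Halts P ⟨ pc , r , m ⟩ (suc t) d
    exec≡ (step-set at h) u rewrite fetch at = exec≡ h u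

    step-add : ∀ {x y z is} → At P pc (add x y z ∷ is) →
      Halts P ⟨ suc pc , r [ x ≔ r y + r z ] , m ⟩ t d → Halts P ⟨ pc , r , m ⟩ (suc t) d
    exec≡ (step-add at h) u rewrite fetch at = exec≡ h u

    step-sub : ∀ {x y z is} → At P pc (sub x y z ∷ is) →
      Halts P ⟨ suc pc , r [ x ≔ r y ∸ r z ] , m ⟩ t d → Halts P ⟨ pc , r , m ⟩ (suc t) d
    exec≡ (step-sub at h) u rewrite fetch at = exec≡ h u

    step-load : ∀ {x y is} → At P pc (load x y ∷ is) →
      Halts P ⟨ suc pc , r [ x ≔ m (r y) ] , m ⟩ t d → Halts P ⟨ pc , r , m ⟩ (suc t) d
    exec≡ (step-load at h) u rewrite fetch at = exec≡ h u

    step-store : ∀ {x y is} → At P pc (store x y ∷ is) →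
      Halts P ⟨ suc pc , r , m [ r x ≔ r y ] ⟩ t d → Halts P ⟨ pc , r , m ⟩ (suc t) d
    exec≡ (step-store at h) u rewrite fetch at = exec≡ h u

    step-jump : ∀ {x l is} → At P pc (jumpZero x l ∷ is) →
      Halts P ⟨ (if r x ≡ᵇ 0 then l else suc pc) , r , m ⟩ t d → Halts P ⟨ pc , r , m ⟩ (suc t) d
    exec≡ (step-jump at h) u rewrite fetch at = exec≡ h u

  bias : Coin → Model.Prob ℝ
  bias (fixed q) = q
  bias density   = p

  step-toss : ∀ {P pc r m t d₁ d₂ x q is} → At P pc (toss x q ∷ is) →
    Halts P ⟨ suc pc , r [ x ≔ 1 ] , m ⟩ t d₁ → Halts P ⟨ suc pc , r [ x ≔ 0 ] , m ⟩ t d₂ →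
    Halts P ⟨ pc , r , m ⟩ (suc t) (flip (bias q) d₁ d₂)
  exec≡ (step-toss {q = fixed q} at h₁ h₂) u rewrite fetch at = cong₂ (flip q) (exec≡ h₁ u) (exec≡ h₂ u)
  exec≡ (step-toss {q = density} at h₁ h₂) u rewrite fetch at = cong₂ (flip p) (exec≡ h₁ u) (exec≡ h₂ u)

  op-sound : ∀ o {P pc σ r m u d} → At P pc (compOp o) → Rel σ r m →
    (∀ r′ m′ → Rel (evalOp o σ) r′ m′ → Halts P ⟨ opEnd o pc , r′ , m′ ⟩ u d) →
    Halts P ⟨ pc , r , m ⟩ (length (compOp o) + u) d
  op-sound (set d v) {r = r} at rel⟨ hr , hm ⟩ k =
    step-set at (k _ _ rel⟨ upd-shift r _ hr d refl , hm ⟩)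
  op-sound (mov d x) {σ = σ} {r = r} at rel⟨ hr , hm ⟩ k =
    step-set at (step-add (at-tail at) (k _ _
      rel⟨ upd-shift (r [ 0 ≔ 0 ]) _ hr d (trans (+-identityʳ _) (hr x)) , hm ⟩))
  op-sound (add d x y) {r = r} at rel⟨ hr , hm ⟩ k =
    step-add at (k _ _ rel⟨ upd-shift r _ hr d (cong₂ _+_ (hr x) (hr y)) , hm ⟩)
  op-sound (sub d x y) {r = r} at rel⟨ hr , hm ⟩ k =
    step-sub at (k _ _ rel⟨ upd-shift r _ hr d (cong₂ _∸_ (hr x) (hr y)) , hm ⟩)
  op-sound (ld a d x) {σ = σ} {r = r} {m = m} at rel⟨ hr , hm ⟩ k =
    let at₁ = at-tail at ; at₂ = at-tail at₁ ; at₃ = at-tail at₂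
        at₄ = at-tail at₃ ; at₅ = at-tail at₄ ; at₆ = at-tail at₅ in
    step-add at (step-add at₁ (step-add at₂ (step-add at₃ (step-set at₄ (step-add at₅ (step-load at₆
      (k _ _ rel⟨ upd-shift r₆ _ hr d val , hm ⟩)))))))
    where
    x₁ = r (2 + x) + r (2 + x)
    x₂ = x₁ + x₁
    x₃ = x₂ + x₂
    x₄ = x₃ + x₃
    r₆ = ((((((r [ 0 ≔ x₁ ]) [ 0 ≔ x₂ ]) [ 0 ≔ x₃ ]) [ 0 ≔ x₄ ]) [ 1 ≔ code a ]) [ 0 ≔ x₄ + code a ])
    val = trans (cong m (times16 (r (2 + x)) (code a)))
          (trans (hm (code a) (r (2 + x)) (code<16 a)) (cong (arr σ (code a)) (hr x)))
  op-sound (st a x y) {σ = σ} {r = r} {m = m} at rel⟨ hr , hm ⟩ k =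
    let at₁ = at-tail at ; at₂ = at-tail at₁ ; at₃ = at-tail at₂
        at₄ = at-tail at₃ ; at₅ = at-tail at₄ ; at₆ = at-tail at₅ in
    step-add at (step-add at₁ (step-add at₂ (step-add at₃ (step-set at₄ (step-add at₅ (step-store at₆
      (k _ _ rel⟨ hr , (λ i z i< →
        trans (cong₂ (λ q w → (m [ q ≔ w ]) (z * 16 + i)) (times16 (r (2 + x)) (code a)) (hr y))
        (trans (cong (λ q → (m [ q * 16 + code a ≔ reg σ y ]) (z * 16 + i)) (hr x))
               (upd-array m (arr σ) hm (code a) (reg σ x) (reg σ y) (code<16 a) i z i<))) ⟩)))))))
  op-sound (ldRaw d x) {σ = σ} {r = r} {m = m} at rel⟨ hr , hm ⟩ k =
    step-load at (k _ _ rel⟨ upd-shift r _ hr d val , hm ⟩)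
    where
    val : m (r (2 + x)) ≡ arr σ (reg σ x % 16) (reg σ x / 16)
    val = trans (cong m (trans (hr x) (trans (DM.m≡m%n+[m/n]*n (reg σ x) 16) (+-comm (reg σ x % 16) _))))
                (hm _ _ (DM.m%n<n (reg σ x) 16))
  op-sound (stRaw x y) {σ = σ} {r = r} {m = m} at rel⟨ hr , hm ⟩ k =
    step-store at (k _ _ rel⟨ hr , (λ i z i< →
      trans (cong₂ (λ q w → (m [ q ≔ w ]) (z * 16 + i)) (hr x) (hr y))
            (upd-raw m (arr σ) hm (reg σ x) (reg σ y) i z i<)) ⟩)

  -- From σ, the code of c takes at most t steps and samples d.  The continuation K
  -- is the rest of the program, with one time bound u for all outcomes.
  record Triple (c : Cmd) (σ : State) (t : ℕ) {X : Set} (d : Dist X) (Q : X → State → Set) : Set where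
    constructor triple
    field
      exe : ∀ {P pc r m u} → At P pc (compile c pc) → Rel σ r m → (K : X → Dist (Maybe ℕ)) →
            (∀ x σ′ r′ m′ → Q x σ′ → Frame c σ σ′ → Rel σ′ r′ m′ → Halts P ⟨ end c pc , r′ , m′ ⟩ u (K x)) →
            Halts P ⟨ pc , r , m ⟩ (t + u) (d >>= K)
  open Triple public

  opLen≤7 : ∀ o → length (compOp o) ≤ 7
  opLen≤7 o = s≤s⁻¹ (<ᵇ⇒< (length (compOp o)) 8 (h o))
    where
    h : ∀ o → T (length (compOp o) <ᵇ 8)
    h (set d v)   = tt
    h (mov d x)   = tt
    h (add d x y) = tt
    h (sub d x y) = tt
    h (ld a d x)  = tt
    h (st a x y)  = tt
    h (ldRaw d x) = tt
    h (stRaw x y) = tt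

  ops-sound : ∀ os {P pc σ r m u d} → At P pc (compOps os) → Rel σ r m →
    (∀ r′ m′ → Rel (evalOps os σ) r′ m′ → Halts P ⟨ opsEnd os pc , r′ , m′ ⟩ u d) →
    Halts P ⟨ pc , r , m ⟩ (length os * 7 + u) d
  ops-sound []       at rel k = k _ _ rel
  ops-sound (o ∷ os) {u = u} at rel k =
    Halts-weaken
      (≤-trans (+-monoˡ-≤ _ (opLen≤7 o)) (≤-reflexive (sym (+-assoc 7 (length os * 7) u))))
      (op-sound o (at-head (compOp o) at) rel λ r′ m′ rel′ →
        ops-sound os (at-++ (compOp o) at) rel′ k)

  blkT : ∀ os σ → Triple (blk os) σ (length os * 7) (return tt) (λ _ σ′ → σ′ ≡ evalOps os σ)
  blkT os σ .exe at rel K k = ops-sound os at rel λ r′ m′ → k tt _ r′ m′ refl (blkFrame os σ)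

  seq-frame : ∀ {c₁ c₂ σ σ′ σ″} → Frame c₁ σ σ′ → Frame c₂ σ′ σ″ → Frame (c₁ ⨾ c₂) σ σ″
  seq-frame {c₁} f g = frame
    (λ i eq → trans (regs g i (∨-conicalʳ (writesReg c₁ i) _ eq)) (regs f i (∨-conicalˡ _ _ eq)))
    (λ i eq y → trans (arrays g i (∨-conicalʳ (writesArr c₁ i) _ eq) y) (arrays f i (∨-conicalˡ _ _ eq) y))

  Halts-≡ : ∀ {P cfg t t′ d d′} → t ≡ t′ → d ≡ d′ → Halts P cfg t d → Halts P cfg t′ d′
  Halts-≡ refl refl h = h

  seqT : ∀ {c₁ c₂ σ t₁ t₂} {X Y : Set} {d : Dist X} {f : X → Dist Y} {Q₁ Q₂} →
    Triple c₁ σ t₁ d Q₁ →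
    (∀ x σ′ → Q₁ x σ′ → Frame c₁ σ σ′ → Triple c₂ σ′ t₂ (f x) Q₂) →
    Triple (c₁ ⨾ c₂) σ (t₁ + t₂) (d >>= f) Q₂
  seqT {c₁} {c₂} {t₁ = t₁} {t₂} {d = d} {f} T₁ T₂ .exe {pc = pc} {u = u} at rel K k =
    Halts-≡ (sym (+-assoc t₁ t₂ u)) (sym (>>=-assoc d f K))
      (exe T₁ (at-head (compile c₁ pc) at) rel (λ x → f x >>= K) λ x σ′ r′ m′ q fr rel′ →
        exe (T₂ x σ′ q fr) (at-next c₁ at) rel′ K λ y σ″ r″ m″ q′ fr′ →
          k y σ″ r″ m″ q′ (seq-frame fr fr′))

  postT : ∀ {c σ t} {X : Set} {d : Dist X} {Q Q′ : X → State → Set} → Triple c σ t d Q →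
    (∀ x σ′ → Q x σ′ → Frame c σ σ′ → Q′ x σ′) → Triple c σ t d Q′
  postT T h .exe at rel K k =
    exe T at rel K λ x σ′ r′ m′ q fr → k x σ′ r′ m′ (h x σ′ q fr) fr

  timeT : ∀ {c σ t t′} {X : Set} {d : Dist X} {Q : X → State → Set} → t ≤ t′ →
    Triple c σ t d Q → Triple c σ t′ d Q
  timeT {t = t} {t′} t≤t′ T .exe {u = u} at rel K k = Halts-weaken (+-monoˡ-≤ u t≤t′) (exe T at rel K k)

  distT : ∀ {c σ t} {X : Set} {d d′ : Dist X} {Q : X → State → Set} → d ≡ d′ →
    Triple c σ t d Q → Triple c σ t d′ Q
  distT refl T = T

  mapT : ∀ {c σ t} {X Y : Set} {d : Dist X} {Q : X → State → Set} (g : X → Y) → Triple c σ t d Q →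
    Triple c σ t (d >>= (return ∘ g)) (λ y σ′ → ∃ λ x → y ≡ g x × Q x σ′)
  mapT {d = d} g T .exe at rel K k =
    Halts-≡ refl (sym (>>=-assoc d (return ∘ g) K))
      (exe T at rel (K ∘ g) λ x σ′ r′ m′ q → k (g x) σ′ r′ m′ (x , refl , q))

  keepT : ∀ {c₁ c₂ σ t₁ t₂} {X : Set} {d : Dist X} {Q₁ Q₂ : X → State → Set} →
    Triple c₁ σ t₁ d Q₁ →
    (∀ x σ′ → Q₁ x σ′ → Frame c₁ σ σ′ → Triple c₂ σ′ t₂ (return tt) (λ _ → Q₂ x)) →
    Triple (c₁ ⨾ c₂) σ (t₁ + t₂) d Q₂
  keepT {d = d} {Q₂ = Q₂} T₁ T₂ =
    distT (>>=-identityʳ d) (seqT T₁ λ x σ′ q fr →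
      postT (mapT (λ _ → x) (T₂ x σ′ q fr)) λ { _ _ (_ , refl , q′) _ → q′ })

  module _ {r : ℕ} {c : Cmd} {σ : State} where
    loop0T : reg σ r ≡ 0 → Triple (loop r c) σ 1 (return tt) (λ _ σ′ → σ′ ≡ σ)
    loop0T r≡0 .exe {P} {pc} {rr} {m} {u} at rel K k =
      step-jump at (subst (λ q → Halts P ⟨ q , rr , m ⟩ u (K tt)) (sym eq)
        (k tt σ _ _ refl (frame (λ _ _ → refl) (λ _ _ _ → refl)) rel))
      where
      eq : (if rr (2 + r) ≡ᵇ 0 then 2 + end c (3 + pc) else suc pc) ≡ 2 + end c (3 + pc)
      eq rewrite trans (regs≡ rel r) r≡0 = refl

    loopST : ∀ {j t t′} {X Y : Set} {d : Dist X} {f : X → Dist Y} {Q : X → State → Set} {Q′ : Y → State → Set} →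
      reg σ r ≡ suc j →
      Triple c ⟪ reg σ [ r ≔ j ] , arr σ ⟫ t d Q →
      (∀ x σ′ → Q x σ′ → Frame (loop r c) σ σ′ → Triple (loop r c) σ′ t′ (f x) Q′) →
      Triple (loop r c) σ (5 + t + t′) (d >>= f) Q′
    loopST {j} {t} {t′} {d = d} {f} {Q = Q} r≡ T T′ .exe {P} {pc} {rr} {m} {u} at rel K k =
      step-jump at (subst (λ q → Halts P ⟨ q , rr , m ⟩ _ _) (sym eq)
      (step-set at₁ (step-sub at₂
      (Halts-≡ tm (sym (>>=-assoc d f K))
        (exe T (at-head (compile c (3 + pc)) at₃) rel₁ (λ x → f x >>= K) λ x σ′ r′ m′ q fr rel′ →
          step-set (at-next c at₃) (step-jump (at-tail (at-next c at₃))
            (exe (T′ x σ′ q (fr₁ fr)) at rel⟨ regs≡ rel′ , mem≡ rel′ ⟩ K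
              λ y σ″ r″ m″ q′ fr′ → k y σ″ r″ m″ q′ (fr₂ (fr₁ fr) fr′))))))))
      where
      at₁ = at-tail at
      at₂ = at-tail at₁
      at₃ = at-tail at₂
      eq : (if rr (2 + r) ≡ᵇ 0 then 2 + end c (3 + pc) else suc pc) ≡ suc pc
      eq rewrite trans (regs≡ rel r) r≡ = refl
      rel₁ : Rel ⟪ reg σ [ r ≔ j ] , arr σ ⟫ _ m
      rel₁ = rel⟨ upd-shift (rr [ 0 ≔ 1 ]) (reg σ) (regs≡ rel) r (cong (_∸ 1) (trans (regs≡ rel r) r≡)) , mem≡ rel ⟩
      tm : t + (2 + (t′ + u)) ≡ 2 + (t + t′ + u)
      tm = lem t t′ u
        where
        lem : ∀ t t′ u → t + (2 + (t′ + u)) ≡ 2 + (t + t′ + u)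
        lem = solve-∀
      fr₁ : ∀ {σ′} → Frame c ⟪ reg σ [ r ≔ j ] , arr σ ⟫ σ′ → Frame (loop r c) σ σ′
      fr₁ fr = frame
        (λ i e → trans (regs fr i (∨-conicalʳ (i ≡ᵇ r) _ e)) (upd-other (reg σ) r j i (∨-conicalˡ _ _ e)))
        (arrays fr)
      fr₂ : ∀ {σ′ σ″} → Frame (loop r c) σ σ′ → Frame (loop r c) σ′ σ″ → Frame (loop r c) σ σ″
      fr₂ f g = frame (λ i e → trans (regs g i e) (regs f i e)) (λ i e y → trans (arrays g i e y) (arrays f i e y))

  module _ {r : ℕ} {c₁ c₂ : Cmd} {σ : State} {t : ℕ} {X : Set} {d : Dist X} {Q : X → State → Set} where
    ifzT : reg σ r ≡ 0 → Triple c₁ σ t d Q → Triple (ifz r c₁ c₂) σ (3 + t) d Q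
    ifzT r≡0 T .exe {P} {pc} {rr} {m} {u} at rel K k =
      Halts-weaken (s≤s (m≤n+m (t + u) 2))
      (step-jump at (subst (λ q → Halts P ⟨ q , rr , m ⟩ _ _) (sym eq)
        (exe T (at-tail (at-tail (at-next c₂ (at-tail at)))) rel K λ x σ′ r′ m′ q fr →
          k x σ′ r′ m′ q (frame (λ i e → regs fr i (∨-conicalˡ _ _ e)) (λ i e → arrays fr i (∨-conicalˡ _ _ e))))))
      where
      eq : (if rr (2 + r) ≡ᵇ 0 then 2 + end c₂ (1 + pc) else suc pc) ≡ 2 + end c₂ (1 + pc)
      eq rewrite trans (regs≡ rel r) r≡0 = refl

    ifnzT : ∀ {j} → reg σ r ≡ suc j → Triple c₂ σ t d Q → Triple (ifz r c₁ c₂) σ (3 + t) d Q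
    ifnzT r≡ T .exe {P} {pc} {rr} {m} {u} at rel K k =
      step-jump at (subst (λ q → Halts P ⟨ q , rr , m ⟩ _ _) (sym eq)
        (Halts-≡ tm refl (exe T (at-head (compile c₂ (1 + pc)) (at-tail at)) rel K λ x σ′ r′ m′ q fr rel′ →
          step-set (at-next c₂ (at-tail at)) (step-jump (at-tail (at-next c₂ (at-tail at)))
          (k x σ′ _ m′ q (frame (λ i e → regs fr i (∨-conicalʳ (writesReg c₁ i) _ e))
                                (λ i e → arrays fr i (∨-conicalʳ (writesArr c₁ i) _ e)))
             rel⟨ regs≡ rel′ , mem≡ rel′ ⟩)))))
      where
      eq : (if rr (2 + r) ≡ᵇ 0 then 2 + end c₂ (1 + pc) else suc pc) ≡ suc pc
      eq rewrite trans (regs≡ rel r) r≡ = refl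
      tm : t + (2 + u) ≡ 2 + (t + u)
      tm = lem t u
        where
        lem : ∀ t u → t + (2 + u) ≡ 2 + (t + u)
        lem = solve-∀

  tossT : ∀ {x σ} → Triple (toss x) σ 1 (flip p (return true) (return false))
                           (λ b σ′ → σ′ ≡ ⟪ reg σ [ x ≔ b2n b ] , arr σ ⟫)
  tossT {x} {σ} .exe {P} {pc} {r} {m} at rel K k =
    step-toss at (k true  _ _ _ refl (fr true)  rel⟨ upd-shift r _ (regs≡ rel) x refl , mem≡ rel ⟩)
                 (k false _ _ _ refl (fr false) rel⟨ upd-shift r _ (regs≡ rel) x refl , mem≡ rel ⟩)
    where
    fr : ∀ b → Frame (toss x) σ _
    fr b = frame (λ i e → upd-other (reg σ) x (b2n b) i e) (λ _ _ _ → refl)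

  +-≡ᵇ : ∀ k m n → (k + m ≡ᵇ k + n) ≡ (m ≡ᵇ n)
  +-≡ᵇ zero    m n = refl
  +-≡ᵇ (suc k) m n = +-≡ᵇ k m n

  -- The registers and the memory of the simulated machine occupy the cells
  -- from F on; the cells from reg σ rNext on are still untouched.
  record Simulates (F : ℕ) (r m : ℕ → ℕ) (σ : State) : Set where
    field
      fresh≡ : reg σ rFresh ≡ F
      regsA  : ∀ i → arr σ 0 (F + i) ≡ r i
      memA   : ∀ i → arr σ 1 (F + i) ≡ m i
      F≤next : F ≤ reg σ rNext
      zeroR  : ∀ i → reg σ rNext ≤ i → arr σ 0 i ≡ 0
      zeroM  : ∀ i → reg σ rNext ≤ i → arr σ 1 i ≡ 0
  open Simulates public

  shifted-upd : ∀ {F} {A r : ℕ → ℕ} → (∀ i → A (F + i) ≡ r i) → ∀ d {v w} → v ≡ w → ∀ i →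
    (if F + i ≡ᵇ F + d then v else A (F + i)) ≡ (r [ d ≔ w ]) i
  shifted-upd {F} h d eq i rewrite +-≡ᵇ F i d with i ≡ᵇ d
  ... | true  = eq
  ... | false = h i

  beyond : ∀ {F N} {A : ℕ → ℕ} → F ≤ N → (∀ i → N ≤ i → A i ≡ 0) → ∀ d v i → N + suc d ≤ i →
    (if i ≡ᵇ F + d then v else A i) ≡ 0
  beyond {F} {N} {A} F≤N z d v i le
    rewrite ≡ᵇ-false {i} {F + d} (λ eq → <-irrefl (sym eq)
      (≤-trans (≤-reflexive (sym (+-suc F d))) (≤-trans (+-monoˡ-≤ (suc d) F≤N) le))) =
    z i (≤-trans (m≤m+n N (suc d)) le)

  read₁ : ∀ {F r m σ} x → Simulates F r m σ →
    Simulates F r m (evalOps (readReg 1 x) σ) × reg (evalOps (readReg 1 x) σ) 1 ≡ r x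
  read₁ {σ = σ} x s = record
    { fresh≡ = fresh≡ s ; regsA = regsA s ; memA = memA s ; F≤next = F≤next s ; zeroR = zeroR s ; zeroM = zeroM s }
    , trans (cong (λ f → arr σ 0 (f + x)) (fresh≡ s)) (regsA s x)

  read₂ : ∀ {F r m σ} x → Simulates F r m σ →
    Simulates F r m (evalOps (readReg 2 x) σ) × reg (evalOps (readReg 2 x) σ) 2 ≡ r x
  read₂ {σ = σ} x s = record
    { fresh≡ = fresh≡ s ; regsA = regsA s ; memA = memA s ; F≤next = F≤next s ; zeroR = zeroR s ; zeroM = zeroM s }
    , trans (cong (λ f → arr σ 0 (f + x)) (fresh≡ s)) (regsA s x)

  write-sim : ∀ {F r m σ v} d → Simulates F r m σ → reg σ 1 ≡ v →
    Simulates F (r [ d ≔ v ]) m (evalOps (writeReg d) σ)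
  write-sim {F} {σ = σ} d s eq = record
    { fresh≡ = fresh≡ s
    ; regsA  = λ i → trans (cong (λ f → if F + i ≡ᵇ f + d then reg σ 1 else arr σ 0 (F + i)) (fresh≡ s))
                           (shifted-upd {F} {arr σ 0} (regsA s) d eq i)
    ; memA   = memA s
    ; F≤next = ≤-trans (F≤next s) (m≤m+n _ _)
    ; zeroR  = λ i le → trans (cong (λ f → if i ≡ᵇ f + d then reg σ 1 else arr σ 0 i) (fresh≡ s))
                              (beyond (F≤next s) (zeroR s) d (reg σ 1) i le)
    ; zeroM  = λ i le → zeroM s i (≤-trans (m≤m+n _ _) le)
    }

  storeOps : List Op
  storeOps = add 3 rFresh 1 ∷ st aMem 3 2 ∷ set 0 1 ∷ add 1 1 0 ∷ add rNext rNext 1 ∷ []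

  store-sim : ∀ {F r m σ a v} → Simulates F r m σ → reg σ 1 ≡ a → reg σ 2 ≡ v →
    Simulates F r (m [ a ≔ v ]) (evalOps storeOps σ)
  store-sim {F} {σ = σ} {a} s ea ev = record
    { fresh≡ = fresh≡ s
    ; regsA  = regsA s
    ; memA   = λ i → trans (cong₂ (λ f b → if F + i ≡ᵇ f + b then reg σ 2 else arr σ 1 (F + i)) (fresh≡ s) ea)
                           (shifted-upd {F} {arr σ 1} (memA s) a ev i)
    ; F≤next = ≤-trans (F≤next s) (m≤m+n _ _)
    ; zeroR  = λ i le → zeroR s i (≤-trans (m≤m+n _ _) le)
    ; zeroM  = λ i le → trans (cong (λ f → if i ≡ᵇ f + reg σ 1 then reg σ 2 else arr σ 1 i) (fresh≡ s))
                              (beyond (F≤next s) (zeroM s) (reg σ 1) (reg σ 2) i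
                                (subst (λ q → reg σ rNext + q ≤ i) (+-comm (reg σ 1) 1) le))
    }

  load-sim : ∀ {F r m σ a} → Simulates F r m σ → reg σ 1 ≡ a →
    let σ′ = evalOps (add 1 rFresh 1 ∷ ld aMem 1 1 ∷ []) σ in Simulates F r m σ′ × reg σ′ 1 ≡ m a
  load-sim {σ = σ} {a} s eq = record
    { fresh≡ = fresh≡ s ; regsA = regsA s ; memA = memA s ; F≤next = F≤next s ; zeroR = zeroR s ; zeroM = zeroM s }
    , trans (cong₂ (λ f b → arr σ 1 (f + b)) (fresh≡ s) eq) (memA s a)

  ≥-suc : ∀ k i → (i <ᵇ k) ≡ false → ∃ λ j → i ≡ k + j
  ≥-suc zero    i       eq = i , refl
  ≥-suc (suc k) (suc i) eq with ≥-suc k i eq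
  ... | j , refl = j , refl

  SimFrame : State → State → Set
  SimFrame σ σ′ = (∀ i → reg σ′ (8 + i) ≡ reg σ (8 + i)) × (∀ i y → arr σ′ (2 + i) y ≡ arr σ (2 + i) y)

  simFrame⇒frame : ∀ {A σ σ′} → SimFrame σ σ′ → Frame (sim A) σ σ′
  simFrame⇒frame {σ = σ} {σ′} (f , g) = frame
    (λ i eq → let (j , e) = ≥-suc 8 i eq in subst (λ i → reg σ′ i ≡ reg σ i) (sym e) (f j))
    (λ i eq y → let (j , e) = ≥-suc 2 i eq in subst (λ i → arr σ′ i y ≡ arr σ i y) (sym e) (g j y))

  at-simInstr : ∀ {P addr stop i} A l pc → head (drop l A) ≡ just i → At P pc (simCode addr stop A) →
    At P (simAddr A l pc) (simInstr addr stop i)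
  at-simInstr {addr = addr} {stop} (i ∷ is) zero    pc refl at = at-head (simInstr addr stop i) at
  at-simInstr {P} {addr = addr} {stop} (i ∷ is) (suc l) pc eq   at =
    at-simInstr is l (simLen i + pc) eq
      (subst (λ n → At P (n + pc) (simCode addr stop is)) (simLen≡ addr stop i) (at-++ (simInstr addr stop i) at))

  simAddr-suc : ∀ {i} A l pc → head (drop l A) ≡ just i → simAddr A (suc l) pc ≡ simLen i + simAddr A l pc
  simAddr-suc (i ∷ [])     zero    pc refl = refl
  simAddr-suc (i ∷ j ∷ is) zero    pc refl = refl
  simAddr-suc (i ∷ is)     (suc l) pc eq   = simAddr-suc is l (simLen i + pc) eq

  simAddr-stop : ∀ A l pc → head (drop l A) ≡ nothing → simAddr A l pc ≡ simStop A pc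
  simAddr-stop []       l       pc eq = refl
  simAddr-stop (i ∷ is) (suc l) pc eq = simAddr-stop is l (simLen i + pc) eq

  record SimResult (F : ℕ) (o : Maybe ℕ) (σ : State) : Set where
    field
      {rA mA} : ℕ → ℕ
      result  : o ≡ just (rA 0)
      state   : Simulates F rA mA σ
  open SimResult public

  module Simulation {P A : Program} {pc₀ : ℕ} (at : At P pc₀ (compile (sim A) pc₀)) {F : ℕ} {σ₀ : State} {u : ℕ}
    (K : Maybe ℕ → Dist (Maybe ℕ))
    (k : ∀ o σ r m → SimResult F o σ → Frame (sim A) σ₀ σ → Rel σ r m →
         Halts P ⟨ simStop A pc₀ , r , m ⟩ u (K o)) where

    addr : ℕ → ℕ
    addr l = simAddr A l pc₀

    finish : ∀ {σ rA mA r m} → Simulates F rA mA σ → SimFrame σ₀ σ → Rel σ r m →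
      Halts P ⟨ simStop A pc₀ , r , m ⟩ u (K (just (rA 0)))
    finish s fr rel = k _ _ _ _ (record { result = refl ; state = s }) (simFrame⇒frame fr) rel

    next : ∀ {σ r m d i} l T os → head (drop l A) ≡ just i → simInstr addr (simStop A pc₀) i ≡ compOps os →
      length os ≤ 14 → Rel σ r m →
      (∀ r′ m′ → Rel (evalOps os σ) r′ m′ → Halts P ⟨ addr (suc l) , r′ , m′ ⟩ (T * 110 + u) d) →
      Halts P ⟨ addr l , r , m ⟩ (suc T * 110 + u) d
    next {i = i} l T os eq ci le rel k′ =
      Halts-weaken (≤-trans (+-monoˡ-≤ (T * 110 + u) (≤-trans (*-monoˡ-≤ 7 le) (m≤m+n 98 12)))
                            (≤-reflexive (sym (+-assoc 110 (T * 110) u))))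
        (ops-sound os (subst (At P (addr l)) ci (at-simInstr A l pc₀ eq at)) rel λ r′ m′ rel′ →
          subst (λ q → Halts P ⟨ q , r′ , m′ ⟩ (T * 110 + u) _)
            (trans (simAddr-suc A l pc₀ eq) (trans (cong (_+ addr l)
              (trans (sym (simLen≡ addr (simStop A pc₀) i)) (cong length ci))) (opsEnd≡ os (addr l))))
            (k′ r′ m′ rel′))

    steps : ∀ T l {σ rA mA r m} → Simulates F rA mA σ → SimFrame σ₀ σ → Rel σ r m →
      Surely (_≢ nothing) (exec p A T ⟨ l , rA , mA ⟩) →
      Halts P ⟨ addr l , r , m ⟩ (T * 110 + u) (exec p A T ⟨ l , rA , mA ⟩ >>= K)

    tossStep : ∀ T l {σ rA mA r m d q} → head (drop l A) ≡ just (toss d q) →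
      Simulates F rA mA σ → SimFrame σ₀ σ → Rel σ r m →
      Surely (_≢ nothing) (exec p A T ⟨ suc l , rA [ d ≔ 1 ] , mA ⟩) →
      Surely (_≢ nothing) (exec p A T ⟨ suc l , rA [ d ≔ 0 ] , mA ⟩) →
      Halts P ⟨ addr l , r , m ⟩ (suc T * 110 + u)
        (flip (bias q) (exec p A T ⟨ suc l , rA [ d ≔ 1 ] , mA ⟩ >>= K)
                       (exec p A T ⟨ suc l , rA [ d ≔ 0 ] , mA ⟩ >>= K))
    tossStep T l {σ} {rA} {mA} {r} {m} {d} {q} eq s fr rel h₁ h₂ =
      step-toss at′ (branch 1 h₁) (branch 0 h₂)
      where
      at′ = at-simInstr A l pc₀ eq at
      branch : ∀ b → Surely (_≢ nothing) (exec p A T ⟨ suc l , rA [ d ≔ b ] , mA ⟩) →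
        Halts P ⟨ suc (addr l) , r [ 3 ≔ b ] , m ⟩ (109 + T * 110 + u) (exec p A T ⟨ suc l , rA [ d ≔ b ] , mA ⟩ >>= K)
      branch b h =
        Halts-weaken (≤-trans (+-monoˡ-≤ (T * 110 + u) (m≤m+n 35 74)) (≤-reflexive (sym (+-assoc 109 (T * 110) u))))
          (ops-sound (writeReg d) {σ = σ′} (at-tail at′)
            rel⟨ upd-shift r (reg σ) (regs≡ rel) 1 refl , mem≡ rel ⟩ λ r′ m′ rel′ →
            subst (λ pc → Halts P ⟨ pc , r′ , m′ ⟩ (T * 110 + u) (exec p A T ⟨ suc l , rA [ d ≔ b ] , mA ⟩ >>= K))
              (trans (simAddr-suc A l pc₀ eq) (trans (sym (+-suc (length (compOps (writeReg d))) (addr l)))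
                (opsEnd≡ (writeReg d) (suc (addr l)))))
              (steps T (suc l) (write-sim {σ = σ′} d s′ refl) fr rel′ h))
        where
        σ′ = ⟪ reg σ [ 1 ≔ b ] , arr σ ⟫
        s′ : Simulates F rA mA σ′
        s′ = record { fresh≡ = fresh≡ s ; regsA = regsA s ; memA = memA s ; F≤next = F≤next s
                    ; zeroR = zeroR s ; zeroM = zeroM s }

    steps zero    l s fr rel h = contradiction refl h
    steps (suc T) l {σ} {rA} {mA} {r} {m} s fr rel with head (drop l A) in eq
    ... | nothing = λ _ → Halts-weaken (m≤n+m u (suc T * 110))
      (subst (λ q → Halts P ⟨ q , r , m ⟩ u _) (sym (simAddr-stop A l pc₀ eq)) (finish s fr rel))
    ... | just halt = λ _ → Halts-weaken (+-monoˡ-≤ u (m≤m+n 2 (108 + T * 110)))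
      (step-set at′ (step-jump (at-tail at′) (finish s fr rel⟨ regs≡ rel , mem≡ rel ⟩)))
      where at′ = at-simInstr A l pc₀ eq at
    ... | just (set d v) = λ h → next l T (simOps (set d v)) eq refl (m≤m+n 6 8) rel λ r′ m′ rel′ →
      steps T (suc l) (write-sim {σ = evalOps (set 1 v ∷ []) σ} d
        (record { fresh≡ = fresh≡ s ; regsA = regsA s ; memA = memA s ; F≤next = F≤next s
                ; zeroR = zeroR s ; zeroM = zeroM s }) refl) fr rel′ h
    ... | just (add d x y) = λ h → next l T (simOps (add d x y)) eq refl (m≤m+n 12 2) rel λ r′ m′ rel′ →
      let (s₁ , e₁) = read₁ x s ; (s₂ , e₂) = read₂ y s₁ in
      steps T (suc l) (write-sim {σ = evalOps (readReg 1 x ++ readReg 2 y ++ add 1 1 2 ∷ []) σ} d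
        (record { fresh≡ = fresh≡ s ; regsA = regsA s ; memA = memA s ; F≤next = F≤next s
                ; zeroR = zeroR s ; zeroM = zeroM s }) (cong₂ _+_ e₁ e₂)) fr rel′ h
    ... | just (sub d x y) = λ h → next l T (simOps (sub d x y)) eq refl (m≤m+n 12 2) rel λ r′ m′ rel′ →
      let (s₁ , e₁) = read₁ x s ; (s₂ , e₂) = read₂ y s₁ in
      steps T (suc l) (write-sim {σ = evalOps (readReg 1 x ++ readReg 2 y ++ sub 1 1 2 ∷ []) σ} d
        (record { fresh≡ = fresh≡ s ; regsA = regsA s ; memA = memA s ; F≤next = F≤next s
                ; zeroR = zeroR s ; zeroM = zeroM s }) (cong₂ _∸_ e₁ e₂)) fr rel′ h
    ... | just (load d a) = λ h → next l T (simOps (load d a)) eq refl (m≤m+n 10 4) rel λ r′ m′ rel′ →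
      let (s₁ , e₁) = read₁ a s ; (s₂ , e₂) = load-sim s₁ e₁ in
      steps T (suc l) (write-sim d s₂ e₂) fr rel′ h
    ... | just (store a x) = λ h → next l T (simOps (store a x)) eq refl (m≤m+n 11 3) rel λ r′ m′ rel′ →
      let (s₁ , e₁) = read₁ a s ; (s₂ , e₂) = read₂ x s₁ in
      steps T (suc l) (store-sim s₂ e₁ e₂) fr rel′ h
    ... | just (toss d (fixed q)) = λ (h₁ , h₂) → tossStep T l eq s fr rel h₁ h₂
    ... | just (toss d density)   = λ (h₁ , h₂) → tossStep T l eq s fr rel h₁ h₂
    ... | just (jumpZero x tgt) = λ h →
      Halts-weaken (≤-trans (+-monoˡ-≤ (T * 110 + u) (m≤m+n 22 88)) (≤-reflexive (sym (+-assoc 110 (T * 110) u))))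
        (ops-sound (readReg 1 x) (at-head (compOps (readReg 1 x)) at′) rel λ r′ m′ rel′ →
          let (s₁ , e₁) = read₁ x s in
          step-jump (subst (λ q → At P q (jumpZero 3 (addr tgt) ∷ [])) (opsEnd≡ (readReg 1 x) (addr l)) (at-++ (compOps (readReg 1 x)) at′))
            (subst (λ q → Halts P ⟨ q , r′ , m′ ⟩ (T * 110 + u) _) (sym (target e₁ rel′))
              (steps T (if rA x ≡ᵇ 0 then tgt else suc l) s₁ fr rel′ h)))
      where
      at′ = at-simInstr A l pc₀ eq at
      target : ∀ {σ′ r′ m′} → reg σ′ 1 ≡ rA x → Rel σ′ r′ m′ →
        (if r′ 3 ≡ᵇ 0 then addr tgt else suc (opsEnd (readReg 1 x) (addr l))) ≡
        addr (if rA x ≡ᵇ 0 then tgt else suc l)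
      target e rel′ rewrite trans (regs≡ rel′ 1) e with rA x ≡ᵇ 0
      ... | true  = refl
      ... | false = sym (simAddr-suc A l pc₀ eq)

  simT : ∀ {A F σ rA mA} T → Simulates F rA mA σ → Surely (_≢ nothing) (exec p A T ⟨ 0 , rA , mA ⟩) →
    Triple (sim A) σ (T * 110) (exec p A T ⟨ 0 , rA , mA ⟩) (SimResult F)
  simT {A} {F} {σ} T s h .exe {P} {pc} at rel K k =
    subst (λ q → Halts P ⟨ q , _ , _ ⟩ _ _) (simAddr-zero A pc)
      (Simulation.steps at {F} {σ} K (λ o σ′ r′ m′ q fr rel′ → k o σ′ r′ m′ q fr rel′) T 0 s
        ((λ _ → refl) , (λ _ _ → refl)) rel h)
    where
    simAddr-zero : ∀ A pc → simAddr A 0 pc ≡ pc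
    simAddr-zero []      pc = refl
    simAddr-zero (_ ∷ _) pc = refl

  detLoop : ∀ {r c t} (Inv : ℕ → State → Set) {σ₀} →
    (∀ j σ → Inv j σ → reg σ r ≡ j) →
    (∀ j σ → Inv (suc j) σ → Frame (loop r c) σ₀ σ →
      Triple c ⟪ reg σ [ r ≔ j ] , arr σ ⟫ t (return tt) (λ _ → Inv j)) →
    ∀ j σ → Inv j σ → Frame (loop r c) σ₀ σ →
    Triple (loop r c) σ (j * (5 + t) + 1) (return tt) (λ _ σ′ → Inv 0 σ′)
  detLoop Inv r≡ body zero    σ inv fr = postT (loop0T (r≡ 0 σ inv)) λ { _ _ refl _ → inv }
  detLoop {r} {c} {t} Inv r≡ body (suc j) σ inv fr =
    timeT (≤-reflexive (sym (+-assoc (5 + t) (j * (5 + t)) 1)))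
      (loopST (r≡ (suc j) σ inv) (body j σ inv fr) λ _ σ′ inv′ fr′ → detLoop Inv r≡ body j σ′ inv′ (fr-trans fr fr′))
    where
    fr-trans : ∀ {σ₁ σ₂ σ₃} → Frame (loop r c) σ₁ σ₂ → Frame (loop r c) σ₂ σ₃ → Frame (loop r c) σ₁ σ₃
    fr-trans f g = frame (λ i e → trans (regs g i e) (regs f i e)) (λ i e y → trans (arrays g i e y) (arrays f i e y))

  -- Inv counts the repetitions still to come.
  repT : ∀ {c} (t : ℕ → ℕ) (Inv : ℕ → State → Set) →
    (∀ j σ → Inv (suc j) σ → Triple c σ (t j) (return tt) (λ _ → Inv j)) →
    ∀ n σ → Inv n σ → Triple (repC n c) σ (sumTo n t) (return tt) (λ _ → Inv 0)
  repT t Inv body zero    σ inv = postT (blkT [] σ) λ { _ _ refl _ → inv }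
  repT t Inv body (suc n) σ inv = seqT (body n σ inv) λ _ σ′ inv′ _ → repT t Inv body n σ′ inv′

 -- The queries for one tuple of blocks

 -- Edges as found in the queue: the label last chosen, the key and the code.
 Item : Set
 Item = ℕ × ℕ × ℕ

 kids : (I P : ℕ → ℕ) (α β : ℕ) → ℕ → List Item
 kids I P α β zero    = []
 kids I P α β (suc u) = (u , α + I u , β + P u) ∷ kids I P α β u

 children : (μ I P : ℕ → ℕ) → Item → List Item
 children μ I P (u , a , b) = kids I P (μ a) (μ b) u

 stages : (μ I P : ℕ → ℕ) → ℕ → List Item → List Item
 stages μ I P zero    its = its
 stages μ I P (suc j) its = stages μ I P j (concatMap (children μ I P) its)

 bfsItems : (μ I P : ℕ → ℕ) → ℕ → ℕ → List Item
 bfsItems μ I P n s = stages μ I P s ((n , 0 , 0) ∷ [])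

 bitAt : List Bool → ℕ → Bool
 bitAt []       i       = false
 bitAt (b ∷ bs) zero    = b
 bitAt (b ∷ bs) (suc i) = bitAt bs i

 bitAt-snoc-< : ∀ bs b i → i ≢ length bs → bitAt (bs ++ b ∷ []) i ≡ bitAt bs i
 bitAt-snoc-< []       b zero    i≢ = contradiction refl i≢
 bitAt-snoc-< []       b (suc i) i≢ = refl
 bitAt-snoc-< (_ ∷ bs) b zero    i≢ = refl
 bitAt-snoc-< (_ ∷ bs) b (suc i) i≢ = bitAt-snoc-< bs b i (λ eq → i≢ (cong suc eq))

 bitAt-snoc : ∀ bs b → bitAt (bs ++ b ∷ []) (length bs) ≡ b
 bitAt-snoc []       b = refl
 bitAt-snoc (_ ∷ bs) b = bitAt-snoc bs b

 bitAt-beyond : ∀ bs i → length bs ≤ i → bitAt bs i ≡ false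
 bitAt-beyond []       i       le       = refl
 bitAt-beyond (b ∷ bs) (suc i) (s≤s le) = bitAt-beyond bs i le

 queryBits : (ℕ → ℕ) → List Item → List (List Bool) → List Bool
 queryBits a ((_ , _ , c) ∷ its) (y ∷ ys) = bitAt y (a c) ∷ queryBits a its ys
 queryBits a _                   _        = []

 hcode : (ℕ → ℕ) → ℕ → List ℕ → ℕ
 hcode μ = foldl (λ a x → μ a + x)

 nth : List ℕ → ℕ → ℕ
 nth []       i       = 0
 nth (t ∷ ts) zero    = t
 nth (t ∷ ts) (suc i) = nth ts i

 Distinct : List ℕ → Set
 Distinct []       = ⊤
 Distinct (κ ∷ κs) = All (κ ≢_) κs × Distinct κs

 blockImage : (m : ℕ) .{{_ : NonZero m}} → List ℕ → ℕ → ℕ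
 blockImage m ts u = nth ts (u / m) * m + u % m

 Arrays : Set
 Arrays = ℕ → ℕ → ℕ

 Segment : Arrays → ℕ → List Item → Set
 Segment A q []                  = ⊤
 Segment A q ((u , a , b) ∷ its) = (A 6 q ≡ u × A 7 q ≡ a × A 8 q ≡ b) × Segment A (suc q) its

 record Below (w : ℕ) (A A′ : Arrays) : Set where
  constructor below
  field
    unchanged : ∀ y → y < w → A′ 6 y ≡ A 6 y × A′ 7 y ≡ A 7 y × A′ 8 y ≡ A 8 y
 open Below public

 below-refl : ∀ {w A} → Below w A A
 below-refl = below λ _ _ → refl , refl , refl

 below-trans : ∀ {w A B C} → Below w A B → Below w B C → Below w A C
 unchanged (below-trans f g) y y<w with unchanged f y y<w | unchanged g y y<w
 ... | a , b , c | a′ , b′ , c′ = trans a′ a , trans b′ b , trans c′ c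

 below-≤ : ∀ {w w′ A B} → w ≤ w′ → Below w′ A B → Below w A B
 below-≤ le f = below λ y y<w → unchanged f y (≤-trans y<w le)

 segment-below : ∀ {A A′} q its {w} → q + length its ≤ w → Below w A A′ → Segment A q its → Segment A′ q its
 segment-below q []                  le f _ = tt
 segment-below {A} {A′} q ((u , a , b) ∷ its) {w} le f ((e₁ , e₂ , e₃) , seg) =
  let le′ = subst (_≤ w) (+-suc q (length its)) le
      (f₁ , f₂ , f₃) = unchanged f q (≤-trans (s≤s (m≤m+n q (length its))) le′) in
  (trans f₁ e₁ , trans f₂ e₂ , trans f₃ e₃) ,
  segment-below (suc q) its le′ f seg

 segment-++ : ∀ {A} q its {its′} → Segment A q its → Segment A (q + length its) its′ → Segment A q (its ++ its′)
 segment-++ {A} q []         {its′} _         seg′ = subst (λ q → Segment A q its′) (+-identityʳ q) seg′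
 segment-++ {A} q (it ∷ its) {its′} (e , seg) seg′ =
  e , segment-++ (suc q) its seg (subst (λ q → Segment A q its′) (+-suc q (length its)) seg′)

 <⇒≡ᵇ-false : ∀ {m n} → m < n → (m ≡ᵇ n) ≡ false
 <⇒≡ᵇ-false m<n = ≡ᵇ-false (<⇒≢ m<n)

 module Commands (ℝ : Reals) where
  open Model ℝ using (Program)
  open Language ℝ

  -- Registers: 8 = n, 9 = scale, 10 = m, 11 = (k + k) * m, 12 = L, 13 = n ^ s,
  -- 14 = first cell of the simulated machine, 15 = parity so far, 16, 17, 18 =
  -- end, start and length of the last stage of the queue, 19 = loop counter,
  -- 20 to 23 = current item, 24, 25, 28 = end, start and cursor of the sampled
  -- vectors, 26 = retries, 27 = parity requested from the sampler.
  pushOps : List Op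
  pushOps = ld image 0 21 ∷ add 0 22 0 ∷ ld part 1 21 ∷ add 1 23 1 ∷
            st qLast 16 21 ∷ st qKey 16 0 ∷ st qCode 16 1 ∷ set 2 1 ∷ add 16 16 2 ∷ []

  popOps : List Op
  popOps = ld qLast 21 20 ∷ ld qKey 22 20 ∷ ld qCode 23 20 ∷ ld mulT 22 22 ∷ ld mulT 23 23 ∷
           set 0 1 ∷ add 20 20 0 ∷ []

  itemC stageC : Cmd
  itemC  = blk popOps ⨾ loop 21 (blk pushOps)
  stageC = blk (mov 19 18 ∷ mov 20 17 ∷ mov 17 16 ∷ []) ⨾ loop 19 itemC ⨾ blk (sub 18 16 17 ∷ [])

  rootOps : List Op
  rootOps = set 0 0 ∷ st qLast 16 8 ∷ st qKey 16 0 ∷ st qCode 16 0 ∷ mov 17 16 ∷ set 18 1 ∷ add 16 16 18 ∷ []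

  bfsC : ℕ → Cmd
  bfsC s = blk rootOps ⨾ repC s stageC

  sampleOps nextOps : List Op
  sampleOps = ld qKey 0 20 ∷ ld table 27 0 ∷ []
  nextOps   = add 24 24 12 ∷ set 0 1 ∷ add 20 20 0 ∷ []

  sampleC : Cmd → Cmd
  sampleC smp = blk sampleOps ⨾ smp ⨾ blk nextOps

  writeOps argOps resultOps : List Op
  writeOps  = ld qCode 0 20 ∷ ld index 0 0 ∷ add 0 28 0 ∷ ld vecs 1 0 ∷ st aMem 7 1 ∷
              set 2 1 ∷ add 7 7 2 ∷ add 20 20 2 ∷ add 28 28 12 ∷ []
  argOps    = mov 0 14 ∷ st aReg 0 8 ∷ set 1 1 ∷ add 0 0 1 ∷ st aReg 0 9 ∷ add 7 7 1 ∷ add 7 7 1 ∷ []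
  resultOps = ld aReg 0 14 ∷ sub 1 15 0 ∷ sub 2 0 15 ∷ add 15 1 2 ∷ mov 14 7 ∷ []

  queryC : Program → Cmd
  queryC A = blk (mov 7 14 ∷ mov 19 18 ∷ mov 20 17 ∷ mov 28 25 ∷ []) ⨾ loop 19 (blk writeOps) ⨾
             blk argOps ⨾ sim A ⨾ blk resultOps

  codeOps : List ℕ → List Op
  codeOps []      = []
  codeOps (x ∷ J) = ld mulT 0 0 ∷ set 1 x ∷ add 0 0 1 ∷ codeOps J

  -- One loop per block of edges; its counter is kept in the cell of the array
  -- `index` that belongs to the block while register 19 is used inside.
  enterC leaveC : List ℕ → Cmd
  enterC J = blk (set 0 0 ∷ codeOps J) ⨾ blk (st index 0 19 ∷ [])
  leaveC J = blk (set 0 0 ∷ codeOps J) ⨾ blk (ld index 19 0 ∷ [])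

  queriesC : Program → List (List ℕ) → Cmd
  queriesC A []       = queryC A
  queriesC A (J ∷ Js) = blk (mov 19 12 ∷ []) ⨾ loop 19 (enterC J ⨾ queriesC A Js ⨾ leaveC J)

  partC : ℕ → ℕ → Cmd
  partC q t = blk (set 2 0 ∷ set 19 t ∷ []) ⨾ loop 19 (blk (add 2 2 10 ∷ [])) ⨾
              blk (set 1 q ∷ mov 19 10 ∷ []) ⨾
              loop 19 (blk (add 0 3 19 ∷ add 4 2 19 ∷ st image 0 4 ∷ st part 0 1 ∷ [])) ⨾
              blk (add 3 3 10 ∷ [])

  partsC : ℕ → List ℕ → Cmd
  partsC q []       = blk []
  partsC q (t ∷ ts) = partC q t ⨾ partsC (suc q) ts

  fillOps : List Op
  fillOps = add 0 3 19 ∷ add 4 2 19 ∷ st image 0 4 ∷ st part 0 1 ∷ []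

  tupleC : Program → Cmd → ℕ → List (List ℕ) → List ℕ → Cmd
  tupleC A smp s Js ts =
    (blk (set 3 0 ∷ []) ⨾ partsC 0 ts) ⨾ bfsC s ⨾
    (blk (mov 25 24 ∷ mov 19 18 ∷ mov 20 17 ∷ []) ⨾ loop 19 (sampleC smp)) ⨾ queriesC A Js

  tuplesC : Program → Cmd → ℕ → List (List ℕ) → List (List ℕ) → Cmd
  tuplesC A smp s Js []         = blk []
  tuplesC A smp s Js (ts ∷ tss) = tupleC A smp s Js ts ⨾ tuplesC A smp s Js tss

 module Trees (ℝ : Reals) where
  open Model ℝ using (Dist; return; _>>=_; _[_≔_])

  combine : ℕ → Maybe ℕ → ℕ
  combine acc nothing  = acc
  combine acc (just v) = (acc ∸ v) + (v ∸ acc)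

  sampleAll : (Bool → Dist (List Bool)) → List Bool → Dist (List (List Bool))
  sampleAll samp []       = return []
  sampleAll samp (x ∷ xs) = samp x >>= λ v → sampleAll samp xs >>= λ vs → return (v ∷ vs)

  iterate : ∀ {X : Set} → (ℕ → X → Dist X) → ℕ → X → Dist X
  iterate f zero    x = return x
  iterate f (suc j) x = f j x >>= iterate f j

  queryTree : ℕ → ((ℕ → ℕ) → Dist (Maybe ℕ)) → List ℕ → (ℕ → ℕ) → ℕ → Dist ℕ
  queryTree L run []       a acc = run a >>= λ o → return (combine acc o)
  queryTree L run (κ ∷ κs) a acc = iterate (λ i → queryTree L run κs (a [ κ ≔ i ])) L acc

 module Main (ℝ : Reals) (p : Model.Prob ℝ) where
  open Model ℝ using
    ( Dist; return; flip; _>>=_; Instr; Program; exec; _[_≔_]; Config; Surely )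
  open Compiler ℝ p public
  open Commands ℝ public
  open Trees ℝ public

  module _ {I P : ℕ → ℕ} {α β : ℕ} {ℓ w : ℕ} where
    record Pushing (A₀ : Arrays) (j : ℕ) (σ : State) : Set where
      field
        done  : List Item
        split : done ++ kids I P α β j ≡ kids I P α β ℓ
        seg   : Segment (arr σ) w done
        tail≡ : reg σ 16 ≡ w + length done
        ctr≡  : reg σ 21 ≡ j
        α≡    : reg σ 22 ≡ α
        β≡    : reg σ 23 ≡ β
        old   : Below w A₀ (arr σ)
    open Pushing

    pushT : ∀ σ → reg σ 16 ≡ w → reg σ 21 ≡ ℓ → reg σ 22 ≡ α → reg σ 23 ≡ β →
      (∀ y → arr σ 4 y ≡ I y) → (∀ y → arr σ 5 y ≡ P y) →
      Triple (loop 21 (blk pushOps)) σ (ℓ * 68 + 1) (return tt) (λ _ σ′ →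
        Segment (arr σ′) w (kids I P α β ℓ) × reg σ′ 16 ≡ w + length (kids I P α β ℓ) × Below w (arr σ) (arr σ′))
    pushT σ₀ w≡ ℓ≡ α≡₀ β≡₀ I≡ P≡ =
      postT (detLoop (Pushing (arr σ₀)) (λ _ _ → ctr≡) body ℓ σ₀
        (record { done = [] ; split = refl ; seg = tt ; tail≡ = trans w≡ (sym (+-identityʳ w))
                ; ctr≡ = ℓ≡ ; α≡ = α≡₀ ; β≡ = β≡₀ ; old = below-refl }) frame-refl)
        λ _ σ′ q _ → let e = trans (sym (++-identityʳ (done q))) (split q) in
          subst (Segment (arr σ′) w) e (seg q) , trans (tail≡ q) (cong (λ l → w + length l) e) , old q
      where
      body : ∀ j σ → Pushing (arr σ₀) (suc j) σ → Frame (loop 21 (blk pushOps)) σ₀ σ →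
             Triple (blk pushOps) ⟪ reg σ [ 21 ≔ j ] , arr σ ⟫ 63 (return tt) (λ _ → Pushing (arr σ₀) j)
      body j σ q fr = postT (blkT pushOps _) λ { _ _ refl _ → record
        { done  = done q ++ (j , α + I j , β + P j) ∷ []
        ; split = trans (++-assoc (done q) _ _) (split q)
        ; seg   = segment-++ w (done q) (segment-below w (done q) (≤-reflexive (sym (tail≡ q))) new (seg q))
                    (subst (λ z → Segment A′ z ((j , α + I j , β + P j) ∷ [])) (tail≡ q)
                      ((at-tail₆ , trans at-tail₇ (cong₂ _+_ (α≡ q) (trans (arrays fr 4 refl j) (I≡ j)))
                                 , trans at-tail₈ (cong₂ _+_ (β≡ q) (trans (arrays fr 5 refl j) (P≡ j)))) , tt))
        ; tail≡ = trans (cong (_+ 1) (tail≡ q)) (trans (+-assoc w _ 1)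
                    (cong (w +_) (sym (length-++ (done q)))))
        ; ctr≡  = refl
        ; α≡    = α≡ q
        ; β≡    = β≡ q
        ; old   = below-trans (old q) (below-≤ (≤-trans (m≤m+n w _) (≤-reflexive (sym (tail≡ q)))) new)
        } }
        where
        z = reg σ 16
        A′ = arr (evalOps pushOps ⟪ reg σ [ 21 ≔ j ] , arr σ ⟫)
        new : Below z (arr σ) A′
        unchanged new y y<z rewrite <⇒≡ᵇ-false y<z = refl , refl , refl
        at-tail₆ : A′ 6 z ≡ j
        at-tail₆ rewrite ≡ᵇ-refl z = refl
        at-tail₇ : A′ 7 z ≡ reg σ 22 + arr σ 4 j
        at-tail₇ rewrite ≡ᵇ-refl z = refl
        at-tail₈ : A′ 8 z ≡ reg σ 23 + arr σ 5 j
        at-tail₈ rewrite ≡ᵇ-refl z = refl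

  module _ {μ I P : ℕ → ℕ} {n : ℕ} where
    record Scanning (A₀ : Arrays) (w : ℕ) (its : List Item) (j : ℕ) (σ : State) : Set where
      field
        done rest : List Item
        split : done ++ concatMap (children μ I P) rest ≡ concatMap (children μ I P) its
        len≡  : length rest ≡ j
        bound : All (λ it → proj₁ it ≤ n) rest
        from  : Segment (arr σ) (reg σ 20) rest
        end≡w : reg σ 20 + length rest ≡ w
        into  : Segment (arr σ) w done
        tail≡ : reg σ 16 ≡ w + length done
        ctr≡  : reg σ 19 ≡ j
        old   : Below w A₀ (arr σ)
    open Scanning

    scanT : ∀ σ w its → Segment (arr σ) (reg σ 20) its → reg σ 20 + length its ≡ w →
      reg σ 16 ≡ w → reg σ 19 ≡ length its → All (λ it → proj₁ it ≤ n) its →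
      (∀ y → arr σ 3 y ≡ μ y) → (∀ y → arr σ 4 y ≡ I y) → (∀ y → arr σ 5 y ≡ P y) →
      Triple (loop 19 itemC) σ (length its * (5 + (49 + (n * 68 + 1))) + 1) (return tt) (λ _ σ′ →
        let out = concatMap (children μ I P) its in
        Segment (arr σ′) w out × reg σ′ 16 ≡ w + length out × Below w (arr σ) (arr σ′))
    scanT σ₀ w its seg₀ end₀ w≡ c≡ b₀ μ≡ I≡ P≡ =
      postT (detLoop (Scanning (arr σ₀) w its) (λ _ _ → ctr≡) body (length its) σ₀
        (record { done = [] ; rest = its ; split = refl ; len≡ = refl ; bound = b₀ ; from = seg₀ ; end≡w = end₀
                ; into = tt ; tail≡ = trans w≡ (sym (+-identityʳ w)) ; ctr≡ = c≡
                ; old = below-refl }) frame-refl)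
        λ _ σ′ q _ → fin σ′ q (rest q) (len≡ q) (split q)
      where
      fin : ∀ σ′ (q : Scanning (arr σ₀) w its 0 σ′) rest → length rest ≡ 0 →
            done q ++ concatMap (children μ I P) rest ≡ concatMap (children μ I P) its → _
      fin σ′ q [] _ sp = let e = trans (sym (++-identityʳ (done q))) sp in
        subst (Segment (arr σ′) w) e (into q) , trans (tail≡ q) (cong (λ l → w + length l) e) , old q
      body : ∀ j σ → Scanning (arr σ₀) w its (suc j) σ → Frame (loop 19 itemC) σ₀ σ →
             Triple itemC ⟪ reg σ [ 19 ≔ j ] , arr σ ⟫ (49 + (n * 68 + 1)) (return tt)
               (λ _ → Scanning (arr σ₀) w its j)
      body j σ q fr = go (rest q) (split q) (len≡ q) (bound q) (from q) (end≡w q)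
        where
        go : ∀ rest → done q ++ concatMap (children μ I P) rest ≡ concatMap (children μ I P) its →
             length rest ≡ suc j → All (λ it → proj₁ it ≤ n) rest →
             Segment (arr σ) (reg σ 20) rest → reg σ 20 + length rest ≡ w →
             Triple itemC ⟪ reg σ [ 19 ≔ j ] , arr σ ⟫ (49 + (n * 68 + 1)) (return tt)
               (λ _ → Scanning (arr σ₀) w its j)
        go ((ℓ , a , b) ∷ rest) sp le (ℓ≤n ∷ bs) ((e₁ , e₂ , e₃) , sg) en =
          seqT (blkT popOps _) λ { _ σ₁ refl _ → timeT (+-monoˡ-≤ 1 (*-monoˡ-≤ 68 ℓ≤n))
            (postT (pushT {I} {P} {μ a} {μ b} {ℓ} {w + length (done q)} σ₁ (tail≡ q) e₁
                     (trans (cong (arr σ 3) e₂) (trans (arrays fr 3 refl a) (μ≡ a)))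
                     (trans (cong (arr σ 3) e₃) (trans (arrays fr 3 refl b) (μ≡ b)))
                     (λ y → trans (arrays fr 4 refl y) (I≡ y)) (λ y → trans (arrays fr 5 refl y) (P≡ y)))
              λ { _ σ₂ (sg₂ , t₂ , old₂) fr₂ → record
                { done  = done q ++ kids I P (μ a) (μ b) ℓ
                ; rest  = rest
                ; split = trans (++-assoc (done q) _ _) sp
                ; len≡  = suc-injective le
                ; bound = bs
                ; from  = subst (λ z → Segment (arr σ₂) z rest)
                            (sym (trans (regs fr₂ 20 refl) (+-comm (reg σ 20) 1)))
                            (segment-below (suc (reg σ 20)) rest (≤-reflexive (en′ rest en))
                              (below-≤ (m≤m+n w (length (done q))) old₂) sg)
                ; end≡w = trans (cong (_+ length rest) (trans (regs fr₂ 20 refl) (+-comm (reg σ 20) 1))) (en′ rest en)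
                ; into  = segment-++ w (done q)
                            (segment-below w (done q) ≤-refl old₂ (into q)) sg₂
                ; tail≡ = trans t₂ (trans (+-assoc w _ _) (cong (w +_) (sym (length-++ (done q)))))
                ; ctr≡  = regs fr₂ 19 refl
                ; old   = below-trans (old q) (below-≤ (m≤m+n w (length (done q))) old₂)
                } }) }
          where
          en′ : ∀ rest → reg σ 20 + suc (length rest) ≡ w → suc (reg σ 20) + length rest ≡ w
          en′ rest en = trans (sym (+-suc (reg σ 20) (length rest))) en

    kids-bound : ∀ {α β} ℓ {N} → ℓ ≤ N → All (λ it → proj₁ it ≤ N) (kids I P α β ℓ)
    kids-bound zero    le = []
    kids-bound (suc ℓ) le = ≤-trans (n≤1+n ℓ) le ∷ kids-bound ℓ (≤-trans (n≤1+n ℓ) le)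

    All-++ : ∀ {B : Item → Set} {xs ys} → All B xs → All B ys → All B (xs ++ ys)
    All-++ []       bs = bs
    All-++ (a ∷ as) bs = a ∷ All-++ as bs

    children-bound : ∀ its {N} → All (λ it → proj₁ it ≤ N) its →
                     All (λ it → proj₁ it ≤ N) (concatMap (children μ I P) its)
    children-bound []         []       = []
    children-bound (it ∷ its) (b ∷ bs) = All-++ (kids-bound (proj₁ it) b) (children-bound its bs)

    length-kids : ∀ α β ℓ → length (kids I P α β ℓ) ≡ ℓ
    length-kids α β zero    = refl
    length-kids α β (suc ℓ) = cong suc (length-kids α β ℓ)

    length-children : ∀ its {N} → All (λ it → proj₁ it ≤ N) its →
                      length (concatMap (children μ I P) its) ≤ length its * N
    length-children []         []       = z≤n
    length-children (it ∷ its) (b ∷ bs) = ≤-trans (≤-reflexive (length-++ (children μ I P it)))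
      (+-mono-≤ (≤-trans (≤-reflexive (length-kids _ _ (proj₁ it))) b) (length-children its bs))

    record Queue (its : List Item) (σ : State) : Set where
      field
        bound  : All (λ it → proj₁ it ≤ n) its
        seg    : Segment (arr σ) (reg σ 17) its
        span≡   : reg σ 17 + length its ≡ reg σ 16
        count≡ : reg σ 18 ≡ length its
    open Queue

    stageT : ∀ σ its → Queue its σ →
      (∀ y → arr σ 3 y ≡ μ y) → (∀ y → arr σ 4 y ≡ I y) → (∀ y → arr σ 5 y ≡ P y) →
      Triple stageC σ (29 + length its * (55 + n * 68)) (return tt) (λ _ → Queue (concatMap (children μ I P) its))
    stageT σ its q μ≡ I≡ P≡ =
      timeT (≤-reflexive (lem n (length its)))
      (seqT (blkT (mov 19 18 ∷ mov 20 17 ∷ mov 17 16 ∷ []) σ) λ { _ σ₁ refl _ →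
        seqT (scanT σ₁ (reg σ 16) its (seg q) (span≡ q) refl (count≡ q) (bound q) μ≡ I≡ P≡) λ { _ σ₂ (sg , t , _) fr →
          postT (blkT (sub 18 16 17 ∷ []) σ₂) λ { _ _ refl _ → record
            { bound  = children-bound its (bound q)
            ; seg    = subst (λ z → Segment (arr σ₂) z (concatMap (children μ I P) its)) (sym (regs fr 17 refl)) sg
            ; span≡   = trans (cong (_+ length (concatMap (children μ I P) its)) (regs fr 17 refl)) (sym t)
            ; count≡ = trans (cong₂ _∸_ t (regs fr 17 refl)) (m+n∸m≡n (reg σ 16) _)
            } } } })
      where
      lem : ∀ n l → 21 + (l * (5 + (49 + (n * 68 + 1))) + 1 + 7) ≡ 29 + l * (55 + n * 68)
      lem = solve-∀

  bfsTime : ℕ → ℕ → ℕ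
  bfsTime s n = 49 + sumTo s (λ j → 29 + n ^ (s ∸ suc j) * (55 + n * 68))

  bfsT : ∀ {μ I P : ℕ → ℕ} {n} s σ → reg σ 8 ≡ n →
    (∀ y → arr σ 3 y ≡ μ y) → (∀ y → arr σ 4 y ≡ I y) → (∀ y → arr σ 5 y ≡ P y) →
    Triple (bfsC s) σ (bfsTime s n) (return tt) (λ _ → Queue {μ} {I} {P} {n} (bfsItems μ I P n s))
  bfsT {μ} {I} {P} {n} s σ n≡ μ≡ I≡ P≡ =
    seqT (blkT rootOps σ) λ { _ σ₁ refl fr₁ →
      postT (repT _ (Inv σ₁) body s σ₁ record
        { its = (n , 0 , 0) ∷ [] ; todo = refl ; len = ≤-reflexive (sym (cong (n ^_) (n∸n≡0 s))) ; j≤s = ≤-refl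
        ; queue = record { bound = ≤-refl ∷ [] ; seg = root , tt ; span≡ = refl ; count≡ = refl }
        ; μ≡′ = μ≡ ; I≡′ = I≡ ; P≡′ = P≡ })
        λ { _ σ₂ q _ → subst (λ its → Queue its σ₂) (todo q) (queue q) } }
    where
    record Inv (σ₁ : State) (j : ℕ) (σ : State) : Set where
      field
        its   : List Item
        todo  : stages μ I P j its ≡ bfsItems μ I P n s
        len   : length its ≤ n ^ (s ∸ j)
        j≤s   : j ≤ s
        queue : Queue {μ} {I} {P} {n} its σ
        μ≡′   : ∀ y → arr σ 3 y ≡ μ y
        I≡′   : ∀ y → arr σ 4 y ≡ I y
        P≡′   : ∀ y → arr σ 5 y ≡ P y
    open Inv
    body : ∀ {σ₁} j σ → Inv σ₁ (suc j) σ → Triple stageC σ (29 + n ^ (s ∸ suc j) * (55 + n * 68)) (return tt) (λ _ → Inv σ₁ j)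
    body j σ q =
      timeT (+-monoʳ-≤ 29 (*-monoˡ-≤ (55 + n * 68) (len q)))
      (postT (stageT {μ} {I} {P} {n} σ (its q) (queue q) (μ≡′ q) (I≡′ q) (P≡′ q)) λ _ σ′ q′ fr → record
        { its = concatMap (children μ I P) (its q)
        ; todo = todo q
        ; len = ≤-trans (length-children {n = n} (its q) (Queue.bound (queue q))) (≤-trans (*-monoˡ-≤ n (len q))
            (≤-reflexive (trans (*-comm _ n) (cong (n ^_) (sym (+-∸-assoc 1 (j≤s q)))))))
        ; j≤s = ≤-trans (n≤1+n j) (j≤s q)
        ; queue = q′
        ; μ≡′ = λ y → trans (arrays fr 3 refl y) (μ≡′ q y)
        ; I≡′ = λ y → trans (arrays fr 4 refl y) (I≡′ q y)
        ; P≡′ = λ y → trans (arrays fr 5 refl y) (P≡′ q y) })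
    z = reg σ 16
    A′ = arr (evalOps rootOps σ)
    root : A′ 6 z ≡ n × A′ 7 z ≡ 0 × A′ 8 z ≡ 0
    root rewrite ≡ᵇ-refl z = n≡ , refl , refl

  codeT : ∀ {μ} J σ → (∀ y → arr σ 3 y ≡ μ y) →
    reg (evalOps (codeOps J) σ) 0 ≡ hcode μ (reg σ 0) J × arr (evalOps (codeOps J) σ) ≡ arr σ
  codeT []      σ h = refl , refl
  codeT {μ} (x ∷ J) σ h =
    let (e₁ , e₂) = codeT {μ} J (evalOps (ld mulT 0 0 ∷ set 1 x ∷ add 0 0 1 ∷ []) σ) h in
    trans e₁ (cong (λ z → hcode μ (z + x) J) (h (reg σ 0))) , e₂

  codeOps-reg : ∀ J i → (i ≡ᵇ 0) ≡ false → (i ≡ᵇ 1) ≡ false → opsW (codeOps J) i ≡ false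
  codeOps-reg []      i e₀ e₁ = refl
  codeOps-reg (x ∷ J) i e₀ e₁ rewrite e₀ | e₁ = codeOps-reg J i e₀ e₁

  codeOps-arr : ∀ J c → opsWA (codeOps J) c ≡ false
  codeOps-arr []      c = refl
  codeOps-arr (x ∷ J) c = codeOps-arr J c

  codeOps-length : ∀ J → length (codeOps J) ≡ length J * 3
  codeOps-length []      = refl
  codeOps-length (x ∷ J) = cong (3 +_) (codeOps-length J)

  queriesC-reg : ∀ A Js i → (i ≡ᵇ 0) ≡ false → (i ≡ᵇ 1) ≡ false → (i ≡ᵇ 19) ≡ false →
    writesReg (queryC A) i ≡ false → writesReg (queriesC A Js) i ≡ false
  queriesC-reg A []       i e₀ e₁ e₁₉ e = e
  queriesC-reg A (J ∷ Js) i e₀ e₁ e₁₉ e = step (queriesC-reg A Js i e₀ e₁ e₁₉ e) (codeOps-reg J i e₀ e₁)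
    where
    step : writesReg (queriesC A Js) i ≡ false → opsW (codeOps J) i ≡ false →
           writesReg (queriesC A (J ∷ Js)) i ≡ false
    step h h′ rewrite e₀ | e₁₉ | h | h′ = refl

  queriesC-arr : ∀ A Js c → (c ≡ᵇ 0) ≡ false → (c ≡ᵇ 1) ≡ false → (c ≡ᵇ 11) ≡ false →
    writesArr (queryC A) c ≡ false → writesArr (queriesC A Js) c ≡ false
  queriesC-arr A []       c e₀ e₁ e₁₁ e = e
  queriesC-arr A (J ∷ Js) c e₀ e₁ e₁₁ e = step (queriesC-arr A Js c e₀ e₁ e₁₁ e)
    where
    step : writesArr (queriesC A Js) c ≡ false → writesArr (queriesC A (J ∷ Js)) c ≡ false
    step h rewrite e₁₁ | codeOps-arr J c | h = refl

  partsC-reg : ∀ i → (∀ q t → writesReg (partC q t) i ≡ false) → ∀ q ts → writesReg (partsC q ts) i ≡ false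
  partsC-reg i h q []       = refl
  partsC-reg i h q (t ∷ ts) rewrite h q t = partsC-reg i h (suc q) ts

  partsC-arr : ∀ i → (∀ q t → writesArr (partC q t) i ≡ false) → ∀ q ts → writesArr (partsC q ts) i ≡ false
  partsC-arr i h q []       = refl
  partsC-arr i h q (t ∷ ts) rewrite h q t = partsC-arr i h (suc q) ts

  Filled : ℕ → (I P : ℕ → ℕ) → ℕ → List ℕ → Set
  Filled m I P q []       = ⊤
  Filled m I P q (t ∷ ts) = (∀ r → r < m → I (q * m + r) ≡ t * m + r × P (q * m + r) ≡ q) × Filled m I P (suc q) ts

  mulLoopT : ∀ {m t} σ → reg σ 10 ≡ m → reg σ 19 ≡ t → reg σ 2 ≡ 0 →
    Triple (loop 19 (blk (add 2 2 10 ∷ []))) σ (t * 12 + 1) (return tt) (λ _ σ′ → reg σ′ 2 ≡ t * m)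
  mulLoopT {m} {t} σ₀ m≡ t≡ z≡ =
    postT (detLoop (λ j σ → reg σ 19 ≡ j × reg σ 2 + j * m ≡ t * m) (λ _ _ → proj₁) body t σ₀
            (t≡ , cong (_+ t * m) z≡) frame-refl)
      λ _ σ (_ , e) _ → trans (sym (+-identityʳ _)) e
    where
    body : ∀ j σ → _ → Frame (loop 19 (blk (add 2 2 10 ∷ []))) σ₀ σ → _
    body j σ (_ , e) fr = postT (blkT (add 2 2 10 ∷ []) _) λ { _ _ refl _ →
      refl , trans (trans (+-assoc (reg σ 2) _ _) (cong (λ z → reg σ 2 + (z + j * m)) (trans (regs fr 10 refl) m≡))) e }

  fillT : ∀ {m b v q} σ → reg σ 19 ≡ m → reg σ 3 ≡ b → reg σ 2 ≡ v → reg σ 1 ≡ q →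
    Triple (loop 19 (blk fillOps)) σ (m * 33 + 1) (return tt) (λ _ σ′ →
      (∀ r → r < m → arr σ′ 4 (b + r) ≡ v + r × arr σ′ 5 (b + r) ≡ q) ×
      (∀ y → y < b → arr σ′ 4 y ≡ arr σ 4 y × arr σ′ 5 y ≡ arr σ 5 y))
  fillT {m} {b} {v} {q} σ₀ m≡ b≡ v≡ q≡ =
    postT (detLoop Inv (λ _ _ → proj₁) body m σ₀
            (m≡ , ≤-refl , (λ r le r< → contradiction (≤-trans r< le) (<-irrefl refl)) , λ _ _ → refl , refl) frame-refl)
      λ { _ σ (_ , _ , f , old) _ → (λ r r< → f r z≤n r<) , old }
    where
    Inv : ℕ → State → Set
    Inv j σ = reg σ 19 ≡ j × j ≤ m × (∀ r → j ≤ r → r < m → arr σ 4 (b + r) ≡ v + r × arr σ 5 (b + r) ≡ q) ×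
              (∀ y → y < b → arr σ 4 y ≡ arr σ₀ 4 y × arr σ 5 y ≡ arr σ₀ 5 y)
    body : ∀ j σ → Inv (suc j) σ → Frame (loop 19 (blk fillOps)) σ₀ σ →
           Triple (blk fillOps) ⟪ reg σ [ 19 ≔ j ] , arr σ ⟫ 28 (return tt) (λ _ → Inv j)
    body j σ (_ , j≤ , f , old) fr = postT (blkT fillOps _) λ { _ _ refl _ →
      refl , ≤-trans (n≤1+n j) j≤ , new , keep }
      where
      σ′ = evalOps fillOps ⟪ reg σ [ 19 ≔ j ] , arr σ ⟫
      b≡′ : reg σ 3 ≡ b
      b≡′ = trans (regs fr 3 refl) b≡
      new : ∀ r → j ≤ r → r < m → arr σ′ 4 (b + r) ≡ v + r × arr σ′ 5 (b + r) ≡ q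
      new r j≤r r<m rewrite b≡′ | +-≡ᵇ b r j with r ≡ᵇ j in eq
      ... | true  = cong₂ _+_ (trans (regs fr 2 refl) v≡) (sym (≡ᵇ-true r j eq)) , trans (regs fr 1 refl) q≡
      ... | false = f r (≤∧≢⇒< j≤r λ j≡r → contradiction (trans (sym eq) (trans (cong (r ≡ᵇ_) j≡r) (≡ᵇ-refl r))) λ ()) r<m
      keep : ∀ y → y < b → arr σ′ 4 y ≡ arr σ₀ 4 y × arr σ′ 5 y ≡ arr σ₀ 5 y
      keep y y<b rewrite b≡′ | <⇒≡ᵇ-false {y} {b + j} (≤-trans y<b (m≤m+n b j)) = old y y<b

  partT : ∀ {m} q t σ → reg σ 10 ≡ m → reg σ 3 ≡ q * m →
    Triple (partC q t) σ (37 + t * 12 + m * 33) (return tt) (λ _ σ′ →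
      (∀ r → r < m → arr σ′ 4 (q * m + r) ≡ t * m + r × arr σ′ 5 (q * m + r) ≡ q) ×
      (∀ y → y < q * m → arr σ′ 4 y ≡ arr σ 4 y × arr σ′ 5 y ≡ arr σ 5 y) ×
      reg σ′ 3 ≡ suc q * m)
  partT {m} q t σ m≡ b≡ =
    timeT (≤-reflexive (lem t m))
    (seqT (blkT (set 2 0 ∷ set 19 t ∷ []) σ) λ { _ σ₁ refl _ →
      seqT (mulLoopT {m} {t} σ₁ m≡ refl refl) λ { _ σ₂ v≡ fr₂ →
        seqT (blkT (set 1 q ∷ mov 19 10 ∷ []) σ₂) λ { _ σ₃ refl _ →
          seqT (fillT {m} {q * m} {t * m} {q} σ₃ (trans (regs fr₂ 10 refl) m≡) (trans (regs fr₂ 3 refl) b≡) v≡ refl)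
            λ { _ σ₄ (f , old) fr₄ →
              postT (blkT (add 3 3 10 ∷ []) σ₄) λ { _ _ refl _ →
                f , (λ y y< → trans (proj₁ (old y y<)) (arrays fr₂ 4 refl y) , trans (proj₂ (old y y<)) (arrays fr₂ 5 refl y)) ,
                trans (cong₂ _+_ (trans (regs fr₄ 3 refl) (trans (regs fr₂ 3 refl) b≡))
                        (trans (regs fr₄ 10 refl) (trans (regs fr₂ 10 refl) m≡))) (+-comm (q * m) m) } } } } })
    where
    lem : ∀ t m → 14 + (t * 12 + 1 + (14 + (m * 33 + 1 + 7))) ≡ 37 + t * 12 + m * 33
    lem = solve-∀

  partsTime : ℕ → List ℕ → ℕ
  partsTime m []       = 0
  partsTime m (t ∷ ts) = 37 + t * 12 + m * 33 + partsTime m ts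

  partsT : ∀ {m} q ts σ → reg σ 10 ≡ m → reg σ 3 ≡ q * m →
    Triple (partsC q ts) σ (partsTime m ts) (return tt) (λ _ σ′ →
      Filled m (arr σ′ 4) (arr σ′ 5) q ts ×
      (∀ y → y < q * m → arr σ′ 4 y ≡ arr σ 4 y × arr σ′ 5 y ≡ arr σ 5 y))
  partsT q []       σ m≡ b≡ = postT (blkT [] σ) λ { _ _ refl _ → tt , λ _ _ → refl , refl }
  partsT {m} q (t ∷ ts) σ m≡ b≡ =
    seqT (partT {m} q t σ m≡ b≡) λ { _ σ₁ (f , old , b≡′) fr₁ →
      postT (partsT {m} (suc q) ts σ₁ (trans (regs fr₁ 10 refl) m≡) b≡′) λ { _ σ₂ (fs , old′) _ →
        ((λ r r< → let in< = ≤-trans (+-monoʳ-< (q * m) r<) (≤-reflexive (+-comm (q * m) m)) in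
            trans (proj₁ (old′ _ in<)) (proj₁ (f r r<)) , trans (proj₂ (old′ _ in<)) (proj₂ (f r r<))) , fs) ,
        λ y y< → let y<′ = ≤-trans y< (m≤n+m (q * m) m) in
          trans (proj₁ (old′ y y<′)) (proj₁ (old y y<)) , trans (proj₂ (old′ y y<′)) (proj₂ (old y y<)) } }

  filled : ∀ {m I P} q ts → Filled m I P q ts → ∀ i r → i < length ts → r < m →
    I ((q + i) * m + r) ≡ nth ts i * m + r × P ((q + i) * m + r) ≡ q + i
  filled {m} q (t ∷ ts) (f , fs) zero    r i< r< rewrite +-identityʳ q = f r r<
  filled {m} q (t ∷ ts) (f , fs) (suc i) r i< r< rewrite +-suc q i = filled (suc q) ts fs i r (s≤s⁻¹ i<) r<

  kids-cong : ∀ {I I′ P P′ : ℕ → ℕ} {α β} ℓ → (∀ u → u < ℓ → I u ≡ I′ u) → (∀ u → u < ℓ → P u ≡ P′ u) →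
    kids I P α β ℓ ≡ kids I′ P′ α β ℓ
  kids-cong zero    hI hP = refl
  kids-cong {α = α} {β} (suc ℓ) hI hP =
    cong₂ _∷_ (cong₂ (λ x y → ℓ , α + x , β + y) (hI ℓ ≤-refl) (hP ℓ ≤-refl))
              (kids-cong ℓ (λ u u< → hI u (≤-trans u< (n≤1+n ℓ))) (λ u u< → hP u (≤-trans u< (n≤1+n ℓ))))

  children-cong : ∀ {μ I I′ P P′ : ℕ → ℕ} {n} its → All (λ it → proj₁ it ≤ n) its →
    (∀ u → u < n → I u ≡ I′ u) → (∀ u → u < n → P u ≡ P′ u) →
    concatMap (children μ I P) its ≡ concatMap (children μ I′ P′) its
  children-cong []              []       hI hP = refl
  children-cong ((ℓ , _) ∷ its) (b ∷ bs) hI hP =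
    cong₂ _++_ (kids-cong ℓ (λ u u< → hI u (≤-trans u< b)) (λ u u< → hP u (≤-trans u< b))) (children-cong its bs hI hP)

  stages-cong : ∀ {μ I I′ P P′ : ℕ → ℕ} {n} j its → All (λ it → proj₁ it ≤ n) its →
    (∀ u → u < n → I u ≡ I′ u) → (∀ u → u < n → P u ≡ P′ u) → stages μ I P j its ≡ stages μ I′ P′ j its
  stages-cong zero    its bs hI hP = refl
  stages-cong {μ} {I} {I′} {P} {P′} {n} (suc j) its bs hI hP =
    trans (stages-cong j _ (children-bound {μ} {I} {P} {n} its bs) hI hP)
          (cong (stages μ I′ P′ j) (children-cong its bs hI hP))

  module Phase (A : Program) (smp : Cmd)
    (smp-reg : ∀ i → writesReg smp (7 + i) ≡ false)
    (smp-arr : ∀ c → (c ≡ᵇ 10) ≡ false → writesArr smp c ≡ false)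
    (n scale L R tS T : ℕ) (samp : Bool → Dist (List Bool))
    (smpT : ∀ σ x v → reg σ 12 ≡ L → reg σ 26 ≡ R → reg σ 27 ≡ b2n x → reg σ 24 ≡ v →
      Triple smp σ tS (samp x) (λ y σ′ →
        (∀ i → i < L → arr σ′ 10 (v + i) ≡ b2n (bitAt y i)) × (∀ i → i < v → arr σ′ 10 i ≡ arr σ 10 i)))
    where

    Vectors : (ℕ → ℕ) → ℕ → List Item → List (List Bool) → Set
    Vectors V v []         []       = ⊤
    Vectors V v (it ∷ its) (y ∷ ys) = (∀ i → i < L → V (v + i) ≡ b2n (bitAt y i)) × Vectors V (v + L) its ys
    Vectors V v _          _        = Data.Empty.⊥

    vectors-cong : ∀ {V V′ v} its ys → (∀ y → V′ y ≡ V y) → Vectors V v its ys → Vectors V′ v its ys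
    vectors-cong []         []       h _         = tt
    vectors-cong (it ∷ its) (y ∷ ys) h (e , vec) =
      (λ i i<L → trans (h _) (e i i<L)) , vectors-cong its ys h vec

    segment-cong : ∀ {A A′} q its → (∀ y → A′ 6 y ≡ A 6 y) → (∀ y → A′ 7 y ≡ A 7 y) → (∀ y → A′ 8 y ≡ A 8 y) →
      Segment A q its → Segment A′ q its
    segment-cong q its h₁ h₂ h₃ = segment-below q its ≤-refl (below λ y _ → h₁ y , h₂ y , h₃ y)

    samplesT : ∀ {Tb : ℕ → Bool} its σ {v} → Segment (arr σ) (reg σ 20) its → reg σ 19 ≡ length its →
      reg σ 24 ≡ v → reg σ 12 ≡ L → reg σ 26 ≡ R → (∀ y → arr σ 9 y ≡ b2n (Tb y)) →
      Triple (loop 19 (sampleC smp)) σ (length its * (40 + tS) + 1)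
        (sampleAll samp (map (λ it → Tb (proj₁ (proj₂ it))) its))
        (λ ys σ′ → Vectors (arr σ′ 10) v its ys × (∀ i → i < v → arr σ′ 10 i ≡ arr σ 10 i))
    samplesT []         σ seg c≡ v≡ L≡ R≡ T≡ = postT (mapT (λ _ → []) (loop0T c≡)) λ { _ _ (_ , refl , refl) _ → tt , λ _ _ → refl }
    samplesT {Tb} ((ℓ , a , b) ∷ its) σ {v} ((_ , e , _) , seg) c≡ v≡ L≡ R≡ T≡ =
      timeT (≤-reflexive (lem tS (length its)))
      (loopST {Q = Sampled} c≡
        (seqT (blkT sampleOps _) λ { _ σ₁ refl _ →
          keepT (smpT σ₁ (Tb a) v L≡ R≡ (trans (cong (arr σ 9) e) (T≡ a)) v≡) λ y σ₂ q fr₂ →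
            postT (blkT nextOps σ₂) λ { _ _ refl _ →
              q , trans (cong₂ _+_ (regs fr₂ 24 (smp-reg 17)) (regs fr₂ 12 (smp-reg 5))) (cong₂ _+_ v≡ L≡)
                , trans (+-comm _ 1) (cong suc (regs fr₂ 20 (smp-reg 13)))
                , regs fr₂ 19 (smp-reg 12)
                , regs fr₂ 12 (smp-reg 5)
                , regs fr₂ 26 (smp-reg 19)
                , (λ c e y → arrays fr₂ c (smp-arr c e) y) } })
        λ { y σ′ ((q , old) , v≡′ , p≡ , c≡′ , L≡′ , R≡′ , same) _ →
          postT (mapT (y ∷_) (samplesT {Tb} its σ′
                   (subst (λ z → Segment (arr σ′) z its) (sym p≡) (segment-cong _ its (same 6 refl) (same 7 refl) (same 8 refl) seg))
                   c≡′ v≡′ (trans L≡′ L≡) (trans R≡′ R≡) (λ z → trans (same 9 refl z) (T≡ z))))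
          λ { _ σ″ (ys , refl , vec , old′) _ →
              ((λ i i<L → trans (old′ (v + i) (+-monoʳ-< v i<L)) (q i i<L)) , vec) ,
              λ i i<v → trans (old′ i (≤-trans i<v (m≤m+n v L))) (old i i<v) } })
      where
      Sampled : List Bool → State → Set
      Sampled y σ′ =
        ((∀ i → i < L → arr σ′ 10 (v + i) ≡ b2n (bitAt y i)) × (∀ i → i < v → arr σ′ 10 i ≡ arr σ 10 i)) ×
        reg σ′ 24 ≡ v + L × reg σ′ 20 ≡ suc (reg σ 20) × reg σ′ 19 ≡ length its ×
        reg σ′ 12 ≡ reg σ 12 × reg σ′ 26 ≡ reg σ 26 ×
        (∀ c → (c ≡ᵇ 10) ≡ false → ∀ y → arr σ′ c y ≡ arr σ c y)
      lem : ∀ t l → 5 + (14 + (t + 21)) + (l * (40 + t) + 1) ≡ 40 + t + l * (40 + t) + 1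
      lem = solve-∀

    record Ready (μ : ℕ → ℕ) (its : List Item) (ys : List (List Bool)) (σ : State) : Set where
      field
        n≡     : reg σ 8 ≡ n
        scale≡ : reg σ 9 ≡ scale
        L≡     : reg σ 12 ≡ L
        count≡ : reg σ 18 ≡ length its
        seg    : Segment (arr σ) (reg σ 17) its
        vec    : Vectors (arr σ 10) (reg σ 25) its ys
        mul≡   : ∀ y → arr σ 3 y ≡ μ y
        freshR : ∀ i → reg σ 14 ≤ i → arr σ 0 i ≡ 0
        freshM : ∀ i → reg σ 14 ≤ i → arr σ 1 i ≡ 0

    writeT : ∀ {a F} its ys done σ → Segment (arr σ) (reg σ 20) its → Vectors (arr σ 10) (reg σ 28) its ys →
      reg σ 19 ≡ length its → reg σ 12 ≡ L → (∀ y → arr σ 11 y ≡ a y) → (∀ y → a y < L) →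
      reg σ 7 ≡ F + length done → (∀ i → arr σ 1 (F + i) ≡ b2n (bitAt done i)) →
      Triple (loop 19 (blk writeOps)) σ (length its * 68 + 1) (return tt) (λ _ σ′ →
        (∀ i → arr σ′ 1 (F + i) ≡ b2n (bitAt (done ++ queryBits a its ys) i)) ×
        reg σ′ 7 ≡ F + length (done ++ queryBits a its ys))
    writeT [] [] done σ seg vec c≡ L≡ i≡ a< t≡ m≡ =
      postT (loop0T c≡) λ { _ _ refl _ → subst (λ bs → ∀ i → arr σ 1 (_ + i) ≡ b2n (bitAt bs i)) (sym (++-identityʳ done)) m≡
                                        , trans t≡ (cong (λ bs → _ + length bs) (sym (++-identityʳ done))) }
    writeT {a} {F} ((ℓ , k , c) ∷ its) (y ∷ ys) done σ ((_ , _ , e) , seg) (ve , vec) c≡ L≡ i≡ a< t≡ m≡ =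
      timeT (≤-reflexive (sym (+-assoc 68 (length its * 68) 1)))
      (loopST c≡ (blkT writeOps _) λ { _ σ′ refl _ →
        postT (writeT {a} {F} its ys (done ++ b ∷ []) σ′
          (subst (λ z → Segment (arr σ′) z its) (sym (+-comm (reg σ 20) 1))
            (segment-cong _ its (λ _ → refl) (λ _ → refl) (λ _ → refl) seg))
          (subst (λ z → Vectors (arr σ 10) z its ys) (cong (reg σ 28 +_) (sym L≡)) vec)
          refl L≡ i≡ a<
          (trans (cong (_+ 1) t≡) (trans (+-assoc F _ 1) (cong (F +_) (sym (length-++ done)))))
          mem)
        λ { _ σ″ (m , l) _ →
          subst (λ bs → ∀ i → arr σ″ 1 (F + i) ≡ b2n (bitAt bs i)) (++-assoc done _ _) m ,
          trans l (cong (λ bs → F + length bs) (++-assoc done _ _)) } })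
      where
      b = bitAt y (a c)
      val : arr σ 10 (reg σ 28 + arr σ 11 (arr σ 8 (reg σ 20))) ≡ b2n b
      val = trans (cong (λ z → arr σ 10 (reg σ 28 + z)) (trans (cong (arr σ 11) e) (i≡ c))) (ve (a c) (a< c))
      mem : ∀ i → (if F + i ≡ᵇ reg σ 7 then arr σ 10 (reg σ 28 + arr σ 11 (arr σ 8 (reg σ 20))) else arr σ 1 (F + i))
                ≡ b2n (bitAt (done ++ b ∷ []) i)
      mem i rewrite t≡ | +-≡ᵇ F i (length done) with i ≡ᵇ length done in eq
      ... | true  = trans val (cong b2n (sym (trans (cong (bitAt (done ++ b ∷ [])) (≡ᵇ-true i _ eq)) (bitAt-snoc done b))))
      ... | false = trans (m≡ i) (cong b2n (sym (bitAt-snoc-< done b i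
                      λ i≡l → contradiction (trans (sym eq) (trans (cong (_≡ᵇ length done) i≡l) (≡ᵇ-refl (length done)))) λ ())))

    startRegs : ℕ → ℕ
    startRegs = ((λ _ → 0) [ 0 ≔ n ]) [ 1 ≔ scale ]

    queryBits-length : ∀ a its ys → length (queryBits a its ys) ≤ length its
    queryBits-length a []         ys       = z≤n
    queryBits-length a (it ∷ its) []       = z≤n
    queryBits-length a (it ∷ its) (y ∷ ys) = s≤s (queryBits-length a its ys)

    queryT : ∀ {μ its ys a σ acc} {mA : ℕ → ℕ} → Ready μ its ys σ → (∀ y → arr σ 11 y ≡ a y) → (∀ y → a y < L) →
      reg σ 15 ≡ acc → (∀ i → mA i ≡ b2n (bitAt (queryBits a its ys) i)) →
      Surely (_≢ nothing) (exec p A T Model.⟨ 0 , startRegs , mA ⟩) →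
      Triple (queryC A) σ (113 + length its * 68 + T * 110)
        (exec p A T Model.⟨ 0 , startRegs , mA ⟩ >>= λ o → return (combine acc o))
        (λ x σ′ → Ready μ its ys σ′ × reg σ′ 15 ≡ x)
    queryT {μ} {its} {ys} {a} {σ} {acc} {mA} rd i≡ a< acc≡ m≡ h =
      timeT (≤-reflexive (lem (length its) T))
      (seqT (blkT (mov 7 14 ∷ mov 19 18 ∷ mov 20 17 ∷ mov 28 25 ∷ []) σ) λ { _ σ₁ refl _ →
        seqT (writeT {a} {F} its ys [] σ₁ seg vec count≡ L≡ i≡ a< (sym (+-identityʳ F))
               (λ i → freshM (F + i) (m≤m+n F i))) λ { _ σ₂ (mem , next≡) fr₂ →
          seqT (blkT argOps σ₂) λ { _ σ₃ refl fr₃ →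
            seqT (simT T (loaded σ₂ mem next≡ fr₂) h) λ o σ₄ res fr₄ →
              postT (mapT (λ _ → combine acc o) (blkT resultOps σ₄)) λ { _ σ₅ (_ , refl , refl) _ →
                let s = SimResult.state res
                    f₂ : ∀ i → writesReg (loop 19 (blk writeOps)) i ≡ false → _
                    f₂ = regs fr₂ in
                record
                { n≡ = trans (regs fr₄ 8 refl) (trans (f₂ 8 refl) n≡)
                ; scale≡ = trans (regs fr₄ 9 refl) (trans (f₂ 9 refl) scale≡)
                ; L≡ = trans (regs fr₄ 12 refl) (trans (f₂ 12 refl) L≡)
                ; count≡ = trans (regs fr₄ 18 refl) (trans (f₂ 18 refl) count≡)
                ; seg = subst (λ z → Segment (arr σ₄) z its) (sym (trans (regs fr₄ 17 refl) (f₂ 17 refl)))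
                          (segment-cong _ its (arr≡ fr₂ fr₄ 6 refl refl refl) (arr≡ fr₂ fr₄ 7 refl refl refl)
                            (arr≡ fr₂ fr₄ 8 refl refl refl) seg)
                ; vec = subst (λ z → Vectors (arr σ₄ 10) z its ys) (sym (trans (regs fr₄ 25 refl) (f₂ 25 refl)))
                          (vectors-cong its ys (arr≡ fr₂ fr₄ 10 refl refl refl) vec)
                ; mul≡ = λ y → trans (arr≡ fr₂ fr₄ 3 refl refl refl y) (mul≡ y)
                ; freshR = Simulates.zeroR s
                ; freshM = Simulates.zeroM s
                } , accum {σ = σ₄} (trans (regs fr₄ 15 refl) (trans (f₂ 15 refl) acc≡)) res } } } })
      where
      open Ready rd
      F = reg σ 14
      lem : ∀ l t → 28 + (l * 68 + 1 + (49 + (t * 110 + 35))) ≡ 113 + l * 68 + t * 110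
      lem = solve-∀
      arr≡ : ∀ {σ₂ σ₄} → Frame (loop 19 (blk writeOps)) (evalOps (mov 7 14 ∷ mov 19 18 ∷ mov 20 17 ∷ mov 28 25 ∷ []) σ) σ₂ →
        Frame (sim A) (evalOps argOps σ₂) σ₄ → ∀ c → (c ≡ᵇ 0) ≡ false → (c ≡ᵇ 1) ≡ false → (c <ᵇ 2) ≡ false →
        ∀ y → arr σ₄ c y ≡ arr σ c y
      arr≡ {σ₂} fr₂ fr₄ c e₀ e₁ e₂ y = trans (arrays fr₄ c e₂ y)
        (trans (arrays (blkFrame argOps σ₂) c w y) (arrays fr₂ c w′ y))
        where
        w : opsWA argOps c ≡ false
        w rewrite e₀ = refl
        w′ : writesArr (loop 19 (blk writeOps)) c ≡ false
        w′ rewrite e₁ = refl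
      accum : ∀ {σ o} → reg σ 15 ≡ acc → SimResult F o σ → reg (evalOps resultOps σ) 15 ≡ combine acc o
      accum {σ} eq record { result = refl ; state = s }
        rewrite eq | trans (cong (arr σ 0) (trans (fresh≡ s) (sym (+-identityʳ F)))) (regsA s 0) = refl
      loaded : ∀ σ₂ → (∀ i → arr σ₂ 1 (F + i) ≡ b2n (bitAt (queryBits a its ys) i)) →
        reg σ₂ 7 ≡ F + length (queryBits a its ys) →
        Frame (loop 19 (blk writeOps)) (evalOps (mov 7 14 ∷ mov 19 18 ∷ mov 20 17 ∷ mov 28 25 ∷ []) σ) σ₂ →
        Simulates F startRegs mA (evalOps argOps σ₂)
      loaded σ₂ mem next≡ fr₂ = record
        { fresh≡ = F≡
        ; regsA  = regsA′
        ; memA   = λ i → trans (mem i) (sym (m≡ i))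
        ; F≤next = ≤-trans (≤-trans (m≤m+n F _) (≤-reflexive (sym next≡))) (≤-trans (m≤m+n _ 1) (m≤m+n _ 1))
        ; zeroR  = zeroR′
        ; zeroM  = λ i le → let (j , e) = split i le in
                     trans (cong (arr σ₂ 1) e) (trans (mem j) (cong b2n (bitAt-beyond (queryBits a its ys) j
                       (+-cancelˡ-≤ F _ _ (≤-trans (≤-reflexive (sym next≡)) (≤-trans (≤-trans (m≤m+n _ 1) (m≤m+n _ 1))
                         (≤-trans le (≤-reflexive e))))))))
        }
        where
        F≡ : reg σ₂ 14 ≡ F
        F≡ = regs fr₂ 14 refl
        F≤ : F ≤ reg σ₂ 7
        F≤ = ≤-trans (m≤m+n F _) (≤-reflexive (sym next≡))
        split : ∀ i → reg σ₂ 7 + 1 + 1 ≤ i → ∃ λ j → i ≡ F + j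
        split i le = i ∸ F , sym (m+[n∸m]≡n (≤-trans F≤ (≤-trans (≤-trans (m≤m+n _ 1) (m≤m+n _ 1)) le)))
        cells : ∀ y → arr σ₂ 0 y ≡ arr σ 0 y
        cells y = arrays fr₂ 0 refl y
        regsA′ : ∀ i → (if F + i ≡ᵇ reg σ₂ 14 + 1 then reg σ₂ 9 else
                        (if F + i ≡ᵇ reg σ₂ 14 then reg σ₂ 8 else arr σ₂ 0 (F + i))) ≡ startRegs i
        regsA′ i rewrite F≡ | +-≡ᵇ F i 1 with i ≡ᵇ 1 in eq₁
        ... | true = trans (regs fr₂ 9 refl) scale≡
        ... | false rewrite trans (cong (F + i ≡ᵇ_) (sym (+-identityʳ F))) (+-≡ᵇ F i 0) with i ≡ᵇ 0
        ...   | true  = trans (regs fr₂ 8 refl) n≡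
        ...   | false = trans (cells (F + i)) (freshR (F + i) (m≤m+n F i))
        zeroR′ : ∀ i → reg σ₂ 7 + 1 + 1 ≤ i → (if i ≡ᵇ reg σ₂ 14 + 1 then reg σ₂ 9 else
                        (if i ≡ᵇ reg σ₂ 14 then reg σ₂ 8 else arr σ₂ 0 i)) ≡ 0
        zeroR′ i le rewrite F≡
          | ≡ᵇ-false {i} {F + 1} (λ e → <-irrefl (sym e) (≤-trans (≤-reflexive (+-comm 1 (F + 1)))
              (≤-trans (+-monoˡ-≤ 1 (+-monoˡ-≤ 1 F≤)) le)))
          | ≡ᵇ-false {i} {F} (λ e → <-irrefl (sym e) (≤-trans (≤-reflexive (+-comm 1 F))
              (≤-trans (+-monoˡ-≤ 1 F≤) (≤-trans (m≤m+n _ 1) le)))) =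
          trans (cells i) (freshR i (≤-trans F≤ (≤-trans (≤-trans (m≤m+n _ 1) (m≤m+n _ 1)) le)))

    ready-frame : ∀ {μ its ys c σ σ′} → Frame c σ σ′ →
      All (λ i → writesReg c i ≡ false) (8 ∷ 9 ∷ 12 ∷ 14 ∷ 17 ∷ 18 ∷ 25 ∷ []) →
      All (λ i → writesArr c i ≡ false) (0 ∷ 1 ∷ 3 ∷ 6 ∷ 7 ∷ 8 ∷ 10 ∷ []) →
      Ready μ its ys σ → Ready μ its ys σ′
    ready-frame {its = its} {ys} {σ = σ} {σ′} fr (w₈ ∷ w₉ ∷ w₁₂ ∷ w₁₄ ∷ w₁₇ ∷ w₁₈ ∷ w₂₅ ∷ [])
      (a₀ ∷ a₁ ∷ a₃ ∷ a₆ ∷ a₇ ∷ a₈ ∷ a₁₀ ∷ []) rd = record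
      { n≡ = trans (regs fr 8 w₈) n≡ ; scale≡ = trans (regs fr 9 w₉) scale≡ ; L≡ = trans (regs fr 12 w₁₂) L≡
      ; count≡ = trans (regs fr 18 w₁₈) count≡
      ; seg = subst (λ z → Segment (arr σ′) z its) (sym (regs fr 17 w₁₇))
                (segment-cong _ its (arrays fr 6 a₆) (arrays fr 7 a₇) (arrays fr 8 a₈) seg)
      ; vec = subst (λ z → Vectors (arr σ′ 10) z its ys) (sym (regs fr 25 w₂₅))
                (vectors-cong its ys (arrays fr 10 a₁₀) vec)
      ; mul≡ = λ y → trans (arrays fr 3 a₃ y) (mul≡ y)
      ; freshR = λ i le → trans (arrays fr 0 a₀ i) (freshR i (subst (_≤ i) (regs fr 14 w₁₄) le))
      ; freshM = λ i le → trans (arrays fr 1 a₁ i) (freshM i (subst (_≤ i) (regs fr 14 w₁₄) le))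
      }
      where open Ready rd

    AgreeOff : List ℕ → (ℕ → ℕ) → State → Set
    AgreeOff κs a σ = ∀ y → All (y ≢_) κs → arr σ 11 y ≡ a y

    queriesTime : ℕ → ℕ → ℕ → ℕ
    queriesTime s t zero    = t
    queriesTime s t (suc d) = 7 + (L * (33 + s * 42 + queriesTime s t d) + 1)

    module _ {μ : ℕ → ℕ} {its : List Item} {ys : List (List Bool)} {s : ℕ} {mA : (ℕ → ℕ) → ℕ → ℕ}
      (mem≡ : ∀ a i → mA a i ≡ b2n (bitAt (queryBits a its ys) i))
      (total : ∀ a → Surely (_≢ nothing) (exec p A T Model.⟨ 0 , startRegs , mA a ⟩)) where

      run : (ℕ → ℕ) → Dist (Maybe ℕ)
      run a = exec p A T Model.⟨ 0 , startRegs , mA a ⟩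

      κ-of : List ℕ → ℕ
      κ-of = hcode μ 0

      codeAtT : ∀ J σ → (∀ y → arr σ 3 y ≡ μ y) → length J ≡ s →
        Triple (blk (set 0 0 ∷ codeOps J)) σ (7 + s * 21) (return tt)
          (λ _ σ′ → reg σ′ 0 ≡ κ-of J × arr σ′ ≡ arr σ)
      codeAtT J σ mul≡ len =
        timeT (≤-reflexive (cong (7 +_) (trans (cong (_* 7) (trans (codeOps-length J) (cong (_* 3) len))) (*-assoc s 3 7))))
        (postT (blkT (set 0 0 ∷ codeOps J) σ) λ { _ _ refl _ → codeT {μ} J (evalOps (set 0 0 ∷ []) σ) mul≡ })

      enterT : ∀ J σ → (∀ y → arr σ 3 y ≡ μ y) → length J ≡ s → ∀ {i} → reg σ 19 ≡ i →
        Triple (enterC J) σ (14 + s * 21) (return tt)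
          (λ _ σ′ → ∀ y → arr σ′ 11 y ≡ (arr σ 11 [ κ-of J ≔ i ]) y)
      enterT J σ mul≡ len {i} ctr =
        timeT (≤-reflexive (lem s))
        (seqT (codeAtT J σ mul≡ len) λ { _ σ₁ (e₀ , e₁) fr →
          postT (blkT (st index 0 19 ∷ []) σ₁) λ { _ _ refl _ y →
            trans (cong₂ (λ κ v → if y ≡ᵇ κ then v else arr σ₁ 11 y) e₀
                    (trans (regs fr 19 (codeOps-reg J 19 refl refl)) ctr))
                  (cong (λ A → if y ≡ᵇ κ-of J then i else A 11 y) e₁) } })
        where
        lem : ∀ s → 7 + s * 21 + 7 ≡ 14 + s * 21
        lem = solve-∀

      leaveT : ∀ J σ → (∀ y → arr σ 3 y ≡ μ y) → length J ≡ s →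
        Triple (leaveC J) σ (14 + s * 21) (return tt) (λ _ σ′ → reg σ′ 19 ≡ arr σ 11 (κ-of J))
      leaveT J σ mul≡ len =
        timeT (≤-reflexive (lem s))
        (seqT (codeAtT J σ mul≡ len) λ { _ σ₁ (e₀ , e₁) fr →
          postT (blkT (ld index 19 0 ∷ []) σ₁) λ { _ _ refl _ → cong₂ (λ A κ → A 11 κ) e₁ e₀ } })
        where
        lem : ∀ s → 7 + s * 21 + 7 ≡ 14 + s * 21
        lem = solve-∀

      enter-reg : ∀ J i → (i ≡ᵇ 0) ≡ false → (i ≡ᵇ 1) ≡ false → writesReg (enterC J) i ≡ false
      enter-reg J i e₀ e₁ rewrite codeOps-reg J i e₀ e₁ | e₀ = refl

      leave-reg : ∀ J i → (i ≡ᵇ 0) ≡ false → (i ≡ᵇ 1) ≡ false → (i ≡ᵇ 19) ≡ false → writesReg (leaveC J) i ≡ false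
      leave-reg J i e₀ e₁ e₁₉ rewrite codeOps-reg J i e₀ e₁ | e₀ | e₁₉ = refl

      enter-arr : ∀ J c → (c ≡ᵇ 11) ≡ false → writesArr (enterC J) c ≡ false
      enter-arr J c e rewrite codeOps-arr J c | e = refl

      leave-arr : ∀ J c → writesArr (leaveC J) c ≡ false
      leave-arr J c rewrite codeOps-arr J c = refl

      ready-enter : ∀ J {σ σ′} → Frame (enterC J) σ σ′ → Ready μ its ys σ → Ready μ its ys σ′
      ready-enter J fr = ready-frame fr
        (r 8 refl refl ∷ r 9 refl refl ∷ r 12 refl refl ∷ r 14 refl refl ∷ r 17 refl refl ∷ r 18 refl refl ∷ r 25 refl refl ∷ [])
        (a 0 refl ∷ a 1 refl ∷ a 3 refl ∷ a 6 refl ∷ a 7 refl ∷ a 8 refl ∷ a 10 refl ∷ [])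
        where
        r = enter-reg J
        a = enter-arr J

      ready-leave : ∀ J {σ σ′} → Frame (leaveC J) σ σ′ → Ready μ its ys σ → Ready μ its ys σ′
      ready-leave J fr = ready-frame fr
        (r 8 refl refl refl ∷ r 9 refl refl refl ∷ r 12 refl refl refl ∷ r 14 refl refl refl ∷
         r 17 refl refl refl ∷ r 18 refl refl refl ∷ r 25 refl refl refl ∷ [])
        (a 0 ∷ a 1 ∷ a 3 ∷ a 6 ∷ a 7 ∷ a 8 ∷ a 10 ∷ [])
        where
        r = leave-reg J
        a = leave-arr J

      Queried : List ℕ → (ℕ → ℕ) → ℕ → State → Set
      Queried κs a x σ = Ready μ its ys σ × reg σ 15 ≡ x × AgreeOff κs a σ

      queriesT : ∀ Js a σ acc → All (λ J → length J ≡ s) Js → Distinct (map κ-of Js) → (∀ y → a y < L) →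
        Queried (map κ-of Js) a acc σ →
        Triple (queriesC A Js) σ (queriesTime s (113 + length its * 68 + T * 110) (length Js))
          (queryTree L run (map κ-of Js) a acc) (Queried (map κ-of Js) a)
      queriesT [] a σ acc _ _ a< (rd , acc≡ , off) =
        postT (queryT {μ} {its} {ys} {a} {σ} {acc} {mA a} rd (λ y → off y []) a< acc≡ (mem≡ a) (total a)) λ x σ′ (rd′ , x≡) fr →
          rd′ , x≡ , λ y _ → trans (arrays fr 11 refl y) (off y [])
      queriesT (J ∷ Js) a σ acc (len ∷ lens) (κ∉ , dist) a< (rd , acc≡ , off) =
        seqT (blkT (mov 19 12 ∷ []) σ) λ { _ σ₁ refl fr₁ →
          loopT L σ₁ acc (Ready.L≡ rd) ≤-refl
            (ready-frame fr₁ (refl ∷ refl ∷ refl ∷ refl ∷ refl ∷ refl ∷ refl ∷ [])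
              (refl ∷ refl ∷ refl ∷ refl ∷ refl ∷ refl ∷ refl ∷ []) rd , acc≡ , off) }
        where
        κ = κ-of J
        κs = map κ-of Js
        q = queriesTime s (113 + length its * 68 + T * 110) (length Js)
        body = enterC J ⨾ queriesC A Js ⨾ leaveC J
        upd< : ∀ {i} → i < L → ∀ y → (a [ κ ≔ i ]) y < L
        upd< i< y with y ≡ᵇ κ
        ... | true  = i<
        ... | false = a< y
        bodyT : ∀ j σ acc → reg σ 19 ≡ j → j < L → Queried (κ ∷ κs) a acc σ →
          Triple body σ (28 + s * 42 + q) (queryTree L run κs (a [ κ ≔ j ]) acc)
            (λ x σ′ → reg σ′ 19 ≡ j × Queried (κ ∷ κs) a x σ′)
        bodyT j σ acc c≡ j< (rd , acc≡ , off) =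
          timeT (≤-reflexive (lem s q))
          (seqT (enterT J σ (Ready.mul≡ rd) len c≡) λ _ σ₁ i≡ fr₁ →
            keepT (queriesT Js (a [ κ ≔ j ]) σ₁ acc lens dist (upd< j<)
                    (ready-enter J fr₁ rd , trans (regs fr₁ 15 (enter-reg J 15 refl refl)) acc≡ , off₁ {σ₁} i≡))
              λ x σ₂ (rd₂ , x≡ , off₂) fr₂ →
                postT (leaveT J σ₂ (Ready.mul≡ rd₂) len) λ _ σ₃ r≡ fr₃ →
                  trans r≡ (trans (off₂ κ κ∉) (at-κ j)) ,
                  ready-leave J fr₃ rd₂ ,
                  trans (regs fr₃ 15 (leave-reg J 15 refl refl refl)) x≡ ,
                  λ { y (y≢ ∷ ys≢) → trans (arrays fr₃ 11 (leave-arr J 11) y) (trans (off₂ y ys≢) (other j y y≢)) })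
          where
          lem : ∀ s q → 14 + s * 21 + (q + (14 + s * 21)) ≡ 28 + s * 42 + q
          lem = solve-∀
          at-κ : ∀ j → (a [ κ ≔ j ]) κ ≡ j
          at-κ j rewrite ≡ᵇ-refl κ = refl
          other : ∀ j y → y ≢ κ → (a [ κ ≔ j ]) y ≡ a y
          other j y y≢ rewrite ≡ᵇ-false y≢ = refl
          off₁ : ∀ {σ₁} → (∀ y → arr σ₁ 11 y ≡ (arr σ 11 [ κ ≔ j ]) y) → AgreeOff κs (a [ κ ≔ j ]) σ₁
          off₁ i≡ y ys≢ with i≡ y
          ... | e with y ≡ᵇ κ in eq
          ...   | true  = e
          ...   | false = trans e (off y ((λ y≡κ → contradiction (trans (sym eq) (trans (cong (_≡ᵇ κ) y≡κ) (≡ᵇ-refl κ))) λ ()) ∷ ys≢))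
        loopT : ∀ j σ acc → reg σ 19 ≡ j → j ≤ L → Queried (κ ∷ κs) a acc σ →
          Triple (loop 19 body) σ (j * (33 + s * 42 + q) + 1)
            (iterate (λ i → queryTree L run κs (a [ κ ≔ i ])) j acc) (Queried (κ ∷ κs) a)
        loopT zero    σ acc c≡ j≤ h = postT (mapT (λ _ → acc) (loop0T c≡)) λ { _ _ (_ , refl , refl) _ → h }
        loopT (suc j) σ acc c≡ j≤ (rd , acc≡ , off) =
          timeT (≤-reflexive (lem s q (j * (33 + s * 42 + q))))
          (loopST c≡
            (bodyT j _ acc refl j≤
              (ready-frame {c = loop 19 (blk [])} (set-frame j σ)
                 (refl ∷ refl ∷ refl ∷ refl ∷ refl ∷ refl ∷ refl ∷ [])
                 (refl ∷ refl ∷ refl ∷ refl ∷ refl ∷ refl ∷ refl ∷ []) rd , acc≡ , off))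
            λ x σ′ (c≡′ , h) _ → loopT j σ′ x c≡′ (≤-trans (n≤1+n j) j≤) h)
          where
          lem : ∀ s q r → 5 + (28 + s * 42 + q) + (r + 1) ≡ 33 + s * 42 + q + r + 1
          lem = solve-∀
          set-frame : ∀ j σ → Frame (loop 19 (blk [])) σ ⟪ reg σ [ 19 ≔ j ] , arr σ ⟫
          set-frame j σ = frame (λ i e → upd-other (reg σ) 19 j i (Bool.∨-conicalˡ _ _ e)) (λ _ _ _ → refl)

    module Phases (s k m : ℕ) .{{_ : NonZero m}} (n≤ : n ≤ (k + k) * m)
      (μ : ℕ → ℕ) (Tb : ℕ → Bool) (Js : List (List ℕ)) (Js-length : All (λ J → length J ≡ s) Js)
      (κs-distinct : Distinct (map (hcode μ 0) Js)) (0<L : 0 < L) where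

      κs : List ℕ
      κs = map (hcode μ 0) Js

      imageOf : List ℕ → ℕ → ℕ
      imageOf = blockImage m

      itemsOf : List ℕ → List Item
      itemsOf ts = bfsItems μ (imageOf ts) (_/ m) n s

      record Between (σ : State) : Set where
        field
          n≡     : reg σ 8 ≡ n
          scale≡ : reg σ 9 ≡ scale
          m≡     : reg σ 10 ≡ m
          L≡     : reg σ 12 ≡ L
          R≡     : reg σ 26 ≡ R
          mul≡   : ∀ y → arr σ 3 y ≡ μ y
          table≡ : ∀ y → arr σ 9 y ≡ b2n (Tb y)
          freshR : ∀ i → reg σ 14 ≤ i → arr σ 0 i ≡ 0
          freshM : ∀ i → reg σ 14 ≤ i → arr σ 1 i ≡ 0
          index≡ : AgreeOff κs (λ _ → 0) σ

      between-frame : ∀ {c σ σ′} → Frame c σ σ′ →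
        All (λ i → writesReg c i ≡ false) (8 ∷ 9 ∷ 10 ∷ 12 ∷ 14 ∷ 26 ∷ []) →
        All (λ i → writesArr c i ≡ false) (0 ∷ 1 ∷ 3 ∷ 9 ∷ 11 ∷ []) → Between σ → Between σ′
      between-frame fr (w₈ ∷ w₉ ∷ w₁₀ ∷ w₁₂ ∷ w₁₄ ∷ w₂₆ ∷ []) (a₀ ∷ a₁ ∷ a₃ ∷ a₉ ∷ a₁₁ ∷ []) b = record
        { n≡ = trans (regs fr 8 w₈) n≡ ; scale≡ = trans (regs fr 9 w₉) scale≡ ; m≡ = trans (regs fr 10 w₁₀) m≡
        ; L≡ = trans (regs fr 12 w₁₂) L≡ ; R≡ = trans (regs fr 26 w₂₆) R≡
        ; mul≡ = λ y → trans (arrays fr 3 a₃ y) (mul≡ y)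
        ; table≡ = λ y → trans (arrays fr 9 a₉ y) (table≡ y)
        ; freshR = λ i le → trans (arrays fr 0 a₀ i) (freshR i (subst (_≤ i) (regs fr 14 w₁₄) le))
        ; freshM = λ i le → trans (arrays fr 1 a₁ i) (freshM i (subst (_≤ i) (regs fr 14 w₁₄) le))
        ; index≡ = λ y y∉ → trans (arrays fr 11 a₁₁ y) (index≡ y y∉)
        }
        where open Between b

      module _ {mA : List Item → List (List Bool) → (ℕ → ℕ) → ℕ → ℕ} (total : ∀ its ys a →
        Surely (_≢ nothing) (exec p A T Model.⟨ 0 , startRegs , mA its ys a ⟩)) where

        runOn : List Item → List (List Bool) → (ℕ → ℕ) → Dist (Maybe ℕ)
        runOn its ys a = exec p A T Model.⟨ 0 , startRegs , mA its ys a ⟩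

        phaseTree : List ℕ → ℕ → Dist ℕ
        phaseTree ts acc =
          sampleAll samp (map (λ it → Tb (proj₁ (proj₂ it))) (itemsOf ts)) >>= λ ys →
          queryTree L (runOn (itemsOf ts) ys) κs (λ _ → 0) acc

        phasesTree : List (List ℕ) → ℕ → Dist ℕ
        phasesTree []         acc = return acc
        phasesTree (ts ∷ tss) acc = phaseTree ts acc >>= phasesTree tss

        phaseTime : List ℕ → ℕ
        phaseTime ts = 7 + partsTime m ts + (bfsTime s n + (21 + (n ^ s * (40 + tS) + 1) +
          queriesTime s (113 + n ^ s * 68 + T * 110) (length Js)))

        phasesTime : List (List ℕ) → ℕ
        phasesTime []         = 0
        phasesTime (ts ∷ tss) = phaseTime ts + phasesTime tss

        queriesTime-mono : ∀ {t t′} d → t ≤ t′ → queriesTime s t d ≤ queriesTime s t′ d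
        queriesTime-mono zero    le = le
        queriesTime-mono (suc d) le = +-monoʳ-≤ 7 (+-monoˡ-≤ 1 (*-monoʳ-≤ L (+-monoʳ-≤ (33 + s * 42) (queriesTime-mono d le))))

        Phased : ℕ → State → Set
        Phased x σ = Between σ × reg σ 15 ≡ x

        phaseT : ∀ ts σ acc → length ts ≡ k + k → length (itemsOf ts) ≤ n ^ s →
          (∀ ys a i → mA (itemsOf ts) ys a i ≡ b2n (bitAt (queryBits a (itemsOf ts) ys) i)) →
          Phased acc σ → Triple (tupleC A smp s Js ts) σ (phaseTime ts) (phaseTree ts acc) Phased
        phaseT ts σ acc len-ts len≤ mem≡ (b , acc≡) =
          seqT (seqT (blkT (set 3 0 ∷ []) σ) λ { _ σ₀ refl _ → partsT {m} 0 ts σ₀ (Between.m≡ b) refl })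
            λ { _ σ₁ (f , _) fr₁ →
              let b₁ = between-frame fr₁
                         (pr 8 (λ _ _ → refl) refl ∷ pr 9 (λ _ _ → refl) refl ∷ pr 10 (λ _ _ → refl) refl ∷ pr 12 (λ _ _ → refl) refl ∷ pr 14 (λ _ _ → refl) refl ∷ pr 26 (λ _ _ → refl) refl ∷ [])
                         (pa 0 (λ _ _ → refl) ∷ pa 1 (λ _ _ → refl) ∷ pa 3 (λ _ _ → refl) ∷ pa 9 (λ _ _ → refl) ∷ pa 11 (λ _ _ → refl) ∷ []) b
                  acc₁ = trans (regs fr₁ 15 (pr 15 (λ _ _ → refl) refl)) acc≡
              in
              seqT (bfsT {μ} {arr σ₁ 4} {arr σ₁ 5} {n} s σ₁ (Between.n≡ b₁) (Between.mul≡ b₁) (λ _ → refl) (λ _ → refl))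
              λ { _ σ₂ q fr₂ →
                let its≡ = stages-cong s ((n , 0 , 0) ∷ []) (≤-refl ∷ []) (image≡ σ₁ f) (part≡ σ₁ f)
                    b₂ = between-frame fr₂
                           (br 8 refl refl ∷ br 9 refl refl ∷ br 10 refl refl ∷ br 12 refl refl ∷ br 14 refl refl ∷ br 26 refl refl ∷ [])
                           (ba 0 refl refl ∷ ba 1 refl refl ∷ ba 3 refl refl ∷ ba 9 refl refl ∷ ba 11 refl refl ∷ []) b₁
                    acc₂ = trans (regs fr₂ 15 (br 15 refl refl)) acc₁
                    seg₂ = subst (Segment (arr σ₂) (reg σ₂ 17)) its≡ (Queue.seg q)
                    cnt₂ = trans (Queue.count≡ q) (cong length its≡)
                in
                seqT (timeT (+-monoʳ-≤ 21 (+-monoˡ-≤ 1 (*-monoˡ-≤ (40 + tS) len≤)))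
                  (seqT (blkT (mov 25 24 ∷ mov 19 18 ∷ mov 20 17 ∷ []) σ₂) λ { _ σ₃ refl _ →
                    postT {Q′ = λ ys σ′ → Vectors (arr σ′ 10) (reg σ₂ 24) (itemsOf ts) ys × reg σ′ 25 ≡ reg σ₂ 24}
                      (samplesT {Tb} (itemsOf ts) σ₃ {reg σ₂ 24} seg₂ cnt₂ refl (Between.L≡ b₂) (Between.R≡ b₂) (Between.table≡ b₂))
                      λ ys σ₄ (vec , _) fr → vec , regs fr 25 (or-false (smp-reg 18)) }))
                λ { ys σ₄ (vec , vec≡) fr₄ →
                  let b₄ = between-frame fr₄
                             (or-false (smp-reg 1) ∷ or-false (smp-reg 2) ∷ or-false (smp-reg 3) ∷ or-false (smp-reg 5) ∷
                              or-false (smp-reg 7) ∷ or-false (smp-reg 19) ∷ [])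
                             (or-false (smp-arr 0 refl) ∷ or-false (smp-arr 1 refl) ∷ or-false (smp-arr 3 refl) ∷
                              or-false (smp-arr 9 refl) ∷ or-false (smp-arr 11 refl) ∷ []) b₂
                      rd = record
                        { n≡ = Between.n≡ b₄ ; scale≡ = Between.scale≡ b₄ ; L≡ = Between.L≡ b₄
                        ; count≡ = trans (regs fr₄ 18 (or-false (smp-reg 11))) cnt₂
                        ; seg = subst (λ z → Segment (arr σ₄) z (itemsOf ts)) (sym (regs fr₄ 17 (or-false (smp-reg 10))))
                                  (segment-cong _ (itemsOf ts) (arrays fr₄ 6 (or-false (smp-arr 6 refl)))
                                    (arrays fr₄ 7 (or-false (smp-arr 7 refl))) (arrays fr₄ 8 (or-false (smp-arr 8 refl))) seg₂)
                        ; vec = subst (λ z → Vectors (arr σ₄ 10) z (itemsOf ts) ys) (sym vec≡) vec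
                        ; mul≡ = Between.mul≡ b₄ ; freshR = Between.freshR b₄ ; freshM = Between.freshM b₄ }
                  in
                  timeT (queriesTime-mono (length Js) (+-monoˡ-≤ (T * 110) (+-monoʳ-≤ 113 (*-monoˡ-≤ 68 len≤))))
                  (postT (queriesT {μ} {itemsOf ts} {ys} {s} {mA (itemsOf ts) ys} (mem≡ ys) (total (itemsOf ts) ys) Js (λ _ → 0) σ₄ acc
                           Js-length κs-distinct (λ _ → 0<L)
                           (rd , trans (regs fr₄ 15 (or-false (smp-reg 8))) acc₂ , Between.index≡ b₄))
                    λ { x σ₅ (rd₅ , x≡ , off) fr₅ → record
                      { n≡ = Ready.n≡ rd₅ ; scale≡ = Ready.scale≡ rd₅
                      ; m≡ = trans (regs fr₅ 10 (queriesC-reg A Js 10 refl refl refl refl)) (Between.m≡ b₄)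
                      ; L≡ = Ready.L≡ rd₅
                      ; R≡ = trans (regs fr₅ 26 (queriesC-reg A Js 26 refl refl refl refl)) (Between.R≡ b₄)
                      ; mul≡ = Ready.mul≡ rd₅
                      ; table≡ = λ y → trans (arrays fr₅ 9 (queriesC-arr A Js 9 refl refl refl refl) y) (Between.table≡ b₄ y)
                      ; freshR = Ready.freshR rd₅ ; freshM = Ready.freshM rd₅ ; index≡ = off } , x≡ }) } } }
          where
          or-false : ∀ {x} → x ≡ false → x ∨ false ≡ false
          or-false refl = refl
          u-split : ∀ u → u ≡ u / m * m + u % m
          u-split u = trans (DM.m≡m%n+[m/n]*n u m) (+-comm (u % m) _)
          quot< : ∀ u → u < n → u / m < length ts
          quot< u u< = ≤-trans (DM.m<n*o⇒m/o<n (≤-trans u< n≤)) (≤-reflexive (sym len-ts))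
          pr : ∀ i → (∀ q t → writesReg (partC q t) i ≡ false) → (i ≡ᵇ 3) ≡ false →
               writesReg (blk (set 3 0 ∷ []) ⨾ partsC 0 ts) i ≡ false
          pr i h e = trans (cong (λ z → (z ∨ false) ∨ writesReg (partsC 0 ts) i) e) (partsC-reg i h 0 ts)
          pa : ∀ i → (∀ q t → writesArr (partC q t) i ≡ false) → writesArr (blk (set 3 0 ∷ []) ⨾ partsC 0 ts) i ≡ false
          pa i h = partsC-arr i h 0 ts
          br : ∀ i → opsW rootOps i ≡ false → writesReg stageC i ≡ false → writesReg (bfsC s) i ≡ false
          br i h h′ = trans (cong (_∨ writesReg (repC s stageC) i) h) (repC-reg s stageC i h′)
          ba : ∀ i → opsWA rootOps i ≡ false → writesArr stageC i ≡ false → writesArr (bfsC s) i ≡ false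
          ba i h h′ = trans (cong (_∨ writesArr (repC s stageC) i) h) (repC-arr s stageC i h′)
          image≡ : ∀ σ₁ → Filled m (arr σ₁ 4) (arr σ₁ 5) 0 ts → ∀ u → u < n → arr σ₁ 4 u ≡ imageOf ts u
          image≡ σ₁ f u u< = trans (cong (arr σ₁ 4) (u-split u)) (proj₁ (filled {m} {arr σ₁ 4} {arr σ₁ 5} 0 ts f (u / m) (u % m) (quot< u u<) (DM.m%n<n u m)))
          part≡ : ∀ σ₁ → Filled m (arr σ₁ 4) (arr σ₁ 5) 0 ts → ∀ u → u < n → arr σ₁ 5 u ≡ u / m
          part≡ σ₁ f u u< = trans (cong (arr σ₁ 5) (u-split u)) (proj₂ (filled {m} {arr σ₁ 4} {arr σ₁ 5} 0 ts f (u / m) (u % m) (quot< u u<) (DM.m%n<n u m)))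

        phasesT : ∀ tss σ acc → All (λ ts → length ts ≡ k + k) tss →
          (∀ ts → length (itemsOf ts) ≤ n ^ s) →
          (∀ ts ys a i → mA (itemsOf ts) ys a i ≡ b2n (bitAt (queryBits a (itemsOf ts) ys) i)) →
          Phased acc σ → Triple (tuplesC A smp s Js tss) σ (phasesTime tss) (phasesTree tss acc) Phased
        phasesT []         σ acc []           len≤ mem≡ h = postT (mapT (λ _ → acc) (blkT [] σ)) λ { _ _ (_ , refl , refl) _ → h }
        phasesT (ts ∷ tss) σ acc (len ∷ lens) len≤ mem≡ h =
          seqT (phaseT ts σ acc len (len≤ ts) (mem≡ ts) h) λ x σ′ h′ _ → phasesT tss σ′ x lens len≤ mem≡ h′

 -- Tables shared by all tuples

 -- The table is only valid below the bound; the cells beyond it are still 0.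
 timesBelow : ℕ → ℕ → ℕ → ℕ
 timesBelow bound M y = if y <ᵇ bound then y * M else 0

 updBool : (ℕ → Bool) → ℕ → Bool → ℕ → Bool
 updBool f x v y = if y ≡ᵇ x then v else f y

 tabulated : (ℕ → Bool) → List Item → List Bool → ℕ → Bool
 tabulated f ((_ , κ , _) ∷ its) (b ∷ bs) = tabulated (updBool f κ b) its bs
 tabulated f _                   _        = f

 baseItems : (ℕ → ℕ) → ℕ → ℕ → List Item
 baseItems μ n s = bfsItems μ (λ u → u) (λ _ → 0) n s

 topXor : ℕ → (ℕ → Bool) → Bool
 topXor zero    f = false
 topXor (suc j) f = f j xor topXor j f

 b2n-xor : ∀ x y → (b2n x ∸ b2n y) + (b2n y ∸ b2n x) ≡ b2n (x xor y)
 b2n-xor true  true  = refl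
 b2n-xor true  false = refl
 b2n-xor false true  = refl
 b2n-xor false false = refl

 module SetupCommands (ℝ : Reals) where
  open Language ℝ
  open Commands ℝ

  powStepC : Cmd
  powStepC = blk (set 4 0 ∷ mov 19 2 ∷ []) ⨾ loop 19 (blk (add 4 4 3 ∷ [])) ⨾ blk (mov 3 4 ∷ [])

  powC : ℕ → Cmd
  powC e = blk (set 3 1 ∷ []) ⨾ repC e powStepC

  copyOps : List Op
  copyOps = ldRaw 0 19 ∷ set 1 0 ∷ stRaw 19 1 ∷ add 1 13 19 ∷ st input 1 0 ∷ []

  divC : ℕ → Cmd
  divC k = blk (set 10 0 ∷ mov 0 8 ∷ mov 19 8 ∷ set 1 k ∷ set 2 1 ∷ []) ⨾
           loop 19 (blk (add 3 0 2 ∷ sub 3 3 1 ∷ []) ⨾ ifz 3 (blk []) (blk (sub 0 0 1 ∷ add 10 10 2 ∷ [])))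

  doubleC : ℕ → Cmd
  doubleC k = blk (set 2 0 ∷ set 19 (k + k) ∷ []) ⨾ loop 19 (blk (add 2 2 10 ∷ [])) ⨾ blk (mov 11 2 ∷ [])

  tableOps : List Op
  tableOps = sub 3 3 11 ∷ st mulT 19 3 ∷ []

  mulTableC : ℕ → Cmd
  mulTableC e = blk (mov 2 11 ∷ []) ⨾ powC e ⨾ blk (mov 5 3 ∷ []) ⨾ powC (suc e) ⨾ blk (mov 19 5 ∷ []) ⨾
                loop 19 (blk tableOps)

  lookupOps : List Op
  lookupOps = ld qKey 0 20 ∷ ld input 1 21 ∷ st table 0 1 ∷ set 2 1 ∷ add 20 20 2 ∷ add 21 21 2 ∷ []

  baseC : ℕ → Cmd
  baseC s = (blk (mov 19 8 ∷ []) ⨾ loop 19 (blk (st image 19 19 ∷ []))) ⨾ bfsC s ⨾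
            (blk (mov 19 18 ∷ mov 20 17 ∷ mov 21 13 ∷ []) ⨾ loop 19 (blk lookupOps))

  copyC : ℕ → Cmd
  copyC s = blk (mov 2 8 ∷ []) ⨾ powC s ⨾ blk (mov 13 3 ∷ mov 19 3 ∷ []) ⨾ loop 19 (blk copyOps)

  reductionC : Model.Program ℝ → Cmd → Cmd → ℕ → ℕ → List (List ℕ) → List (List ℕ) → Cmd
  reductionC A smp prep e k Js tss =
    copyC (suc e) ⨾ divC k ⨾ doubleC k ⨾ mulTableC e ⨾ prep ⨾ baseC (suc e) ⨾ tuplesC A smp (suc e) Js tss

  cliqueC : Model.Program ℝ → Cmd → Cmd → ℕ → ℕ → List (List ℕ) → List (List ℕ) → Cmd
  cliqueC A smp prep e k Js tss =
    blk (set 0 k ∷ set 1 1 ∷ add 2 8 1 ∷ sub 2 2 0 ∷ []) ⨾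
    ifz 2 (blk (set 15 0 ∷ [])) (reductionC A smp prep e k Js tss)

  xorOps : List Op
  xorOps = ldRaw 0 19 ∷ sub 1 15 0 ∷ sub 2 0 15 ∷ add 15 1 2 ∷ []

  countEdgesC : ℕ → Cmd
  countEdgesC s = blk (mov 2 8 ∷ []) ⨾ powC s ⨾ blk (mov 19 3 ∷ set 15 0 ∷ []) ⨾ loop 19 (blk xorOps)

  program : Cmd → Model.Program ℝ
  program c = add 10 0 2 ∷ add 11 1 2 ∷ compile c 2 ++ set 1 0 ∷ add 0 17 1 ∷ []
    where open Model.Instr

 module Preparation (ℝ : Reals) (p : Model.Prob ℝ) where
  open Model ℝ using (Dist; return; flip; _>>=_; _[_≔_]; exec; Surely)
  open Main ℝ p
  open SetupCommands ℝ

  powTime : ℕ → ℕ → ℕ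
  powTime b e = 7 + sumTo e (λ _ → 22 + b * 12)

  powT : ∀ {b} e σ → reg σ 2 ≡ b → Triple (powC e) σ (powTime b e) (return tt) (λ _ σ′ → reg σ′ 3 ≡ b ^ e)
  powT {b} e σ b≡ = seqT (blkT (set 3 1 ∷ []) σ) λ { _ σ₁ refl _ →
    postT (repT (λ _ → 22 + b * 12) Inv body e σ₁ (b≡ , *-identityʳ _)) λ { _ σ₂ (_ , e≡) _ →
      trans (sym (*-identityˡ _)) e≡ } }
    where
    Inv : ℕ → State → Set
    Inv j σ = reg σ 2 ≡ b × b ^ j * reg σ 3 ≡ b ^ e
    body : ∀ j σ → Inv (suc j) σ → Triple powStepC σ (22 + b * 12) (return tt) (λ _ → Inv j)
    body j σ (b≡ , e≡) =
      timeT (≤-reflexive (lem b))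
      (seqT (blkT (set 4 0 ∷ mov 19 2 ∷ []) σ) λ { _ σ₁ refl _ →
        seqT (detLoop (λ i σ → reg σ 19 ≡ i × reg σ 4 + i * reg σ₁ 3 ≡ b * reg σ₁ 3) (λ _ _ → proj₁)
               (λ i σ′ (_ , h) fr → postT (blkT (add 4 4 3 ∷ []) _) λ { _ _ refl _ →
                 refl , trans (cong (λ z → reg σ′ 4 + z + i * reg σ 3) (regs fr 3 refl))
                          (trans (+-assoc (reg σ′ 4) _ _) h) })
               b σ₁ (b≡ , refl) frame-refl)
          λ { _ σ₂ (_ , h) fr₂ → postT (blkT (mov 3 4 ∷ []) σ₂) λ { _ _ refl _ →
            trans (regs fr₂ 2 refl) b≡ ,
            trans (cong (b ^ j *_) (trans (sym (+-identityʳ _)) h)) (trans (lem₂ (b ^ j) b (reg σ 3)) e≡) } } })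
      where
      lem : ∀ b → 14 + (b * 12 + 1 + 7) ≡ 22 + b * 12
      lem = solve-∀
      lem₂ : ∀ x b r → x * (b * r) ≡ b * x * r
      lem₂ = solve-∀

  powC-reg : ∀ e i → (i ≡ᵇ 3) ≡ false → writesReg powStepC i ≡ false → writesReg (powC e) i ≡ false
  powC-reg e i h h′ = trans (cong (λ z → (z ∨ false) ∨ writesReg (repC e powStepC) i) h) (repC-reg e powStepC i h′)

  powC-arr : ∀ e c → writesArr (powC e) c ≡ false
  powC-arr e c = repC-arr e powStepC c refl

  module _ {b : ℕ} {mem₀ : ℕ → ℕ} where
    record Copying (j : ℕ) (σ : State) : Set where
      field
        ctr≡  : reg σ 19 ≡ j
        todo  : ∀ c y → c < 16 → y * 16 + c < j → arr σ c y ≡ mem₀ (y * 16 + c)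
        clear : ∀ c y → c < 16 → j ≤ y * 16 + c → c ≢ 2 → arr σ c y ≡ 0
        moved : ∀ i → j ≤ i → i < b → arr σ 2 (b + i) ≡ mem₀ i
    open Copying

    copyLoopT : ∀ σ → reg σ 13 ≡ b → reg σ 19 ≡ b → (∀ c y → c < 16 → arr σ c y ≡ mem₀ (y * 16 + c)) →
      (∀ i → b ≤ i → mem₀ i ≡ 0) →
      Triple (loop 19 (blk copyOps)) σ (b * 40 + 1) (return tt) (λ _ → Copying 0)
    copyLoopT σ₀ b≡ c≡ all≡ zero≡ =
      detLoop Copying (λ _ _ → ctr≡) body b σ₀
        (record { ctr≡ = c≡ ; todo = λ c y c< _ → all≡ c y c<
                ; clear = λ c y c< le _ → trans (all≡ c y c<) (zero≡ _ le)
                ; moved = λ i le lt → contradiction (≤-trans lt le) (<-irrefl refl) }) frame-refl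
      where
      body : ∀ j σ → Copying (suc j) σ → Frame (loop 19 (blk copyOps)) σ₀ σ →
             Triple (blk copyOps) ⟪ reg σ [ 19 ≔ j ] , arr σ ⟫ 35 (return tt) (λ _ → Copying j)
      body j σ q fr = postT (blkT copyOps _) λ { _ _ refl _ → record
        { ctr≡ = refl ; todo = todo′ ; clear = clear′ ; moved = moved′ } }
        where
        σ′ = evalOps copyOps ⟪ reg σ [ 19 ≔ j ] , arr σ ⟫
        at-j : j / 16 * 16 + j % 16 ≡ j
        at-j = sym (trans (DM.m≡m%n+[m/n]*n j 16) (+-comm (j % 16) _))
        val : arr σ (j % 16) (j / 16) ≡ mem₀ j
        val = trans (todo q (j % 16) (j / 16) (DM.m%n<n j 16) (s≤s (≤-reflexive at-j))) (cong mem₀ at-j)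
        b≡′ : reg σ 13 ≡ b
        b≡′ = trans (regs fr 13 refl) b≡
        far : ∀ i x → x ≤ b + i → x ≤ (b + i) * 16 + 2
        far i x le = ≤-trans le (≤-trans (m≤m*n (b + i) 16) (m≤m+n _ 2))
        raw : ∀ c y → y * 16 + c ≢ j → rawSet (arr σ) j 0 c y ≡ arr σ c y
        raw c y ne rewrite ≡ᵇ-false ne = refl
        rest : ∀ c y → (c ≡ 2 → y ≢ b + j) → arr σ′ c y ≡ rawSet (arr σ) j 0 c y
        rest c y ne rewrite b≡′ with c ≡ᵇ 2 in eq
        ... | false = refl
        ... | true rewrite ≡ᵇ-false (ne (≡ᵇ-true c 2 eq)) = refl
        todo′ : ∀ c y → c < 16 → y * 16 + c < j → arr σ′ c y ≡ mem₀ (y * 16 + c)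
        todo′ c y c< lt = trans (rest c y λ { refl refl → <-irrefl refl (≤-trans lt (far j j (m≤n+m j b))) })
          (trans (raw c y (<⇒≢ lt)) (todo q c y c< (≤-trans lt (n≤1+n j))))
        clear′ : ∀ c y → c < 16 → j ≤ y * 16 + c → c ≢ 2 → arr σ′ c y ≡ 0
        clear′ c y c< le ne = trans (rest c y λ e → contradiction e ne) go
          where
          go : rawSet (arr σ) j 0 c y ≡ 0
          go with y * 16 + c ≡ᵇ j in eq
          ... | true  = refl
          ... | false = clear q c y c< (≤∧≢⇒< le λ e → contradiction (trans (sym eq)
                          (trans (cong (_≡ᵇ j) (sym e)) (≡ᵇ-refl j))) λ ()) ne
        moved′ : ∀ i → j ≤ i → i < b → arr σ′ 2 (b + i) ≡ mem₀ i
        moved′ i le lt with i ≟ j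
        ... | yes refl = at-b+i
          where
          at-b+i : arr σ′ 2 (b + i) ≡ mem₀ i
          at-b+i rewrite b≡′ | ≡ᵇ-refl (b + i) = val
        ... | no ne = trans (rest 2 (b + i) λ _ e → ne (+-cancelˡ-≡ b i j e))
          (trans (raw 2 (b + i) λ e → <-irrefl (sym e) (≤-trans (≤∧≢⇒< le (λ e → ne (sym e))) (far i i (m≤n+m i b))))
                 (moved q i (≤∧≢⇒< le (λ e → ne (sym e))) lt))

  divT : ∀ {n} k .{{_ : NonZero k}} σ → reg σ 8 ≡ n →
    Triple (divC k) σ (36 + n * 36) (return tt) (λ _ σ′ → reg σ′ 10 ≡ n / k)
  divT {n} k σ₀ n≡ =
    timeT (≤-reflexive (lem n))
    (seqT (blkT (set 10 0 ∷ mov 0 8 ∷ mov 19 8 ∷ set 1 k ∷ set 2 1 ∷ []) σ₀) λ { _ σ₁ refl _ →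
      postT (detLoop Inv (λ _ _ → proj₁) (body refl refl) n σ₁
              (n≡ , trans (+-identityʳ _) n≡ , ≤-trans (≤-reflexive (cong suc n≡)) (m<n+m n (>-nonZero⁻¹ k))) frame-refl)
        λ { _ σ₂ (_ , e , lt) _ → sym (trans (cong (_/ k) (sym e))
          (trans (DM.+-distrib-/-∣ʳ (reg σ₂ 0) (divides-refl (reg σ₂ 10)))
            (cong₂ _+_ (DM.m<n⇒m/n≡0 (≤-trans lt (≤-reflexive (+-identityʳ k)))) (DM.m*n/n≡m (reg σ₂ 10) k)))) } })
    where
    lem : ∀ n → 35 + (n * (5 + (14 + 17)) + 1) ≡ 36 + n * 36
    lem = solve-∀
    loopC = blk (add 3 0 2 ∷ sub 3 3 1 ∷ []) ⨾ ifz 3 (blk []) (blk (sub 0 0 1 ∷ add 10 10 2 ∷ []))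
    Inv : ℕ → State → Set
    Inv j σ = reg σ 19 ≡ j × reg σ 0 + reg σ 10 * k ≡ n × reg σ 0 < k + j
    body : ∀ {σ₁} → reg σ₁ 1 ≡ k → reg σ₁ 2 ≡ 1 → ∀ j σ → Inv (suc j) σ → Frame (loop 19 loopC) σ₁ σ →
           Triple loopC ⟪ reg σ [ 19 ≔ j ] , arr σ ⟫ 31 (return tt) (λ _ → Inv j)
    body k≡ one≡ j σ (_ , e , lt) fr = seqT (blkT (add 3 0 2 ∷ sub 3 3 1 ∷ []) _) λ { _ σ₂ refl _ → go σ₂ refl refl refl refl refl refl }
      where
      k≡′ = trans (regs fr 1 refl) k≡
      one≡′ = trans (regs fr 2 refl) one≡
      go : ∀ σ₂ → reg σ₂ 3 ≡ reg σ 0 + reg σ 2 ∸ reg σ 1 → reg σ₂ 0 ≡ reg σ 0 → reg σ₂ 10 ≡ reg σ 10 →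
        reg σ₂ 19 ≡ j → reg σ₂ 1 ≡ reg σ 1 → reg σ₂ 2 ≡ reg σ 2 →
        Triple (ifz 3 (blk []) (blk (sub 0 0 1 ∷ add 10 10 2 ∷ []))) σ₂ 17 (return tt) (λ _ → Inv j)
      go σ₂ t≡ x≡ q≡ c≡ k≡₂ o≡₂ with reg σ 0 + reg σ 2 ∸ reg σ 1 in eq
      ... | zero  = timeT (m≤m+n 3 14) (ifzT t≡ (postT (blkT [] σ₂) λ { _ _ refl _ →
              c≡ , trans (cong₂ (λ x q → x + q * k) x≡ q≡) e ,
              ≤-trans (subst₂ _≤_ (trans (cong₂ _+_ refl one≡′) (trans (+-comm (reg σ 0) 1) (cong suc (sym x≡)))) k≡′ (m∸n≡0⇒m≤n eq)) (m≤m+n k j) }))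
      ... | suc d = ifnzT t≡ (postT (blkT (sub 0 0 1 ∷ add 10 10 2 ∷ []) σ₂) λ { _ _ refl _ →
              c≡ ,
              trans (cong₂ (λ x q → x + q * k) (cong₂ _∸_ x≡ k≡₃) (trans (cong₂ _+_ q≡ (trans o≡₂ one≡′)) (+-comm (reg σ 10) 1)))
                (trans (sym (+-assoc (reg σ 0 ∸ k) k _)) (trans (cong (_+ reg σ 10 * k) (m∸n+n≡m k≤)) e)) ,
              ≤-trans (s≤s (≤-reflexive (cong₂ _∸_ x≡ k≡₃)))
                (≤-trans (m<n+o⇒m∸n<o (reg σ 0) k lt) (+-monoˡ-≤ j (>-nonZero⁻¹ k))) })
        where
        k≡₃ = trans k≡₂ k≡′
        k≤ : k ≤ reg σ 0
        k≤ = s≤s⁻¹ (subst₂ _<_ k≡′ (trans (cong (reg σ 0 +_) one≡′) (+-comm (reg σ 0) 1))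
               (m∸n≢0⇒n<m (λ z → contradiction (trans (sym eq) z) λ ())))

  doubleT : ∀ {m} k σ → reg σ 10 ≡ m →
    Triple (doubleC k) σ (22 + (k + k) * 12) (return tt) (λ _ σ′ → reg σ′ 11 ≡ (k + k) * m)
  doubleT {m} k σ m≡ =
    timeT (≤-reflexive (lem (k + k)))
    (seqT (blkT (set 2 0 ∷ set 19 (k + k) ∷ []) σ) λ { _ σ₁ refl _ →
      seqT (mulLoopT {m} {k + k} σ₁ m≡ refl refl) λ { _ σ₂ e _ →
        postT (blkT (mov 11 2 ∷ []) σ₂) λ { _ _ refl _ → e } } })
    where
    lem : ∀ t → 14 + (t * 12 + 1 + 7) ≡ 22 + t * 12
    lem = solve-∀

  mulTableTime : ℕ → ℕ → ℕ
  mulTableTime M e = 7 + (powTime M e + (7 + (powTime M (suc e) + (7 + (M ^ e * 19 + 1)))))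

  mulTableT : ∀ {M} e σ → reg σ 11 ≡ M → (∀ y → arr σ 3 y ≡ 0) →
    Triple (mulTableC e) σ (mulTableTime M e) (return tt) (λ _ σ′ → ∀ y → arr σ′ 3 y ≡ timesBelow (M ^ e) M y)
  mulTableT {M} e σ M≡ zero≡ =
    seqT (blkT (mov 2 11 ∷ []) σ) λ { _ σ₁ refl _ →
    seqT (powT {M} e σ₁ M≡) λ { _ σ₂ p≡ fr₂ →
    seqT (blkT (mov 5 3 ∷ []) σ₂) λ { _ σ₃ refl _ →
    seqT (powT {M} (suc e) σ₃ (trans (regs fr₂ 2 (powC-reg e 2 refl refl)) M≡)) λ { _ σ₄ p≡′ fr₄ →
    seqT (blkT (mov 19 5 ∷ []) σ₄) λ { _ σ₅ refl _ →
    postT (detLoop Inv (λ _ _ → proj₁)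
            (λ j σ q fr → body j σ q (trans (regs fr 11 refl) (trans (regs fr₄ 11 (powC-reg (suc e) 11 refl refl))
                                                       (trans (regs fr₂ 11 (powC-reg e 11 refl refl)) M≡))))
            (M ^ e) σ₅
            (trans (regs fr₄ 5 (powC-reg (suc e) 5 refl refl)) p≡ , ≤-refl , trans p≡′ (*-comm M (M ^ e)) ,
             (λ y le lt → contradiction (≤-trans lt le) (<-irrefl refl)) ,
             λ y _ → trans (arrays fr₄ 3 (powC-arr (suc e) 3) y) (trans (arrays fr₂ 3 (powC-arr e 3) y) (zero≡ y)))
            frame-refl)
      λ { _ σ₆ (_ , _ , _ , f , g) _ y → final σ₆ f g y } } } } } }
    where
    Inv : ℕ → State → Set
    Inv j σ = reg σ 19 ≡ j × j ≤ M ^ e × reg σ 3 ≡ j * M ×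
              (∀ y → j ≤ y → y < M ^ e → arr σ 3 y ≡ y * M) × (∀ y → M ^ e ≤ y → arr σ 3 y ≡ 0)
    final : ∀ σ → (∀ y → 0 ≤ y → y < M ^ e → arr σ 3 y ≡ y * M) → (∀ y → M ^ e ≤ y → arr σ 3 y ≡ 0) →
            ∀ y → arr σ 3 y ≡ timesBelow (M ^ e) M y
    final σ f g y with y <ᵇ M ^ e in eq
    ... | true  = f y z≤n (<ᵇ⇒< y _ (subst Data.Bool.Base.T (sym eq) tt))
    ... | false = g y (≮⇒≥ λ lt → subst Data.Bool.Base.T eq (<⇒<ᵇ lt))
    body : ∀ j σ → Inv (suc j) σ → reg σ 11 ≡ M →
           Triple (blk tableOps) ⟪ reg σ [ 19 ≔ j ] , arr σ ⟫ 14 (return tt) (λ _ → Inv j)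
    body j σ (_ , j≤ , v≡ , f , g) M≡ = postT (blkT tableOps _) λ { _ _ refl _ →
      refl , ≤-trans (n≤1+n j) j≤ , val , f′ , g′ }
      where
      σ′ = evalOps tableOps ⟪ reg σ [ 19 ≔ j ] , arr σ ⟫
      val : reg σ 3 ∸ reg σ 11 ≡ j * M
      val = trans (cong₂ _∸_ v≡ M≡) (m+n∸m≡n M (j * M))
      f′ : ∀ y → j ≤ y → y < M ^ e → arr σ′ 3 y ≡ y * M
      f′ y le lt with y ≡ᵇ j in eq
      ... | true  = trans val (cong (_* M) (sym (≡ᵇ-true y j eq)))
      ... | false = f y (≤∧≢⇒< le λ j≡y → contradiction (trans (sym eq) (trans (cong (y ≡ᵇ_) j≡y) (≡ᵇ-refl y))) λ ()) lt
      g′ : ∀ y → M ^ e ≤ y → arr σ′ 3 y ≡ 0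
      g′ y le rewrite ≡ᵇ-false {y} {j} (λ y≡j → <-irrefl (sym y≡j) (≤-trans j≤ le)) = g y le

  identityT : ∀ {n} σ → reg σ 19 ≡ n →
    Triple (loop 19 (blk (st image 19 19 ∷ []))) σ (n * 12 + 1) (return tt) (λ _ σ′ → ∀ u → u < n → arr σ′ 4 u ≡ u)
  identityT {n} σ₀ n≡ =
    postT (detLoop (λ j σ → reg σ 19 ≡ j × (∀ u → j ≤ u → u < n → arr σ 4 u ≡ u)) (λ _ _ → proj₁)
            (λ { j σ (_ , f) _ → postT (blkT (st image 19 19 ∷ []) _) λ { _ _ refl _ → refl , step j σ f } })
            n σ₀ (n≡ , λ u le lt → contradiction (≤-trans lt le) (<-irrefl refl)) frame-refl)
      λ { _ _ (_ , f) _ u → f u z≤n }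
    where
    step : ∀ j σ → (∀ u → suc j ≤ u → u < n → arr σ 4 u ≡ u) → ∀ u → j ≤ u → u < n →
           (if u ≡ᵇ j then j else arr σ 4 u) ≡ u
    step j σ f u le lt with u ≡ᵇ j in eq
    ... | true  = sym (≡ᵇ-true u j eq)
    ... | false = f u (≤∧≢⇒< le λ j≡u → contradiction (trans (sym eq) (trans (cong (u ≡ᵇ_) j≡u) (≡ᵇ-refl u))) λ ()) lt

  tabulateT : ∀ its bs f σ → length its ≡ length bs → Segment (arr σ) (reg σ 20) its →
    (∀ i → i < length bs → arr σ 2 (reg σ 21 + i) ≡ b2n (bitAt bs i)) → reg σ 19 ≡ length its →
    (∀ y → arr σ 9 y ≡ b2n (f y)) →
    Triple (loop 19 (blk lookupOps)) σ (length its * 47 + 1) (return tt)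
      (λ _ σ′ → ∀ y → arr σ′ 9 y ≡ b2n (tabulated f its bs y))
  tabulateT []        []       f σ _  _   _  c≡ t≡ = postT (loop0T c≡) λ { _ _ refl _ → t≡ }
  tabulateT ((ℓ , κ , c) ∷ its) (b ∷ bs) f σ l≡ ((_ , e , _) , seg) in≡ c≡ t≡ =
    timeT (≤-reflexive (sym (+-assoc 47 (length its * 47) 1)))
    (loopST c≡ (blkT lookupOps _) λ { _ σ′ refl _ →
      tabulateT its bs (updBool f κ b) σ′ (suc-injective l≡)
        (subst (λ z → Segment (arr σ′) z its) (sym (+-comm (reg σ 20) 1))
          (segment-below _ its ≤-refl (below λ y _ → refl , refl , refl) seg))
        (λ i i< → trans (cong (arr σ 2) (+-assoc (reg σ 21) 1 i)) (in≡ (suc i) (s≤s i<)))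
        refl upd })
    where
    upd : ∀ y → (if y ≡ᵇ arr σ 7 (reg σ 20) then arr σ 2 (reg σ 21) else arr σ 9 y) ≡ b2n (updBool f κ b y)
    upd y rewrite e with y ≡ᵇ κ
    ... | true  = trans (cong (arr σ 2) (sym (+-identityʳ (reg σ 21)))) (in≡ 0 (s≤s z≤n))
    ... | false = t≡ y

  baseT : ∀ {μ n b} s σ bs → reg σ 8 ≡ n → reg σ 13 ≡ b → (∀ y → arr σ 3 y ≡ μ y) → (∀ y → arr σ 5 y ≡ 0) →
    (∀ y → arr σ 9 y ≡ 0) → length (baseItems μ n s) ≡ length bs → (∀ i → i < length bs → arr σ 2 (b + i) ≡ b2n (bitAt bs i)) →
    Triple (baseC s) σ (29 + n * 12 + bfsTime s n + length bs * 47 + 1) (return tt)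
      (λ _ σ′ → ∀ y → arr σ′ 9 y ≡ b2n (tabulated (λ _ → false) (baseItems μ n s) bs y))
  baseT {μ} {n} {b} s σ bs n≡ b≡ μ≡ P≡ t≡ l≡ in≡ =
    timeT (≤-reflexive (trans (cong (λ z → 7 + (n * 12 + 1) + (bfsTime s n + (21 + (z * 47 + 1)))) l≡)
                              (lem n (bfsTime s n) (length bs))))
    (seqT (seqT (blkT (mov 19 8 ∷ []) σ) λ { _ σ₀ refl _ → identityT {n} σ₀ n≡ }) λ { _ σ₁ I≡ fr₁ →
    seqT (bfsT {μ} {arr σ₁ 4} {arr σ₁ 5} {n} s σ₁ (trans (regs fr₁ 8 refl) n≡)
           (λ y → trans (arrays fr₁ 3 refl y) (μ≡ y)) (λ _ → refl) (λ _ → refl)) λ { _ σ₂ q fr₂ →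
      let its≡ = stages-cong {μ} {arr σ₁ 4} {λ u → u} {arr σ₁ 5} {λ _ → 0} s ((n , 0 , 0) ∷ []) (≤-refl ∷ [])
                   I≡ (λ u _ → trans (arrays fr₁ 5 refl u) (P≡ u))
          a : ∀ c → (c ≡ᵇ 4) ≡ false → opsWA rootOps c ≡ false → writesArr stageC c ≡ false → ∀ y → arr σ₂ c y ≡ arr σ c y
          a = λ c e h h′ y → trans (arrays fr₂ c (trans (cong (_∨ writesArr (repC s stageC) c) h) (repC-arr s stageC c h′)) y)
                (arrays fr₁ c (trans (cong (_∨ false) e) refl) y)
      in
      seqT (blkT (mov 19 18 ∷ mov 20 17 ∷ mov 21 13 ∷ []) σ₂) λ { _ σ₃ refl _ →
        tabulateT (baseItems μ n s) bs (λ _ → false) σ₃ l≡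
          (subst (Segment (arr σ₂) (reg σ₂ 17)) its≡ (Queue.seg q))
          (λ i i< → trans (cong (λ z → arr σ₂ 2 (z + i)) (trans (regs fr₂ 13 (repC-reg s stageC 13 refl))
                             (trans (regs fr₁ 13 refl) b≡)))
                      (trans (a 2 refl refl refl (b + i)) (in≡ i i<)))
          (trans (Queue.count≡ q) (cong length its≡))
          (λ y → trans (a 9 refl refl refl y) (t≡ y)) } } })
    where
    lem : ∀ n t l → 7 + (n * 12 + 1) + (t + (21 + (l * 47 + 1))) ≡ 29 + n * 12 + t + l * 47 + 1
    lem = solve-∀

  copyTime : ℕ → ℕ → ℕ
  copyTime n s = 22 + powTime n s + n ^ s * 40

  copyT : ∀ {n mem₀} s σ → reg σ 8 ≡ n → (∀ c y → c < 16 → arr σ c y ≡ mem₀ (y * 16 + c)) →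
    (∀ i → n ^ s ≤ i → mem₀ i ≡ 0) →
    Triple (copyC s) σ (copyTime n s) (return tt) (λ _ σ′ → reg σ′ 13 ≡ n ^ s ×
      (∀ c y → c < 16 → c ≢ 2 → arr σ′ c y ≡ 0) × (∀ i → i < n ^ s → arr σ′ 2 (n ^ s + i) ≡ mem₀ i))
  copyT {n} {mem₀} s σ n≡ arr≡ zero≡ =
    timeT (≤-reflexive (lem (powTime n s) (n ^ s)))
    (seqT (blkT (mov 2 8 ∷ []) σ) λ { _ σ₁ refl _ →
    seqT (powT {n} s σ₁ n≡) λ { _ σ₂ p≡ fr₂ →
    seqT (blkT (mov 13 3 ∷ mov 19 3 ∷ []) σ₂) λ { _ σ₃ refl _ →
      postT (copyLoopT {n ^ s} {mem₀} σ₃ p≡ p≡ (λ c y c< → trans (arrays fr₂ c (powC-arr s c) y) (arr≡ c y c<)) zero≡)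
        λ { _ σ₄ q fr₄ → trans (regs fr₄ 13 refl) p≡ , (λ c y c< → Copying.clear q c y c< z≤n) ,
                          λ i → Copying.moved q i z≤n } } } })
    where
    lem : ∀ t b → 7 + (t + (14 + (b * 40 + 1))) ≡ 22 + t + b * 40
    lem = solve-∀

  countEdgesT : ∀ {n} {f : ℕ → Bool} s σ → reg σ 8 ≡ n → (∀ c y → c < 16 → arr σ c y ≡ b2n (f (y * 16 + c))) →
    Triple (countEdgesC s) σ (22 + powTime n s + n ^ s * 33) (return tt) (λ _ σ′ → reg σ′ 15 ≡ b2n (topXor (n ^ s) f))
  countEdgesT {n} {f} s σ n≡ arr≡ =
    timeT (≤-reflexive (lem (powTime n s) (n ^ s)))
    (seqT (blkT (mov 2 8 ∷ []) σ) λ { _ σ₁ refl _ →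
    seqT (powT {n} s σ₁ n≡) λ { _ σ₂ p≡ fr₂ →
    seqT (blkT (mov 19 3 ∷ set 15 0 ∷ []) σ₂) λ { _ σ₃ refl _ →
      postT (detLoop Inv (λ _ _ → proj₁) (body {σ₃} λ c y c< → trans (arrays fr₂ c (powC-arr s c) y) (arr≡ c y c<))
              (n ^ s) σ₃ (p≡ , false , refl , refl) frame-refl)
        λ { _ σ₄ (_ , a , a≡ , e) _ → trans a≡ (cong b2n (trans (sym (Bool.xor-identityʳ a)) e)) } } } })
    where
    lem : ∀ t b → 7 + (t + (14 + (b * 33 + 1))) ≡ 22 + t + b * 33
    lem = solve-∀
    Inv : ℕ → State → Set
    Inv j σ = reg σ 19 ≡ j × ∃ λ a → reg σ 15 ≡ b2n a × a xor topXor j f ≡ topXor (n ^ s) f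
    body : ∀ {σ₃} → (∀ c y → c < 16 → arr σ₃ c y ≡ b2n (f (y * 16 + c))) → ∀ j σ → Inv (suc j) σ →
           Frame (loop 19 (blk xorOps)) σ₃ σ →
           Triple (blk xorOps) ⟪ reg σ [ 19 ≔ j ] , arr σ ⟫ 28 (return tt) (λ _ → Inv j)
    body arr≡₃ j σ (_ , a , a≡ , e) fr = postT (blkT xorOps _) λ { _ _ refl _ →
      refl , a xor f j ,
      trans (cong₂ (λ x y → (x ∸ y) + (y ∸ x)) a≡ val) (b2n-xor a (f j)) ,
      trans (Bool.xor-assoc a (f j) (topXor j f)) e }
      where
      val : arr σ (j % 16) (j / 16) ≡ b2n (f j)
      val = trans (arrays fr (j % 16) refl (j / 16)) (trans (arr≡₃ _ _ (DM.m%n<n j 16))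
              (cong (λ z → b2n (f z)) (sym (trans (DM.m≡m%n+[m/n]*n j 16) (+-comm (j % 16) _)))))

  module Reduction (A : Model.Program ℝ) (smp prep : Cmd)
    (smp-reg : ∀ i → writesReg smp (7 + i) ≡ false)
    (smp-arr : ∀ c → (c ≡ᵇ 10) ≡ false → writesArr smp c ≡ false)
    (prep-reg : All (λ i → writesReg prep i ≡ false) (8 ∷ 9 ∷ 10 ∷ 13 ∷ 14 ∷ 15 ∷ []))
    (prep-arr : ∀ c → writesArr prep c ≡ false)
    (n scale L R tS tP T : ℕ) (samp : Bool → Dist (List Bool))
    (smpT : ∀ σ x v → reg σ 12 ≡ L → reg σ 26 ≡ R → reg σ 27 ≡ b2n x → reg σ 24 ≡ v →
      Triple smp σ tS (samp x) (λ y σ′ →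
        (∀ i → i < L → arr σ′ 10 (v + i) ≡ b2n (bitAt y i)) × (∀ i → i < v → arr σ′ 10 i ≡ arr σ 10 i)))
    (prepT : ∀ σ → reg σ 8 ≡ n → reg σ 9 ≡ scale →
      Triple prep σ tP (return tt) (λ _ σ′ → reg σ′ 12 ≡ L × reg σ′ 26 ≡ R))
    (e k : ℕ) .{{_ : NonZero k}} .{{_ : NonZero (n / k)}} (bs : List Bool) (0<L : 0 < L) where

    s m M b : ℕ
    s = suc e
    m = n / k
    M = (k + k) * m
    b = n ^ s

    μ : ℕ → ℕ
    μ = timesBelow (M ^ e) M

    Tb : ℕ → Bool
    Tb = tabulated (λ _ → false) (baseItems μ n s) bs

    mem₀ : ℕ → ℕ
    mem₀ i = b2n (bitAt bs i)

    module Ph = Phase A smp smp-reg smp-arr n scale L R tS T samp smpT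

    record Prep (σ : State) : Set where
      field
        n≡     : reg σ 8 ≡ n
        scale≡ : reg σ 9 ≡ scale
        base≡  : reg σ 13 ≡ b
        F≡     : reg σ 14 ≡ 0
        acc≡   : reg σ 15 ≡ 0
        in≡    : ∀ i → i < b → arr σ 2 (b + i) ≡ mem₀ i
        zero₀  : ∀ y → arr σ 0 y ≡ 0
        zero₁  : ∀ y → arr σ 1 y ≡ 0
        zero₅  : ∀ y → arr σ 5 y ≡ 0
        zero₉  : ∀ y → arr σ 9 y ≡ 0
        zero₁₁ : ∀ y → arr σ 11 y ≡ 0

    prep-frame : ∀ {c σ σ′} → Frame c σ σ′ →
      All (λ i → writesReg c i ≡ false) (8 ∷ 9 ∷ 13 ∷ 14 ∷ 15 ∷ []) →
      All (λ i → writesArr c i ≡ false) (0 ∷ 1 ∷ 2 ∷ 5 ∷ 9 ∷ 11 ∷ []) → Prep σ → Prep σ′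
    prep-frame fr (w₈ ∷ w₉ ∷ w₁₃ ∷ w₁₄ ∷ w₁₅ ∷ []) (a₀ ∷ a₁ ∷ a₂ ∷ a₅ ∷ a₉ ∷ a₁₁ ∷ []) q = record
      { n≡ = trans (regs fr 8 w₈) n≡ ; scale≡ = trans (regs fr 9 w₉) scale≡ ; base≡ = trans (regs fr 13 w₁₃) base≡
      ; F≡ = trans (regs fr 14 w₁₄) F≡ ; acc≡ = trans (regs fr 15 w₁₅) acc≡
      ; in≡ = λ i i< → trans (arrays fr 2 a₂ (b + i)) (in≡ i i<)
      ; zero₀ = λ y → trans (arrays fr 0 a₀ y) (zero₀ y) ; zero₁ = λ y → trans (arrays fr 1 a₁ y) (zero₁ y)
      ; zero₅ = λ y → trans (arrays fr 5 a₅ y) (zero₅ y) ; zero₉ = λ y → trans (arrays fr 9 a₉ y) (zero₉ y)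
      ; zero₁₁ = λ y → trans (arrays fr 11 a₁₁ y) (zero₁₁ y) }
      where open Prep q

    module _ (Js : List (List ℕ)) (Js-length : All (λ J → length J ≡ s) Js)
      (κs-distinct : Distinct (map (hcode μ 0) Js)) (n≤M : n ≤ M) where

      module Phs = Ph.Phases s k m n≤M μ Tb Js Js-length κs-distinct 0<L

      module _ {mA : List Item → List (List Bool) → (ℕ → ℕ) → ℕ → ℕ} (total : ∀ its ys a →
        Surely (_≢ nothing) (exec p A T Model.⟨ 0 , Ph.startRegs , mA its ys a ⟩)) where

        reductionTime : List (List ℕ) → ℕ
        reductionTime tss = copyTime n s + (36 + n * 36 + (22 + (k + k) * 12 + (mulTableTime M e + (tP +
          (29 + n * 12 + bfsTime s n + length bs * 47 + 1 + Phs.phasesTime total tss)))))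

        reductionT : ∀ tss σ → reg σ 8 ≡ n → reg σ 9 ≡ scale → reg σ 14 ≡ 0 → reg σ 15 ≡ 0 →
          (∀ c y → c < 16 → arr σ c y ≡ mem₀ (y * 16 + c)) → length bs ≤ b → length (baseItems μ n s) ≡ length bs →
          All (λ ts → length ts ≡ k + k) tss →
          (∀ ts → length (Phs.itemsOf ts) ≤ b) →
          (∀ ts ys a i → mA (Phs.itemsOf ts) ys a i ≡ b2n (bitAt (queryBits a (Phs.itemsOf ts) ys) i)) →
          Triple (reductionC A smp prep e k Js tss) σ (reductionTime tss) (Phs.phasesTree total tss 0)
            (λ x σ′ → reg σ′ 15 ≡ x)
        reductionT tss σ n≡ sc≡ F≡ acc≡ arr≡ bs≤ its≡ lens len≤ mem≡ =
          seqT (copyT {n} {mem₀} s σ n≡ arr≡ (λ i le → cong b2n (bitAt-beyond bs i (≤-trans bs≤ le))))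
            λ { _ σ₁ (b≡ , clear , moved) fr₁ →
          let q₁ = record
                { n≡ = trans (regs fr₁ 8 (cw 8 refl refl refl refl)) n≡ ; scale≡ = trans (regs fr₁ 9 (cw 9 refl refl refl refl)) sc≡
                ; base≡ = b≡ ; F≡ = trans (regs fr₁ 14 (cw 14 refl refl refl refl)) F≡
                ; acc≡ = trans (regs fr₁ 15 (cw 15 refl refl refl refl)) acc≡ ; in≡ = moved
                ; zero₀ = λ y → clear 0 y (m≤m+n 1 15) λ () ; zero₁ = λ y → clear 1 y (m≤m+n 2 14) λ ()
                ; zero₅ = λ y → clear 5 y (m≤m+n 6 10) λ () ; zero₉ = λ y → clear 9 y (m≤m+n 10 6) λ ()
                ; zero₁₁ = λ y → clear 11 y (m≤m+n 12 4) λ () }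
              zero₃ = λ y → clear 3 y (m≤m+n 4 12) λ ()
          in
          seqT (divT {n} k σ₁ (Prep.n≡ q₁)) λ { _ σ₂ m≡ fr₂ →
          let q₂ = prep-frame fr₂ (refl ∷ refl ∷ refl ∷ refl ∷ refl ∷ []) (refl ∷ refl ∷ refl ∷ refl ∷ refl ∷ refl ∷ []) q₁ in
          seqT (doubleT {m} k σ₂ m≡) λ { _ σ₃ M≡ fr₃ →
          let q₃ = prep-frame fr₃ (refl ∷ refl ∷ refl ∷ refl ∷ refl ∷ []) (refl ∷ refl ∷ refl ∷ refl ∷ refl ∷ refl ∷ []) q₂ in
          seqT (mulTableT {M} e σ₃ M≡ (λ y → trans (arrays fr₃ 3 refl y) (trans (arrays fr₂ 3 refl y) (zero₃ y)))) λ { _ σ₄ μ≡ fr₄ →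
          let q₄ = prep-frame fr₄
                     (mw 8 refl refl refl refl refl refl ∷ mw 9 refl refl refl refl refl refl ∷ mw 13 refl refl refl refl refl refl ∷ mw 14 refl refl refl refl refl refl ∷ mw 15 refl refl refl refl refl refl ∷ [])
                     (ma 0 refl ∷ ma 1 refl ∷ ma 2 refl ∷ ma 5 refl ∷ ma 9 refl ∷ ma 11 refl ∷ []) q₃
              m≡₄ = trans (regs fr₄ 10 (mw 10 refl refl refl refl refl refl)) (trans (regs fr₃ 10 refl) m≡)
          in
          seqT (prepT σ₄ (Prep.n≡ q₄) (Prep.scale≡ q₄)) λ { _ σ₅ (L≡ , R≡) fr₅ →
          case-prep prep-reg λ w₈ w₉ w₁₀ w₁₃ w₁₄ w₁₅ →
          let q₅ = prep-frame fr₅ (w₈ ∷ w₉ ∷ w₁₃ ∷ w₁₄ ∷ w₁₅ ∷ [])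
                     (prep-arr 0 ∷ prep-arr 1 ∷ prep-arr 2 ∷ prep-arr 5 ∷ prep-arr 9 ∷ prep-arr 11 ∷ []) q₄
              m≡₅ = trans (regs fr₅ 10 w₁₀) m≡₄
              μ≡₅ = λ y → trans (arrays fr₅ 3 (prep-arr 3) y) (μ≡ y)
          in
          seqT (baseT {μ} {n} {b} s σ₅ bs (Prep.n≡ q₅) (Prep.base≡ q₅) μ≡₅ (Prep.zero₅ q₅) (Prep.zero₉ q₅) its≡
                 (λ i i< → Prep.in≡ q₅ i (≤-trans i< bs≤))) λ { _ σ₆ t≡ fr₆ →
          let r : ∀ i → writesReg (baseC s) i ≡ false → reg σ₆ i ≡ reg σ₅ i
              r = regs fr₆
              F≡₆ = trans (r 14 (bw 14 refl refl refl refl refl)) (Prep.F≡ q₅)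
          in
          postT (Phs.phasesT total tss σ₆ 0 lens len≤ mem≡
            ( record
              { n≡ = trans (r 8 (bw 8 refl refl refl refl refl)) (Prep.n≡ q₅)
              ; scale≡ = trans (r 9 (bw 9 refl refl refl refl refl)) (Prep.scale≡ q₅)
              ; m≡ = trans (r 10 (bw 10 refl refl refl refl refl)) m≡₅
              ; L≡ = trans (r 12 (bw 12 refl refl refl refl refl)) L≡
              ; R≡ = trans (r 26 (bw 26 refl refl refl refl refl)) R≡
              ; mul≡ = λ y → trans (arrays fr₆ 3 (ba 3 refl refl refl refl) y) (μ≡₅ y)
              ; table≡ = t≡
              ; freshR = λ i _ → trans (arrays fr₆ 0 (ba 0 refl refl refl refl) i) (Prep.zero₀ q₅ i)
              ; freshM = λ i _ → trans (arrays fr₆ 1 (ba 1 refl refl refl refl) i) (Prep.zero₁ q₅ i)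
              ; index≡ = λ y _ → trans (arrays fr₆ 11 (ba 11 refl refl refl refl) y) (Prep.zero₁₁ q₅ y) }
            , trans (r 15 (bw 15 refl refl refl refl refl)) (Prep.acc≡ q₅)))
            λ { x σ₇ (_ , x≡) _ → x≡ } } } } } } }
          where
          case-prep : ∀ {Z : Set} → All (λ i → writesReg prep i ≡ false) (8 ∷ 9 ∷ 10 ∷ 13 ∷ 14 ∷ 15 ∷ []) →
            (writesReg prep 8 ≡ false → writesReg prep 9 ≡ false → writesReg prep 10 ≡ false → writesReg prep 13 ≡ false →
             writesReg prep 14 ≡ false → writesReg prep 15 ≡ false → Z) → Z
          case-prep (a ∷ b ∷ c ∷ d ∷ f ∷ g ∷ []) h = h a b c d f g
          or₂ : ∀ {x y} → x ≡ false → y ≡ false → x ∨ y ≡ false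
          or₂ refl refl = refl
          cw : ∀ i → (i ≡ᵇ 2) ≡ false → (i ≡ᵇ 3) ≡ false → writesReg powStepC i ≡ false →
               opsW (mov 13 3 ∷ mov 19 3 ∷ []) i ∨ ((i ≡ᵇ 19) ∨ opsW copyOps i) ≡ false → writesReg (copyC s) i ≡ false
          cw i h h′ h″ h‴ = or₂ (or₂ h refl) (or₂ (powC-reg s i h′ h″) h‴)
          mw : ∀ i → (i ≡ᵇ 2) ≡ false → (i ≡ᵇ 3) ≡ false → writesReg powStepC i ≡ false → (i ≡ᵇ 5) ≡ false →
               (i ≡ᵇ 19) ≡ false → opsW tableOps i ≡ false → writesReg (mulTableC e) i ≡ false
          mw i h h′ h″ e₅ e₁₉ h‴ = or₂ (or₂ h refl) (or₂ (powC-reg e i h′ h″) (or₂ (or₂ e₅ refl) (or₂ (powC-reg s i h′ h″)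
                                     (or₂ (or₂ e₁₉ refl) (or₂ e₁₉ h‴)))))
          ma : ∀ c → (c ≡ᵇ 3) ≡ false → writesArr (mulTableC e) c ≡ false
          ma c h = or₂ (powC-arr e c) (or₂ (powC-arr s c) (or₂ h refl))
          bw : ∀ i → (i ≡ᵇ 19) ≡ false → opsW rootOps i ≡ false → writesReg stageC i ≡ false →
               opsW (mov 19 18 ∷ mov 20 17 ∷ mov 21 13 ∷ []) i ≡ false → opsW lookupOps i ≡ false → writesReg (baseC s) i ≡ false
          bw i h h₁ h₂ h₃ h₄ = or₂ (or₂ (or₂ h refl) (or₂ h refl)) (or₂ (or₂ h₁ (repC-reg s stageC i h₂)) (or₂ h₃ (or₂ h h₄)))
          ba : ∀ c → (c ≡ᵇ 4) ≡ false → opsWA rootOps c ≡ false → writesArr stageC c ≡ false → opsWA lookupOps c ≡ false →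
               writesArr (baseC s) c ≡ false
          ba c h h₁ h₂ h₃ = or₂ (or₂ h refl) (or₂ (or₂ h₁ (repC-arr s stageC c h₂)) h₃)

  step-end : ∀ {P pc r m} → drop pc P ≡ [] → Halts P Model.⟨ pc , r , m ⟩ 1 (return (just (r 0)))
  exec≡ (step-end eq) u rewrite eq = refl

  startState : ℕ → ℕ → (ℕ → ℕ) → State
  startState n scale mem = ⟪ (λ i → ((r [ 10 ≔ n ]) [ 11 ≔ scale ]) (2 + i)) , (λ c y → mem (y * 16 + c)) ⟫
    where r = ((λ _ → 0) [ 0 ≔ n ]) [ 1 ≔ scale ]

  programT : ∀ {c n scale mem t} {d : Dist ℕ} → Triple c (startState n scale mem) t d (λ x σ′ → reg σ′ 15 ≡ x) →
    Halts (program c) Model.⟨ 0 , ((λ _ → 0) [ 0 ≔ n ]) [ 1 ≔ scale ] , mem ⟩ (2 + (t + 3)) (d >>= λ x → return (just x))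
  programT {c} {n} {scale} {mem} {t} T =
    step-add at₀ (step-add (at-tail at₀)
      (exe T (at-head (compile c 2) at₂) rel (λ x → return (just x)) λ x σ′ r′ m′ x≡ fr rel′ →
        step-set (at-next c at₂) (step-add (at-tail (at-next c at₂))
          (Halts-≡ refl (cong (λ v → return (just v)) (trans (+-identityʳ _) (trans (regs≡ rel′ 15) x≡)))
            (step-end stop)))))
    where
    code₂ = compile c 2 ++ Model.Instr.set 1 0 ∷ Model.Instr.add 0 17 1 ∷ []
    at₀ : At (program c) 0 (program c)
    at₀ = [] , sym (++-identityʳ _)
    at₂ : At (program c) 2 code₂
    at₂ = [] , sym (++-identityʳ _)
    rel : Rel (startState n scale mem) _ mem
    rel = rel⟨ regs₀ , (λ i y _ → refl) ⟩
      where
      regs₀ : ∀ i → ((((λ _ → 0) [ 0 ≔ n ]) [ 1 ≔ scale ]) [ 10 ≔ n + 0 ] [ 11 ≔ scale + 0 ]) (2 + i) ≡ reg (startState n scale mem) i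
      regs₀ i rewrite +-identityʳ n | +-identityʳ scale = refl
    stop : drop (2 + end c 2) (program c) ≡ []
    stop = drop-all (2 + end c 2) (program c) (≤-reflexive (cong (2 +_)
      (trans (length-++ (compile c 2)) (end≡ c 2))))

 -- Sampling a vector of prescribed parity

 xors : List Bool → Bool
 xors = foldr _xor_ false

 doubling : ℕ → ℕ → ℕ × ℕ → ℕ × ℕ
 doubling n zero    x       = x
 doubling n (suc j) (l , w) = doubling n j (if w <ᵇ n then (suc l , w + w) else (l , w))

 ceilLog : ℕ → ℕ
 ceilLog n = proj₁ (doubling n n (0 , 1))

 module SamplerCommands (ℝ : Reals) where
  open Language ℝ

  tossOps : List Op
  tossOps = add 2 24 3 ∷ st vecs 2 1 ∷ sub 4 0 1 ∷ sub 5 1 0 ∷ add 0 4 5 ∷ []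

  attemptC rejectC pairC pairPrepC : Cmd
  attemptC = blk (set 0 0 ∷ mov 3 12 ∷ []) ⨾ loop 3 (toss 1 ⨾ blk tossOps)
  rejectC  = attemptC ⨾ blk (mov 6 26 ∷ []) ⨾
             loop 6 (blk (sub 4 0 27 ∷ sub 5 27 0 ∷ add 4 4 5 ∷ []) ⨾ ifz 4 (blk []) attemptC)
  pairC    = toss 1 ⨾ blk (st vecs 24 1 ∷ sub 2 1 27 ∷ sub 3 27 1 ∷ add 2 2 3 ∷ set 3 1 ∷ add 3 24 3 ∷ st vecs 3 2 ∷ [])
  pairPrepC = blk (set 12 2 ∷ set 26 0 ∷ [])

  logC : Cmd
  logC = blk (set 0 0 ∷ set 1 1 ∷ set 2 1 ∷ mov 19 8 ∷ []) ⨾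
         loop 19 (blk (sub 3 8 1 ∷ []) ⨾ ifz 3 (blk []) (blk (add 1 1 1 ∷ add 0 0 2 ∷ [])))

  rejectPrepC : ℕ → ℕ → ℕ → Cmd
  rejectPrepC s λ₀ R₀ =
    logC ⨾ (blk (set 3 λ₀ ∷ []) ⨾ repC s (blk (add 3 3 0 ∷ []))) ⨾ blk (set 4 0 ∷ mov 19 3 ∷ []) ⨾
    loop 19 (blk (add 4 4 9 ∷ [])) ⨾ blk (add 4 4 4 ∷ set 5 2 ∷ add 12 4 5 ∷ set 5 R₀ ∷ add 26 12 5 ∷ [])

 module Samplers (ℝ : Reals) (p : Model.Prob ℝ) where
  open Model ℝ using (Dist; return; flip; _>>=_; _[_≔_])
  open Main ℝ p
  open SamplerCommands ℝ public

  coin : Dist Bool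
  coin = flip p (return true) (return false)

  tossOnto : ℕ → List Bool → Dist (List Bool)
  tossOnto _ v = coin >>= λ b → return (b ∷ v)

  attempt : ℕ → Dist (List Bool)
  attempt L = iterate tossOnto L []

  retry : ℕ → Bool → ℕ → List Bool → Dist (List Bool)
  retry L x _ v = if xors v xor x then attempt L else return v

  reject : ℕ → ℕ → Bool → Dist (List Bool)
  reject L R x = attempt L >>= iterate (retry L x) R

  pair : Bool → Dist (List Bool)
  pair x = coin >>= λ b → return (b ∷ (b xor x) ∷ [])

  module _ {L vec : ℕ} where
    record Attempted (A₀ : ℕ → ℕ) (j : ℕ) (v : List Bool) (σ : State) : Set where
      field
        bits : ∀ i → j ≤ i → i < L → arr σ 10 (vec + i) ≡ b2n (bitAt v (i ∸ j))
        par≡ : reg σ 0 ≡ b2n (xors v)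
        old  : ∀ i → i < vec → arr σ 10 i ≡ A₀ i
        L≡   : reg σ 12 ≡ L
        vec≡ : reg σ 24 ≡ vec
    open Attempted

    tossesT : ∀ {A₀} j v σ → reg σ 3 ≡ j → j ≤ L → Attempted A₀ j v σ →
      Triple (loop 3 (toss 1 ⨾ blk tossOps)) σ (j * 41 + 1) (iterate tossOnto j v) (Attempted A₀ 0)
    tossesT zero    v σ c≡ j≤ a = postT (mapT (λ _ → v) (loop0T c≡)) λ { _ _ (_ , refl , refl) _ → a }
    tossesT {A₀} (suc j) v σ c≡ j≤ a =
      timeT (≤-reflexive (sym (+-assoc 41 (j * 41) 1)))
      (loopST {Q = λ v′ σ′ → reg σ′ 3 ≡ j × Attempted A₀ j v′ σ′} c≡
        (postT (mapT (_∷ v) (keepT {Q₂ = λ b σ′ → reg σ′ 3 ≡ j × Attempted A₀ j (b ∷ v) σ′} tossT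
            λ { b σ₁ refl _ → postT (blkT tossOps _) λ { _ _ refl _ → refl , next b } }))
          λ { _ _ (b , refl , q) _ → q })
        λ v′ σ′ (c≡′ , a′) _ → tossesT j v′ σ′ c≡′ (≤-trans (n≤1+n j) j≤) a′)
      where
      next : ∀ b → Attempted A₀ j (b ∷ v)
        (evalOps tossOps ⟪ (reg σ [ 3 ≔ j ]) [ 1 ≔ b2n b ] , arr σ ⟫)
      next b = record
        { bits = new
        ; par≡ = trans (cong (λ z → (z ∸ b2n b) + (b2n b ∸ z)) (par≡ a))
                       (trans (b2n-xor (xors v) b) (cong b2n (Bool.xor-comm (xors v) b)))
        ; old = λ i i< → trans (same i i<) (old a i i<)
        ; L≡ = L≡ a ; vec≡ = vec≡ a }
        where
        new : ∀ i → j ≤ i → i < L → (if vec + i ≡ᵇ reg σ 24 + j then b2n b else arr σ 10 (vec + i)) ≡ b2n (bitAt (b ∷ v) (i ∸ j))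
        new i le lt rewrite vec≡ a | +-≡ᵇ vec i j with i ≡ᵇ j in eq
        ... | true rewrite ≡ᵇ-true i j eq | n∸n≡0 j = refl
        ... | false with ≤∧≢⇒< le (λ e → contradiction (trans (sym eq) (trans (cong (i ≡ᵇ_) e) (≡ᵇ-refl i))) λ ())
        ...   | j<i rewrite trans (sym (suc-pred (i ∸ j) {{>-nonZero (m<n⇒0<n∸m j<i)}})) (cong suc (pred[m∸n]≡m∸[1+n] i j)) = bits a i j<i lt
        same : ∀ i → i < vec → (if i ≡ᵇ reg σ 24 + j then b2n b else arr σ 10 i) ≡ arr σ 10 i
        same i i< rewrite vec≡ a | <⇒≡ᵇ-false {i} {vec + j} (≤-trans i< (m≤m+n vec j)) = refl

    attemptT : ∀ {A₀} σ → reg σ 12 ≡ L → reg σ 24 ≡ vec → (∀ i → i < vec → arr σ 10 i ≡ A₀ i) →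
      Triple attemptC σ (15 + L * 41) (attempt L) (Attempted A₀ 0)
    attemptT {A₀} σ L≡ vec≡ old≡ =
      timeT (≤-reflexive (lem L))
      (seqT (blkT (set 0 0 ∷ mov 3 12 ∷ []) σ) λ { _ σ₁ refl _ →
        tossesT L [] σ₁ L≡ ≤-refl record
          { bits = λ i le lt → contradiction (≤-trans lt le) (<-irrefl refl)
          ; par≡ = refl ; old = old≡ ; L≡ = L≡ ; vec≡ = vec≡ } })
      where
      lem : ∀ L → 14 + (L * 41 + 1) ≡ 15 + L * 41
      lem = solve-∀

    retriesT : ∀ {A₀} x j v σ → reg σ 6 ≡ j → reg σ 27 ≡ b2n x → Attempted A₀ 0 v σ →
      Triple (loop 6 (blk (sub 4 0 27 ∷ sub 5 27 0 ∷ add 4 4 5 ∷ []) ⨾ ifz 4 (blk []) attemptC)) σ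
        (j * (44 + L * 41) + 1) (iterate (retry L x) j v) (Attempted A₀ 0)
    retriesT x zero    v σ c≡ x≡ a = postT (mapT (λ _ → v) (loop0T c≡)) λ { _ _ (_ , refl , refl) _ → a }
    retriesT {A₀} x (suc j) v σ c≡ x≡ a =
      timeT (≤-reflexive (lem L (j * (44 + L * 41))))
      (loopST {d = retry L x j v} {Q = λ v′ σ′ → reg σ′ 6 ≡ j × reg σ′ 27 ≡ b2n x × Attempted A₀ 0 v′ σ′} c≡
        (seqT (blkT (sub 4 0 27 ∷ sub 5 27 0 ∷ add 4 4 5 ∷ []) _) λ { _ σ₁ refl _ → test (xors v xor x)
          (trans (cong₂ (λ y z → (y ∸ z) + (z ∸ y)) (par≡ a) x≡) (b2n-xor (xors v) x)) })
        λ v′ σ′ (c≡′ , x≡′ , a′) _ → retriesT x j v′ σ′ c≡′ x≡′ a′)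
      where
      lem : ∀ L r → 5 + (21 + (3 + (15 + L * 41))) + (r + 1) ≡ 44 + L * 41 + r + 1
      lem = solve-∀
      σ₁ = evalOps (sub 4 0 27 ∷ sub 5 27 0 ∷ add 4 4 5 ∷ []) ⟪ reg σ [ 6 ≔ j ] , arr σ ⟫
      test : ∀ b → reg σ₁ 4 ≡ b2n b →
        Triple (ifz 4 (blk []) attemptC) σ₁ (3 + (15 + L * 41)) (if b then attempt L else return v)
          (λ v′ σ′ → reg σ′ 6 ≡ j × reg σ′ 27 ≡ b2n x × Attempted A₀ 0 v′ σ′)
      test false e = ifzT e (timeT z≤n (postT (mapT (λ _ → v) (blkT [] σ₁)) λ { _ _ (_ , refl , refl) _ →
        refl , x≡ , record { bits = bits a ; par≡ = par≡ a ; old = old a ; L≡ = L≡ a ; vec≡ = vec≡ a } }))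
      test true  e = ifnzT e (postT (attemptT {A₀} σ₁ (L≡ a) (vec≡ a) (old a)) λ _ σ₂ a₂ fr →
        regs fr 6 refl , trans (regs fr 27 refl) x≡ , a₂)

    rejectTime : ℕ → ℕ
    rejectTime R = 15 + L * 41 + (7 + (R * (44 + L * 41) + 1))

    rejectT : ∀ {R} σ x → reg σ 12 ≡ L → reg σ 26 ≡ R → reg σ 27 ≡ b2n x → reg σ 24 ≡ vec →
      Triple rejectC σ (rejectTime R) (reject L R x) (λ y σ′ →
        (∀ i → i < L → arr σ′ 10 (vec + i) ≡ b2n (bitAt y i)) × (∀ i → i < vec → arr σ′ 10 i ≡ arr σ 10 i))
    rejectT {R} σ x L≡ R≡ x≡ vec≡ =
      seqT (attemptT {arr σ 10} σ L≡ vec≡ (λ _ _ → refl)) λ v σ₁ a fr₁ →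
        seqT (blkT (mov 6 26 ∷ []) σ₁) λ { _ σ₂ refl _ →
          postT (retriesT x R v σ₂ (trans (regs fr₁ 26 refl) R≡) (trans (regs fr₁ 27 refl) x≡)
                  record { bits = bits a ; par≡ = par≡ a ; old = old a ; L≡ = Attempted.L≡ a ; vec≡ = Attempted.vec≡ a })
            λ y σ₃ q _ → (λ i i< → bits q i z≤n i<) , old q }

    pairT : ∀ σ x → reg σ 27 ≡ b2n x → reg σ 24 ≡ vec →
      Triple pairC σ 50 (pair x) (λ y σ′ →
        (∀ i → i < 2 → arr σ′ 10 (vec + i) ≡ b2n (bitAt y i)) × (∀ i → i < vec → arr σ′ 10 i ≡ arr σ 10 i))
    pairT σ x x≡ vec≡ =
      postT (mapT (λ b → b ∷ (b xor x) ∷ []) (keepT {Q₂ = λ b σ′ →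
          (∀ i → i < 2 → arr σ′ 10 (vec + i) ≡ b2n (bitAt (b ∷ (b xor x) ∷ []) i)) × (∀ i → i < vec → arr σ′ 10 i ≡ arr σ 10 i)} tossT
        λ { b σ₁ refl _ → postT (blkT pairOps _) λ { _ _ refl _ → cells b , below-cells b } }))
        λ { _ _ (b , refl , q) _ → q }
      where
      pairOps = st vecs 24 1 ∷ sub 2 1 27 ∷ sub 3 27 1 ∷ add 2 2 3 ∷ set 3 1 ∷ add 3 24 3 ∷ st vecs 3 2 ∷ []
      σ₂ : Bool → State
      σ₂ b = evalOps pairOps ⟪ reg σ [ 1 ≔ b2n b ] , arr σ ⟫
      cells : ∀ b i → i < 2 → arr (σ₂ b) 10 (vec + i) ≡ b2n (bitAt (b ∷ (b xor x) ∷ []) i)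
      cells b 0 _ rewrite vec≡ | +-≡ᵇ vec 0 1 | trans (cong (vec + 0 ≡ᵇ_) (sym (+-identityʳ vec))) (+-≡ᵇ vec 0 0) = refl
      cells b 1 _ rewrite vec≡ | ≡ᵇ-refl (vec + 1) | x≡ = b2n-xor b x
      cells b (suc (suc i)) (s≤s (s≤s ()))
      below-cells : ∀ b i → i < vec → arr (σ₂ b) 10 i ≡ arr σ 10 i
      below-cells b i i< rewrite vec≡ | <⇒≡ᵇ-false {i} {vec + 1} (≤-trans i< (m≤m+n vec 1)) | <⇒≡ᵇ-false i< = refl

  pairPrepT : ∀ σ → Triple pairPrepC σ 14 (return tt) (λ _ σ′ → reg σ′ 12 ≡ 2 × reg σ′ 26 ≡ 0)
  pairPrepT σ = postT (blkT (set 12 2 ∷ set 26 0 ∷ []) σ) λ { _ _ refl _ → refl , refl }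

  logT : ∀ {n} σ → reg σ 8 ≡ n → Triple logC σ (29 + n * 29) (return tt) (λ _ σ′ → reg σ′ 0 ≡ ceilLog n)
  logT {n} σ n≡ =
    timeT (≤-reflexive (lem n))
    (seqT (blkT (set 0 0 ∷ set 1 1 ∷ set 2 1 ∷ mov 19 8 ∷ []) σ) λ { _ σ₁ refl _ →
      postT (detLoop Inv (λ _ _ → proj₁) (λ j σ q fr → body j σ q (trans (regs fr 8 refl) n≡) (regs fr 2 refl))
              n σ₁ (n≡ , 0 , 1 , refl , refl , refl) frame-refl)
        λ { _ σ₂ (_ , l , w , l≡ , _ , e) _ → trans l≡ (cong proj₁ e) } })
    where
    lem : ∀ n → 28 + (n * (5 + (7 + 17)) + 1) ≡ 29 + n * 29
    lem = solve-∀
    bodyC = blk (sub 3 8 1 ∷ []) ⨾ ifz 3 (blk []) (blk (add 1 1 1 ∷ add 0 0 2 ∷ []))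
    Inv : ℕ → State → Set
    Inv j σ = reg σ 19 ≡ j × ∃ λ l → ∃ λ w → reg σ 0 ≡ l × reg σ 1 ≡ w × doubling n j (l , w) ≡ doubling n n (0 , 1)
    body : ∀ j σ → Inv (suc j) σ → reg σ 8 ≡ n → reg σ 2 ≡ 1 →
           Triple bodyC ⟪ reg σ [ 19 ≔ j ] , arr σ ⟫ 24 (return tt) (λ _ → Inv j)
    body j σ (_ , l , w , l≡ , w≡ , e) n≡ one≡ =
      seqT (blkT (sub 3 8 1 ∷ []) _) λ { _ σ₁ refl _ → go σ₁ (cong₂ _∸_ n≡ w≡) refl l≡ w≡ one≡ e }
      where
      go : ∀ σ₁ → reg σ₁ 3 ≡ n ∸ w → reg σ₁ 19 ≡ j → reg σ₁ 0 ≡ l → reg σ₁ 1 ≡ w → reg σ₁ 2 ≡ 1 →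
        doubling n (suc j) (l , w) ≡ doubling n n (0 , 1) →
        Triple (ifz 3 (blk []) (blk (add 1 1 1 ∷ add 0 0 2 ∷ []))) σ₁ 17 (return tt) (λ _ → Inv j)
      go σ₁ t≡ c≡ l≡ w≡ one≡ e with w <ᵇ n in eq
      ... | true = ifnzT (trans t≡ (sym (m+[n∸m]≡n (m<n⇒0<n∸m w<n))))
              (postT (blkT (add 1 1 1 ∷ add 0 0 2 ∷ []) σ₁) λ { _ _ refl _ →
                c≡ , suc l , w + w , trans (cong₂ _+_ l≡ one≡) (+-comm l 1) , cong₂ _+_ w≡ w≡ , e })
        where
        w<n : w < n
        w<n = <ᵇ⇒< w n (subst Data.Bool.Base.T (sym eq) tt)
      ... | false = timeT (m≤m+n 3 14) (ifzT (trans t≡ (m≤n⇒m∸n≡0 {n} {w} (≮⇒≥ λ lt → subst Data.Bool.Base.T eq (<⇒<ᵇ lt))))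
              (postT (blkT [] σ₁) λ { _ _ refl _ → c≡ , l , w , l≡ , w≡ , e }))

  module _ (s λ₀ R₀ : ℕ) where
    exponent vectorLength : ℕ → ℕ
    exponent n = s * ceilLog n + λ₀
    vectorLength h = (h + h) + 2

    rejectPrepTime : ℕ → ℕ
    rejectPrepTime n = 86 + n * 29 + s * 7 + exponent n * 12

    addsT : ∀ l σ → reg σ 0 ≡ l → ∀ {c} → reg σ 3 ≡ c →
      Triple (repC s (blk (add 3 3 0 ∷ []))) σ (sumTo s (λ _ → 7)) (return tt) (λ _ σ′ → reg σ′ 3 ≡ s * l + c)
    addsT l σ l≡ {c} c≡ = postT (repT (λ _ → 7) (λ j σ′ → reg σ′ 0 ≡ l × j * l + reg σ′ 3 ≡ s * l + c)
        (λ { j σ′ (l≡ , e) → postT (blkT (add 3 3 0 ∷ []) σ′) λ { _ _ refl _ →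
          l≡ , trans (cong (λ z → j * l + (reg σ′ 3 + z)) l≡) (trans (lem (j * l) (reg σ′ 3) l) e) } })
        s σ (l≡ , cong (s * l +_) c≡))
      λ { _ _ (_ , e) _ → e }
      where
      lem : ∀ a b c → a + (b + c) ≡ c + a + b
      lem = solve-∀

    sumTo-const : ∀ m c → sumTo m (λ _ → c) ≡ m * c
    sumTo-const zero    c = refl
    sumTo-const (suc m) c = cong (c +_) (sumTo-const m c)

    rejectPrepT : ∀ {n scale} σ → reg σ 8 ≡ n → reg σ 9 ≡ scale →
      Triple (rejectPrepC s λ₀ R₀) σ (rejectPrepTime n) (return tt) (λ _ σ′ →
        reg σ′ 12 ≡ vectorLength (exponent n * scale) × reg σ′ 26 ≡ vectorLength (exponent n * scale) + R₀)
    rejectPrepT {n} {scale} σ n≡ sc≡ =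
      timeT (≤-reflexive (trans (cong (λ z → 29 + n * 29 + (7 + z + (14 + (exponent n * 12 + 1 + 35)))) (sumTo-const s 7))
                                (lem n (s * 7) (exponent n * 12))))
      (seqT (logT {n} σ n≡) λ { _ σ₁ l≡ fr₁ →
       seqT (seqT (blkT (set 3 λ₀ ∷ []) σ₁) λ { _ σ₂ refl _ → addsT (ceilLog n) σ₂ l≡ refl }) λ { _ σ₃ e≡ fr₃ →
       seqT (blkT (set 4 0 ∷ mov 19 3 ∷ []) σ₃) λ { _ σ₄ refl _ →
       seqT (detLoop (λ j σ′ → reg σ′ 19 ≡ j × reg σ′ 4 + j * scale ≡ exponent n * scale) (λ _ _ → proj₁)
              (λ { j σ′ (_ , h) fr → postT (blkT (add 4 4 9 ∷ []) _) λ { _ _ refl _ →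
                refl , trans (cong (λ z → reg σ′ 4 + z + j * scale)
                                (trans (regs fr 9 refl) (trans (regs fr₃ 9 (repC-reg s (blk (add 3 3 0 ∷ [])) 9 refl))
                                  (trans (regs fr₁ 9 refl) sc≡))))
                         (trans (+-assoc (reg σ′ 4) scale (j * scale)) h) } })
              (exponent n) σ₄ (e≡ , refl) frame-refl) λ { _ σ₅ (_ , h) _ →
         postT (blkT (add 4 4 4 ∷ set 5 2 ∷ add 12 4 5 ∷ set 5 R₀ ∷ add 26 12 5 ∷ []) σ₅) λ { _ _ refl _ →
           let e = trans (sym (+-identityʳ (reg σ₅ 4))) h in
           cong vectorLength e , cong (λ z → vectorLength z + R₀) e } } } } })
      where
      lem : ∀ n a b → 29 + n * 29 + (7 + a + (14 + (b + 1 + 35))) ≡ 86 + n * 29 + a + b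
      lem = solve-∀

 -- Arithmetic

 m<2^m : ∀ m → m < 2 ^ m
 m<2^m zero    = s≤s z≤n
 m<2^m (suc m) = ≤-trans (+-mono-≤ (>-nonZero⁻¹ (2 ^ m) {{m^n≢0 2 m}}) (m<2^m m)) (≤-reflexive (cong (2 ^ m +_) (sym (+-identityʳ _))))

 double≡ : ∀ l → 2 ^ l + 2 ^ l ≡ 2 ^ suc l
 double≡ l = cong (2 ^ l +_) (sym (+-identityʳ _))

 doubling-upper : ∀ n j l → n ≤ 2 ^ (l + j) → n ≤ 2 ^ proj₁ (doubling n j (l , 2 ^ l))
 doubling-upper n zero    l h = subst (λ z → n ≤ 2 ^ z) (+-identityʳ l) h
 doubling-upper n (suc j) l h with 2 ^ l <ᵇ n in eq
 ... | true  = subst (λ w → n ≤ 2 ^ proj₁ (doubling n j (suc l , w))) (sym (double≡ l))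
                (doubling-upper n j (suc l) (subst (λ z → n ≤ 2 ^ z) (+-suc l j) h))
 ... | false = doubling-upper n j l (≤-trans (≮⇒≥ λ lt → subst Data.Bool.Base.T eq (<⇒<ᵇ lt)) (^-monoʳ-≤ 2 (m≤m+n l j)))

 doubling-lower : ∀ n j l → (∀ l′ → l ≡ suc l′ → 2 ^ l′ < n) → ∀ l′ → proj₁ (doubling n j (l , 2 ^ l)) ≡ suc l′ → 2 ^ l′ < n
 doubling-lower n zero    l h = h
 doubling-lower n (suc j) l h with 2 ^ l <ᵇ n in eq
 ... | true  = subst (λ w → ∀ l′ → proj₁ (doubling n j (suc l , w)) ≡ suc l′ → 2 ^ l′ < n) (sym (double≡ l))
                (doubling-lower n j (suc l) λ { l′ refl → <ᵇ⇒< (2 ^ l′) n (subst Data.Bool.Base.T (sym eq) _) })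
 ... | false = doubling-lower n j l h

 n≤2^ceilLog : ∀ n → n ≤ 2 ^ ceilLog n
 n≤2^ceilLog n = doubling-upper n n 0 (<⇒≤ (m<2^m n))

 2^<n : ∀ n l → ceilLog n ≡ suc l → 2 ^ l < n
 2^<n n l = doubling-lower n n 0 (λ _ ()) l

 0<ceilLog : ∀ n → 2 ≤ n → 0 < ceilLog n
 0<ceilLog n 2≤n with ceilLog n | n≤2^ceilLog n
 ... | zero  | h = contradiction (≤-trans 2≤n h) (<-irrefl refl)
 ... | suc l | _ = s≤s z≤n

 2k≤2^k : ∀ k → 0 < k → k + k ≤ 2 ^ k
 2k≤2^k (suc k) _ = ≤-trans (+-mono-≤ (m<2^m k) (m<2^m k)) (≤-reflexive (double≡ k))

 -- Binomial coefficients

 k≤kCs : ∀ n s → s < n → 0 < s → n ≤ n C s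
 k≤kCs (suc n) (suc zero)    _        _ = ≤-reflexive (sym (nC1≡n (suc n)))
 k≤kCs (suc n) (suc (suc s)) (s≤s s<) _ = ≤-trans
  (≤-trans (≤-reflexive (+-comm 1 n)) (+-mono-≤ (k≤kCs n (suc s) s< (s≤s z≤n)) one))
  (≤-reflexive (nCk+nC[k+1]≡[n+1]C[k+1] n (suc s)))
  where
  one : 1 ≤ n C suc (suc s)
  one with suc (suc s) ≟ n
  ... | yes refl = ≤-reflexive (sym (nCn≡1 n))
  ... | no ne    = ≤-trans (≤-trans (s≤s z≤n) s<) (k≤kCs n (suc (suc s)) (≤∧≢⇒< s< ne) (s≤s z≤n))

 kC2≤kCs : ∀ n s → 2 ≤ s → 2 + s ≤ n → n C 2 ≤ n C s
 kC2≤kCs (suc n) (suc zero) (s≤s ()) _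
 kC2≤kCs (suc n) (suc (suc zero))    _ _        = ≤-refl
 kC2≤kCs (suc n) (suc (suc (suc s))) _ (s≤s le) = ≤-trans
  (≤-reflexive (sym (nCk+nC[k+1]≡[n+1]C[k+1] n 1)))
  (≤-trans (≤-reflexive (+-comm (n C 1) (n C 2)))
  (≤-trans (+-mono-≤ (kC2≤kCs n (2 + s) (s≤s (s≤s z≤n)) le)
                     (≤-trans (≤-reflexive (nC1≡n n)) (k≤kCs n (3 + s) le (s≤s z≤n))))
           (≤-reflexive (nCk+nC[k+1]≡[n+1]C[k+1] n (2 + s)))))

 2*nC2 : ∀ n → 2 * (n C 2) + n ≡ n * n
 2*nC2 zero    = refl
 2*nC2 (suc n) = trans (cong (λ z → 2 * z + suc n) (trans (sym (nCk+nC[k+1]≡[n+1]C[k+1] n 1)) (cong (_+ n C 2) (nC1≡n n))))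
  (trans (lem₁ n (n C 2)) (trans (cong (λ z → z + n + suc n) (2*nC2 n)) (lem₂ n)))
  where
  lem₁ : ∀ n c → 2 * (n + c) + suc n ≡ 2 * c + n + n + suc n
  lem₁ = solve-∀
  lem₂ : ∀ n → n * n + n + suc n ≡ suc n * suc n
  lem₂ = solve-∀

 tuples-few : ∀ s k → 2 ≤ s → s < k → (k + k) ^ k ≤ (16 * s) ^ (k C s)
 tuples-few s@(suc _) k 2≤s s<k with 2 + s ≤? k
 ... | yes le = ≤-trans (^-monoˡ-≤ k (2k≤2^k k (≤-trans (s≤s z≤n) s<k))) (≤-trans (≤-reflexive (^-*-assoc 2 k k)) (≤-trans (^-monoʳ-≤ 2 square)
    (≤-trans (≤-reflexive (sym (^-*-assoc 2 4 (k C s)))) (^-monoˡ-≤ (k C s) (m≤m*n 16 s)))))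
  where
  square : k * k ≤ 4 * (k C s)
  square = ≤-trans (+-cancelʳ-≤ (k * k) (k * k) (4 * (k C 2)) sq) (*-monoʳ-≤ 4 (kC2≤kCs k s 2≤s le))
    where
    sq : k * k + k * k ≤ 4 * (k C 2) + k * k
    sq = ≤-trans (≤-reflexive (cong₂ _+_ (sym (2*nC2 k)) (sym (2*nC2 k)))) (≤-trans (≤-reflexive (lem (k C 2) k))
      (+-monoʳ-≤ (4 * (k C 2)) (*-monoˡ-≤ k (≤-trans 2≤s (<⇒≤ s<k)))))
      where
      lem : ∀ c k → 2 * c + k + (2 * c + k) ≡ 4 * c + 2 * k
      lem = solve-∀
 ... | no ¬le = ≤-trans (^-monoˡ-≤ k base) (^-monoʳ-≤ (16 * s) {{m*n≢0 16 s}} (k≤kCs k s s<k (s≤s z≤n)))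
  where
  k≡ : k ≡ suc s
  k≡ = ≤-antisym (s≤s⁻¹ (≰⇒> ¬le)) s<k
  base : k + k ≤ 16 * s
  base = subst (λ k → k + k ≤ 16 * s) (sym k≡) (≤-trans (+-mono-≤ h h) (≤-trans (≤-reflexive (lem s)) (*-monoˡ-≤ s (m≤m+n 4 12))))
    where
    h : suc s ≤ 2 * s
    h = ≤-trans (+-monoˡ-≤ s {1} {s} (s≤s z≤n)) (≤-reflexive (cong (s +_) (sym (+-identityʳ s))))
    lem : ∀ s → 2 * s + 2 * s ≡ 4 * s
    lem = solve-∀

 ^-distrib : ∀ m n s → (m * n) ^ s ≡ m ^ s * n ^ s
 ^-distrib m n zero    = refl
 ^-distrib m n (suc s) = trans (cong (m * n *_) (^-distrib m n s)) (lem m n (m ^ s) (n ^ s))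
  where
  lem : ∀ m n a b → m * n * (a * b) ≡ m * a * (n * b)
  lem = solve-∀

 module Budget (n k s : ℕ) (2≤s : 2 ≤ s) (s<k : s < k) (k≤n : k ≤ n) where
  B : ℕ
  B = (n * k) ^ s

  private
    instance
      k≢0 : NonZero k
      k≢0 = >-nonZero (≤-trans (s≤s z≤n) s<k)
      n≢0 : NonZero n
      n≢0 = >-nonZero (≤-trans (>-nonZero⁻¹ k) k≤n)
      nk≢0 : NonZero (n * k)
      nk≢0 = m*n≢0 n k

  B≢0 : NonZero B
  B≢0 = m^n≢0 (n * k) s

  1≤B : 1 ≤ B
  1≤B = >-nonZero⁻¹ B {{B≢0}}

  square≤B : n * k * (n * k) ≤ B
  square≤B = ≤-trans (≤-reflexive (cong (n * k *_) (sym (*-identityʳ (n * k))))) (^-monoʳ-≤ (n * k) 2≤s)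

  nk≤B : n * k ≤ B
  nk≤B = ≤-trans (m≤m*n (n * k) (n * k)) square≤B

  n≤B : n ≤ B
  n≤B = ≤-trans (m≤m*n n k) nk≤B

  k≤B : k ≤ B
  k≤B = ≤-trans k≤n n≤B

  s≤B : s ≤ B
  s≤B = ≤-trans (<⇒≤ s<k) k≤B

  sn≤B : s * n ≤ B
  sn≤B = ≤-trans (*-monoˡ-≤ n (<⇒≤ s<k)) (≤-trans (≤-reflexive (*-comm k n)) nk≤B)

  kk≤B : k * k ≤ B
  kk≤B = ≤-trans (*-monoˡ-≤ k k≤n) nk≤B

  n^s≤B : n ^ s ≤ B
  n^s≤B = ^-monoˡ-≤ s (m≤m*n n k)

  kkn^s≤B : k * k * n ^ s ≤ B
  kkn^s≤B = ≤-trans (*-monoˡ-≤ (n ^ s) (≤-trans (≤-reflexive (cong (k *_) (sym (*-identityʳ k)))) (^-monoʳ-≤ k 2≤s)))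
    (≤-reflexive (trans (*-comm (k ^ s) (n ^ s)) (sym (^-distrib n k s))))

  sn^s≤B : s * n ^ s ≤ B
  sn^s≤B = ≤-trans (*-monoˡ-≤ (n ^ s) (≤-trans (<⇒≤ s<k) (m≤m*n k k))) kkn^s≤B

 -- Cliques as lists of labels

 -- The vertex with index i in Fin n gets the label n - 1 - i, so that the
 -- enumeration `choose` lists the label lists in decreasing lexicographic order.
 labels : ∀ {n} → Subset n → List ℕ
 labels []                      = []
 labels {suc n} (inside  ∷ e)   = n ∷ labels e
 labels {suc n} (outside ∷ e)   = labels e

 edgeLabels : ∀ {n s} → SizedSubset n s → List ℕ
 edgeLabels e = labels (proj₁ e)

 Descending : ℕ → List ℕ → Set
 Descending n []       = ⊤
 Descending n (u ∷ us) = u < n × Descending u us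

 descending-≤ : ∀ {n n′} us → n ≤ n′ → Descending n us → Descending n′ us
 descending-≤ []       le _        = tt
 descending-≤ (u ∷ us) le (lt , d) = ≤-trans lt le , d

 descending-< : ∀ {n} us → Descending n us → All (_< n) us
 descending-< []       _        = []
 descending-< (u ∷ us) (lt , d) = lt ∷ All.map (λ l → <-trans l lt) (descending-< us d)

 labels-descending : ∀ {n} (e : Subset n) → Descending n (labels e)
 labels-descending []            = tt
 labels-descending (inside  ∷ e) = ≤-refl , labels-descending e
 labels-descending (outside ∷ e) = descending-≤ (labels e) (n≤1+n _) (labels-descending e)

 labels-length : ∀ {n} (e : Subset n) → length (labels e) ≡ ∣ e ∣
 labels-length []            = refl
 labels-length (inside  ∷ e) = cong suc (labels-length e)
 labels-length (outside ∷ e) = labels-length e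

 sized-≡ : ∀ {n s} {e f : SizedSubset n s} → proj₁ e ≡ proj₁ f → e ≡ f
 sized-≡ {e = e , refl} {.e , q} refl = cong (e ,_) (≡-irrelevant refl q)

 labels-injective : ∀ {n} (e f : Subset n) → labels e ≡ labels f → e ≡ f
 labels-injective []            []            eq = refl
 labels-injective (inside  ∷ e) (inside  ∷ f) eq = cong (inside ∷_) (labels-injective e f (List.∷-injectiveʳ eq))
 labels-injective (outside ∷ e) (outside ∷ f) eq = cong (outside ∷_) (labels-injective e f eq)
 labels-injective {suc n} (inside ∷ e) (outside ∷ f) eq =
  contradiction (All.head (subst (All (_< n)) (sym eq) (descending-< _ (labels-descending f)))) (<-irrefl refl)
 labels-injective {suc n} (outside ∷ e) (inside ∷ f) eq =
  contradiction (All.head (subst (All (_< n)) eq (descending-< _ (labels-descending e)))) (<-irrefl refl)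

 insideˢ : ∀ {n s} → SizedSubset n s → SizedSubset (suc n) (suc s)
 insideˢ (e , p) = inside ∷ e , cong suc p

 outsideˢ : ∀ {n s} → SizedSubset n s → SizedSubset (suc n) s
 outsideˢ (e , p) = outside ∷ e , p

 choose-complete : ∀ {n s} (e : SizedSubset n s) → e ∈ choose n s
 choose-complete {zero}  ([] , refl)            = here refl
 choose-complete {suc n} {zero}  (outside ∷ e , p) = ∈-map⁺ outsideˢ (choose-complete (e , p))
 choose-complete {suc n} {suc s} (inside ∷ e , p) =
  subst (_∈ choose (suc n) (suc s)) (sized-≡ refl) (∈-++⁺ˡ (∈-map⁺ insideˢ (choose-complete (e , suc-injective p))))
 choose-complete {suc n} {suc s} (outside ∷ e , p) =
  ∈-++⁺ʳ (List.map insideˢ (choose n s)) (∈-map⁺ outsideˢ (choose-complete (e , p)))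

 choose-unique : ∀ n s → Unique (choose n s)
 choose-unique zero    zero    = [] ∷ []
 choose-unique zero    (suc s) = []
 choose-unique (suc n) zero    = Unique.map⁺ (λ eq → sized-≡ (tail-≡ (cong proj₁ eq))) (choose-unique n zero)
  where
  tail-≡ : ∀ {x} {e f : Subset n} → x Vec.∷ e ≡ x ∷ f → e ≡ f
  tail-≡ refl = refl
 choose-unique (suc n) (suc s) = Unique.++⁺
  (Unique.map⁺ (λ eq → sized-≡ (tail-≡ (cong proj₁ eq))) (choose-unique n s))
  (Unique.map⁺ (λ eq → sized-≡ (tail-≡ (cong proj₁ eq))) (choose-unique n (suc s)))
  λ (p , q) → disjoint (proj₂ (proj₂ (∈-map⁻ insideˢ p))) (proj₂ (proj₂ (∈-map⁻ outsideˢ q)))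
  where
  tail-≡ : ∀ {x} {e f : Subset n} → x Vec.∷ e ≡ x ∷ f → e ≡ f
  tail-≡ refl = refl
  disjoint : ∀ {v : SizedSubset (suc n) (suc s)} {e : SizedSubset n s} {f} → v ≡ insideˢ e → v ≡ outsideˢ f → Data.Empty.⊥
  disjoint refl ()

 length-choose : ∀ n s → length (choose n s) ≤ n ^ s
 length-choose zero    zero    = s≤s z≤n
 length-choose zero    (suc s) = z≤n
 length-choose (suc n) zero    = ≤-trans (≤-reflexive (length-map _ (choose n zero))) (length-choose n zero)
 length-choose (suc n) (suc s) = ≤-trans
  (≤-reflexive (trans (length-++ (List.map insideˢ (choose n s))) (cong₂ _+_ (length-map _ (choose n s)) (length-map _ (choose n (suc s))))))
  (+-mono-≤ (≤-trans (length-choose n s) (^-monoˡ-≤ s (n≤1+n n)))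
            (≤-trans (length-choose n (suc s)) (*-monoʳ-≤ n (^-monoˡ-≤ s (n≤1+n n)))))

 module _ {A : Set} (default : A) where
  look : ∀ n s → (SizedSubset n s → A) → List ℕ → A
  look zero    zero    f l        = f ([] , refl)
  look zero    (suc s) f l        = default
  look (suc n) zero    f l        = look n zero (f ∘ outsideˢ) l
  look (suc n) (suc s) f []       = default
  look (suc n) (suc s) f (u ∷ us) =
    if u ≡ᵇ n then look n s (f ∘ insideˢ) us else look n (suc s) (f ∘ outsideˢ) (u ∷ us)

  look-labels : ∀ {n s} (f : SizedSubset n s → A) e → look n s f (edgeLabels e) ≡ f e
  look-labels {zero}  f ([] , refl) = refl
  look-labels {suc n} {zero}  f (outside ∷ e , p) = look-labels (f ∘ outsideˢ) (e , p)
  look-labels {suc n} {suc s} f (inside ∷ e , p) rewrite ≡ᵇ-refl n =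
    trans (look-labels (f ∘ insideˢ) (e , suc-injective p)) (cong f (sized-≡ refl))
  look-labels {suc n} {suc s} f (outside ∷ e , p) with labels e in eq
  ... | []     = contradiction (trans (cong length (sym eq)) (trans (labels-length e) p)) λ ()
  ... | u ∷ us rewrite <⇒≡ᵇ-false {u} {n} (proj₁ (subst (Descending n) eq (labels-descending e))) =
    subst (λ l → look n (suc s) (f ∘ outsideˢ) l ≡ f (outside ∷ e , p)) eq (look-labels (f ∘ outsideˢ) (e , p))

 descending-labels : ∀ n s l → Descending n l → length l ≡ s → Σ (SizedSubset n s) λ e → edgeLabels e ≡ l
 descending-labels zero    zero    []      _ _ = ([] , refl) , refl
 descending-labels (suc n) zero    []      _ _ with descending-labels n zero [] tt refl
 ... | e , eq = outsideˢ e , eq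
 descending-labels (suc n) (suc s) (u ∷ us) (u< , d) len with u ≟ n
 ... | yes refl with descending-labels n s us d (suc-injective len)
 ...   | e , eq = insideˢ e , cong (u ∷_) eq
 descending-labels (suc n) (suc s) (u ∷ us) (u< , d) len | no u≢n
  with descending-labels n (suc s) (u ∷ us) (≤∧≢⇒< (s≤s⁻¹ u<) u≢n , d) len
 ... | e , eq = outsideˢ e , eq

 sumSub : ℕ → ℕ → (List ℕ → Bool) → Bool
 sumSub zero    n       Φ = Φ []
 sumSub (suc k) zero    Φ = false
 sumSub (suc k) (suc n) Φ = sumSub k n (Φ ∘ (n ∷_)) xor sumSub (suc k) n Φ

 sublists : ℕ → List ℕ → List (List ℕ)
 sublists zero    l        = [] ∷ []
 sublists (suc s) []       = []
 sublists (suc s) (u ∷ us) = map (u ∷_) (sublists s us) ++ sublists (suc s) us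

 allOf : List (List ℕ) → (List ℕ → Bool) → Bool
 allOf []       f = true
 allOf (l ∷ ls) f = f l ∧ allOf ls f

 allOf-++ : ∀ ls ls′ f → allOf (ls ++ ls′) f ≡ allOf ls f ∧ allOf ls′ f
 allOf-++ []       ls′ f = refl
 allOf-++ (l ∷ ls) ls′ f = trans (cong (f l ∧_) (allOf-++ ls ls′ f)) (sym (Bool.∧-assoc (f l) _ _))

 allOf-map : ∀ g ls f → allOf (map g ls) f ≡ allOf ls (f ∘ g)
 allOf-map g []       f = refl
 allOf-map g (l ∷ ls) f = cong (f (g l) ∧_) (allOf-map g ls f)

 allOf-cong : ∀ ls {f g} → (∀ l → l ∈ ls → f l ≡ g l) → allOf ls f ≡ allOf ls g
 allOf-cong []       h = refl
 allOf-cong (l ∷ ls) h = cong₂ _∧_ (h l (here refl)) (allOf-cong ls λ l′ l′∈ → h l′ (there l′∈))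

 allSub : ℕ → List ℕ → (List ℕ → Bool) → Bool
 allSub s l f = allOf (sublists s l) f

 sublists-length : ∀ s l {l′} → l′ ∈ sublists s l → length l′ ≡ s
 sublists-length zero    l        (here refl) = refl
 sublists-length (suc s) (u ∷ us) l′∈ with ∈-++⁻ (map (u ∷_) (sublists s us)) l′∈
 ... | inj₂ q = sublists-length (suc s) us q
 ... | inj₁ q with ∈-map⁻ (u ∷_) q
 ...   | l″ , l″∈ , refl = cong suc (sublists-length s us l″∈)

 sublists-descending : ∀ s l {n l′} → Descending n l → l′ ∈ sublists s l → Descending n l′
 sublists-descending zero    l        d        (here refl) = tt
 sublists-descending (suc s) (u ∷ us) (u< , d) l′∈ with ∈-++⁻ (map (u ∷_) (sublists s us)) l′∈
 ... | inj₂ q = sublists-descending (suc s) us (descending-≤ us (<⇒≤ u<) d) q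
 ... | inj₁ q with ∈-map⁻ (u ∷_) q
 ...   | l″ , l″∈ , refl = u< , sublists-descending s us d l″∈

 sublists-All : ∀ {P : ℕ → Set} s l {l′} → All P l → l′ ∈ sublists s l → All P l′
 sublists-All zero    l        ps       (here refl) = []
 sublists-All (suc s) (u ∷ us) (p ∷ ps) l′∈ with ∈-++⁻ (map (u ∷_) (sublists s us)) l′∈
 ... | inj₂ q = sublists-All (suc s) us ps q
 ... | inj₁ q with ∈-map⁻ (u ∷_) q
 ...   | l″ , l″∈ , refl = p ∷ sublists-All s us ps l″∈

 sublists-map : ∀ g s l → sublists s (map g l) ≡ map (map g) (sublists s l)
 sublists-map g zero    l        = refl
 sublists-map g (suc s) []       = refl
 sublists-map g (suc s) (u ∷ us) = trans
  (cong₂ _++_ (trans (cong (map (g u ∷_)) (sublists-map g s us)) (trans (sym (map-∘ (sublists s us))) (map-∘ (sublists s us))))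
              (sublists-map g (suc s) us))
  (sym (map-++ (map g) (map (u ∷_) (sublists s us)) (sublists (suc s) us)))

 sumSub-cong : ∀ k n {Φ Ψ} → (∀ l → Descending n l → length l ≡ k → Φ l ≡ Ψ l) → sumSub k n Φ ≡ sumSub k n Ψ
 sumSub-cong zero    n       h = h [] tt refl
 sumSub-cong (suc k) zero    h = refl
 sumSub-cong (suc k) (suc n) h = cong₂ _xor_
  (sumSub-cong k n λ l d len → h (n ∷ l) (≤-refl , d) (cong suc len))
  (sumSub-cong (suc k) n λ l d len → h l (descending-≤ l (n≤1+n n) d) len)

 sumSub-false : ∀ k n {Φ} → (∀ l → Descending n l → length l ≡ k → Φ l ≡ false) → sumSub k n Φ ≡ false
 sumSub-false k n h = trans (sumSub-cong k n h) (zeros k n)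
  where
  zeros : ∀ k n → sumSub k n (λ _ → false) ≡ false
  zeros zero    n       = refl
  zeros (suc k) zero    = refl
  zeros (suc k) (suc n) = cong₂ _xor_ (zeros k n) (zeros (suc k) n)

 parityOf : ∀ {n s} → ℕ → Hypergraph n s → Bool
 parityOf {n} {s} k G = sumSub k n λ S → allSub s S (look false n s G)

 xorList : ∀ {A : Set} → (A → Bool) → List A → Bool
 xorList f []       = false
 xorList f (x ∷ xs) = f x xor xorList f xs

 xorList-++ : ∀ {A : Set} (f : A → Bool) xs ys → xorList f (xs ++ ys) ≡ xorList f xs xor xorList f ys
 xorList-++ f []       ys = refl
 xorList-++ f (x ∷ xs) ys = trans (cong (f x xor_) (xorList-++ f xs ys)) (sym (Bool.xor-assoc (f x) _ _))

 xorList-map : ∀ {A B : Set} (f : B → Bool) (g : A → B) xs → xorList f (map g xs) ≡ xorList (f ∘ g) xs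
 xorList-map f g []       = refl
 xorList-map f g (x ∷ xs) = cong (f (g x) xor_) (xorList-map f g xs)

 xorList-cong : ∀ {A : Set} {f g : A → Bool} → (∀ x → f x ≡ g x) → ∀ xs → xorList f xs ≡ xorList g xs
 xorList-cong h []       = refl
 xorList-cong h (x ∷ xs) = cong₂ _xor_ (h x) (xorList-cong h xs)

 xorList-choose : ∀ n k Φ → xorList (Φ ∘ edgeLabels) (choose n k) ≡ sumSub k n Φ
 xorList-choose zero    zero    Φ = Bool.xor-identityʳ (Φ [])
 xorList-choose zero    (suc k) Φ = refl
 xorList-choose (suc n) zero    Φ = trans (xorList-map _ outsideˢ (choose n zero)) (xorList-choose n zero Φ)
 xorList-choose (suc n) (suc k) Φ = trans (xorList-++ _ (map insideˢ (choose n k)) _)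
  (cong₂ _xor_ (trans (xorList-map _ insideˢ (choose n k)) (xorList-choose n k (Φ ∘ (n ∷_))))
               (trans (xorList-map _ outsideˢ (choose n (suc k))) (xorList-choose n (suc k) Φ)))

 module _ {n : ℕ} {e S : Subset n} {b : Bool} {X : Set} where
  below-out : (outside Vec.∷ e ⊆ b Vec.∷ S → X) → e ⊆ S → X
  below-out f incl = f (out⊆ {p = e} {q = S} {s = b} incl)

  below-same : (b Vec.∷ e ⊆ b Vec.∷ S → X) → e ⊆ S → X
  below-same f incl = f (s⊆s {p = e} {q = S} {s = b} incl)

  above : ∀ {b′} → (e ⊆ S → X) → b Vec.∷ e ⊆ b′ Vec.∷ S → X
  above f incl = f (drop-∷-⊆ incl)

 inside⊈outside : ∀ {n} {e S : Subset n} → ¬ (inside Vec.∷ e ⊆ outside Vec.∷ S)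
 inside⊈outside incl with incl Vec.here
 ... | ()

 look-[] : ∀ n s (f : SizedSubset n (suc s) → Bool) → look false n (suc s) f [] ≡ false
 look-[] zero    s f = refl
 look-[] (suc n) s f = refl

 look-below : ∀ {n} s (G : SizedSubset (suc n) (suc s) → Bool) (S : Subset n) →
  allSub (suc s) (labels S) (look false (suc n) (suc s) G) ≡ allSub (suc s) (labels S) (look false n (suc s) (G ∘ outsideˢ))
 look-below {n} s G S = allOf-cong (sublists (suc s) (labels S)) λ l l∈ →
  go l (sublists-descending (suc s) (labels S) (labels-descending S) l∈)
  where
  go : ∀ l → Descending n l → look false (suc n) (suc s) G l ≡ look false n (suc s) (G ∘ outsideˢ) l
  go []       _        = sym (look-[] n s (G ∘ outsideˢ))
  go (u ∷ us) (u< , _) rewrite <⇒≡ᵇ-false u< = refl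

 clique-⇔ : ∀ {n s} (G : SizedSubset n s → Bool) (S : Subset n) →
  (All (λ e → proj₁ e ⊆ S → G e ≡ true) (choose n s) → allSub s (labels S) (look false n s G) ≡ true) ×
  (allSub s (labels S) (look false n s G) ≡ true → All (λ e → proj₁ e ⊆ S → G e ≡ true) (choose n s))
 clique-⇔ {zero}  {zero}  G [] = (λ { (h ∷ []) → cong (_∧ true) (h λ ()) }) , λ h → (λ _ → trans (sym (Bool.∧-identityʳ _)) h) ∷ []
 clique-⇔ {zero}  {suc s} G [] = (λ _ → refl) , λ _ → []
 clique-⇔ {suc n} {zero}  G (b ∷ S) =
  (λ h → proj₁ ih (All.map below-out (All.map⁻ h))) , λ h → All.map⁺ (All.map above (proj₂ ih h))
  where
  ih = clique-⇔ {n} {zero} (G ∘ outsideˢ) S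
 clique-⇔ {suc n} {suc s} G (outside ∷ S) = to , from
  where
  ih = clique-⇔ {n} {suc s} (G ∘ outsideˢ) S
  low = look-below s G S
  to : All (λ e → proj₁ e ⊆ (outside ∷ S) → G e ≡ true) (choose (suc n) (suc s)) → _
  to h = trans low (proj₁ ih (All.map below-out (All.map⁻ (All.++⁻ʳ (map insideˢ (choose n s)) h))))
  from : _ → All (λ e → proj₁ e ⊆ (outside ∷ S) → G e ≡ true) (choose (suc n) (suc s))
  from h = All.++⁺ (All.map⁺ (All.universal (λ e incl → contradiction (λ {x} → incl {x}) inside⊈outside) (choose n s)))
                   (All.map⁺ (All.map above (proj₂ ih (trans (sym low) h))))
 clique-⇔ {suc n} {suc s} G (inside ∷ S) = to , from
  where
  ih = clique-⇔ {n} {suc s} (G ∘ outsideˢ) S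
  ih′ = clique-⇔ {n} {s} (G ∘ insideˢ) S
  low = look-below s G S
  high : allOf (map (n ∷_) (sublists s (labels S))) (look false (suc n) (suc s) G) ≡ allSub s (labels S) (look false n s (G ∘ insideˢ))
  high = trans (allOf-map (n ∷_) (sublists s (labels S)) _) (allOf-cong (sublists s (labels S)) λ l _ → top l)
    where
    top : ∀ l → look false (suc n) (suc s) G (n ∷ l) ≡ look false n s (G ∘ insideˢ) l
    top l rewrite ≡ᵇ-refl n = refl
  to : All (λ e → proj₁ e ⊆ (inside ∷ S) → G e ≡ true) (choose (suc n) (suc s)) → _
  to h = trans (allOf-++ (map (n ∷_) (sublists s (labels S))) _ _)
    (cong₂ _∧_ (trans high (proj₁ ih′ (All.map below-same (All.map⁻ (All.++⁻ˡ (map insideˢ (choose n s)) h)))))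
               (trans low (proj₁ ih (All.map below-out (All.map⁻ (All.++⁻ʳ (map insideˢ (choose n s)) h))))))
  from : _ → All (λ e → proj₁ e ⊆ (inside ∷ S) → G e ≡ true) (choose (suc n) (suc s))
  from h with trans (sym (allOf-++ (map (n ∷_) (sublists s (labels S))) _ _)) h
  ... | h′ = All.++⁺
    (All.map⁺ (All.map above (proj₂ ih′ (trans (sym high) (Bool.∧-conicalˡ _ _ h′)))))
    (All.map⁺ (All.map above (proj₂ ih (trans (sym low) (Bool.∧-conicalʳ _ _ h′)))))

 does-clique : ∀ {n s k} (G : Hypergraph n s) (S : SizedSubset n k) →
  does (isClique? G S) ≡ allSub s (edgeLabels S) (look false n s G)
 does-clique {n} {s} G S with isClique? G S
 ... | yes c  = sym (proj₁ (clique-⇔ G (proj₁ S)) c)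
 ... | no ¬c with allSub s (edgeLabels S) (look false n s G) in eq
 ...   | true  = contradiction (proj₂ (clique-⇔ G (proj₁ S)) eq) ¬c
 ...   | false = refl

 length-filter-parity : ∀ {A : Set} {P : A → Set} (P? : ∀ x → Dec (P x)) xs →
  length (filter P? xs) % 2 ≡ b2n (xorList (does ∘ P?) xs)
 length-filter-parity P? []       = refl
 length-filter-parity P? (x ∷ xs) with does (P? x)
 ... | false = length-filter-parity P? xs
 ... | true  = trans (sucParity (length (filter P? xs)) _ (length-filter-parity P? xs)) refl
  where
  sucParity : ∀ l b → l % 2 ≡ b2n b → suc l % 2 ≡ b2n (true xor b)
  sucParity l b eq = trans (DM.%-distribˡ-+ 1 l 2) (trans (cong (λ z → (1 + z) % 2) eq) (h b))
    where
    h : ∀ b → (1 + b2n b) % 2 ≡ b2n (true xor b)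
    h true  = refl
    h false = refl

 cliqueParity≡ : ∀ {n s} k (G : Hypergraph n s) → cliqueParity k G ≡ b2n (parityOf k G)
 cliqueParity≡ {n} {s} k G = trans (length-filter-parity (isClique? G) (choose n k))
  (cong b2n (trans (xorList-cong (does-clique G) (choose n k)) (xorList-choose n k _)))

 -- Sums over F₂

 topXor-cong : ∀ n {f g : ℕ → Bool} → (∀ i → i < n → f i ≡ g i) → topXor n f ≡ topXor n g
 topXor-cong zero    h = refl
 topXor-cong (suc n) h = cong₂ _xor_ (h n ≤-refl) (topXor-cong n λ i i< → h i (≤-trans i< (n≤1+n n)))

 topXor-false : ∀ n → topXor n (λ _ → false) ≡ false
 topXor-false zero    = refl
 topXor-false (suc n) = topXor-false n

 xor-interchange : ∀ a b c d → (a xor b) xor (c xor d) ≡ (a xor c) xor (b xor d)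
 xor-interchange a b c d = trans (Bool.xor-assoc a b (c xor d))
  (trans (cong (a xor_) (trans (sym (Bool.xor-assoc b c d)) (trans (cong (_xor d) (Bool.xor-comm b c)) (Bool.xor-assoc c b d))))
         (sym (Bool.xor-assoc a c (b xor d))))

 topXor-xor : ∀ n f g → topXor n (λ i → f i xor g i) ≡ topXor n f xor topXor n g
 topXor-xor zero    f g = refl
 topXor-xor (suc n) f g = trans (cong ((f n xor g n) xor_) (topXor-xor n f g)) (xor-interchange (f n) (g n) _ _)

 topXor-∧ : ∀ n b f → topXor n (λ i → b ∧ f i) ≡ b ∧ topXor n f
 topXor-∧ n true  f = refl
 topXor-∧ n false f = topXor-false n

 topXor-+ : ∀ a b f → topXor (a + b) f ≡ topXor a (λ i → f (b + i)) xor topXor b f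
 topXor-+ zero    b f = refl
 topXor-+ (suc a) b f = trans (cong₂ _xor_ (cong f (+-comm a b)) (topXor-+ a b f)) (sym (Bool.xor-assoc (f (b + a)) _ _))

 topXor-* : ∀ g m f → topXor (g * m) f ≡ topXor g (λ v → topXor m (λ r → f (v * m + r)))
 topXor-* zero    m f = refl
 topXor-* (suc g) m f = trans (topXor-+ m (g * m) f) (cong (topXor m (λ r → f (g * m + r)) xor_) (topXor-* g m f))

 topXor-even : ∀ h b → topXor (h + h) (λ _ → b) ≡ false
 topXor-even zero    b = refl
 topXor-even (suc h) b rewrite +-suc h h | topXor-even h b | Bool.xor-identityʳ b = Bool.xor-same b

 sumSub-xor : ∀ k n Φ Ψ → sumSub k n (λ S → Φ S xor Ψ S) ≡ sumSub k n Φ xor sumSub k n Ψ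
 sumSub-xor zero    n       Φ Ψ = refl
 sumSub-xor (suc k) zero    Φ Ψ = refl
 sumSub-xor (suc k) (suc n) Φ Ψ = trans (cong₂ _xor_ (sumSub-xor k n _ _) (sumSub-xor (suc k) n Φ Ψ)) (xor-interchange (sumSub k n (Φ ∘ (n ∷_))) (sumSub k n (Ψ ∘ (n ∷_))) _ _)

 topXor-sumSub : ∀ L k n (F : ℕ → List ℕ → Bool) → topXor L (λ i → sumSub k n (F i)) ≡ sumSub k n (λ S → topXor L (λ i → F i S))
 topXor-sumSub zero    k n F = sym (sumSub-false k n λ _ _ _ → refl)
 topXor-sumSub (suc L) k n F = trans (cong (sumSub k n (F L) xor_) (topXor-sumSub L k n F)) (sym (sumSub-xor k n (F L) _))

 sumSub-suc : ∀ k n Φ → sumSub (suc k) n Φ ≡ topXor n (λ u → sumSub k u (Φ ∘ (u ∷_)))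
 sumSub-suc k zero    Φ = refl
 sumSub-suc k (suc n) Φ = cong (sumSub k n (Φ ∘ (n ∷_)) xor_) (sumSub-suc k n Φ)

 -- Queue items in terms of edges

 dfs : (μ I P : ℕ → ℕ) → ℕ → Item → List Item
 dfs μ I P zero    it                = it ∷ []
 dfs μ I P (suc j) (zero  , a , b) = []
 dfs μ I P (suc j) (suc u , a , b) = dfs μ I P j (u , μ a + I u , μ b + P u) ++ dfs μ I P (suc j) (u , a , b)

 dfs-children : ∀ μ I P j u a b → concatMap (dfs μ I P j) (children μ I P (u , a , b)) ≡ dfs μ I P (suc j) (u , a , b)
 dfs-children μ I P j zero    a b = refl
 dfs-children μ I P j (suc u) a b = cong (dfs μ I P j (u , μ a + I u , μ b + P u) ++_) (dfs-children μ I P j u a b)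

 stages-dfs : ∀ μ I P j its → stages μ I P j its ≡ concatMap (dfs μ I P j) its
 stages-dfs μ I P zero    []         = refl
 stages-dfs μ I P zero    (it ∷ its) = cong (it ∷_) (stages-dfs μ I P zero its)
 stages-dfs μ I P (suc j) its        = trans (stages-dfs μ I P j _) (regroup its)
  where
  regroup : ∀ its → concatMap (dfs μ I P j) (concatMap (children μ I P) its) ≡ concatMap (dfs μ I P (suc j)) its
  regroup []                = refl
  regroup ((u , a , b) ∷ its) = trans (List.concatMap-++ (dfs μ I P j) (children μ I P (u , a , b)) _)
    (cong₂ _++_ (dfs-children μ I P j u a b) (regroup its))

 hcodeBy : (μ f : ℕ → ℕ) → ℕ → List ℕ → ℕ
 hcodeBy μ f a l = hcode μ a (map f l)

 dfs-choose : ∀ μ I P n s a b → map proj₂ (dfs μ I P s (n , a , b)) ≡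
  map (λ e → hcodeBy μ I a (edgeLabels e) , hcodeBy μ P b (edgeLabels e)) (choose n s)
 dfs-choose μ I P zero    zero    a b = refl
 dfs-choose μ I P zero    (suc s) a b = refl
 dfs-choose μ I P (suc n) zero    a b = trans (dfs-choose μ I P n zero a b) (map-∘ (choose n zero))
 dfs-choose μ I P (suc n) (suc s) a b =
  trans (map-++ proj₂ (dfs μ I P s (n , μ a + I n , μ b + P n)) _)
  (trans (cong₂ _++_ (trans (dfs-choose μ I P n s _ _) (map-∘ (choose n s)))
                     (trans (dfs-choose μ I P n (suc s) a b) (map-∘ (choose n (suc s)))))
         (sym (map-++ _ (map insideˢ (choose n s)) _)))

 items-choose : ∀ μ I P n s → map proj₂ (bfsItems μ I P n s) ≡
  map (λ e → hcodeBy μ I 0 (edgeLabels e) , hcodeBy μ P 0 (edgeLabels e)) (choose n s)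
 items-choose μ I P n s = trans (cong (map proj₂) (trans (stages-dfs μ I P s _) (++-identityʳ _))) (dfs-choose μ I P n s 0 0)

 items-length : ∀ μ I P n s → length (bfsItems μ I P n s) ≡ length (choose n s)
 items-length μ I P n s = trans (sym (length-map proj₂ (bfsItems μ I P n s)))
  (trans (cong length (items-choose μ I P n s)) (length-map _ (choose n s)))

 -- The codes are injective: they are numbers in base M.

 digits-injective : ∀ {M x x′ y y′} → x < M → x′ < M → y * M + x ≡ y′ * M + x′ → x ≡ x′ × y ≡ y′
 digits-injective {M@(suc _)} {x} {x′} {y} {y′} x< x′< eq = x≡ , *-cancelʳ-≡ y y′ M (+-cancelʳ-≡ x _ _ (trans eq (cong (y′ * M +_) (sym x≡))))
  where
  rem : ∀ y x → x < M → (y * M + x) % M ≡ x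
  rem y x x< = trans (cong (_% M) (+-comm (y * M) x)) (trans (DM.[m+kn]%n≡m%n x y M) (DM.m<n⇒m%n≡m x<))
  x≡ : x ≡ x′
  x≡ = trans (sym (rem y x x<)) (trans (cong (_% M) eq) (rem y′ x′ x′<))

 hcode-injective : ∀ {M e} .{{_ : NonZero M}} v v′ i {a a′} → i + length v ≡ suc e → length v ≡ length v′ →
  a < M ^ i → a′ < M ^ i → All (_< M) v → All (_< M) v′ →
  hcode (timesBelow (M ^ e) M) a v ≡ hcode (timesBelow (M ^ e) M) a′ v′ → a ≡ a′ × v ≡ v′
 hcode-injective []      []        i len len≡ a< a′< _ _ eq = eq , refl
 hcode-injective {M} {e} (x ∷ v) (x′ ∷ v′) i {a} {a′} len len≡ a< a′< (x< ∷ v<) (x′< ∷ v′<) eq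
  with hcode-injective {M} {e} v v′ (suc i) (trans (sym (+-suc i (length v))) len) (suc-injective len≡)
         (step a< x<) (step a′< x′<) v< v′< (trans (sym (cong (λ z → hcode μ (z + x) v) (times a<)))
           (trans eq (cong (λ z → hcode μ (z + x′) v′) (times a′<))))
  where
  μ = timesBelow (M ^ e) M
  times : ∀ {a} → a < M ^ i → μ a ≡ a * M
  times {a} a< with a <ᵇ M ^ e in eq
  ... | true  = refl
  ... | false = contradiction (subst T eq (<⇒<ᵇ (≤-trans a< (^-monoʳ-≤ M i≤e)))) (λ ())
    where
    i≤e : i ≤ e
    i≤e = s≤s⁻¹ (≤-trans (s≤s (m≤m+n i (length v))) (≤-reflexive (trans (sym (+-suc i (length v))) len)))
  step : ∀ {a x} → a < M ^ i → x < M → a * M + x < M ^ suc i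
  step {a} {x} a< x< = ≤-trans (+-monoʳ-< (a * M) x<)
    (≤-trans (≤-reflexive (+-comm (a * M) M)) (≤-trans (*-monoˡ-≤ M a<) (≤-reflexive (*-comm (M ^ i) M))))
 ... | a≡ , refl with digits-injective {M} {y = a} {a′} x< x′< a≡
 ...   | refl , refl = refl , refl

 updBool-hit : ∀ f v {x y} → x ≡ y → updBool f x v y ≡ v
 updBool-hit f v {x} refl rewrite ≡ᵇ-refl x = refl

 updBool-miss : ∀ f v {x y} → y ≢ x → updBool f x v y ≡ f y
 updBool-miss f v ne rewrite ≡ᵇ-false ne = refl

 module _ {n s : ℕ} (key : SizedSubset n s → ℕ) (G : SizedSubset n s → Bool) where

  tabulated-in : ∀ f es its {κ g} → map (proj₁ ∘ proj₂) its ≡ map key es → (f κ ≡ g ⊎ Any (λ e → key e ≡ κ) es) →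
    (∀ e → key e ≡ κ → G e ≡ g) → tabulated f its (map G es) κ ≡ g
  tabulated-in f []       []                  eq (inj₁ h) unique = h
  tabulated-in f (e ∷ es) ((_ , κ′ , _) ∷ its) {κ} {g} eq h unique =
    tabulated-in (updBool f κ′ (G e)) es its (List.∷-injectiveʳ eq) (next h) unique
    where
    κ≡ : κ′ ≡ key e
    κ≡ = List.∷-injectiveˡ eq
    hit : key e ≡ κ → updBool f κ′ (G e) κ ≡ g
    hit k≡ = trans (updBool-hit f (G e) (trans κ≡ k≡)) (unique e k≡)
    next : f κ ≡ g ⊎ Any (λ e → key e ≡ κ) (e ∷ es) → updBool f κ′ (G e) κ ≡ g ⊎ Any (λ e → key e ≡ κ) es
    next (inj₂ (here k≡)) = inj₁ (hit k≡)
    next (inj₂ (there a)) = inj₂ a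
    next (inj₁ h) with κ ≟ κ′
    ... | yes refl = inj₁ (hit (sym κ≡))
    ... | no  ne = inj₁ (trans (updBool-miss f (G e) ne) h)

  tabulated-out : ∀ f es its {κ} → map (proj₁ ∘ proj₂) its ≡ map key es → tabulated f its (map G es) κ ≡ true →
    f κ ≡ true ⊎ Any (λ e → key e ≡ κ) es
  tabulated-out f []       []                  eq h = inj₁ h
  tabulated-out f (e ∷ es) ((_ , κ′ , _) ∷ its) {κ} eq h
    with tabulated-out (updBool f κ′ (G e)) es its (List.∷-injectiveʳ eq) h
  ... | inj₂ a = inj₂ (there a)
  ... | inj₁ h′ with κ ≡ᵇ κ′ in e≡
  ...   | true  = inj₂ (here (trans (sym (List.∷-injectiveˡ eq)) (sym (≡ᵇ-true κ κ′ e≡))))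
  ...   | false = inj₁ h′

 -- The identity behind the self-reduction: since L is even, only the choices of
 -- one edge out of every block survive.

 sumA : ℕ → List ℕ → (ℕ → ℕ) → ((ℕ → ℕ) → Bool) → Bool
 sumA L []       a f = f a
 sumA L (κ ∷ κs) a f = topXor L λ i → sumA L κs (λ y → if y ≡ᵇ κ then i else a y) f

 sumA-cong : ∀ L κs a {f g} → (∀ a′ → (∀ y → All (y ≢_) κs → a′ y ≡ a y) → f a′ ≡ g a′) → sumA L κs a f ≡ sumA L κs a g
 sumA-cong L []       a h = h a λ _ _ → refl
 sumA-cong L (κ ∷ κs) a h = topXor-cong L λ i _ → sumA-cong L κs _ λ a′ h′ → h a′ λ { y (y≢ ∷ ys≢) →
  trans (h′ y ys≢) (cong (λ z → if z then i else a y) (≡ᵇ-false y≢)) }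

 sumA-∧ : ∀ L κs a b f → sumA L κs a (λ a → b ∧ f a) ≡ b ∧ sumA L κs a f
 sumA-∧ L []       a b f = refl
 sumA-∧ L (κ ∷ κs) a b f = trans (topXor-cong L λ i _ → sumA-∧ L κs _ b f) (topXor-∧ L b _)

 sumA-sumSub : ∀ L κs a k n (F : (ℕ → ℕ) → List ℕ → Bool) →
  sumA L κs a (λ a → sumSub k n (F a)) ≡ sumSub k n (λ S → sumA L κs a (λ a → F a S))
 sumA-sumSub L []       a k n F = refl
 sumA-sumSub L (κ ∷ κs) a k n F = trans (topXor-cong L λ i _ → sumA-sumSub L κs _ k n F) (topXor-sumSub L k n _)

 sumA-rainbow : ∀ L (y : List ℕ → ℕ → Bool) (c : List ℕ → ℕ) κs ls a → map c ls ≡ κs → Distinct κs →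
  sumA L κs a (λ a → allOf ls (λ l → y l (a (c l)))) ≡ allOf ls (λ l → topXor L (y l))
 sumA-rainbow L y c []       []       a _    _ = refl
 sumA-rainbow L y c (κ ∷ κs) (l ∷ ls) a refl (κ∉ , dist) =
  trans (topXor-cong L λ i _ →
    trans (sumA-cong L κs _ λ a′ h → cong (λ z → y l z ∧ allOf ls (λ l → y l (a′ (c l)))) (trans (h κ κ∉) (at-κ i)))
    (trans (sumA-∧ L κs _ (y l i) _)
           (cong (y l i ∧_) (sumA-rainbow L y c κs ls _ refl dist))))
  (trans (topXor-cong L λ i _ → Bool.∧-comm (y l i) _)
  (trans (topXor-∧ L (allOf ls (λ l → topXor L (y l))) (y l)) (Bool.∧-comm _ (topXor L (y l)))))
  where
  at-κ : ∀ i → (if κ ≡ᵇ κ then i else a κ) ≡ i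
  at-κ i rewrite ≡ᵇ-refl κ = refl

 sumA-indep : ∀ L κs κ {f : (ℕ → ℕ) → Bool} → (∀ a a′ → (∀ y → y ≢ κ → a y ≡ a′ y) → f a ≡ f a′) →
  ∀ a a′ → (∀ y → y ≢ κ → a y ≡ a′ y) → sumA L κs a f ≡ sumA L κs a′ f
 sumA-indep L []        κ h a a′ e = h a a′ e
 sumA-indep L (κ′ ∷ κs) κ h a a′ e = topXor-cong L λ i _ → sumA-indep L κs κ h _ _ λ y y≢ →
  cong (λ z → if y ≡ᵇ κ′ then i else z) (e y y≢)

 sumA-vanish : ∀ h κs κ a {f : (ℕ → ℕ) → Bool} → κ ∈ κs → (∀ a a′ → (∀ y → y ≢ κ → a y ≡ a′ y) → f a ≡ f a′) →
  sumA (h + h) κs a f ≡ false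
 sumA-vanish h (κ ∷ κs) κ a (here refl) indep =
  trans (topXor-cong (h + h) λ i _ → sumA-indep (h + h) κs κ indep _ a λ y y≢ →
          cong (λ z → if z then i else a y) (≡ᵇ-false y≢))
        (topXor-even h _)
 sumA-vanish h (κ′ ∷ κs) κ a (there κ∈) indep =
  trans (topXor-cong (h + h) λ i _ → sumA-vanish h κs κ _ κ∈ indep) (topXor-false (h + h))

 -- Rainbow sets

 WeaklyDescending : List ℕ → Set
 WeaklyDescending []      = ⊤
 WeaklyDescending (x ∷ w) = All (_≤ x) w × WeaklyDescending w

 covered-length : ∀ w j → WeaklyDescending w → (∀ p → p < j → p ∈ w) → j ≤ length w
 covered-tail : ∀ x w j → WeaklyDescending (x ∷ w) → (∀ p → p < suc j → p ∈ x ∷ w) → ∀ p → p < j → p ∈ w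

 covered-tail x w j (le , _) h p p<j with h p (≤-trans p<j (n≤1+n j)) | h j ≤-refl
 ... | there p∈  | _         = p∈
 ... | here refl | here refl = contradiction p<j (<-irrefl refl)
 ... | here refl | there j∈  = contradiction (≤-trans p<j (All.lookup le j∈)) (<-irrefl refl)

 covered-length w       zero    _  h = z≤n
 covered-length []      (suc j) _  h with h 0 (s≤s z≤n)
 ... | ()
 covered-length (x ∷ w) (suc j) wd h = s≤s (covered-length w j (proj₂ wd) (covered-tail x w j wd h))

 ∈-downFrom : ∀ {p} j → p ∈ downFrom j → p < j
 ∈-downFrom (suc j) (here refl) = ≤-refl
 ∈-downFrom (suc j) (there p∈)  = ≤-trans (∈-downFrom j p∈) (n≤1+n j)

 downFrom-∈ : ∀ {p} j → p < j → p ∈ downFrom j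
 downFrom-∈ {p} (suc j) p< with p ≟ j
 ... | yes refl = here refl
 ... | no ne    = there (downFrom-∈ j (≤∧≢⇒< (s≤s⁻¹ p<) ne))

 covered-≡ : ∀ w j → WeaklyDescending w → (∀ p → p < j → p ∈ w) → length w ≡ j → w ≡ downFrom j
 covered-≡ []      zero    _  h _   = refl
 covered-≡ (x ∷ w) (suc j) wd h len
  with covered-≡ w j (proj₂ wd) (covered-tail x w j wd h) (suc-injective len) | h j ≤-refl
 ... | refl | here refl = refl
 ... | refl | there j∈  = contradiction (∈-downFrom j j∈) (<-irrefl refl)

 sublist-exists : ∀ s l → s ≤ length l → ∃ λ J → J ∈ sublists s l
 sublist-exists zero    l       _        = [] , here refl
 sublist-exists (suc s) (x ∷ l) (s≤s le) with sublist-exists s l le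
 ... | J , J∈ = x ∷ J , ∈-++⁺ˡ (∈-map⁺ (x ∷_) J∈)

 sublist-through : ∀ s l {p} → p ∈ l → suc s ≤ length l → ∃ λ J → J ∈ sublists (suc s) l × p ∈ J
 sublist-through s (x ∷ l) (here refl) (s≤s le) with sublist-exists s l le
 ... | J , J∈ = x ∷ J , ∈-++⁺ˡ (∈-map⁺ (x ∷_) J∈) , here refl
 sublist-through s (x ∷ l) (there p∈) (s≤s le) with suc s ≤? length l
 ... | yes le′ with sublist-through s l p∈ le′
 ...   | J , J∈ , p∈J = J , ∈-++⁺ʳ (map (x ∷_) (sublists s l)) J∈ , p∈J
 sublist-through zero    (x ∷ y ∷ l) (there p∈) (s≤s le) | no ¬le = contradiction (s≤s z≤n) ¬le
 sublist-through (suc s) (x ∷ l)     (there p∈) (s≤s le) | no ¬le with sublist-through s l p∈ le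
 ... | J , J∈ , p∈J = x ∷ J , ∈-++⁺ˡ (∈-map⁺ (x ∷_) J∈) , there p∈J

 _∈ˡ?_ : (J : List ℕ) (ls : List (List ℕ)) → Dec (J ∈ ls)
 J ∈ˡ? ls = Any.any? (List.≡-dec _≟_ J) ls

 missing-block : ∀ e k w → suc e ≤ k → length w ≡ k → WeaklyDescending w → w ≢ downFrom k →
  ∃ λ J → J ∈ sublists (suc e) (downFrom k) × J ∉ sublists (suc e) w
 missing-block e k w e<k len wd ne with all? (_∈ˡ? sublists (suc e) w) (sublists (suc e) (downFrom k))
 ... | yes all = contradiction (covered-≡ w k wd cover len) ne
  where
  cover : ∀ p → p < k → p ∈ w
  cover p p<k with sublist-through e (downFrom k) (downFrom-∈ k p<k) (≤-trans e<k (≤-reflexive (sym (List.length-downFrom k))))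
  ... | J , J∈ , p∈J = All.lookup (sublists-All (suc e) w (All.tabulate λ x∈ → x∈) (All.lookup all J∈)) p∈J
 ... | no ¬all with Data.List.Membership.Propositional.find (All.¬All⇒Any¬ (_∈ˡ? sublists (suc e) w) _ ¬all)
 ...   | J , J∈ , J∉ = J , J∈ , J∉

 sublists-unique : ∀ s l {n} → Descending n l → Unique (sublists s l)
 sublists-unique zero    l        d = [] ∷ []
 sublists-unique (suc s) []       d = []
 sublists-unique (suc s) (u ∷ us) (_ , d) = Unique.++⁺
  (Unique.map⁺ List.∷-injectiveʳ (sublists-unique s us d)) (sublists-unique (suc s) us d)
  λ (p , q) → clash (proj₂ (proj₂ (∈-map⁻ (u ∷_) p))) (sublists-descending (suc s) us d q)
  where
  clash : ∀ {v l} → v ≡ u ∷ l → Descending u v → Data.Empty.⊥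
  clash refl (lt , _) = <-irrefl refl lt

 distinct-map : ∀ (c : List ℕ → ℕ) ls → Unique ls → (∀ {l l′} → l ∈ ls → l′ ∈ ls → c l ≡ c l′ → l ≡ l′) → Distinct (map c ls)
 distinct-map c []       []         inj = tt
 distinct-map c (l ∷ ls) (l∉ ∷ un) inj =
  All.map⁺ (All.tabulate λ l′∈ eq → All.lookup l∉ l′∈ (inj (here refl) (there l′∈) eq)) ,
  distinct-map c ls un λ p q → inj (there p) (there q)

 descending-downFrom : ∀ k → Descending k (downFrom k)
 descending-downFrom zero    = tt
 descending-downFrom (suc k) = ≤-refl , descending-downFrom k

 insertEdge : ∀ {n s} → SizedSubset n s → Hypergraph n s → Hypergraph n s
 insertEdge e G f = if does (f ≟ˢ e) then true else G f

 fromBits : ∀ {n s} → List (SizedSubset n s) → List Bool → Hypergraph n s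
 fromBits (e ∷ es) (b ∷ bs) = if b then insertEdge e (fromBits es bs) else fromBits es bs
 fromBits _        _        = λ _ → false

 assign : ∀ {n s} → List (SizedSubset n s) → List (List Bool) → SizedSubset n s → List Bool
 assign (e ∷ es) (y ∷ ys) f = if does (f ≟ˢ e) then y else assign es ys f
 assign _        _        f = []

 fromBits-∉ : ∀ {n s} es bs {f : SizedSubset n s} → All (f ≢_) es → fromBits es bs f ≡ false
 fromBits-∉ []       bs           f∉ = refl
 fromBits-∉ (e ∷ es) []           f∉ = refl
 fromBits-∉ (e ∷ es) (false ∷ bs) (_ ∷ f∉) = fromBits-∉ es bs f∉
 fromBits-∉ (e ∷ es) (true ∷ bs) {f} (f≢e ∷ f∉) with f ≟ˢ e
 ... | yes f≡e = contradiction f≡e f≢e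
 ... | no _    = fromBits-∉ es bs f∉

 fromBits-∷ : ∀ {n s} (e : SizedSubset n s) es b bs {f} → f ≢ e → fromBits (e ∷ es) (b ∷ bs) f ≡ fromBits es bs f
 fromBits-∷ e es false bs ne = refl
 fromBits-∷ e es true  bs {f} ne with f ≟ˢ e
 ... | yes f≡e = contradiction f≡e ne
 ... | no _    = refl

 fromBits-here : ∀ {n s} (e : SizedSubset n s) es b bs → All (e ≢_) es → fromBits (e ∷ es) (b ∷ bs) e ≡ b
 fromBits-here e es false bs e∉ = fromBits-∉ es bs e∉
 fromBits-here e es true  bs e∉ with e ≟ˢ e
 ... | yes _  = refl
 ... | no ne  = contradiction refl ne

 map-fromBits : ∀ {n s} (es : List (SizedSubset n s)) bs → Unique es → length bs ≡ length es → map (fromBits es bs) es ≡ bs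
 map-fromBits []       []       _         _   = refl
 map-fromBits (e ∷ es) (b ∷ bs) (e∉ ∷ un) len = cong₂ _∷_ (fromBits-here e es b bs e∉)
  (trans (map-∈ es λ f f∈ → fromBits-∷ e es b bs λ { refl → All.lookup e∉ f∈ refl }) (map-fromBits es bs un (suc-injective len)))
  where
  map-∈ : ∀ fs {g h : _ → Bool} → (∀ f → f ∈ fs → g f ≡ h f) → map g fs ≡ map h fs
  map-∈ []       h = refl
  map-∈ (f ∷ fs) h = cong₂ _∷_ (h f (here refl)) (map-∈ fs λ f f∈ → h f (there f∈))

 queryBits-at : ∀ {n s} (c : SizedSubset n s → ℕ) a es its ys → Unique es → map (proj₂ ∘ proj₂) its ≡ map c es →
  ∀ {e} → e ∈ es → fromBits es (queryBits a its ys) e ≡ bitAt (assign es ys e) (a (c e))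
 queryBits-at c a (e₀ ∷ es) (it ∷ its) []       (e∉ ∷ un) eq e∈ = refl
 queryBits-at c a (e₀ ∷ es) ((_ , _ , κ) ∷ its) (y ∷ ys) (e∉ ∷ un) eq {e} e∈ with e ≟ˢ e₀
 ... | yes refl = trans (fromBits-here e es (bitAt y (a κ)) (queryBits a its ys) e∉) (cong (bitAt y ∘ a) (List.∷-injectiveˡ eq))
 ... | no ne with e∈
 ...   | here e≡ = contradiction e≡ ne
 ...   | there e∈′ = trans (fromBits-∷ e₀ es (bitAt y (a κ)) (queryBits a its ys) ne) (queryBits-at c a es its ys un (List.∷-injectiveʳ eq) e∈′)

 Good : ℕ → List Bool → List (List Bool) → Set
 Good L []       []       = ⊤
 Good L (x ∷ xs) (y ∷ ys) = topXor L (bitAt y) ≡ x × Good L xs ys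
 Good L _        _        = Data.Empty.⊥

 good-at : ∀ {n s} L (x : SizedSubset n s → Bool) es ys → Good L (map x es) ys →
  ∀ {e} → e ∈ es → topXor L (bitAt (assign es ys e)) ≡ x e
 good-at L x (e₀ ∷ es) (y ∷ ys) (g , gs) {e} e∈ with e ≟ˢ e₀
 ... | yes refl = g
 ... | no ne with e∈
 ...   | here e≡ = contradiction e≡ ne
 ...   | there e∈′ = good-at L x es ys gs e∈′

 rainbow? : ∀ k w → Dec (w ≡ downFrom k)
 rainbow? k w = List.≡-dec _≟_ w (downFrom k)

 rainbowSum : (k n s m : ℕ) .{{_ : NonZero m}} → (List ℕ → Bool) → List ℕ → Bool
 rainbowSum k n s m X ts =
  sumSub k n λ S → does (rainbow? k (map (_/ m) S)) ∧ allSub s S (λ l → X (map (blockImage m ts) l))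

 module _ (n k e m h : ℕ) .{{_ : NonZero m}} (e<k : e < k) (n≤ : n ≤ (k + k) * m) (Tb : ℕ → Bool) where
  private
    s = suc e
    M = (k + k) * m
    L = h + h
    μ = timesBelow (M ^ e) M
    Js = sublists s (downFrom k)
    κs = map (hcode μ 0) Js

    instance
      M≢0 : NonZero M
      M≢0 = >-nonZero (≤-trans (≤-trans (s≤s z≤n) e<k) (≤-trans (m≤m+n k k) (m≤m*n (k + k) m)))

    k≤M : k ≤ M
    k≤M = ≤-trans (m≤m+n k k) (m≤m*n (k + k) m)

  code-injective : ∀ {v v′} → length v ≡ s → length v′ ≡ s → All (_< M) v → All (_< M) v′ → hcode μ 0 v ≡ hcode μ 0 v′ → v ≡ v′
  code-injective {v} {v′} len len′ b b′ eq =
    proj₂ (hcode-injective {M} {e} v v′ 0 len (trans len (sym len′)) (s≤s z≤n) (s≤s z≤n) b b′ eq)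

  Js-bound : ∀ {J} → J ∈ Js → All (_< M) J
  Js-bound J∈ = All.map (λ lt → ≤-trans lt k≤M) (sublists-All s (downFrom k) (descending-< _ (descending-downFrom k)) J∈)

  blocks-distinct : Distinct κs
  blocks-distinct = distinct-map (hcode μ 0) Js (sublists-unique s (downFrom k) (descending-downFrom k))
    λ p q → code-injective (sublists-length s (downFrom k) p) (sublists-length s (downFrom k) q) (Js-bound p) (Js-bound q)

  module _ (ts : List ℕ) where
    private
      items = bfsItems μ (blockImage m ts) (_/ m) n s
      X : List ℕ → Bool
      X v = Tb (hcode μ 0 v)

    items-keys : map (proj₁ ∘ proj₂) items ≡ map (λ e → hcodeBy μ (blockImage m ts) 0 (edgeLabels e)) (choose n s)
    items-keys = trans (map-∘ items) (trans (cong (map proj₁) (items-choose μ (blockImage m ts) (_/ m) n s)) (sym (map-∘ (choose n s))))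

    items-codes : map (proj₂ ∘ proj₂) items ≡ map (λ e → hcodeBy μ (_/ m) 0 (edgeLabels e)) (choose n s)
    items-codes = trans (map-∘ items) (trans (cong (map proj₂) (items-choose μ (blockImage m ts) (_/ m) n s)) (sym (map-∘ (choose n s))))

    queries-xor : ∀ ys → Good L (map (λ it → Tb (proj₁ (proj₂ it))) items) ys →
      sumA L κs (λ _ → 0) (λ a → parityOf k (fromBits (choose n s) (queryBits a items ys))) ≡ rainbowSum k n s m X ts
    queries-xor ys good =
      trans (sumA-cong L κs _ λ a _ → sumSub-cong k n λ S d _ → bits a S d)
      (trans (sumA-sumSub L κs _ k n _)
      (sumSub-cong k n λ S d len → perSet S d len))
      where
      es = choose n s
      vec : List ℕ → List Bool
      vec = look [] n s (assign es ys)
      c : List ℕ → ℕ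
      c = hcodeBy μ (_/ m) 0
      good′ : Good L (map (λ e → Tb (hcodeBy μ (blockImage m ts) 0 (edgeLabels e))) es) ys
      good′ = subst (λ xs → Good L xs ys)
        (trans (map-∘ items) (trans (cong (map Tb) items-keys) (sym (map-∘ es)))) good
      bits : ∀ a S → Descending n S → allSub s S (look false n s (fromBits es (queryBits a items ys))) ≡
                                      allOf (sublists s S) (λ l → bitAt (vec l) (a (c l)))
      bits a S d = allOf-cong (sublists s S) λ l l∈ →
        go l (descending-labels n s l (sublists-descending s S d l∈) (sublists-length s S l∈))
        where
        go : ∀ l → Σ (SizedSubset n s) (λ e → edgeLabels e ≡ l) →
             look false n s (fromBits es (queryBits a items ys)) l ≡ bitAt (vec l) (a (c l))
        go .(edgeLabels e) (e , refl) = trans (look-labels false (fromBits es (queryBits a items ys)) e)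
          (trans (queryBits-at _ a es items ys (choose-unique n s) items-codes (choose-complete e))
                 (cong (λ y → bitAt y (a (c (edgeLabels e)))) (sym (look-labels [] (assign es ys) e))))
      parts : ∀ S → Descending n S → WeaklyDescending (map (_/ m) S)
      parts S d = weak S d
        where
        weak : ∀ {n} S → Descending n S → WeaklyDescending (map (_/ m) S)
        weak []      _       = tt
        weak (u ∷ S) (_ , d) = All.map⁺ (All.map (λ lt → DM./-monoˡ-≤ m (<⇒≤ lt)) (descending-< S d)) , weak S d
      parts-bound : ∀ S → Descending n S → All (_< M) (map (_/ m) S)
      parts-bound S d = All.map⁺ (All.map (λ {u} lt → ≤-trans (s≤s (DM.m/n≤m u m)) (≤-trans lt n≤)) (descending-< S d))
      perSet : ∀ S → Descending n S → length S ≡ k →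
        sumA L κs (λ _ → 0) (λ a → allOf (sublists s S) (λ l → bitAt (vec l) (a (c l)))) ≡
        does (rainbow? k (map (_/ m) S)) ∧ allSub s S (λ l → X (map (blockImage m ts) l))
      perSet S d len with rainbow? k (map (_/ m) S)
      ... | yes rb = trans
        (sumA-rainbow L (λ l → bitAt (vec l)) c κs (sublists s S) _
          (trans (map-∘ (sublists s S)) (cong (map (hcode μ 0)) (trans (sym (sublists-map (_/ m) s S)) (cong (sublists s) rb))))
          blocks-distinct)
        (allOf-cong (sublists s S) λ l l∈ →
          go l (descending-labels n s l (sublists-descending s S d l∈) (sublists-length s S l∈)))
        where
        go : ∀ l → Σ (SizedSubset n s) (λ e → edgeLabels e ≡ l) → topXor L (bitAt (vec l)) ≡ X (map (blockImage m ts) l)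
        go .(edgeLabels e) (e , refl) = trans (cong (λ y → topXor L (bitAt y)) (look-labels [] (assign es ys) e))
          (good-at L _ es ys good′ (choose-complete e))
      ... | no ¬rb with missing-block e k (map (_/ m) S) e<k (trans (length-map (_/ m) S) len) (parts S d) ¬rb
      ...   | J , J∈ , J∉ = sumA-vanish h κs (hcode μ 0 J) _ (∈-map⁺ (hcode μ 0) J∈) λ a a′ agree →
        allOf-cong (sublists s S) λ l l∈ → cong (bitAt (vec l)) (agree (c l) λ eq →
          J∉ (subst (_∈ sublists s (map (_/ m) S))
            (code-injective (trans (length-map (_/ m) l) (sublists-length s S l∈)) (sublists-length s (downFrom k) J∈)
              (sublists-All s (map (_/ m) S) (parts-bound S d) (mapped l∈)) (Js-bound J∈) eq)
            (mapped l∈)))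
        where
        mapped : ∀ {l} → l ∈ sublists s S → map (_/ m) l ∈ sublists s (map (_/ m) S)
        mapped l∈ = subst (_ ∈_) (sym (sublists-map (_/ m) s S)) (∈-map⁺ (map (_/ m)) l∈)

 -- Summing over all block tuples

 tuples : ℕ → ℕ → List (List ℕ)
 tuples zero    g = [] ∷ []
 tuples (suc j) g = concatMap (λ v → map (_++ v ∷ []) (tuples j g)) (downFrom g)

 paddedTuples : ℕ → List (List ℕ)
 paddedTuples k = map (_++ replicate k 0) (tuples k (k + k))

 xorList-tuples : ∀ j g f → xorList f (tuples (suc j) g) ≡ topXor g (λ v → xorList (λ t → f (t ++ v ∷ [])) (tuples j g))
 xorList-tuples j g f = go g
  where
  go : ∀ g′ → xorList f (concatMap (λ v → map (_++ v ∷ []) (tuples j g)) (downFrom g′)) ≡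
              topXor g′ (λ v → xorList (λ t → f (t ++ v ∷ [])) (tuples j g))
  go zero     = refl
  go (suc g′) = trans (xorList-++ f (map (_++ g′ ∷ []) (tuples j g)) _) (cong₂ _xor_ (xorList-map f _ (tuples j g)) (go g′))

 tuples-length : ∀ j g → All (λ t → length t ≡ j) (tuples j g)
 tuples-length zero    g = refl ∷ []
 tuples-length (suc j) g = All.concat⁺ (All.map⁺ (All.universal (λ v →
  All.map⁺ (All.map (λ {t} len → trans (length-++ t) (trans (cong (_+ 1) len) (+-comm j 1))) (tuples-length j g))) (downFrom g)))

 padded-length : ∀ k → All (λ ts → length ts ≡ k + k) (paddedTuples k)
 padded-length k = All.map⁺ (All.map (λ {t} len → trans (length-++ t) (cong₂ _+_ len (List.length-replicate k))) (tuples-length k (k + k)))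

 length-tuples : ∀ j g → length (tuples j g) ≡ g ^ j
 length-tuples zero    g = refl
 length-tuples (suc j) g = go g
  where
  go : ∀ g′ → length (concatMap (λ v → map (_++ v ∷ []) (tuples j g)) (downFrom g′)) ≡ g′ * g ^ j
  go zero     = refl
  go (suc g′) = trans (length-++ (map (_++ g′ ∷ []) (tuples j g)))
    (cong₂ _+_ (trans (length-map _ (tuples j g)) (length-tuples j g)) (go g′))

 xorList-cong-All : ∀ {A : Set} {P : A → Set} {f g : A → Bool} {xs} → All P xs → (∀ x → P x → f x ≡ g x) → xorList f xs ≡ xorList g xs
 xorList-cong-All []       h = refl
 xorList-cong-All (p ∷ ps) h = cong₂ _xor_ (h _ p) (xorList-cong-All ps h)

 xorList-topXor : ∀ {A : Set} n (f : A → ℕ → Bool) xs → xorList (λ x → topXor n (f x)) xs ≡ topXor n (λ i → xorList (λ x → f x i) xs)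
 xorList-topXor n f []       = sym (topXor-false n)
 xorList-topXor n f (x ∷ xs) = trans (cong (topXor n (f x) xor_) (xorList-topXor n f xs)) (sym (topXor-xor n (f x) _))

 gridSum : ℕ → ℕ → (List ℕ → Bool) → Bool
 gridSum zero    c F = F []
 gridSum (suc j) c F = topXor c λ v → gridSum j c (F ∘ (v ∷_))

 blockSum : ℕ → ℕ → (List ℕ → Bool) → Bool
 blockSum m zero    Φ = Φ []
 blockSum m (suc j) Φ = topXor m λ r → blockSum m j (Φ ∘ (j * m + r ∷_))

 module _ (m : ℕ) .{{_ : NonZero m}} where
  quot-block : ∀ j {r} → r < m → (j * m + r) / m ≡ j
  quot-block j {r} r< = trans (cong (_/ m) (+-comm (j * m) r))
    (trans (DM.+-distrib-/-∣ʳ r (divides-refl j)) (cong₂ _+_ (DM.m<n⇒m/n≡0 r<) (DM.m*n/n≡m j m)))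

  rem-block : ∀ j {r} → r < m → (j * m + r) % m ≡ r
  rem-block j {r} r< = trans (cong (_% m) (+-comm (j * m) r)) (trans (DM.[m+kn]%n≡m%n r j m) (DM.m<n⇒m%n≡m r<))

  nth-++ : ∀ t v zs → nth (t ++ v ∷ zs) (length t) ≡ v
  nth-++ []      v zs = refl
  nth-++ (_ ∷ t) v zs = nth-++ t v zs

  blocks-grid : ∀ g j zs Ψ →
    xorList (λ t → blockSum m j (λ S → Ψ (map (blockImage m (t ++ zs)) S))) (tuples j g) ≡ gridSum j (g * m) Ψ
  blocks-grid g zero    zs Ψ = Bool.xor-identityʳ (Ψ [])
  blocks-grid g (suc j) zs Ψ = trans (xorList-tuples j g _) (trans (topXor-cong g λ v _ →
      trans (xorList-cong-All (tuples-length j g) λ t len → topXor-cong m λ r r< →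
              cong₂ (λ ts u → blockSum m j (λ S → Ψ (u ∷ map (blockImage m ts) S))) (++-assoc t (v ∷ []) zs) (head-image v t len r<))
      (trans (xorList-topXor m _ (tuples j g)) (topXor-cong m λ r _ → blocks-grid g j (v ∷ zs) (Ψ ∘ (v * m + r ∷_)))))
    (sym (topXor-* g m _)))
    where
    head-image : ∀ v t {r} → length t ≡ j → r < m → blockImage m ((t ++ v ∷ []) ++ zs) (j * m + r) ≡ v * m + r
    head-image v t refl r< rewrite quot-block (length t) r< | rem-block (length t) r< | ++-assoc t (v ∷ []) zs | nth-++ t v zs = refl

  rainbow-∷ : ∀ j x w → does (rainbow? (suc j) (x ∷ w)) ≡ does (x ≟ j) ∧ does (rainbow? j w)
  rainbow-∷ j x w = refl

  topXor-≤′ : ∀ {n N} f → n ≤ N → (∀ i → n ≤ i → i < N → f i ≡ false) → topXor N f ≡ topXor n f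
  topXor-≤′ {n} {N} f n≤N h = trans (cong (λ z → topXor z f) (sym (m∸n+n≡m n≤N)))
    (trans (topXor-+ (N ∸ n) n f) (cong (_xor topXor n f)
      (trans (topXor-cong (N ∸ n) λ i i< → h (n + i) (m≤m+n n i)
                (≤-trans (+-monoʳ-< n i<) (≤-reflexive (m+[n∸m]≡n n≤N)))) (topXor-false (N ∸ n)))))

  rainbow-blocks : ∀ j N Φ → j * m ≤ N → sumSub j N (λ S → does (rainbow? j (map (_/ m) S)) ∧ Φ S) ≡ blockSum m j Φ
  rainbow-blocks zero    N Φ le = refl
  rainbow-blocks (suc j) N Φ le = trans (sumSub-suc j N _) (trans (topXor-≤′ g le λ u u≥ _ → off u λ eq →
      <-irrefl refl (≤-trans (≤-trans (≤-reflexive (sym (DM.m*n/n≡m (suc j) m))) (DM./-monoˡ-≤ m u≥)) (≤-reflexive eq)))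
    (trans (topXor-+ m (j * m) g) (trans (cong₂ _xor_
        (topXor-cong m λ r r< → trans (sumSub-cong j (j * m + r) λ S _ _ → on r r< S) (rainbow-blocks j (j * m + r) _ (m≤m+n (j * m) r)))
        (trans (topXor-cong (j * m) λ u u< → off u λ eq → <-irrefl eq (DM.m<n*o⇒m/o<n u<)) (topXor-false (j * m))))
      (Bool.xor-identityʳ _))))
    where
    g : ℕ → Bool
    g u = sumSub j u (λ S → does (rainbow? (suc j) (map (_/ m) (u ∷ S))) ∧ Φ (u ∷ S))
    off : ∀ u → u / m ≢ j → g u ≡ false
    off u ne = sumSub-false j u λ S _ _ → cong (_∧ Φ (u ∷ S))
      (trans (rainbow-∷ j (u / m) (map (_/ m) S)) (cong (_∧ does (rainbow? j (map (_/ m) S))) (dec-false (u / m ≟ j) ne)))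
    on : ∀ r → r < m → ∀ S → does (rainbow? (suc j) (map (_/ m) (j * m + r ∷ S))) ∧ Φ (j * m + r ∷ S) ≡
                              does (rainbow? j (map (_/ m) S)) ∧ Φ (j * m + r ∷ S)
    on r r< S = cong (_∧ Φ (j * m + r ∷ S)) (trans (rainbow-∷ j ((j * m + r) / m) (map (_/ m) S))
      (cong (_∧ does (rainbow? j (map (_/ m) S))) (dec-true ((j * m + r) / m ≟ j) (quot-block j r<))))

  gridSum-false : ∀ j M Ψ → (∀ v → length v ≡ j → All (_< M) v → Ψ v ≡ false) → gridSum j M Ψ ≡ false
  gridSum-false zero    M Ψ h = h [] refl []
  gridSum-false (suc j) M Ψ h = trans (topXor-cong M λ v v< →
    gridSum-false j M (Ψ ∘ (v ∷_)) λ w len b → h (v ∷ w) (cong suc len) (v< ∷ b)) (topXor-false M)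

  grid-descending : ∀ j n M Ψ → n ≤ M → (∀ v → length v ≡ j → All (_< M) v → Ψ v ≡ true → Descending n v) →
    gridSum j M Ψ ≡ sumSub j n Ψ
  grid-descending zero    n M Ψ n≤M h = refl
  grid-descending (suc j) n M Ψ n≤M h = trans
    (topXor-≤′ _ n≤M λ v n≤v v< → gridSum-false j M (Ψ ∘ (v ∷_)) λ w len b → Bool.¬-not λ eq →
      <-irrefl refl (≤-trans (proj₁ (h (v ∷ w) (cong suc len) (v< ∷ b) eq)) n≤v))
    (trans (topXor-cong n λ v v< → let v<M = ≤-trans v< n≤M in
              grid-descending j v M (Ψ ∘ (v ∷_)) (<⇒≤ v<M) λ w len b eq → proj₂ (h (v ∷ w) (cong suc len) (v<M ∷ b) eq))
           (sym (sumSub-suc j n Ψ)))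

 allOf-true : ∀ ls {f l} → allOf ls f ≡ true → l ∈ ls → f l ≡ true
 allOf-true (l ∷ ls) eq (here refl) = Bool.∧-conicalˡ _ _ eq
 allOf-true (l ∷ ls) {f} eq (there l∈) = allOf-true ls (Bool.∧-conicalʳ (f l) _ eq) l∈

 sublists-self : ∀ v → v ∈ sublists (length v) v
 sublists-self []      = here refl
 sublists-self (x ∷ v) = ∈-++⁺ˡ (∈-map⁺ (x ∷_) (sublists-self v))

 sublists-descending⁻ : ∀ s v {n} → 2 + s ≤ length v → (∀ {e} → e ∈ sublists (2 + s) v → Descending n e) → Descending n v
 sublists-descending⁻ s (u ∷ us) (s≤s le) h with 2 + s ≤? length us
 sublists-descending⁻ s (u ∷ u′ ∷ us) (s≤s le) h | yes le′
  with sublists-descending⁻ s (u′ ∷ us) le′ (λ e∈ → h (∈-++⁺ʳ (map (u ∷_) (sublists (suc s) (u′ ∷ us))) e∈))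
     | sublist-exists s us (≤-trans (n≤1+n s) (s≤s⁻¹ le′))
 ... | (_ , d) | J , J∈ with h (∈-++⁺ˡ (∈-map⁺ (u ∷_) (∈-++⁺ˡ (∈-map⁺ (u′ ∷_) J∈))))
 ...   | (u< , u′< , _) = u< , u′< , d
 sublists-descending⁻ s (u ∷ us) (s≤s le) h | no ¬le =
  h (subst (λ z → (u ∷ us) ∈ sublists z (u ∷ us)) (cong suc (≤-antisym (s≤s⁻¹ (≰⇒> ¬le)) le)) (sublists-self (u ∷ us)))

 module _ (n k s₂ m : ℕ) .{{_ : NonZero m}} (s<k : 2 + s₂ < k) (km≤n : k * m ≤ n) (n≤ : n ≤ (k + k) * m)
  (G : Hypergraph n (2 + s₂)) where
  private
    s = 2 + s₂
    M = (k + k) * m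
    μ = timesBelow (M ^ suc s₂) M
    Tb = tabulated (λ _ → false) (baseItems μ n s) (map G (choose n s))
    X : List ℕ → Bool
    X v = Tb (hcode μ 0 v)
    e<k : suc s₂ < k
    e<k = ≤-trans (n≤1+n _) s<k

    key : SizedSubset n s → ℕ
    key e = hcodeBy μ (λ u → u) 0 (edgeLabels e)

    key≡ : ∀ e → key e ≡ hcode μ 0 (edgeLabels e)
    key≡ e = cong (hcode μ 0) (List.map-id (edgeLabels e))

    keys : map (proj₁ ∘ proj₂) (baseItems μ n s) ≡ map key (choose n s)
    keys = trans (map-∘ (baseItems μ n s)) (trans (cong (map proj₁) (items-choose μ (λ u → u) (λ _ → 0) n s)) (sym (map-∘ (choose n s))))

    labels-bound : ∀ (e : SizedSubset n s) → All (_< M) (edgeLabels e)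
    labels-bound e = All.map (λ lt → ≤-trans lt n≤) (descending-< _ (labels-descending (proj₁ e)))

    edge-length : ∀ (e : SizedSubset n s) → length (edgeLabels e) ≡ s
    edge-length (e , p) = trans (labels-length e) p

  X-descending : ∀ v → length v ≡ s → All (_< M) v → X v ≡ true → Descending n v
  X-descending v len b eq with tabulated-out key G (λ _ → false) (choose n s) (baseItems μ n s) keys eq
  ... | inj₂ a with Data.List.Membership.Propositional.find a
  ...   | e , _ , k≡ = subst (Descending n)
    (code-injective n k (suc s₂) m 0 e<k n≤ Tb (edge-length e) len (labels-bound e) b (trans (sym (key≡ e)) k≡))
    (labels-descending (proj₁ e))

  X-labels : ∀ e → X (edgeLabels e) ≡ G e
  X-labels e = tabulated-in key G (λ _ → false) (choose n s) (baseItems μ n s) keys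
    (inj₂ (Data.List.Membership.Propositional.lose (choose-complete e) (key≡ e)))
    λ e′ eq → cong G (sized-≡ (labels-injective _ _
      (code-injective n k (suc s₂) m 0 e<k n≤ Tb (edge-length e′) (edge-length e) (labels-bound e′) (labels-bound e) (trans (sym (key≡ e′)) eq))))

  rainbow-total : xorList (rainbowSum k n s m X) (paddedTuples k) ≡ parityOf k G
  rainbow-total =
    trans (xorList-map _ (_++ replicate k 0) (tuples k (k + k)))
    (trans (xorList-cong (λ t → trans (sumSub-cong k n λ S _ _ → cong (does (rainbow? k (map (_/ m) S)) ∧_)
               (trans (sym (allOf-map (map (blockImage m (t ++ replicate k 0))) (sublists s S) X))
                      (cong (λ ls → allOf ls X) (sym (sublists-map (blockImage m (t ++ replicate k 0)) s S)))))
             (rainbow-blocks m k n (λ S → allSub s (map (blockImage m (t ++ replicate k 0)) S) X) km≤n)) (tuples k (k + k)))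
    (trans (blocks-grid m (k + k) k (replicate k 0) (λ v → allSub s v X))
    (trans (grid-descending m k n M (λ v → allSub s v X) n≤ λ v len b eq →
              sublists-descending⁻ s₂ v (≤-trans (<⇒≤ s<k) (≤-reflexive (sym len))) λ {l} l∈ →
                X-descending l (sublists-length s v l∈) (sublists-All s v b l∈) (allOf-true (sublists s v) eq l∈))
    (sumSub-cong k n λ S d _ → allOf-cong (sublists s S) λ l l∈ →
      go l (descending-labels n s l (sublists-descending s S d l∈) (sublists-length s S l∈))))))
    where
    go : ∀ l → Σ (SizedSubset n s) (λ e → edgeLabels e ≡ l) → X l ≡ look false n s G l
    go .(edgeLabels e) (e , refl) = trans (X-labels e) (sym (look-labels false G e))

 length-sublists : ∀ s l → length (sublists s l) ≡ length l C s
 length-sublists zero    l        = refl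
 length-sublists (suc s) []       = sym (k>n⇒nCk≡0 {0} {suc s} (s≤s z≤n))
 length-sublists (suc s) (u ∷ us) = trans (length-++ (map (u ∷_) (sublists s us)))
  (trans (cong₂ _+_ (trans (length-map (u ∷_) (sublists s us)) (length-sublists s us)) (length-sublists (suc s) us))
         (nCk+nC[k+1]≡[n+1]C[k+1] (length us) s))

 tuples-entries : ∀ j g → All (All (_< g)) (tuples j g)
 tuples-entries zero    g = [] ∷ []
 tuples-entries (suc j) g = go g ≤-refl
  where
  go : ∀ g′ → g′ ≤ g → All (All (_< g)) (concatMap (λ v → map (_++ v ∷ []) (tuples j g)) (downFrom g′))
  go zero     _  = []
  go (suc g′) le = All.++⁺ (All.map⁺ (All.map (λ ps → All.++⁺ ps (le ∷ [])) (tuples-entries j g))) (go g′ (<⇒≤ le))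

 padded-entries : ∀ k → All (All (_≤ k + k)) (paddedTuples k)
 padded-entries k = All.map⁺ (All.map (λ ps → All.++⁺ (All.map <⇒≤ ps) (zeros k)) (tuples-entries k (k + k)))
  where
  zeros : ∀ j → All (_≤ k + k) (replicate j 0)
  zeros zero    = []
  zeros (suc j) = z≤n ∷ zeros j

 sum-phases : ∀ {A : Set} (time : A → ℕ) (total : List A → ℕ) → total [] ≡ 0 → (∀ x xs → total (x ∷ xs) ≡ time x + total xs) →
  ∀ {t} xs → All (λ x → time x ≤ t) xs → total xs ≤ length xs * t
 sum-phases time total h₀ h₁ []       []       = ≤-reflexive h₀
 sum-phases time total h₀ h₁ (x ∷ xs) (p ∷ ps) = ≤-trans (≤-reflexive (h₁ x xs)) (+-mono-≤ p (sum-phases time total h₀ h₁ xs ps))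

 sumSub-empty : ∀ k n Φ → n ℕ.< k → sumSub k n Φ ≡ false
 sumSub-empty (suc k) zero    Φ _         = ≡.refl
 sumSub-empty (suc k) (suc n) Φ (s≤s n<k) = ≡.cong₂ _xor_ (sumSub-empty k n _ n<k) (sumSub-empty (suc k) n Φ (ℕ.m<n⇒m<1+n n<k))

 topXor-head : ∀ n f → topXor (suc n) f ≡ f 0 xor topXor n (f ∘ suc)
 topXor-head zero    f = ≡.refl
 topXor-head (suc n) f = ≡.trans (≡.cong (f (suc n) xor_) (topXor-head n f))
  (≡.trans (≡.sym (Bool.xor-assoc (f (suc n)) (f 0) _))
  (≡.trans (≡.cong (_xor topXor n (f ∘ suc)) (Bool.xor-comm (f (suc n)) (f 0))) (Bool.xor-assoc (f 0) _ _)))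

 not-xor : ∀ a b → not a xor b ≡ not (a xor b)
 not-xor a b = ≡.sym (Bool.not-distribˡ-xor a b)

 topXor-bits : ∀ v → topXor (length v) (bitAt v) ≡ xors v
 topXor-bits []      = ≡.refl
 topXor-bits (b ∷ v) = ≡.trans (topXor-head (length v) (bitAt (b ∷ v))) (≡.cong (b xor_) (topXor-bits v))

 sublists-longer : ∀ s l → length l < s → sublists s l ≡ []
 sublists-longer (suc s) []       _         = ≡.refl
 sublists-longer (suc s) (u ∷ us) (s≤s lt) rewrite sublists-longer s us lt = sublists-longer (suc s) us (ℕ.m<n⇒m<1+n lt)

 sublists-all : ∀ l → sublists (length l) l ≡ l ∷ []
 sublists-all []       = ≡.refl
 sublists-all (u ∷ us) rewrite sublists-all us | sublists-longer (suc (length us)) us ℕ.≤-refl = ≡.refl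

 parity-of-edges : ∀ {n s} (G : Hypergraph n s) → parityOf s G ≡ xorList G (choose n s)
 parity-of-edges {n} {s} G = ≡.trans (≡.sym (xorList-choose n s _)) (xorList-cong single (choose n s))
  where
  single : ∀ e → allSub s (edgeLabels e) (look false n s G) ≡ G e
  single e@(v , v≡s) = ≡.trans (≡.cong (λ ls → allOf ls (look false n s G))
      (≡.subst (λ j → sublists j (edgeLabels e) ≡ edgeLabels e ∷ []) (≡.trans (labels-length v) v≡s) (sublists-all (edgeLabels e))))
    (≡.trans (Bool.∧-identityʳ _) (look-labels false G e))

 xors-map : ∀ {A : Set} (f : A → Bool) xs → xors (map f xs) ≡ xorList f xs
 xors-map f []       = ≡.refl
 xors-map f (x ∷ xs) = ≡.cong (f x xor_) (xors-map f xs)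

 topXor-beyond : ∀ v j → topXor (j + length v) (bitAt v) ≡ topXor (length v) (bitAt v)
 topXor-beyond v zero    = ≡.refl
 topXor-beyond v (suc j) rewrite bitAt-beyond v (j + length v) (ℕ.m≤n+m (length v) j) = topXor-beyond v j

open Discrete

-- Order and expectation

module RealOrder (ℝ : Reals) where
  open Reals ℝ
  open RealFacts ℝ
  open import Algebra.Solver.Ring.NaturalCoefficients.Default R.commutativeSemiring public
    using (solve; _:=_; _:+_; _:*_; con; Polynomial)
  open import Algebra.Properties.Semiring.Mult R.semiring using (×-homo-+; ×1-homo-*)

  num : ∀ {m} → ℕ → Polynomial m
  num zero    = con 0
  num (suc n) = con 1 :+ num n

  private
    irrefl : ∀ {x} → ¬ x < x
    irrefl = irr
      where open import Relation.Binary.Structures using (IsStrictPartialOrder)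
            open IsStrictPartialOrder isStrictPartialOrder renaming (irrefl to irr′)
            irr : ∀ {x} → ¬ x < x
            irr = irr′ R.refl

  ≤-reflexive : ∀ {x y} → x ≈ y → x ≤ʳ y
  ≤-reflexive x≈y y<x = irrefl (<-respˡ (R.sym x≈y) y<x)

  ≤-refl : ∀ {x} → x ≤ʳ x
  ≤-refl = irrefl

  <⇒≤ : ∀ {x y} → x < y → x ≤ʳ y
  <⇒≤ x<y y<x = irrefl (<-trans x<y y<x)

  ≤-trans : ∀ {x y z} → x ≤ʳ y → y ≤ʳ z → x ≤ʳ z
  ≤-trans {y = y} x≤y y≤z z<x with <-cotrans z<x y
  ... | inj₁ z<y = y≤z z<y
  ... | inj₂ y<x = x≤y y<x

  <-≤-trans : ∀ {x y z} → x < y → y ≤ʳ z → x < z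
  <-≤-trans {z = z} x<y y≤z with <-cotrans x<y z
  ... | inj₁ x<z = x<z
  ... | inj₂ z<y = contradiction z<y y≤z

  ≤-<-trans : ∀ {x y z} → x ≤ʳ y → y < z → x < z
  ≤-<-trans {x = x} x≤y y<z with <-cotrans y<z x
  ... | inj₁ y<x = contradiction y<x x≤y
  ... | inj₂ x<z = x<z

  ≤-preorder : Preorder 0ℓ 0ℓ 0ℓ
  ≤-preorder = record { isPreorder = record { isEquivalence = R.isEquivalence ; reflexive = ≤-reflexive ; trans = ≤-trans } }

  open import Relation.Binary.Reasoning.Preorder ≤-preorder public

  +-cancelʳ-< : ∀ z {x y} → x + z < y + z → x < y
  +-cancelʳ-< z {x} {y} h = <-respˡ (cancel x) (<-respʳ (cancel y) (+-monoˡ-< (- z) h))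
    where
    cancel : ∀ x → x + z + (- z) ≈ x
    cancel x = R.trans (R.+-assoc x z (- z)) (R.trans (R.+-congˡ (R.-‿inverseʳ z)) (R.+-identityʳ x))

  +-monoˡ-≤ : ∀ z {x y} → x ≤ʳ y → x + z ≤ʳ y + z
  +-monoˡ-≤ z x≤y h = x≤y (+-cancelʳ-< z h)

  +-mono-≤ : ∀ {x y u v} → x ≤ʳ y → u ≤ʳ v → x + u ≤ʳ y + v
  +-mono-≤ {x} {y} {u} {v} x≤y u≤v = ≤-trans (+-monoˡ-≤ u x≤y)
    (≤-trans (≤-reflexive (R.+-comm y u)) (≤-trans (+-monoˡ-≤ y u≤v) (≤-reflexive (R.+-comm v y))))

  +-nonneg : ∀ {x y} → 0# ≤ʳ x → 0# ≤ʳ y → 0# ≤ʳ x + y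
  +-nonneg {x} {y} 0≤x 0≤y = ≤-trans (≤-reflexive (R.sym (R.+-identityˡ 0#))) (+-mono-≤ 0≤x 0≤y)

  *-nonneg : ∀ {x y} → 0# ≤ʳ x → 0# ≤ʳ y → 0# ≤ʳ x * y
  *-nonneg {x} {y} 0≤x 0≤y xy<0 = ¬¬pos 0≤x λ where
      (inj₂ x≈0) → irrefl (<-respˡ (R.trans (R.*-congʳ x≈0) (R.zeroˡ y)) xy<0)
      (inj₁ 0<x) → ¬¬pos 0≤y λ where
        (inj₂ y≈0) → irrefl (<-respˡ (R.trans (R.*-congˡ y≈0) (R.zeroʳ x)) xy<0)
        (inj₁ 0<y) → irrefl (<-trans (*-pos 0<x 0<y) xy<0)
    where
    open import Data.Sum.Base using (_⊎_)
    ¬¬pos : ∀ {x} → 0# ≤ʳ x → ¬ ¬ (0# < x ⊎ x ≈ 0#)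
    ¬¬pos 0≤x h = h (inj₂ (<-tight 0≤x (λ 0<x → h (inj₁ 0<x))))

  0≤-‿ : ∀ {x y} → x ≤ʳ y → 0# ≤ʳ y - x
  0≤-‿ {x} {y} x≤y = ≤-trans (≤-reflexive (R.sym (R.-‿inverseʳ x))) (+-monoˡ-≤ (- x) x≤y)

  minus-plus : ∀ x y → (y - x) + x ≈ y
  minus-plus x y = R.trans (R.+-assoc y (- x) x) (R.trans (R.+-congˡ (R.-‿inverseˡ x)) (R.+-identityʳ y))

  *-monoˡ-≤ : ∀ {z x y} → 0# ≤ʳ z → x ≤ʳ y → z * x ≤ʳ z * y
  *-monoˡ-≤ {z} {x} {y} 0≤z x≤y = begin
    z * x                    ≈⟨ R.+-identityˡ (z * x) ⟨
    0# + z * x               ≲⟨ +-monoˡ-≤ (z * x) (*-nonneg 0≤z (0≤-‿ x≤y)) ⟩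
    z * (y - x) + z * x      ≈⟨ R.distribˡ z (y - x) x ⟨
    z * ((y - x) + x)        ≈⟨ R.*-congˡ (minus-plus x y) ⟩
    z * y                    ∎

  *-mono-≤ : ∀ {x y u v} → 0# ≤ʳ x → 0# ≤ʳ v → x ≤ʳ y → u ≤ʳ v → x * u ≤ʳ y * v
  *-mono-≤ {x} {y} {u} {v} 0≤x 0≤v x≤y u≤v = ≤-trans (*-monoˡ-≤ 0≤x u≤v)
    (≤-trans (≤-reflexive (R.*-comm x v)) (≤-trans (*-monoˡ-≤ 0≤v x≤y) (≤-reflexive (R.*-comm v y))))

  0≤1 : 0# ≤ʳ 1#
  0≤1 = <⇒≤ 0<1

  ι-+ : ∀ m n → ι (m ℕ.+ n) ≈ ι m + ι n
  ι-+ m n = ×-homo-+ 1# m n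

  ι-* : ∀ m n → ι (m ℕ.* n) ≈ ι m * ι n
  ι-* m n = ×1-homo-* m n

  ι-nonneg : ∀ n → 0# ≤ʳ ι n
  ι-nonneg zero    = ≤-refl
  ι-nonneg (suc n) = <⇒≤ (0<ι n)

  ι-mono : ∀ {m n} → m ℕ.≤ n → ι m ≤ʳ ι n
  ι-mono {m} {n} m≤n = begin
    ι m                    ≈⟨ R.+-identityʳ (ι m) ⟨
    ι m + 0#               ≲⟨ +-mono-≤ ≤-refl (ι-nonneg (n ℕ.∸ m)) ⟩
    ι m + ι (n ℕ.∸ m)      ≈⟨ ι-+ m (n ℕ.∸ m) ⟨
    ι (m ℕ.+ (n ℕ.∸ m))    ≡⟨ ≡.cong ι (ℕ.m+[n∸m]≡n m≤n) ⟩
    ι n                    ∎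

  ι1 : ι 1 ≈ 1#
  ι1 = R.+-identityʳ 1#

  ^-nonneg : ∀ {x} n → 0# ≤ʳ x → 0# ≤ʳ x ^ n
  ^-nonneg zero    0≤x = 0≤1
  ^-nonneg (suc n) 0≤x = *-nonneg 0≤x (^-nonneg n 0≤x)

  ^-mono : ∀ {x y} n → 0# ≤ʳ x → x ≤ʳ y → x ^ n ≤ʳ y ^ n
  ^-mono zero    0≤x x≤y = ≤-refl
  ^-mono (suc n) 0≤x x≤y = *-mono-≤ 0≤x (^-nonneg n (≤-trans 0≤x x≤y)) x≤y (^-mono n 0≤x x≤y)

  ι-^ : ∀ m n → ι (m ℕ.^ n) ≈ ι m ^ n
  ι-^ m zero    = ι1
  ι-^ m (suc n) = R.trans (ι-* m (m ℕ.^ n)) (R.*-congˡ (ι-^ m n))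

  *-cancelˡ-≤ : ∀ {z x y} → 0# < z → z * x ≤ʳ z * y → x ≤ʳ y
  *-cancelˡ-≤ {z} {x} {y} 0<z le y<x = le (0<y-x⇒x<y (<-respʳ eq (*-pos 0<z (x<y⇒0<y-x y<x))))
    where
    open import Algebra.Properties.Ring R.ring using (-‿distribʳ-*)
    eq : z * (x - y) ≈ z * x - z * y
    eq = R.trans (R.distribˡ z x (- y)) (R.+-congˡ (R.sym (-‿distribʳ-* z y)))

module Expectation (ℝ : Reals) where
  open Model ℝ
  open RealFacts ℝ
  open RealOrder ℝ
  open Trees ℝ

  co : Prob → Carrier
  co q = 1# - value q

  p+co : ∀ q → value q + co q ≈ 1#
  p+co q = R.trans (R.+-comm (value q) (co q)) (minus-plus (value q) 1#)

  0≤p : ∀ q → 0# ≤ʳ value q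
  0≤p q = <⇒≤ (0<p q)

  0≤co : ∀ q → 0# ≤ʳ co q
  0≤co q = 0≤-‿ (<⇒≤ (p<1 q))

  E : ∀ {A : Set} → Dist A → (A → Carrier) → Carrier
  E (return a)   F = F a
  E (flip q d e) F = value q * E d F + co q * E e F

  E-bind : ∀ {A B : Set} (d : Dist A) (f : A → Dist B) F → E (d >>= f) F ≈ E d (λ a → E (f a) F)
  E-bind (return a)   f F = R.refl
  E-bind (flip q d e) f F = R.+-cong (R.*-congˡ (E-bind d f F)) (R.*-congˡ (E-bind e f F))

  E-mono : ∀ {A : Set} (d : Dist A) {F G} → (∀ a → F a ≤ʳ G a) → E d F ≤ʳ E d G
  E-mono (return a)   h = h a
  E-mono (flip q d e) h = +-mono-≤ (*-monoˡ-≤ (0≤p q) (E-mono d h)) (*-monoˡ-≤ (0≤co q) (E-mono e h))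

  E-cong : ∀ {A : Set} (d : Dist A) {F G} → (∀ a → F a ≈ G a) → E d F ≈ E d G
  E-cong (return a)   h = h a
  E-cong (flip q d e) h = R.+-cong (R.*-congˡ (E-cong d h)) (R.*-congˡ (E-cong e h))

  E-const : ∀ {A : Set} (d : Dist A) x → E d (λ _ → x) ≈ x
  E-const (return a)   x = R.refl
  E-const (flip q d e) x = R.trans (R.+-cong (R.*-congˡ (E-const d x)) (R.*-congˡ (E-const e x)))
    (R.trans (R.sym (R.distribʳ x (value q) (co q))) (R.trans (R.*-congʳ (p+co q)) (R.*-identityˡ x)))

  E-+ : ∀ {A : Set} (d : Dist A) F G → E d (λ a → F a + G a) ≈ E d F + E d G
  E-+ (return a)   F G = R.refl
  E-+ (flip q d e) F G = R.trans (R.+-cong (R.*-congˡ (E-+ d F G)) (R.*-congˡ (E-+ e F G)))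
    (solve 6 (λ p c a b a′ b′ → p :* (a :+ b) :+ c :* (a′ :+ b′) := (p :* a :+ c :* a′) :+ (p :* b :+ c :* b′)) R.refl
      (value q) (co q) (E d F) (E d G) (E e F) (E e G))

  E-* : ∀ {A : Set} (d : Dist A) x F → E d (λ a → x * F a) ≈ x * E d F
  E-* (return a)   x F = R.refl
  E-* (flip q d e) x F = R.trans (R.+-cong (R.*-congˡ (E-* d x F)) (R.*-congˡ (E-* e x F)))
    (solve 5 (λ p c x a b → p :* (x :* a) :+ c :* (x :* b) := x :* (p :* a :+ c :* b)) R.refl
      (value q) (co q) x (E d F) (E e F))

  E-nonneg : ∀ {A : Set} (d : Dist A) {F} → (∀ a → 0# ≤ʳ F a) → 0# ≤ʳ E d F
  E-nonneg d {F} h = ≤-trans (≤-reflexive (R.sym (E-const d 0#))) (E-mono d h)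

  E-≤1 : ∀ {A : Set} (d : Dist A) {F} → (∀ a → F a ≤ʳ 1#) → E d F ≤ʳ 1#
  E-≤1 d h = ≤-trans (E-mono d h) (≤-reflexive (E-const d 1#))

  indicator : Bool → Carrier
  indicator b = if b then 1# else 0#

  indicator-nonneg : ∀ b → 0# ≤ʳ indicator b
  indicator-nonneg true  = 0≤1
  indicator-nonneg false = ≤-refl

  indicator-≤1 : ∀ b → indicator b ≤ʳ 1#
  indicator-≤1 true  = ≤-refl
  indicator-≤1 false = 0≤1

  Pr≈E : ∀ {A : Set} {P : A → Set} (P? : Unary.Decidable P) (d : Dist A) → Pr P? d ≈ E d (λ a → indicator (does (P? a)))
  Pr≈E P? (return a)   = R.refl
  Pr≈E P? (flip q d e) = R.+-cong (R.*-congˡ (Pr≈E P? d)) (R.*-congˡ (Pr≈E P? e))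

  wrong : ℕ → ℕ → Carrier
  wrong t x = indicator (not (does (x ℕ.≟ t)))

  -- The union bound for two consecutive steps.
  E->>=-wrong : ∀ (d : Dist ℕ) (f : ℕ → Dist ℕ) t u →
    E (d >>= f) (wrong u) ≤ʳ E d (wrong t) + E (f t) (wrong u)
  E->>=-wrong d f t u = begin
    E (d >>= f) (wrong u)                            ≈⟨ E-bind d f (wrong u) ⟩
    E d (λ x → E (f x) (wrong u))                    ≲⟨ E-mono d pointwise ⟩
    E d (λ x → wrong t x + E (f t) (wrong u))        ≈⟨ E-+ d (wrong t) _ ⟩
    E d (wrong t) + E d (λ _ → E (f t) (wrong u))    ≈⟨ R.+-congˡ (E-const d _) ⟩
    E d (wrong t) + E (f t) (wrong u)                ∎
    where
    pointwise : ∀ x → E (f x) (wrong u) ≤ʳ wrong t x + E (f t) (wrong u)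
    pointwise x with x ℕ.≟ t
    ... | yes ≡.refl = ≤-reflexive (≈-lem (ℕ.≡ᵇ⇒≡ x x))
      where
      ≈-lem : _ → E (f x) (wrong u) ≈ wrong x x + E (f x) (wrong u)
      ≈-lem _ rewrite ≡ᵇ-refl x = R.sym (R.+-identityˡ _)
    ... | no ne rewrite ≡ᵇ-false ne = begin
      E (f x) (wrong u)        ≲⟨ E-≤1 (f x) (λ a → indicator-≤1 _) ⟩
      1#                       ≈⟨ R.+-identityʳ 1# ⟨
      1# + 0#                  ≲⟨ +-mono-≤ ≤-refl (E-nonneg (f t) λ a → indicator-nonneg _) ⟩
      1# + E (f t) (wrong u)   ∎

  topSum : ℕ → (ℕ → Carrier) → Carrier
  topSum zero    f = 0#
  topSum (suc j) f = f j + topSum j f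

  sumR : ℕ → List ℕ → (ℕ → ℕ) → ((ℕ → ℕ) → Carrier) → Carrier
  sumR L []       a f = f a
  sumR L (κ ∷ κs) a f = topSum L λ i → sumR L κs (a [ κ ≔ i ]) f

  topSum-mono : ∀ n {f g : ℕ → Carrier} → (∀ i → i ℕ.< n → f i ≤ʳ g i) → topSum n f ≤ʳ topSum n g
  topSum-mono zero    h = ≤-refl
  topSum-mono (suc n) h = +-mono-≤ (h n ℕ.≤-refl) (topSum-mono n λ i i< → h i (ℕ.≤-trans i< (ℕ.n≤1+n n)))

  topSum-const : ∀ n x → topSum n (λ _ → x) ≈ ι n * x
  topSum-const zero    x = R.sym (R.zeroˡ x)
  topSum-const (suc n) x = R.trans (R.+-cong (R.sym (R.*-identityˡ x)) (topSum-const n x)) (R.sym (R.distribʳ x 1# (ι n)))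

  E-topSum : ∀ {A : Set} (d : Dist A) n (f : A → ℕ → Carrier) → E d (λ x → topSum n (f x)) ≈ topSum n (λ i → E d (λ x → f x i))
  E-topSum d zero    f = E-const d 0#
  E-topSum d (suc n) f = R.trans (E-+ d _ _) (R.+-congˡ (E-topSum d n f))

  E-sumR : ∀ {A : Set} (d : Dist A) L κs a (f : A → (ℕ → ℕ) → Carrier) B → (∀ y → a y ℕ.< L) →
    (∀ a → (∀ y → a y ℕ.< L) → E d (λ x → f x a) ≤ʳ B) → E d (λ x → sumR L κs a (f x)) ≤ʳ ι (L ℕ.^ length κs) * B
  E-sumR d L []       a f B a< h = ≤-trans (h a a<) (≤-reflexive (R.sym (R.trans (R.*-congʳ ι1) (R.*-identityˡ B))))
  E-sumR d L (κ ∷ κs) a f B a< h = begin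
    E d (λ x → topSum L (λ i → sumR L κs (a [ κ ≔ i ]) (f x)))   ≈⟨ E-topSum d L _ ⟩
    topSum L (λ i → E d (λ x → sumR L κs (a [ κ ≔ i ]) (f x)))   ≲⟨ topSum-mono L (λ i i< → E-sumR d L κs _ f B (upd< i<) h) ⟩
    topSum L (λ i → ι (L ℕ.^ length κs) * B)                     ≈⟨ topSum-const L _ ⟩
    ι L * (ι (L ℕ.^ length κs) * B)                              ≈⟨ R.*-assoc _ _ _ ⟨
    ι L * ι (L ℕ.^ length κs) * B                                ≈⟨ R.*-congʳ (ι-* L (L ℕ.^ length κs)) ⟨
    ι (L ℕ.^ suc (length κs)) * B                                ∎
    where
    upd< : ∀ {i} → i ℕ.< L → ∀ y → (a [ κ ≔ i ]) y ℕ.< L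
    upd< i< y with y ℕ.≡ᵇ κ
    ... | true  = i<
    ... | false = a< y

  module _ {L : ℕ} (run : (ℕ → ℕ) → Dist (Maybe ℕ)) (par : (ℕ → ℕ) → Bool) (err : (ℕ → ℕ) → Carrier)
    (run-err : ∀ a β → E (run a >>= λ o → return (combine (b2n β) o)) (wrong (b2n (β xor par a))) ≤ʳ err a) where

    queryTree-wrong : ∀ κs a β → E (queryTree L run κs a (b2n β)) (wrong (b2n (β xor sumA L κs a par))) ≤ʳ sumR L κs a err
    queryTree-wrong []       a β = run-err a β
    queryTree-wrong (κ ∷ κs) a β = go L β
      where
      inner : ℕ → Bool
      inner i = sumA L κs (a [ κ ≔ i ]) par
      go : ∀ j β → E (iterate (λ i → queryTree L run κs (a [ κ ≔ i ])) j (b2n β)) (wrong (b2n (β xor topXor j inner)))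
                   ≤ʳ topSum j (λ i → sumR L κs (a [ κ ≔ i ]) err)
      go zero    β rewrite Bool.xor-identityʳ β | ≡ᵇ-refl (b2n β) = ≤-refl
      go (suc j) β = ≤-trans
        (E->>=-wrong (queryTree L run κs (a [ κ ≔ j ]) (b2n β)) _ (b2n (β xor inner j)) _)
        (+-mono-≤ (queryTree-wrong κs (a [ κ ≔ j ]) β)
          (≡.subst (λ z → E (iterate (λ i → queryTree L run κs (a [ κ ≔ i ])) j (b2n (β xor inner j))) (wrong (b2n z)) ≤ʳ _)
            (Bool.xor-assoc β (inner j) (topXor j inner)) (go j (β xor inner j))))

  iid : Prob → ℕ → Dist (List Bool)
  iid q zero    = return []
  iid q (suc N) = flip q (return true) (return false) >>= λ b → iid q N >>= λ bs → return (b ∷ bs)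

  E-bind-return : ∀ {A B : Set} (d : Dist A) (g : A → B) F → E (d >>= λ a → return (g a)) F ≈ E d (λ a → F (g a))
  E-bind-return d g F = E-bind d (λ a → return (g a)) F

  module _ (q : Prob) (L : ℕ) (samp : Bool → Dist (List Bool)) (ρ φ : Carrier) (0≤ρ : 0# ≤ʳ ρ)
    (marginal : ∀ x i → i ℕ.< L → ∀ (F : Bool → Carrier) → (∀ b → 0# ≤ʳ F b) →
      E (samp x) (λ y → F (bitAt y i)) ≤ʳ ρ * (value q * F true + co q * F false))
    (failure : ∀ x → E (samp x) (λ y → indicator (topXor L (bitAt y) xor x)) ≤ʳ φ) where

    queries-ratio : ∀ a → (∀ y → a y ℕ.< L) → ∀ (f : Item → Bool) its (Φ : List Bool → Carrier) → (∀ bs → 0# ≤ʳ Φ bs) →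
      E (sampleAll samp (map f its)) (λ ys → Φ (queryBits a its ys)) ≤ʳ ρ ^ length its * E (iid q (length its)) Φ
    queries-ratio a a< f []                  Φ 0≤Φ = ≤-reflexive (R.sym (R.*-identityˡ _))
    queries-ratio a a< f (it@(_ , _ , c) ∷ its) Φ 0≤Φ = begin
      E (samp (f it) >>= λ v → sampleAll samp (map f its) >>= λ vs → return (v ∷ vs)) (λ ys → Φ (queryBits a (it ∷ its) ys))
        ≈⟨ E-bind (samp (f it)) _ _ ⟩
      E (samp (f it)) (λ v → E (sampleAll samp (map f its) >>= λ vs → return (v ∷ vs)) (λ ys → Φ (queryBits a (it ∷ its) ys)))
        ≈⟨ E-cong (samp (f it)) (λ v → E-bind-return (sampleAll samp (map f its)) (v ∷_) _) ⟩
      E (samp (f it)) (λ v → E (sampleAll samp (map f its)) (λ vs → Φ (bitAt v (a c) ∷ queryBits a its vs)))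
        ≲⟨ E-mono (samp (f it)) (λ v → queries-ratio a a< f its (λ bs → Φ (bitAt v (a c) ∷ bs)) (λ bs → 0≤Φ _)) ⟩
      E (samp (f it)) (λ v → F (bitAt v (a c)))
        ≲⟨ marginal (f it) (a c) (a< c) F (λ b → *-nonneg (^-nonneg (length its) 0≤ρ) (E-nonneg (iid q (length its)) λ bs → 0≤Φ _)) ⟩
      ρ * (value q * F true + co q * F false)
        ≈⟨ solve 6 (λ r s p c a b → r :* (p :* (s :* a) :+ c :* (s :* b)) := (r :* s) :* (p :* a :+ c :* b)) R.refl
             ρ (ρ ^ length its) (value q) (co q) (G true) (G false) ⟩
      ρ ^ length (it ∷ its) * (value q * G true + co q * G false)
        ≈⟨ R.*-congˡ (R.+-cong (R.*-congˡ (E-bind-return (iid q (length its)) (true ∷_) Φ))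
                               (R.*-congˡ (E-bind-return (iid q (length its)) (false ∷_) Φ))) ⟨
      ρ ^ length (it ∷ its) * E (iid q (length (it ∷ its))) Φ ∎
      where
      G F : Bool → Carrier
      G b = E (iid q (length its)) (λ bs → Φ (b ∷ bs))
      F b = ρ ^ length its * G b

    goodᵇ : List Bool → List (List Bool) → Bool
    goodᵇ []       []       = true
    goodᵇ (x ∷ xs) (y ∷ ys) = not (topXor L (bitAt y) xor x) ∧ goodᵇ xs ys
    goodᵇ _        _        = false

    goodᵇ⇒Good : ∀ xs ys → goodᵇ xs ys ≡ true → Good L xs ys
    goodᵇ⇒Good []       []       _  = tt
    goodᵇ⇒Good (x ∷ xs) (y ∷ ys) eq =
      xor-false (topXor L (bitAt y)) x (Bool.∧-conicalˡ _ _ eq) , goodᵇ⇒Good xs ys (Bool.∧-conicalʳ (not (topXor L (bitAt y) xor x)) _ eq)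
      where
      xor-false : ∀ a b → not (a xor b) ≡ true → a ≡ b
      xor-false true  true  _ = ≡.refl
      xor-false false false _ = ≡.refl

    indicator-∧ : ∀ a b → indicator (not (not a ∧ b)) ≤ʳ indicator a + indicator (not b)
    indicator-∧ true  b = ≤-trans (≤-reflexive (R.sym (R.+-identityʳ 1#))) (+-mono-≤ ≤-refl (indicator-nonneg (not b)))
    indicator-∧ false b = ≤-reflexive (R.sym (R.+-identityˡ _))

    samples-bad : ∀ xs → E (sampleAll samp xs) (λ ys → indicator (not (goodᵇ xs ys))) ≤ʳ ι (length xs) * φ
    samples-bad []       = ≤-reflexive (R.sym (R.zeroˡ φ))
    samples-bad (x ∷ xs) = begin
      E (samp x >>= λ v → sampleAll samp xs >>= λ vs → return (v ∷ vs)) (λ ys → indicator (not (goodᵇ (x ∷ xs) ys)))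
        ≈⟨ R.trans (E-bind (samp x) _ _) (E-cong (samp x) λ v → E-bind-return (sampleAll samp xs) (v ∷_) _) ⟩
      E (samp x) (λ v → E (sampleAll samp xs) (λ vs → indicator (not (not (topXor L (bitAt v) xor x) ∧ goodᵇ xs vs))))
        ≲⟨ E-mono (samp x) (λ v → E-mono (sampleAll samp xs) λ vs → indicator-∧ (topXor L (bitAt v) xor x) (goodᵇ xs vs)) ⟩
      E (samp x) (λ v → E (sampleAll samp xs) (λ vs → indicator (topXor L (bitAt v) xor x) + indicator (not (goodᵇ xs vs))))
        ≈⟨ E-cong (samp x) (λ v → R.trans (E-+ (sampleAll samp xs) _ _) (R.+-congʳ (E-const (sampleAll samp xs) _))) ⟩
      E (samp x) (λ v → indicator (topXor L (bitAt v) xor x) + E (sampleAll samp xs) (λ vs → indicator (not (goodᵇ xs vs))))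
        ≈⟨ R.trans (E-+ (samp x) _ _) (R.+-congˡ (E-const (samp x) _)) ⟩
      E (samp x) (λ v → indicator (topXor L (bitAt v) xor x)) + E (sampleAll samp xs) (λ vs → indicator (not (goodᵇ xs vs)))
        ≲⟨ +-mono-≤ (failure x) (samples-bad xs) ⟩
      φ + ι (length xs) * φ
        ≈⟨ R.+-congʳ (R.*-identityˡ φ) ⟨
      1# * φ + ι (length xs) * φ
        ≈⟨ R.distribʳ φ 1# (ι (length xs)) ⟨
      ι (length (x ∷ xs)) * φ ∎

    phase-wrong : ∀ (f : Item → Bool) its (run : List (List Bool) → (ℕ → ℕ) → Dist (Maybe ℕ))
      (par : List (List Bool) → (ℕ → ℕ) → Bool) (err : List Bool → Carrier) (Q : Bool) κs ε →
      (∀ bs → 0# ≤ʳ err bs) → 0 ℕ.< L →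
      (∀ ys a β → E (run ys a >>= λ o → return (combine (b2n β) o)) (wrong (b2n (β xor par ys a))) ≤ʳ err (queryBits a its ys)) →
      (∀ ys → Good L (map f its) ys → sumA L κs (λ _ → 0) (par ys) ≡ Q) →
      E (iid q (length its)) err ≤ʳ ε → ∀ β →
      E (sampleAll samp (map f its) >>= λ ys → queryTree L (run ys) κs (λ _ → 0) (b2n β)) (wrong (b2n (β xor Q))) ≤ʳ
        ι (length its) * φ + ι (L ℕ.^ length κs) * (ρ ^ length its * ε)
    phase-wrong f its run par err Q κs ε 0≤err 0<L run-err good-sum iid≤ε β = begin
      E (sampleAll samp xs >>= λ ys → queryTree L (run ys) κs (λ _ → 0) (b2n β)) (wrong (b2n (β xor Q)))
        ≈⟨ E-bind (sampleAll samp xs) _ _ ⟩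
      E (sampleAll samp xs) (λ ys → E (queryTree L (run ys) κs (λ _ → 0) (b2n β)) (wrong (b2n (β xor Q))))
        ≲⟨ E-mono (sampleAll samp xs) pointwise ⟩
      E (sampleAll samp xs) (λ ys → indicator (not (goodᵇ xs ys)) + sumR L κs (λ _ → 0) (λ a → err (queryBits a its ys)))
        ≈⟨ E-+ (sampleAll samp xs) _ _ ⟩
      E (sampleAll samp xs) (λ ys → indicator (not (goodᵇ xs ys))) +
      E (sampleAll samp xs) (λ ys → sumR L κs (λ _ → 0) (λ a → err (queryBits a its ys)))
        ≲⟨ +-mono-≤ (≤-trans (samples-bad xs) (≤-reflexive (R.reflexive (≡.cong (λ z → ι z * φ) (length-map f its)))))
             (E-sumR (sampleAll samp xs) L κs _ _ _ (λ _ → 0<L) λ a a< →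
               ≤-trans (queries-ratio a a< f its err 0≤err) (*-monoˡ-≤ (^-nonneg (length its) 0≤ρ) iid≤ε)) ⟩
      ι (length its) * φ + ι (L ℕ.^ length κs) * (ρ ^ length its * ε) ∎
      where
      xs = map f its
      sumR-nonneg : ∀ κs a (F : (ℕ → ℕ) → Carrier) → (∀ a → 0# ≤ʳ F a) → 0# ≤ʳ sumR L κs a F
      sumR-nonneg []       a F h = h a
      sumR-nonneg (κ ∷ κs) a F h = go L
        where
        go : ∀ j → 0# ≤ʳ topSum j (λ i → sumR L κs (a [ κ ≔ i ]) F)
        go zero    = ≤-refl
        go (suc j) = +-nonneg (sumR-nonneg κs _ F h) (go j)
      pointwise : ∀ ys → E (queryTree L (run ys) κs (λ _ → 0) (b2n β)) (wrong (b2n (β xor Q))) ≤ʳ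
                         indicator (not (goodᵇ xs ys)) + sumR L κs (λ _ → 0) (λ a → err (queryBits a its ys))
      pointwise ys with goodᵇ xs ys in eq
      ... | false = begin
        E (queryTree L (run ys) κs (λ _ → 0) (b2n β)) (wrong (b2n (β xor Q)))
          ≲⟨ E-≤1 (queryTree L (run ys) κs (λ _ → 0) (b2n β)) (λ _ → indicator-≤1 _) ⟩
        1#       ≈⟨ R.+-identityʳ 1# ⟨
        1# + 0#  ≲⟨ +-mono-≤ ≤-refl (sumR-nonneg κs _ _ λ a → 0≤err _) ⟩
        1# + sumR L κs (λ _ → 0) (λ a → err (queryBits a its ys)) ∎
      ... | true = begin
        E (queryTree L (run ys) κs (λ _ → 0) (b2n β)) (wrong (b2n (β xor Q)))
          ≡⟨ ≡.cong (λ z → E (queryTree L (run ys) κs (λ _ → 0) (b2n β)) (wrong (b2n (β xor z)))) (≡.sym (good-sum ys (goodᵇ⇒Good xs ys eq))) ⟩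
        E (queryTree L (run ys) κs (λ _ → 0) (b2n β)) (wrong (b2n (β xor sumA L κs (λ _ → 0) (par ys))))
          ≲⟨ queryTree-wrong (run ys) (par ys) _ (run-err ys) κs _ β ⟩
        sumR L κs (λ _ → 0) (λ a → err (queryBits a its ys))
          ≈⟨ R.+-identityˡ _ ⟨
        0# + sumR L κs (λ _ → 0) (λ a → err (queryBits a its ys)) ∎

  -- The samplers of the definitions are local; they are reached by
  -- generalising the enumeration of the edges to a variable.
  module _ {n s : ℕ} where
    private
      sample-iid : ∀ q (sample : List (SizedSubset n s) → Dist (Hypergraph n s)) → sample [] ≡ return (λ _ → false) →
        (∀ e es → sample (e ∷ es) ≡ (sample es >>= λ G → flip q (return (insertEdge e G)) (return G))) →
        ∀ es F → E (sample es) F ≈ E (iid q (length es)) (λ bs → F (fromBits es bs))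
      sample-iid q sample eq₀ eq₁ []       F rewrite eq₀ = R.refl
      sample-iid q sample eq₀ eq₁ (e ∷ es) F rewrite eq₁ e es = R.trans (E-bind (sample es) _ F)
        (R.trans (E-+ (sample es) _ _) (R.+-cong
          (R.trans (E-* (sample es) (value q) _) (R.*-congˡ (R.trans (sample-iid q sample eq₀ eq₁ es (λ G → F (insertEdge e G)))
            (R.sym (E-bind-return (iid q (length es)) (true ∷_) _)))))
          (R.trans (E-* (sample es) (co q) F) (R.*-congˡ (R.trans (sample-iid q sample eq₀ eq₁ es F)
            (R.sym (E-bind-return (iid q (length es)) (false ∷_) _)))))))

      bits-map : ∀ (G : Hypergraph n s) (bits : List (SizedSubset n s) → ℕ → ℕ) → (∀ i → bits [] i ≡ 0) →
        (∀ e es → bits (e ∷ es) 0 ≡ b2n (G e)) → (∀ e es i → bits (e ∷ es) (suc i) ≡ bits es i) →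
        ∀ es i → bits es i ≡ b2n (bitAt (map G es) i)
      bits-map G bits h₀ h₁ h₂ []       i       = h₀ i
      bits-map G bits h₀ h₁ h₂ (e ∷ es) zero    = h₁ e es
      bits-map G bits h₀ h₁ h₂ (e ∷ es) (suc i) = ≡.trans (h₂ e es i) (bits-map G bits h₀ h₁ h₂ es i)

      mutual
        localSample : Prob → List (SizedSubset n s) → Dist (Hypergraph n s)
        localSample q = _

        localSample≡ : ∀ q → erdősRényi n q s ≡ localSample q (choose n s)
        localSample≡ q with choose n s
        ... | es = ≡.refl

      mutual
        localBits : Density → Hypergraph n s → List (SizedSubset n s) → ℕ → ℕ
        localBits D G = _

        localBits≡ : ∀ D (G : Hypergraph n s) → Config.mem (initial D G) ≡ localBits D G (choose n s)
        localBits≡ D G with choose n s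
        ... | es = ≡.refl

    erdősRényi-iid : ∀ q (F : Hypergraph n s → Carrier) →
      E (erdősRényi n q s) F ≈ E (iid q (length (choose n s))) (λ bs → F (fromBits (choose n s) bs))
    erdősRényi-iid q F = R.trans (R.reflexive (≡.cong (λ d → E d F) (localSample≡ q)))
      (sample-iid q (localSample q) ≡.refl (λ _ _ → ≡.refl) (choose n s) F)

    initial-mem : ∀ (D : Density) (G : Hypergraph n s) i →
      Config.mem (initial D G) i ≡ b2n (bitAt (map G (choose n s)) i)
    initial-mem D G i = ≡.trans (≡.cong (λ f → f i) (localBits≡ D G))
      (bits-map G (localBits D G) (λ _ → ≡.refl) (λ _ _ → ≡.refl) (λ _ _ _ → ≡.refl) (choose n s) i)

-- The distribution of the sampled vectors

module SamplerProb (ℝ : Reals) (q : Model.Prob ℝ) where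
  open Model ℝ
  open RealFacts ℝ
  open RealOrder ℝ
  open Expectation ℝ
  open Trees ℝ
  open Samplers ℝ q

  mean : (Bool → Carrier) → Carrier
  mean F = value q * F true + co q * F false

  mean-nonneg : ∀ {F} → (∀ b → 0# ≤ʳ F b) → 0# ≤ʳ mean F
  mean-nonneg h = +-nonneg (*-nonneg (0≤p q) (h true)) (*-nonneg (0≤co q) (h false))

  pair-marginal : value q + value q ≈ 1# → ∀ x i → i ℕ.< 2 → ∀ (F : Bool → Carrier) → E (pair x) (λ y → F (bitAt y i)) ≈ 1# * mean F
  pair-marginal half x     0 _ F = R.sym (R.*-identityˡ _)
  pair-marginal half false 1 _ F = R.sym (R.*-identityˡ _)
  pair-marginal half true  1 _ F = R.trans (R.+-comm (value q * F false) (co q * F true))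
    (R.trans (R.+-cong (R.*-congʳ (R.sym p≈co)) (R.*-congʳ p≈co)) (R.sym (R.*-identityˡ _)))
    where
    p≈co : value q ≈ co q
    p≈co = R.trans (R.sym (R.+-identityʳ _)) (R.trans (R.+-congˡ (R.sym (R.-‿inverseʳ (value q))))
      (R.trans (R.sym (R.+-assoc _ _ _)) (R.+-congʳ half)))
  pair-marginal half x (suc (suc i)) (s≤s (s≤s ())) F

  pair-failure : ∀ x → E (pair x) (λ y → indicator (topXor 2 (bitAt y) xor x)) ≈ 0#
  pair-failure x = R.trans (R.+-cong (R.*-congˡ (R.reflexive (≡.cong indicator (lem true x))))
                                     (R.*-congˡ (R.reflexive (≡.cong indicator (lem false x)))))
    (R.trans (R.+-cong (R.zeroʳ _) (R.zeroʳ _)) (R.+-identityˡ 0#))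
    where
    lem : ∀ b x → ((b xor x) xor (b xor false)) xor x ≡ false
    lem true  true  = ≡.refl
    lem true  false = ≡.refl
    lem false true  = ≡.refl
    lem false false = ≡.refl

  tosses : ℕ → List Bool → Dist (List Bool)
  tosses = iterate tossOnto

  parityPr : ℕ → Bool → Carrier
  parityPr zero    b = indicator (not b)
  parityPr (suc j) b = value q * parityPr j (not b) + co q * parityPr j b

  parityPr-nonneg : ∀ j b → 0# ≤ʳ parityPr j b
  parityPr-nonneg zero    b = indicator-nonneg _
  parityPr-nonneg (suc j) b = +-nonneg (*-nonneg (0≤p q) (parityPr-nonneg j (not b))) (*-nonneg (0≤co q) (parityPr-nonneg j b))

  parityPr-sum : ∀ j b → parityPr j b + parityPr j (not b) ≈ 1#
  parityPr-sum zero    true  = R.+-identityˡ 1#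
  parityPr-sum zero    false = R.+-identityʳ 1#
  parityPr-sum (suc j) b = begin-equality′ (Bool.not-involutive b)
    where
    begin-equality′ : not (not b) ≡ b → parityPr (suc j) b + parityPr (suc j) (not b) ≈ 1#
    begin-equality′ eq rewrite eq = R.trans
      (solve 4 (λ p c x y → (p :* y :+ c :* x) :+ (p :* x :+ c :* y) := (p :+ c) :* (x :+ y)) R.refl
        (value q) (co q) (parityPr j b) (parityPr j (not b)))
      (R.trans (R.*-cong (p+co q) (parityPr-sum j b)) (R.*-identityˡ 1#))

  hit : Bool → List Bool → Carrier
  hit x y = indicator (not (xors y xor x))

  tosses-parity : ∀ j v x → E (tosses j v) (hit x) ≈ parityPr j (xors v xor x)
  tosses-parity zero    v x = R.refl
  tosses-parity (suc j) v x = R.+-cong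
    (R.*-congˡ (R.trans (tosses-parity j (true ∷ v) x) (R.reflexive (≡.cong (parityPr j) (not-xor (xors v) x)))))
    (R.*-congˡ (tosses-parity j (false ∷ v) x))

  tosses-old : ∀ j v i x (F : Bool → Carrier) → E (tosses j v) (λ y → F (bitAt y (j ℕ.+ i)) * hit x y) ≈ F (bitAt v i) * parityPr j (xors v xor x)
  tosses-old zero    v i x F = R.refl
  tosses-old (suc j) v i x F = R.trans (R.+-cong (R.*-congˡ (side true)) (R.*-congˡ (side false)))
    (R.trans (solve 5 (λ p c f a b → p :* (f :* a) :+ c :* (f :* b) := f :* (p :* a :+ c :* b)) R.refl
      (value q) (co q) (F (bitAt v i)) _ _) (R.*-congˡ (R.+-congʳ (R.*-congˡ (R.reflexive (≡.cong (parityPr j) (not-xor (xors v) x)))))))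
    where
    side : ∀ b → E (tosses j (b ∷ v)) (λ y → F (bitAt y (suc j ℕ.+ i)) * hit x y) ≈ F (bitAt v i) * parityPr j ((b xor xors v) xor x)
    side b = ≡.subst (λ k → E (tosses j (b ∷ v)) (λ y → F (bitAt y k) * hit x y) ≈ F (bitAt v i) * parityPr j ((b xor xors v) xor x))
      (ℕ.+-suc j i) (tosses-old j (b ∷ v) (suc i) x F)

  joint : ℕ → Bool → (Bool → Carrier) → Carrier
  joint j b F = value q * (F true * parityPr j (not b)) + co q * (F false * parityPr j b)

  tosses-joint : ∀ j v i x (F : Bool → Carrier) → i ℕ.≤ j → E (tosses (suc j) v) (λ y → F (bitAt y i) * hit x y) ≈ joint j (xors v xor x) F
  tosses-joint j v i x F i≤j with i ℕ.≟ j
  ... | yes ≡.refl = R.+-cong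
    (R.*-congˡ (R.trans (old true) (R.*-congˡ (R.reflexive (≡.cong (parityPr j) (not-xor (xors v) x))))))
    (R.*-congˡ (old false))
    where
    old : ∀ b → E (tosses i (b ∷ v)) (λ y → F (bitAt y i) * hit x y) ≈ F b * parityPr i ((b xor xors v) xor x)
    old b = ≡.subst (λ k → E (tosses i (b ∷ v)) (λ y → F (bitAt y k) * hit x y) ≈ F b * parityPr i ((b xor xors v) xor x))
      (ℕ.+-identityʳ i) (tosses-old i (b ∷ v) 0 x F)
  tosses-joint zero    v zero x F z≤n | no ne = contradiction ≡.refl ne
  tosses-joint (suc j) v i    x F i≤j | no ne = R.trans
    (R.+-cong (R.*-congˡ (R.trans (tosses-joint j (true ∷ v) i x F i≤) (R.reflexive (≡.cong (λ b → joint j b F) (not-xor (xors v) x)))))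
              (R.*-congˡ (tosses-joint j (false ∷ v) i x F i≤)))
    (go (Bool.not-involutive (xors v xor x)))
    where
    i≤ = ℕ.s≤s⁻¹ (ℕ.≤∧≢⇒< i≤j ne)
    b = xors v xor x
    go : not (not b) ≡ b → value q * joint j (not b) F + co q * joint j b F ≈ joint (suc j) b F
    go eq rewrite eq = solve 6 (λ p c f g x y →
        p :* (p :* (f :* x) :+ c :* (g :* y)) :+ c :* (p :* (f :* y) :+ c :* (g :* x)) :=
        p :* (f :* (p :* x :+ c :* y)) :+ c :* (g :* (p :* y :+ c :* x))) R.refl
      (value q) (co q) (F true) (F false) (parityPr j b) (parityPr j (not b))

  tosses-marginal : ∀ j v i (F : Bool → Carrier) → i ℕ.≤ j → E (tosses (suc j) v) (λ y → F (bitAt y i)) ≈ mean F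
  tosses-marginal j v i F i≤j = begin′
    where
    pw : ∀ y → F (bitAt y i) ≈ F (bitAt y i) * hit true y + F (bitAt y i) * hit false y
    pw y = R.sym (R.trans (R.sym (R.distribˡ _ _ _)) (R.trans (R.*-congˡ (both (xors y))) (R.*-identityʳ _)))
      where
      both : ∀ b → indicator (not (b xor true)) + indicator (not (b xor false)) ≈ 1#
      both true  = R.+-identityʳ 1#
      both false = R.+-identityˡ 1#
    begin′ : E (tosses (suc j) v) (λ y → F (bitAt y i)) ≈ mean F
    begin′ = R.trans (E-cong (tosses (suc j) v) pw) (R.trans (E-+ (tosses (suc j) v) _ _)
      (R.trans (R.+-cong (tosses-joint j v i true F i≤j) (tosses-joint j v i false F i≤j)) (sum (xors v))))
      where
      sum : ∀ a → joint j (a xor true) F + joint j (a xor false) F ≈ mean F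
      sum a = R.trans (R.reflexive (≡.cong₂ (λ x y → joint j x F + joint j y F) (flip-true a) (Bool.xor-identityʳ a)))
        (go (Bool.not-involutive a))
        where
        flip-true : ∀ a → a xor true ≡ not a
        flip-true true  = ≡.refl
        flip-true false = ≡.refl
        go : not (not a) ≡ a → joint j (not a) F + joint j a F ≈ mean F
        go eq rewrite eq = R.trans
          (solve 6 (λ p c f g x y → (p :* (f :* x) :+ c :* (g :* y)) :+ (p :* (f :* y) :+ c :* (g :* x)) := (x :+ y) :* (p :* f :+ c :* g)) R.refl
            (value q) (co q) (F true) (F false) (parityPr j a) (parityPr j (not a)))
          (R.trans (R.*-congʳ (parityPr-sum j a)) (R.*-identityˡ _))

  parityPr-+ : ∀ {g} j i → (∀ b → parityPr j b ≤ʳ g) → ∀ b → parityPr (i ℕ.+ j) b ≤ʳ g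
  parityPr-+ j zero    h b = h b
  parityPr-+ {g} j (suc i) h b = ≤-trans
    (+-mono-≤ (*-monoˡ-≤ (0≤p q) (parityPr-+ j i h (not b))) (*-monoˡ-≤ (0≤co q) (parityPr-+ j i h b)))
    (≤-reflexive (R.trans (R.sym (R.distribʳ g _ _)) (R.trans (R.*-congʳ (p+co q)) (R.*-identityˡ g))))

  joint-≤ : ∀ {g} j b F → (∀ b → 0# ≤ʳ F b) → (∀ b → parityPr j b ≤ʳ g) → joint j b F ≤ʳ g * mean F
  joint-≤ {g} j b F 0≤F h = ≤-trans
    (+-mono-≤ (*-monoˡ-≤ (0≤p q) (*-monoˡ-≤ (0≤F true) (h (not b)))) (*-monoˡ-≤ (0≤co q) (*-monoˡ-≤ (0≤F false) (h b))))
    (≤-reflexive (solve 5 (λ p c f k g → p :* (f :* g) :+ c :* (k :* g) := g :* (p :* f :+ c :* k)) R.refl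
      (value q) (co q) (F true) (F false) g))

  module _ {L₀ : ℕ} {g : Carrier} (bound : ∀ b → parityPr L₀ b ≤ʳ g) (x : Bool) where
    private
      L = suc L₀
      bound′ : ∀ b → parityPr L b ≤ʳ g
      bound′ = parityPr-+ L₀ 1 bound
      0≤g : 0# ≤ʳ g
      0≤g = ≤-trans (parityPr-nonneg L₀ true) (bound true)

    miss : List Bool → Carrier
    miss y = indicator (xors y xor x)

    attempt-miss : E (attempt L) miss ≤ʳ g
    attempt-miss = ≤-trans (≤-reflexive (R.trans (E-cong (attempt L) λ y → R.reflexive (≡.cong indicator (lem (xors y) x)))
      (tosses-parity L [] (not x)))) (bound′ (not x))
      where
      lem : ∀ a x → a xor x ≡ not (a xor not x)
      lem true  true  = ≡.refl
      lem true  false = ≡.refl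
      lem false true  = ≡.refl
      lem false false = ≡.refl

    retries : ℕ → List Bool → Dist (List Bool)
    retries = iterate (retry L x)

    retries-stable : ∀ R v → xors v xor x ≡ false → retries R v ≡ return v
    retries-stable zero    v eq = ≡.refl
    retries-stable (suc R) v eq rewrite eq = retries-stable R v eq

    -- One more retry: a hit is kept, a miss starts afresh.
    retry-step : ∀ R v (Φ : List Bool → Carrier) →
      E (retries (suc R) v) Φ ≈ Φ v * hit x v + E (attempt L >>= retries R) Φ * miss v
    retry-step R v Φ with xors v xor x in eq
    ... | true  = R.sym (R.trans (R.+-cong (R.zeroʳ _) (R.*-identityʳ _)) (R.+-identityˡ _))
    ... | false rewrite retries-stable R v eq = R.sym (R.trans (R.+-cong (R.*-identityʳ _) (R.zeroʳ _)) (R.+-identityʳ _))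

    reject-step : ∀ R (Φ : List Bool → Carrier) →
      E (reject L (suc R) x) Φ ≈ E (attempt L) (λ v → Φ v * hit x v) + E (reject L R x) Φ * E (attempt L) miss
    reject-step R Φ = R.trans (E-bind (attempt L) _ Φ) (R.trans (E-cong (attempt L) λ v → retry-step R v Φ)
      (R.trans (E-+ (attempt L) _ _) (R.+-congˡ (E-* (attempt L) _ miss))))

    reject-marginal : ∀ {ρ} → 1# ≤ʳ ρ → g + ρ * g ≤ʳ ρ → ∀ R i → i ℕ.< L → ∀ (F : Bool → Carrier) → (∀ b → 0# ≤ʳ F b) →
      E (reject L R x) (λ y → F (bitAt y i)) ≤ʳ ρ * mean F
    reject-marginal {ρ} 1≤ρ fix zero i i< F 0≤F = begin
      E (reject L 0 x) (λ y → F (bitAt y i))  ≈⟨ R.trans (E-bind (attempt L) _ _) (tosses-marginal L₀ [] i F (ℕ.s≤s⁻¹ i<)) ⟩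
      mean F                                  ≈⟨ R.*-identityˡ _ ⟨
      1# * mean F                             ≲⟨ *-mono-≤ 0≤1 (mean-nonneg 0≤F) 1≤ρ ≤-refl ⟩
      ρ * mean F                              ∎
    reject-marginal {ρ} 1≤ρ fix (suc R) i i< F 0≤F = begin
      E (reject L (suc R) x) (λ y → F (bitAt y i))
        ≈⟨ reject-step R _ ⟩
      E (attempt L) (λ v → F (bitAt v i) * hit x v) + E (reject L R x) (λ y → F (bitAt y i)) * E (attempt L) miss
        ≲⟨ +-mono-≤ (≤-trans (≤-reflexive (tosses-joint L₀ [] i x F (ℕ.s≤s⁻¹ i<))) (joint-≤ L₀ x F 0≤F bound))
                    (*-mono-≤ (E-nonneg (reject L R x) λ y → 0≤F (bitAt y i)) 0≤g (reject-marginal 1≤ρ fix R i i< F 0≤F) attempt-miss) ⟩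
      g * mean F + ρ * mean F * g
        ≈⟨ solve 3 (λ g r m → g :* m :+ r :* m :* g := (g :+ r :* g) :* m) R.refl g ρ (mean F) ⟩
      (g + ρ * g) * mean F
        ≲⟨ *-mono-≤ (+-nonneg 0≤g (*-nonneg (≤-trans 0≤1 1≤ρ) 0≤g)) (mean-nonneg 0≤F) fix ≤-refl ⟩
      ρ * mean F ∎

    reject-miss : g ≤ʳ 1# → ∀ R → E (reject L R x) miss ≤ʳ g ^ R
    reject-miss g≤1 zero    = E-≤1 (reject L 0 x) λ _ → indicator-≤1 _
    reject-miss g≤1 (suc R) = begin
      E (reject L (suc R) x) miss
        ≈⟨ reject-step R miss ⟩
      E (attempt L) (λ v → miss v * hit x v) + E (reject L R x) miss * E (attempt L) miss
        ≲⟨ +-mono-≤ (≤-trans (E-mono (attempt L) λ v → ≤-reflexive (clash (xors v xor x))) (≤-reflexive (E-const (attempt L) 0#)))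
             (*-mono-≤ (E-nonneg (reject L R x) λ y → indicator-nonneg (xors y xor x)) 0≤g (reject-miss g≤1 R) attempt-miss) ⟩
      0# + g ^ R * g
        ≈⟨ R.trans (R.+-identityˡ _) (R.*-comm _ g) ⟩
      g ^ suc R ∎
      where
      clash : ∀ b → indicator b * indicator (not b) ≈ 0#
      clash true  = R.zeroʳ _
      clash false = R.zeroˡ _

    tosses-length : ∀ j v → Surely (λ y → length y ≡ j ℕ.+ length v) (tosses j v)
    tosses-length zero    v = ≡.refl
    tosses-length (suc j) v = step true , step false
      where
      step : ∀ b → Surely (λ y → length y ≡ suc j ℕ.+ length v) (tosses j (b ∷ v))
      step b = ≡.subst (λ l → Surely (λ y → length y ≡ l) (tosses j (b ∷ v))) (ℕ.+-suc j (length v)) (tosses-length j (b ∷ v))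

    Surely-bind : ∀ {A B : Set} {P : A → Set} {Q : B → Set} (d : Dist A) {f} → Surely P d → (∀ a → P a → Surely Q (f a)) → Surely Q (d >>= f)
    Surely-bind (return a)    pa        h = h a pa
    Surely-bind (flip _ d d′) (pd , pe) h = Surely-bind d pd h , Surely-bind d′ pe h

    E-monoˢ : ∀ {A : Set} {P : A → Set} (d : Dist A) {F G} → Surely P d → (∀ a → P a → F a ≤ʳ G a) → E d F ≤ʳ E d G
    E-monoˢ (return a)    pa        h = h a pa
    E-monoˢ (flip r d d′) (pd , pe) h = +-mono-≤ (*-monoˡ-≤ (0≤p r) (E-monoˢ d pd h)) (*-monoˡ-≤ (0≤co r) (E-monoˢ d′ pe h))

    attempt-length : Surely (λ y → length y ≡ L) (attempt L)
    attempt-length = ≡.subst (λ l → Surely (λ y → length y ≡ l) (attempt L)) (ℕ.+-identityʳ L) (tosses-length L [])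

    reject-length : ∀ R → Surely (λ y → length y ≡ L) (reject L R x)
    reject-length R = Surely-bind (attempt L) attempt-length (go R)
      where
      go : ∀ R v → length v ≡ L → Surely (λ y → length y ≡ L) (retries R v)
      go zero    v eq = eq
      go (suc R) v eq = Surely-bind (retry L x R v) (once (xors v xor x)) (go R)
        where
        once : ∀ b → Surely (λ y → length y ≡ L) (if b then attempt L else return v)
        once true  = attempt-length
        once false = eq

    reject-failure : g ≤ʳ 1# → ∀ R → E (reject L R x) (λ y → indicator (topXor L (bitAt y) xor x)) ≤ʳ g ^ R
    reject-failure g≤1 R = ≤-trans
      (E-monoˢ (reject L R x) (reject-length R) λ y len →
        ≤-reflexive (R.reflexive (≡.cong (λ b → indicator (b xor x))
          (≡.trans (≡.cong (λ l → topXor l (bitAt y)) (≡.sym len)) (topXor-bits y)))))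
      (reject-miss g≤1 R)

  κ : Carrier
  κ = 1# - ι 4 * (value q * co q)

  κ+4pc : κ + ι 4 * (value q * co q) ≈ 1#
  κ+4pc = minus-plus _ 1#

  square-nonneg : ∀ x → 0# ≤ʳ x * x
  square-nonneg x xx<0 = neither pos neg
    where
    open import Algebra.Properties.Ring R.ring using (-‿distribˡ-*; -‿distribʳ-*; -‿involutive)
    pos : ¬ 0# < x
    pos 0<x = ≤-refl (<-trans xx<0 (*-pos 0<x 0<x))
    neg : ¬ x < 0#
    neg x<0 = ≤-refl (<-trans xx<0 (<-respʳ eq (*-pos 0<-x 0<-x)))
      where
      0<-x : 0# < - x
      0<-x = <-respʳ (R.+-identityˡ (- x)) (x<y⇒0<y-x x<0)
      eq : - x * - x ≈ x * x
      eq = R.trans (R.sym (-‿distribˡ-* x (- x))) (R.trans (R.-‿cong (R.sym (-‿distribʳ-* x x))) (-‿involutive (x * x)))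
    neither : ¬ 0# < x → ¬ x < 0# → Data.Empty.⊥
    neither h h′ = ≤-refl (<-respˡ (R.trans (R.*-congʳ (<-tight h′ h)) (R.zeroˡ x)) xx<0)

  0≤κ : 0# ≤ʳ κ
  0≤κ = 0≤-‿ (begin
    ι 4 * (value q * co q)                      ≈⟨ R.+-identityˡ _ ⟨
    0# + ι 4 * (value q * co q)                 ≲⟨ +-monoˡ-≤ _ (square-nonneg d) ⟩
    d * d + ι 4 * (value q * co q)              ≈⟨ R.+-congˡ (R.*-congˡ (R.*-congʳ p≈)) ⟩
    d * d + ι 4 * ((d + co q) * co q)           ≈⟨ solve 2 (λ d c → d :* d :+ num 4 :* ((d :+ c) :* c) := ((d :+ c) :+ c) :* ((d :+ c) :+ c)) R.refl d (co q) ⟩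
    ((d + co q) + co q) * ((d + co q) + co q)   ≈⟨ R.*-cong (R.+-congʳ p≈) (R.+-congʳ p≈) ⟨
    (value q + co q) * (value q + co q)         ≈⟨ R.*-cong (p+co q) (p+co q) ⟩
    1# * 1#                                     ≈⟨ R.*-identityˡ 1# ⟩
    1#                                          ∎)
    where
    d = value q - co q
    p≈ : value q ≈ d + co q
    p≈ = R.sym (minus-plus (co q) (value q))

  double-parity : ∀ h b → ι 2 * parityPr (h ℕ.+ h) b ≤ʳ 1# + κ ^ h
  double-parity zero b = ≤-trans (*-monoˡ-≤ (ι-nonneg 2) (indicator-≤1 (not b)))
    (≤-reflexive (R.trans (R.*-identityʳ _) (R.+-congˡ (R.+-identityʳ 1#))))
  double-parity (suc h) b rewrite ℕ.+-suc h h = ≤-trans (≤-reflexive two) (≤-trans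
      (+-monoˡ-≤ _ (*-monoˡ-≤ 0≤κ (double-parity h b)))
      (≤-reflexive (R.trans (solve 3 (λ k x y → k :* (con 1 :+ x) :+ y := (k :+ y) :+ k :* x) R.refl κ (κ ^ h) (ι 4 * (value q * co q)))
                            (R.+-congʳ κ+4pc))))
    where
    P P′ : Carrier
    P = parityPr (h ℕ.+ h) b
    P′ = parityPr (h ℕ.+ h) (not b)
    squares : value q * value q + co q * co q + ι 2 * (value q * co q) ≈ κ + ι 4 * (value q * co q)
    squares = R.trans (solve 2 (λ p c → p :* p :+ c :* c :+ num 2 :* (p :* c) := (p :+ c) :* (p :+ c)) R.refl (value q) (co q))
      (R.trans (R.*-cong (p+co q) (p+co q)) (R.trans (R.*-identityˡ 1#) (R.sym κ+4pc)))
    squares′ : value q * value q + co q * co q ≈ κ + ι 2 * (value q * co q)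
    squares′ = +-cancelʳ (ι 2 * (value q * co q)) _ _ (R.trans squares
      (solve 2 (λ k z → k :+ num 4 :* z := (k :+ num 2 :* z) :+ num 2 :* z) R.refl κ (value q * co q)))
      where open import Algebra.Properties.Group R.+-group using () renaming (∙-cancelʳ to +-cancelʳ)
    go : not (not b) ≡ b → ι 2 * parityPr (suc (suc (h ℕ.+ h))) b ≈ κ * (ι 2 * P) + ι 4 * (value q * co q)
    go eq rewrite eq = R.trans
      (solve 4 (λ p c x y → num 2 :* (p :* (p :* x :+ c :* y) :+ c :* (p :* y :+ c :* x)) :=
        num 2 :* ((p :* p :+ c :* c) :* x :+ num 2 :* (p :* c) :* y)) R.refl (value q) (co q) P P′)
      (R.trans (R.*-congˡ (R.+-congʳ (R.*-congʳ squares′)))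
      (R.trans (solve 4 (λ k z x y → num 2 :* ((k :+ num 2 :* z) :* x :+ num 2 :* z :* y) := k :* (num 2 :* x) :+ num 4 :* z :* (x :+ y)) R.refl
                 κ (value q * co q) P P′)
        (R.+-congˡ (R.trans (R.*-congˡ (parityPr-sum (h ℕ.+ h) b)) (R.*-identityʳ _)))))
    two : ι 2 * parityPr (suc (suc (h ℕ.+ h))) b ≈ κ * (ι 2 * P) + ι 4 * (value q * co q)
    two = go (Bool.not-involutive b)

  bernoulli : ∀ n → κ ^ n * (1# + ι n * (ι 4 * (value q * co q))) ≤ʳ 1#
  bernoulli zero    = ≤-reflexive (R.trans (R.*-identityˡ _) (R.trans (R.+-congˡ (R.zeroˡ _)) (R.+-identityʳ 1#)))
  bernoulli (suc n) = ≤-trans (≤-reflexive (R.trans (R.*-congʳ (R.*-comm κ (κ ^ n))) (R.*-assoc _ _ _)))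
    (≤-trans (*-monoˡ-≤ (^-nonneg n 0≤κ) step) (bernoulli n))
    where
    y = ι 4 * (value q * co q)
    0≤y : 0# ≤ʳ y
    0≤y = *-nonneg (ι-nonneg 4) (*-nonneg (0≤p q) (0≤co q))
    step : κ * (1# + ι (suc n) * y) ≤ʳ 1# + ι n * y
    step = begin
      κ * (1# + ι (suc n) * y)                      ≈⟨ R.+-identityʳ _ ⟨
      κ * (1# + ι (suc n) * y) + 0#                 ≲⟨ +-mono-≤ ≤-refl (*-nonneg (*-nonneg (ι-nonneg (suc n)) 0≤y) 0≤y) ⟩
      κ * (1# + ι (suc n) * y) + ι (suc n) * y * y  ≈⟨ solve 3 (λ k i y → k :* (con 1 :+ (con 1 :+ i) :* y) :+ (con 1 :+ i) :* y :* y :=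
                                                           k :+ (k :+ y) :* (y :+ i :* y)) R.refl κ (ι n) y ⟩
      κ + (κ + y) * (y + ι n * y)                   ≈⟨ R.+-congˡ (R.trans (R.*-congʳ κ+4pc) (R.*-identityˡ _)) ⟩
      κ + (y + ι n * y)                             ≈⟨ R.+-assoc _ _ _ ⟨
      (κ + y) + ι n * y                             ≈⟨ R.+-congʳ κ+4pc ⟩
      1# + ι n * y                                  ∎

  module _ {scale : ℕ} (wide : 1# < ι scale * (value q * co q)) where
    5κ≤1 : ι 5 * κ ^ scale ≤ʳ 1#
    5κ≤1 = ≤-trans (≤-reflexive (R.*-comm _ _)) (≤-trans (*-monoˡ-≤ (^-nonneg scale 0≤κ) five) (bernoulli scale))
      where
      five : ι 5 ≤ʳ 1# + ι scale * (ι 4 * (value q * co q))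
      five = begin
        ι 5                                          ≈⟨ solve 0 (num 5 := con 1 :* con 1 :+ num 4 :* con 1) R.refl ⟩
        1# * 1# + ι 4 * 1#                           ≲⟨ +-mono-≤ ≤-refl (*-monoˡ-≤ (ι-nonneg 4) (<⇒≤ wide)) ⟩
        1# * 1# + ι 4 * (ι scale * (value q * co q)) ≈⟨ solve 2 (λ s z → con 1 :* con 1 :+ num 4 :* (s :* z) := con 1 :+ s :* (num 4 :* z)) R.refl (ι scale) (value q * co q) ⟩
        1# + ι scale * (ι 4 * (value q * co q))      ∎

    5κ^≤1 : ∀ j → ι (5 ℕ.^ j) * κ ^ (j ℕ.* scale) ≤ʳ 1#
    5κ^≤1 zero    = ≤-reflexive (R.trans (R.*-identityʳ _) ι1)
    5κ^≤1 (suc j) = begin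
      ι (5 ℕ.* 5 ℕ.^ j) * κ ^ (scale ℕ.+ j ℕ.* scale)            ≈⟨ R.*-cong (ι-* 5 (5 ℕ.^ j)) (^-homo-* κ scale (j ℕ.* scale)) ⟩
      ι 5 * ι (5 ℕ.^ j) * (κ ^ scale * κ ^ (j ℕ.* scale))        ≈⟨ solve 4 (λ a b c d → a :* b :* (c :* d) := (a :* c) :* (b :* d)) R.refl (ι 5) (ι (5 ℕ.^ j)) (κ ^ scale) (κ ^ (j ℕ.* scale)) ⟩
      (ι 5 * κ ^ scale) * (ι (5 ℕ.^ j) * κ ^ (j ℕ.* scale))      ≲⟨ *-mono-≤ (*-nonneg (ι-nonneg 5) (^-nonneg scale 0≤κ)) 0≤1 5κ≤1 (5κ^≤1 j) ⟩
      1# * 1#                                                    ≈⟨ R.*-identityˡ 1# ⟩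
      1#                                                         ∎
      where open import Algebra.Properties.Semiring.Exp R.semiring using (^-homo-*)

-- Numerical bounds

module Bounds (ℝ : Reals) where
  open Model ℝ
  open RealFacts ℝ
  open RealOrder ℝ
  open import Algebra.Properties.CommutativeSemiring.Exp R.commutativeSemiring using (^-distrib-*)

  *-cancelˡ-< : ∀ {z x y} → 0# < z → z * x < z * y → x < y
  *-cancelˡ-< {z} {x} {y} 0<z h = <-≤-trans′ (<-cotrans h (z * y))
    where
    open import Algebra.Properties.Ring R.ring using (-‿distribʳ-*)
    diff : 0# < z * (y - x)
    diff = <-respʳ (R.trans (R.+-congˡ (-‿distribʳ-* z x)) (R.sym (R.distribˡ z y (- x)))) (x<y⇒0<y-x h)
    eq : inv z 0<z * (z * (y - x)) ≈ y - x
    eq = R.trans (R.sym (R.*-assoc _ z _)) (R.trans (R.*-congʳ (R.trans (R.*-comm _ z) (*-inv z 0<z))) (R.*-identityˡ _))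
    <-≤-trans′ : _ → x < y
    <-≤-trans′ _ = 0<y-x⇒x<y (<-respʳ eq (*-pos (inv-pos z 0<z) diff))

  inv-cancel : ∀ {x} (0<x : 0# < x) {y} → x * y ≤ʳ 1# → y ≤ʳ inv x 0<x
  inv-cancel 0<x h = *-cancelˡ-≤ 0<x (≤-trans h (≤-reflexive (R.sym (*-inv _ 0<x))))

  ι-pos : ∀ n → .{{NonZero n}} → 0# < ι n
  ι-pos (suc n) = 0<ι n

  -- The parameters of the rejection sampler, for at most Z edges.
  module Rejection (Z : ℕ) .{{Z≢0 : NonZero Z}} {η : Carrier} (0≤η : 0# ≤ʳ η) (small : ι (6 ℕ.* Z) * η ≤ʳ 1#) where
    instance
      2Z≢0 : NonZero (2 ℕ.* Z)
      2Z≢0 = ℕ.m*n≢0 2 Z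
    half δ ρ g : Carrier
    half = inv (ι 2) (0<ι 1)
    δ    = inv (ι (2 ℕ.* Z)) (ι-pos (2 ℕ.* Z))
    ρ    = 1# + δ
    g    = half * (1# + η)

    2g≈ : ι 2 * g ≈ 1# + η
    2g≈ = R.trans (R.sym (R.*-assoc _ half _)) (R.trans (R.*-congʳ (*-inv (ι 2) (0<ι 1))) (R.*-identityˡ _))

    0≤δ : 0# ≤ʳ δ
    0≤δ = <⇒≤ (inv-pos (ι (2 ℕ.* Z)) (ι-pos (2 ℕ.* Z)))

    1≤ρ : 1# ≤ʳ ρ
    1≤ρ = ≤-trans (≤-reflexive (R.sym (R.+-identityʳ 1#))) (+-mono-≤ ≤-refl 0≤δ)

    3η≤δ : ι 3 * η ≤ʳ δ
    3η≤δ = inv-cancel (ι-pos (2 ℕ.* Z)) (≤-trans (≤-reflexive (R.trans (R.sym (R.*-assoc _ _ η))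
      (R.*-congʳ (R.trans (R.sym (ι-* (2 ℕ.* Z) 3)) (R.reflexive (≡.cong ι (lem Z))))))) small)
      where
      lem : ∀ Z → 2 ℕ.* Z ℕ.* 3 ≡ 6 ℕ.* Z
      lem = solve-∀

    3η≤1 : ι 3 * η ≤ʳ 1#
    3η≤1 = ≤-trans (*-mono-≤ (ι-nonneg 3) 0≤η (ι-mono (ℕ.≤-trans (ℕ.m≤m+n 3 3) (ℕ.m≤m*n 6 Z))) ≤-refl) small

    3g≤2 : ι 3 * g ≤ʳ ι 2
    3g≤2 = *-cancelˡ-≤ (0<ι 1) (begin
      ι 2 * (ι 3 * g)       ≈⟨ solve 3 (λ a b g → a :* (b :* g) := b :* (a :* g)) R.refl (ι 2) (ι 3) g ⟩
      ι 3 * (ι 2 * g)       ≈⟨ R.*-congˡ 2g≈ ⟩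
      ι 3 * (1# + η)        ≈⟨ solve 2 (λ a e → a :* (con 1 :+ e) := a :+ a :* e) R.refl (ι 3) η ⟩
      ι 3 + ι 3 * η         ≲⟨ +-mono-≤ ≤-refl 3η≤1 ⟩
      ι 3 + 1#              ≈⟨ solve 0 (num 3 :+ con 1 := num 2 :* num 2) R.refl ⟩
      ι 2 * ι 2             ∎)

    0≤g : 0# ≤ʳ g
    0≤g = *-nonneg (<⇒≤ (inv-pos (ι 2) (0<ι 1))) (+-nonneg 0≤1 0≤η)

    g≤1 : g ≤ʳ 1#
    g≤1 = *-cancelˡ-≤ (0<ι 2) (≤-trans 3g≤2 (≤-trans (ι-mono (ℕ.n≤1+n 2)) (≤-reflexive (R.sym (R.*-identityʳ _)))))

    fixpoint : g + ρ * g ≤ʳ ρ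
    fixpoint = *-cancelˡ-≤ (0<ι 2) (begin
      ι 3 * (g + (1# + δ) * g)               ≈⟨ solve 3 (λ t g d → t :* (g :+ (con 1 :+ d) :* g) := t :* (num 2 :* g) :+ d :* (t :* g)) R.refl (ι 3) g δ ⟩
      ι 3 * (ι 2 * g) + δ * (ι 3 * g)        ≲⟨ +-mono-≤ (≤-reflexive (R.*-congˡ 2g≈)) (*-monoˡ-≤ 0≤δ 3g≤2) ⟩
      ι 3 * (1# + η) + δ * ι 2               ≈⟨ solve 3 (λ t e d → t :* (con 1 :+ e) :+ d :* num 2 := t :* e :+ (t :+ d :* num 2)) R.refl (ι 3) η δ ⟩
      ι 3 * η + (ι 3 + δ * ι 2)              ≲⟨ +-monoˡ-≤ _ 3η≤δ ⟩
      δ + (ι 3 + δ * ι 2)                    ≈⟨ solve 1 (λ d → d :+ (num 3 :+ d :* num 2) := num 3 :* (con 1 :+ d)) R.refl δ ⟩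
      ι 3 * (1# + δ)                         ∎)

    ρ^-≤ : ∀ j → ι (2 ℕ.* j) * δ ≤ʳ 1# → ρ ^ j ≤ʳ 1# + ι (2 ℕ.* j) * δ
    ρ^-≤ zero    _ = ≤-reflexive (R.sym (R.trans (R.+-congˡ (R.zeroˡ δ)) (R.+-identityʳ 1#)))
    ρ^-≤ (suc j) h = begin
      (1# + δ) * ρ ^ j                               ≲⟨ *-monoˡ-≤ (≤-trans 0≤1 1≤ρ) (ρ^-≤ j h′) ⟩
      (1# + δ) * (1# + ι (2 ℕ.* j) * δ)              ≈⟨ solve 2 (λ d y → (con 1 :+ d) :* (con 1 :+ y) := (con 1 :+ d :+ y) :+ d :* y) R.refl δ (ι (2 ℕ.* j) * δ) ⟩
      (1# + δ + ι (2 ℕ.* j) * δ) + δ * (ι (2 ℕ.* j) * δ) ≲⟨ +-mono-≤ ≤-refl (≤-trans (*-monoˡ-≤ 0≤δ h′) (≤-reflexive (R.*-identityʳ δ))) ⟩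
      (1# + δ + ι (2 ℕ.* j) * δ) + δ                 ≈⟨ solve 2 (λ d i → (con 1 :+ d :+ i :* d) :+ d := con 1 :+ (num 2 :+ i) :* d) R.refl δ (ι (2 ℕ.* j)) ⟩
      1# + (ι 2 + ι (2 ℕ.* j)) * δ                   ≈⟨ R.+-congˡ (R.*-congʳ (R.trans (R.sym (ι-+ 2 (2 ℕ.* j))) (R.reflexive (≡.cong ι (≡.sym (ℕ.*-suc 2 j)))))) ⟩
      1# + ι (2 ℕ.* suc j) * δ                       ∎
      where
      h′ : ι (2 ℕ.* j) * δ ≤ʳ 1#
      h′ = ≤-trans (*-mono-≤ (ι-nonneg (2 ℕ.* j)) 0≤δ (ι-mono (ℕ.*-monoʳ-≤ 2 (ℕ.n≤1+n j))) ≤-refl) h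

    ρ^≤2 : ∀ {j} → j ℕ.≤ Z → ρ ^ j ≤ʳ ι 2
    ρ^≤2 {j} j≤Z = ≤-trans (ρ^-≤ j h) (≤-trans (+-mono-≤ ≤-refl h) (≤-reflexive (R.+-congˡ (R.sym (R.+-identityʳ 1#)))))
      where
      h : ι (2 ℕ.* j) * δ ≤ʳ 1#
      h = ≤-trans (*-mono-≤ (ι-nonneg (2 ℕ.* j)) 0≤δ (ι-mono (ℕ.*-monoʳ-≤ 2 j≤Z)) ≤-refl)
                  (≤-reflexive (*-inv (ι (2 ℕ.* Z)) (ι-pos (2 ℕ.* Z))))

    g^-small : ∀ R m → 2 ℕ.^ R ℕ.* m ℕ.≤ 3 ℕ.^ R → ι m * g ^ R ≤ʳ 1#
    g^-small R m h = *-cancelˡ-≤ (ι-pos (2 ℕ.^ R) {{ℕ.m^n≢0 2 R}}) (begin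
      ι (2 ℕ.^ R) * (ι m * g ^ R)    ≈⟨ R.*-assoc _ _ _ ⟨
      ι (2 ℕ.^ R) * ι m * g ^ R      ≈⟨ R.*-congʳ (ι-* (2 ℕ.^ R) m) ⟨
      ι (2 ℕ.^ R ℕ.* m) * g ^ R      ≲⟨ *-mono-≤ (ι-nonneg (2 ℕ.^ R ℕ.* m)) (^-nonneg R 0≤g) (ι-mono h) ≤-refl ⟩
      ι (3 ℕ.^ R) * g ^ R            ≈⟨ R.*-congʳ (ι-^ 3 R) ⟩
      ι 3 ^ R * g ^ R                ≈⟨ ^-distrib-* (ι 3) g R ⟨
      (ι 3 * g) ^ R                  ≲⟨ ^-mono R (*-nonneg (ι-nonneg 3) 0≤g) 3g≤2 ⟩
      ι 2 ^ R                        ≈⟨ ι-^ 2 R ⟨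
      ι (2 ℕ.^ R)                    ≈⟨ R.*-identityʳ _ ⟨
      ι (2 ℕ.^ R) * 1#               ∎)

  -- log x ≤ log y + (x / y - 1), in a form without subtraction.
  log-quotient : ∀ {x y} (0<x : 0# < x) (0<y : 0# < y) → log x 0<x + 1# ≤ʳ log y 0<y + x * inv y 0<y
  log-quotient {x} {y} 0<x 0<y = begin
    log x 0<x + 1#                         ≈⟨ R.+-congʳ (R.trans (log-cong 0<x (*-pos 0<y 0<z) x≈) (log-* 0<y 0<z)) ⟩
    log y 0<y + log z 0<z + 1#             ≲⟨ +-monoˡ-≤ 1# (+-mono-≤ ≤-refl (log-≤ z 0<z)) ⟩
    log y 0<y + (z - 1#) + 1#              ≈⟨ R.trans (R.+-assoc _ _ _) (R.+-congˡ (minus-plus 1# z)) ⟩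
    log y 0<y + z                          ∎
    where
    z = x * inv y 0<y
    0<z : 0# < z
    0<z = *-pos 0<x (inv-pos y 0<y)
    x≈ : x ≈ y * z
    x≈ = R.sym (R.trans (solve 3 (λ y x i → y :* (x :* i) := x :* (y :* i)) R.refl y x (inv y 0<y))
                        (R.trans (R.*-congˡ (*-inv y 0<y)) (R.*-identityʳ x)))

  +-cancelʳ-≤ : ∀ z {x y} → x + z ≤ʳ y + z → x ≤ʳ y
  +-cancelʳ-≤ z h y<x = h (+-monoˡ-< z y<x)

  log-mono : ∀ {x y} (0<x : 0# < x) (0<y : 0# < y) → x ≤ʳ y → log x 0<x ≤ʳ log y 0<y
  log-mono {x} {y} 0<x 0<y x≤y = +-cancelʳ-≤ 1# (≤-trans (log-quotient 0<x 0<y) (+-mono-≤ ≤-refl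
    (≤-trans (*-mono-≤ (<⇒≤ 0<x) (<⇒≤ (inv-pos y 0<y)) x≤y ≤-refl) (≤-reflexive (*-inv y 0<y)))))

  logℕ-mono : ∀ m n .{{_ : NonZero m}} → m ℕ.≤ n → logℕ m ≤ʳ logℕ n
  logℕ-mono (suc m) (suc n) m≤n = log-mono (0<ι m) (0<ι n) (ι-mono m≤n)

  logℕ-* : ∀ m n .{{m≢0 : NonZero m}} .{{n≢0 : NonZero n}} → logℕ (m ℕ.* n) ≈ logℕ m + logℕ n
  logℕ-* (suc m) (suc n) = R.trans (log-cong (0<ι (n ℕ.+ m ℕ.* suc n)) (*-pos (0<ι m) (0<ι n)) (ι-* (suc m) (suc n))) (log-* (0<ι m) (0<ι n))

  logℕ-1 : logℕ 1 ≈ 0#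
  logℕ-1 = R.trans (log-cong (0<ι 0) 0<1 ι1) log1≈0

  logℕ-^ : ∀ m j .{{_ : NonZero m}} → logℕ (m ℕ.^ j) ≈ ι j * logℕ m
  logℕ-^ m zero    = R.trans logℕ-1 (R.sym (R.zeroˡ _))
  logℕ-^ m (suc j) = R.trans (logℕ-* m (m ℕ.^ j) {{n≢0 = ℕ.m^n≢0 m j}})
    (R.trans (R.+-cong (R.sym (R.*-identityˡ _)) (logℕ-^ m j)) (R.sym (R.distribʳ _ _ _)))

  1≤2log : ∀ k → 2 ℕ.≤ k → 1# ≤ʳ ι 2 * logℕ k
  1≤2log (suc k) 2≤k = +-cancelʳ-≤ 1# (begin
    1# + 1#                                            ≈⟨ solve 0 (con 1 :+ con 1 := num 2 :* (con 0 :+ con 1)) R.refl ⟩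
    ι 2 * (0# + 1#)                                    ≈⟨ R.*-congˡ (R.+-congʳ log1≈0) ⟨
    ι 2 * (log 1# 0<1 + 1#)                            ≲⟨ *-monoˡ-≤ (ι-nonneg 2) (log-quotient 0<1 (0<ι k)) ⟩
    ι 2 * (logℕ (suc k) + 1# * inv (ι (suc k)) (0<ι k)) ≈⟨ solve 2 (λ l i → num 2 :* (l :+ con 1 :* i) := num 2 :* l :+ num 2 :* i) R.refl (logℕ (suc k)) (inv (ι (suc k)) (0<ι k)) ⟩
    ι 2 * logℕ (suc k) + ι 2 * inv (ι (suc k)) (0<ι k) ≲⟨ +-mono-≤ ≤-refl (≤-trans (*-mono-≤ (ι-nonneg 2) (<⇒≤ (inv-pos (ι (suc k)) (0<ι k))) (ι-mono 2≤k) ≤-refl) (≤-reflexive (*-inv (ι (suc k)) (0<ι k)))) ⟩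
    ι 2 * logℕ (suc k) + 1#                            ∎)

  log-ratio : ∀ a b c j .{{_ : NonZero a}} .{{_ : NonZero b}} .{{_ : NonZero c}} → a ℕ.^ j ℕ.≤ c ℕ.* b ℕ.^ j →
    ι j * logℕ a ≤ʳ logℕ c + ι j * logℕ b
  log-ratio a b c j h = ≤-trans (≤-reflexive (R.sym (logℕ-^ a j))) (≤-trans
    (logℕ-mono (a ℕ.^ j) (c ℕ.* b ℕ.^ j) {{ℕ.m^n≢0 a j}} h)
    (≤-reflexive (R.trans (logℕ-* c (b ℕ.^ j) {{n≢0 = ℕ.m^n≢0 b j}}) (R.+-congˡ (logℕ-^ b j)))))

  log-step : ∀ a → ι (suc (suc a)) * logℕ (suc a) + 1# ≤ʳ ι (suc (suc a)) * logℕ (suc (suc a))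
  log-step a = +-cancelʳ-≤ (ι (suc a)) (begin
    ι (suc (suc a)) * logℕ (suc a) + 1# + ι (suc a)     ≈⟨ solve 2 (λ y l → (con 1 :+ y) :* l :+ con 1 :+ y := (con 1 :+ y) :* (l :+ con 1)) R.refl (ι (suc a)) (logℕ (suc a)) ⟩
    ι (suc (suc a)) * (logℕ (suc a) + 1#)               ≲⟨ *-monoˡ-≤ (ι-nonneg (suc (suc a))) (log-quotient (0<ι a) (0<ι (suc a))) ⟩
    ι (suc (suc a)) * (logℕ (suc (suc a)) + ι (suc a) * i) ≈⟨ solve 4 (λ y l x i → y :* (l :+ x :* i) := y :* l :+ x :* (y :* i)) R.refl (ι (suc (suc a))) (logℕ (suc (suc a))) (ι (suc a)) i ⟩
    ι (suc (suc a)) * logℕ (suc (suc a)) + ι (suc a) * (ι (suc (suc a)) * i) ≈⟨ R.+-congˡ (R.trans (R.*-congˡ (*-inv _ (0<ι (suc a)))) (R.*-identityʳ _)) ⟩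
    ι (suc (suc a)) * logℕ (suc (suc a)) + ι (suc a)    ∎)
    where
    i = inv (ι (suc (suc a))) (0<ι (suc a))

  1≤log3 : 1# ≤ʳ logℕ 3
  1≤log3 = +-cancelʳ-≤ (ι 6 * logℕ 5) (≤-trans (≤-reflexive (R.+-comm 1# _)) (≤-trans (log-step 4)
    (log-ratio 6 5 3 6 (ℕ.≤ᵇ⇒≤ (6 ℕ.^ 6) (3 ℕ.* 5 ℕ.^ 6) _))))

  loglog-nonneg : ∀ n → 3 ℕ.≤ n → 0# ≤ʳ loglogℕ n
  loglog-nonneg (suc zero) (s≤s ())
  loglog-nonneg (suc (suc n)) 3≤n = ≤-trans (≤-reflexive (R.sym log1≈0))
    (log-mono 0<1 _ (≤-trans 1≤log3 (logℕ-mono 3 (suc (suc n)) 3≤n)))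

-- The algorithm and its error

findLeast : ∀ {P : ℕ → Set} → (∀ t → Dec (P t)) → ∀ b → P b → ∃ λ t → P t × t ≤ b × (∀ t′ → P t′ → t ≤ t′)
findLeast {P} P? b pb = search b 0 (ℕ.+-identityʳ b) λ _ ()
  where
  search : ∀ fuel i → fuel ℕ.+ i ≡ b → (∀ t → t ℕ.< i → ¬ P t) → ∃ λ t → P t × t ≤ b × (∀ t′ → P t′ → t ≤ t′)
  search zero i eq none = b , pb , ℕ.≤-refl , λ t′ pt → ℕ.≮⇒≥ λ t< → none t′ (ℕ.≤-trans t< (ℕ.≤-reflexive (≡.sym eq))) pt
  search (suc f) i eq none with P? i
  ... | yes pi = i , pi , ℕ.≤-trans (ℕ.m≤n+m i (suc f)) (ℕ.≤-reflexive eq) , λ t′ pt → ℕ.≮⇒≥ λ t< → none t′ t< pt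
  ... | no ¬pi = search f (suc i) (≡.trans (ℕ.+-suc f i) eq) λ t t<si → below-suc t t<si
    where
    below-suc : ∀ t → t ℕ.< suc i → ¬ P t
    below-suc t (s≤s t≤i) pt with t ℕ.≟ i
    ... | yes ≡.refl = ¬pi pt
    ... | no ne = none t (ℕ.≤∧≢⇒< t≤i ne) pt

allBits : ℕ → List (List Bool)
allBits zero    = [] ∷ []
allBits (suc N) = map (true ∷_) (allBits N) ++ map (false ∷_) (allBits N)

allBits-complete : ∀ bs → bs ∈ allBits (length bs)
allBits-complete []           = here ≡.refl
allBits-complete (true  ∷ bs) = ∈-++⁺ˡ (∈-map⁺ (true ∷_) (allBits-complete bs))
allBits-complete (false ∷ bs) = ∈-++⁺ʳ (map (true ∷_) (allBits (length bs))) (∈-map⁺ (false ∷_) (allBits-complete bs))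

module Algorithms (ℝ : Reals) where
  open Model ℝ hiding (_+_; _-_; _*_; _^_; _<_)
  open Model ℝ using () renaming (_+_ to _+ʳ_; _*_ to _*ʳ_; _^_ to _^ʳ_)
  open RealOrder ℝ
  open Expectation ℝ

  upd-cong : ∀ {f g : ℕ → ℕ} → (∀ i → f i ≡ g i) → ∀ {d d′ v w} → d ≡ d′ → v ≡ w → ∀ i → (f [ d ≔ v ]) i ≡ (g [ d′ ≔ w ]) i
  upd-cong h {d} ≡.refl eq i with i ℕ.≡ᵇ d
  ... | true  = eq
  ... | false = h i

  exec-cong : ∀ p P t pc {r r′ m m′} → (∀ i → r i ≡ r′ i) → (∀ i → m i ≡ m′ i) →
    exec p P t ⟨ pc , r , m ⟩ ≡ exec p P t ⟨ pc , r′ , m′ ⟩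
  exec-cong p P zero    pc         hr hm = ≡.refl
  exec-cong p P (suc t) pc {r} {r′} {m} {m′} hr hm with head (drop pc P)
  ... | nothing             = ≡.cong (return ∘ just) (hr 0)
  ... | just halt           = ≡.cong (return ∘ just) (hr 0)
  ... | just (set d v)      = exec-cong p P t (suc pc) (upd-cong hr {d} ≡.refl ≡.refl) hm
  ... | just (add d x y)    = exec-cong p P t (suc pc) (upd-cong hr {d} ≡.refl (≡.cong₂ ℕ._+_ (hr x) (hr y))) hm
  ... | just (sub d x y)    = exec-cong p P t (suc pc) (upd-cong hr {d} ≡.refl (≡.cong₂ ℕ._∸_ (hr x) (hr y))) hm
  ... | just (load d a)     = exec-cong p P t (suc pc) (upd-cong hr {d} ≡.refl (≡.trans (hm (r a)) (≡.cong m′ (hr a)))) hm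
  ... | just (store a x)    = exec-cong p P t (suc pc) hr (upd-cong hm (hr a) (hr x))
  ... | just (jumpZero x l) rewrite hr x = exec-cong p P t _ hr hm
  ... | just (toss d (fixed q)) = ≡.cong₂ (flip q) (exec-cong p P t (suc pc) (upd-cong hr {d} ≡.refl ≡.refl) hm)
                                                   (exec-cong p P t (suc pc) (upd-cong hr {d} ≡.refl ≡.refl) hm)
  ... | just (toss d density)   = ≡.cong₂ (flip p) (exec-cong p P t (suc pc) (upd-cong hr {d} ≡.refl ≡.refl) hm)
                                                   (exec-cong p P t (suc pc) (upd-cong hr {d} ≡.refl ≡.refl) hm)

  exec-halted : ∀ p P t u cfg → Surely (_≢ nothing) (exec p P t cfg) → exec p P (t ℕ.+ u) cfg ≡ exec p P t cfg
  exec-halted p P zero    u cfg h = contradiction ≡.refl h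
  exec-halted p P (suc t) u ⟨ pc , r , m ⟩ with head (drop pc P)
  ... | nothing             = λ _ → ≡.refl
  ... | just halt           = λ _ → ≡.refl
  ... | just (set d v)      = exec-halted p P t u _
  ... | just (add d x y)    = exec-halted p P t u _
  ... | just (sub d x y)    = exec-halted p P t u _
  ... | just (load d a)     = exec-halted p P t u _
  ... | just (store a x)    = exec-halted p P t u _
  ... | just (jumpZero x l) = exec-halted p P t u _
  ... | just (toss d (fixed q)) = λ (h₁ , h₂) → ≡.cong₂ (flip q) (exec-halted p P t u _ h₁) (exec-halted p P t u _ h₂)
  ... | just (toss d density)   = λ (h₁ , h₂) → ≡.cong₂ (flip p) (exec-halted p P t u _ h₁) (exec-halted p P t u _ h₂)

  surely? : ∀ {A : Set} {P : A → Set} → (∀ a → Dec (P a)) → ∀ d → Dec (Surely P d)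
  surely? P? (return a)   = P? a
  surely? P? (flip _ d e) = surely? P? d ×-dec surely? P? e

  surely-just : ∀ {A B : Set} (f : A → B) (d : Dist A) → Surely (_≢ nothing) (d >>= λ x → return (just (f x)))
  surely-just f (return a)   = λ ()
  surely-just f (flip _ d e) = surely-just f d , surely-just f e

  isJust? : ∀ (o : Maybe ℕ) → Dec (o ≢ nothing)
  isJust? nothing  = no λ h → h ≡.refl
  isJust? (just _) = yes λ ()

  module _ (D : Density) {s : ℕ} where
    run-cong : ∀ P t {n} (G G′ : Hypergraph n s) → map G (choose n s) ≡ map G′ (choose n s) → run D P t G ≡ run D P t G′
    run-cong P t {n} G G′ eq = exec-cong (c D n) P t 0 (λ _ → ≡.refl) λ i →
      ≡.trans (initial-mem D G i) (≡.trans (≡.cong (λ bs → b2n (bitAt bs i)) eq) (≡.sym (initial-mem D G′ i)))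

    haltsWithin? : ∀ P n t → Dec (HaltsWithin D P s n t)
    haltsWithin? P n t with all? (λ bs → surely? isJust? (run D P t (fromBits (choose n s) bs))) (allBits (length (choose n s)))
    ... | yes h = yes λ G → ≡.subst (Surely (_≢ nothing))
      (run-cong P t (fromBits (choose n s) (map G (choose n s))) G
        (map-fromBits (choose n s) (map G (choose n s)) (choose-unique n s) (length-map G (choose n s))))
      (All.lookup h (≡.subst (λ l → map G (choose n s) ∈ allBits l) (length-map G (choose n s)) (allBits-complete (map G (choose n s)))))
    ... | no ¬h = no λ h → ¬h (All.universal (λ bs → h (fromBits (choose n s) bs)) _)

    module _ (k : ℕ) (P : Program) (bound : ℕ → ℕ) (tree : ∀ n → Hypergraph n s → Dist ℕ)
      (exec≡tree : ∀ n G u → exec (c D n) P (bound n ℕ.+ u) (initial D G) ≡ (tree n G >>= λ x → return (just x))) where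

      halting : ∀ n → HaltsWithin D P s n (bound n)
      halting n G = ≡.subst (Surely (_≢ nothing))
        (≡.sym (≡.trans (≡.cong (λ t → exec (c D n) P t (initial D G)) (≡.sym (ℕ.+-identityʳ (bound n)))) (exec≡tree n G 0)))
        (surely-just (λ x → x) (tree n G))

      least-time : ∀ n → ∃ λ t → HaltsWithin D P s n t × t ≤ bound n × (∀ t′ → HaltsWithin D P s n t′ → t ≤ t′)
      least-time n = findLeast (haltsWithin? P n) (bound n) (halting n)

      algorithm : Algorithm D s
      algorithm = record
        { program = P
        ; T       = λ n → proj₁ (least-time n)
        ; halts   = λ n → proj₁ (proj₂ (least-time n))
        ; least   = λ n t h → proj₂ (proj₂ (proj₂ (least-time n))) t h }

      algorithm-time : ∀ n → T algorithm n ≤ bound n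
      algorithm-time n = proj₁ (proj₂ (proj₂ (least-time n)))

      algorithm-output : ∀ n (G : Hypergraph n s) → output algorithm G ≡ (tree n G >>= λ x → return (just x))
      algorithm-output n G = ≡.trans (≡.sym (exec-halted (c D n) P (T algorithm n) (bound n ℕ.∸ T algorithm n) (initial D G) (Algorithm.halts algorithm n G)))
        (≡.trans (≡.cong (λ t → exec (c D n) P t (initial D G)) (≡.trans (ℕ.m+[n∸m]≡n (algorithm-time n)) (≡.sym (ℕ.+-identityʳ (bound n)))))
                 (exec≡tree n G 0))

      algorithm-error : ∀ n (G : Hypergraph n s) → errorOn algorithm k G ≈ E (tree n G) (wrong (cliqueParity k G))
      algorithm-error n G = R.trans (Pr≈E (wrong? k) (output algorithm G >>= λ o → return (G , o)))
        (R.trans (E-bind-return (output algorithm G) (λ o → (G , o)) _)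
        (R.trans (R.reflexive (≡.cong (λ d → E d (λ o → indicator (does (wrong? k (G , o))))) (algorithm-output n G)))
        (R.trans (E-bind-return (tree n G) just _) (E-cong (tree n G) λ x → R.reflexive (≡.cong indicator ≡.refl)))))

  errorAt : ∀ {D s n} → Algorithm D s → ℕ → Hypergraph n s → Carrier
  errorAt A k G = E (output A G) λ o → indicator (not (does (Maybe.≡-dec ℕ._≟_ o (just (cliqueParity k G)))))

  averageError≈ : ∀ {D s} (A : Algorithm D s) k n → averageError A k n ≈
    E (iid (c D n) (length (choose n s))) (λ bs → errorAt A k (fromBits (choose n s) bs))
  averageError≈ {D} {s} A k n = R.trans (Pr≈E (wrong? k) (erdősRényi n (c D n) s >>= λ G → output A G >>= λ o → return (G , o)))
    (R.trans (E-bind (erdősRényi n (c D n) s) _ _)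
    (R.trans (E-cong (erdősRényi n (c D n) s) λ G → E-bind-return (output A G) (λ o → (G , o)) (λ a → indicator (does (wrong? k a))))
             (erdősRényi-iid {n} {s} (c D n) (errorAt A k))))

  combine-error : ∀ {D s n} (A : Algorithm D s) k (G : Hypergraph n s) β →
    E (output A G >>= λ o → return (Trees.combine ℝ (b2n β) o)) (wrong (b2n (β xor parityOf k G))) ≤ʳ errorAt A k G
  combine-error A k G β = ≤-trans (≤-reflexive (E-bind-return (output A G) _ _)) (E-mono (output A G) pointwise)
    where
    pointwise : ∀ o → wrong (b2n (β xor parityOf k G)) (Trees.combine ℝ (b2n β) o) ≤ʳ
                      indicator (not (does (Maybe.≡-dec ℕ._≟_ o (just (cliqueParity k G)))))
    pointwise nothing  = indicator-≤1 _
    pointwise (just v) with v ℕ.≟ cliqueParity k G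
    ... | no ne rewrite ≡ᵇ-false ne = indicator-≤1 _
    ... | yes eq rewrite eq | ≡ᵇ-refl (cliqueParity k G) | cliqueParity≡ k G | b2n-xor β (parityOf k G) | ≡ᵇ-refl (b2n (β xor parityOf k G)) = ≤-refl

  record Scheme (D : Density) : Set where
    open Language ℝ
    field
      sampler prepare : Cmd
      sampler-reg : ∀ i → writesReg sampler (7 ℕ.+ i) ≡ false
      sampler-arr : ∀ i → (i ℕ.≡ᵇ 10) ≡ false → writesArr sampler i ≡ false
      prepare-reg : All (λ i → writesReg prepare i ≡ false) (8 ∷ 9 ∷ 10 ∷ 13 ∷ 14 ∷ 15 ∷ [])
      prepare-arr : ∀ i → writesArr prepare i ≡ false
      half retries samplerTime prepareTime : ℕ → ℕ
      0<half : ∀ n → 0 ℕ.< half n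
      sample : ℕ → Bool → Dist (List Bool)
      samplerT : ∀ n σ x v → reg σ 12 ≡ half n ℕ.+ half n → reg σ 26 ≡ retries n → reg σ 27 ≡ b2n x → reg σ 24 ≡ v →
        Compiler.Triple ℝ (c D n) sampler σ (samplerTime n) (sample n x) (λ y σ′ →
          (∀ i → i ℕ.< half n ℕ.+ half n → arr σ′ 10 (v ℕ.+ i) ≡ b2n (bitAt y i)) × (∀ i → i ℕ.< v → arr σ′ 10 i ≡ arr σ 10 i))
      prepareT : ∀ n σ → reg σ 8 ≡ n → reg σ 9 ≡ scale D n →
        Compiler.Triple ℝ (c D n) prepare σ (prepareTime n) (return tt) (λ _ σ′ → reg σ′ 12 ≡ half n ℕ.+ half n × reg σ′ 26 ≡ retries n)
      ρ φ : ℕ → Carrier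
      0≤ρ : ∀ n → 0# ≤ʳ ρ n
      marginal : ∀ n x i → i ℕ.< half n ℕ.+ half n → ∀ (F : Bool → Carrier) → (∀ b → 0# ≤ʳ F b) →
        E (sample n x) (λ y → F (bitAt y i)) ≤ʳ ρ n *ʳ (value (c D n) *ʳ F true +ʳ co (c D n) *ʳ F false)
      failure : ∀ n x → E (sample n x) (λ y → indicator (topXor (half n ℕ.+ half n) (bitAt y) xor x)) ≤ʳ φ n

  module FromScheme {D : Density} (S : Scheme D) (s₂ k : ℕ) (s<k : 2 ℕ.+ s₂ ℕ.< k) (A : Algorithm D (2 ℕ.+ s₂)) where
    open Scheme S
    open SetupCommands ℝ using (cliqueC)
    private
      s = 2 ℕ.+ s₂
      instance
        k≢0 : NonZero k
        k≢0 = ℕ.>-nonZero (ℕ.≤-trans (s≤s z≤n) s<k)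

    Js tss : List (List ℕ)
    Js  = sublists s (downFrom k)
    tss = paddedTuples k

    command : Language.Cmd ℝ
    command = cliqueC (program A) sampler prepare (suc s₂) k Js tss

    module At (n : ℕ) (k≤n : k ≤ n) where
      open Main ℝ (c D n)
      open Preparation ℝ (c D n)

      m M L N : ℕ
      m = n ℕ./ k
      M = (k ℕ.+ k) ℕ.* m
      L = half n ℕ.+ half n
      N = length (choose n s)

      instance
        m≢0 : NonZero m
        m≢0 = ℕ.>-nonZero (DM.m≥n⇒m/n>0 k≤n)

      km≤n : k ℕ.* m ≤ n
      km≤n = ℕ.≤-trans (ℕ.≤-reflexive (ℕ.*-comm k m)) (DM.m/n*n≤m n k)

      n≤M : n ≤ M
      n≤M = ℕ.≤-trans (ℕ.≤-reflexive (DM.m≡m%n+[m/n]*n n k)) (ℕ.≤-trans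
        (ℕ.+-mono-≤ (ℕ.≤-trans (ℕ.<⇒≤ (DM.m%n<n n k)) (ℕ.m≤m*n k m)) (ℕ.≤-reflexive (ℕ.*-comm m k)))
        (ℕ.≤-reflexive (≡.sym (ℕ.*-distribʳ-+ m k k))))

      e<k : suc s₂ ℕ.< k
      e<k = ℕ.≤-trans (ℕ.n≤1+n _) s<k

      0<L : 0 ℕ.< L
      0<L = ℕ.≤-trans (0<half n) (ℕ.m≤m+n (half n) (half n))

      module OnGraph (G : Hypergraph n s) where
        bs : List Bool
        bs = map G (choose n s)

        module Rd = Reduction (program A) sampler prepare sampler-reg sampler-arr prepare-reg prepare-arr
          n (scale D n) L (retries n) (samplerTime n) (prepareTime n) (T A n) (sample n) (samplerT n) (prepareT n) (suc s₂) k bs 0<L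

        κs-distinct : Distinct (map (hcode Rd.μ 0) Js)
        κs-distinct = blocks-distinct n k (suc s₂) m 0 e<k n≤M (λ _ → false)

        Js-length : All (λ J → length J ≡ s) Js
        Js-length = All.tabulate λ J∈ → sublists-length s (downFrom k) J∈

        module Ph = Rd.Phs Js Js-length κs-distinct n≤M

        query : List Item → List (List Bool) → (ℕ → ℕ) → Hypergraph n s
        query its ys a = fromBits (choose n s) (queryBits a its ys)

        memOf : List Item → List (List Bool) → (ℕ → ℕ) → ℕ → ℕ
        memOf its ys a = Config.mem (initial D (query its ys a))

        total : ∀ its ys a → Surely (_≢ nothing) (exec (c D n) (program A) (T A n) ⟨ 0 , Rd.Ph.startRegs , memOf its ys a ⟩)
        total its ys a = Algorithm.halts A n (query its ys a)

        tree : Dist ℕ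
        tree = Ph.phasesTree {memOf} total tss 0

        time : ℕ
        time = Rd.reductionTime Js Js-length κs-distinct n≤M {memOf} total tss

        items-N : ∀ ts → length (Ph.itemsOf ts) ≡ N
        items-N ts = items-length Rd.μ (blockImage m ts) (ℕ._/ m) n s

        fromBits-bits : ∀ (es : List (SizedSubset n s)) bits → Unique es → length bits ≤ length es → ∀ i →
          bitAt (map (fromBits es bits) es) i ≡ bitAt bits i
        fromBits-bits es bits un le i = go es bits un le i
          where
          map-∈ : ∀ {X : Set} fs {g h : SizedSubset n s → X} → (∀ f → f ∈ fs → g f ≡ h f) → map g fs ≡ map h fs
          map-∈ []       h = ≡.refl
          map-∈ (f ∷ fs) h = ≡.cong₂ _∷_ (h f (here ≡.refl)) (map-∈ fs λ f f∈ → h f (there f∈))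
          go : ∀ es bits → Unique es → length bits ≤ length es → ∀ i → bitAt (map (fromBits es bits) es) i ≡ bitAt bits i
          go []       []         un le i       = ≡.refl
          go (e ∷ es) []         un le zero    = ≡.refl
          go (e ∷ es) []         un le (suc i) = all-false es i
            where
            all-false : ∀ es i → bitAt (map (λ _ → false) es) i ≡ false
            all-false []       i       = ≡.refl
            all-false (_ ∷ es) zero    = ≡.refl
            all-false (_ ∷ es) (suc i) = all-false es i
          go (e ∷ es) (b ∷ bits) (e∉ ∷ un) le zero    = fromBits-here e es b bits e∉
          go (e ∷ es) (b ∷ bits) (e∉ ∷ un) (s≤s le) (suc i) =
            ≡.trans (≡.cong (λ z → bitAt z i) (map-∈ es λ f f∈ → fromBits-∷ e es b bits λ { ≡.refl → All.lookup e∉ f∈ ≡.refl }))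
                    (go es bits un le i)

        memOf≡ : ∀ ts ys a i → memOf (Ph.itemsOf ts) ys a i ≡ b2n (bitAt (queryBits a (Ph.itemsOf ts) ys) i)
        memOf≡ ts ys a i = ≡.trans (initial-mem D (query (Ph.itemsOf ts) ys a) i)
          (≡.cong b2n (fromBits-bits (choose n s) (queryBits a (Ph.itemsOf ts) ys) (choose-unique n s)
            (ℕ.≤-trans (queryBits-length (Ph.itemsOf ts) ys) (ℕ.≤-reflexive (items-N ts))) i))
          where
          queryBits-length : ∀ its ys → length (queryBits a its ys) ≤ length its
          queryBits-length []         ys       = z≤n
          queryBits-length (it ∷ its) []       = z≤n
          queryBits-length (it ∷ its) (y ∷ ys) = s≤s (queryBits-length its ys)

        reduction : Triple (SetupCommands.reductionC ℝ (program A) sampler prepare (suc s₂) k Js tss)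
          (evalOps (set 0 k ∷ set 1 1 ∷ add 2 8 1 ∷ sub 2 2 0 ∷ []) (startState n (scale D n) (Config.mem (initial D G))))
          time tree (λ x σ′ → reg σ′ 15 ≡ x)
        reduction = Rd.reductionT Js Js-length κs-distinct n≤M {memOf} total tss _ ≡.refl ≡.refl ≡.refl ≡.refl
          (λ i y _ → initial-mem D G (y ℕ.* 16 ℕ.+ i))
          (ℕ.≤-trans (ℕ.≤-reflexive (length-map G (choose n s))) (length-choose n s))
          (≡.trans (items-length Rd.μ (λ u → u) (λ _ → 0) n s) (≡.sym (length-map G (choose n s))))
          (padded-length k)
          (λ ts → ℕ.≤-trans (ℕ.≤-reflexive (items-N ts)) (length-choose n s))
          memOf≡

        X : List ℕ → Bool
        X v = Rd.Tb (hcode Rd.μ 0 v)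

        phaseError : Carrier
        phaseError = ι N *ʳ φ n +ʳ ι (L ℕ.^ length Js) *ʳ ((ρ n ^ʳ N) *ʳ averageError A k n)

        phase-error : ∀ ts β → E (Ph.phaseTree {memOf} total ts (b2n β)) (wrong (b2n (β xor rainbowSum k n s m X ts))) ≤ʳ phaseError
        phase-error ts β = ≤-trans
          (phase-wrong (c D n) L (sample n) (ρ n) (φ n) (0≤ρ n) (marginal n) (failure n)
            (λ it → Rd.Tb (proj₁ (proj₂ it))) its (λ ys a → output A (query its ys a)) (λ ys a → parityOf k (query its ys a))
            (λ bits → errorAt A k (fromBits (choose n s) bits)) (rainbowSum k n s m X ts) Ph.κs (averageError A k n)
            (λ bits → E-nonneg (output A (fromBits (choose n s) bits)) λ _ → indicator-nonneg _) 0<L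
            (λ ys a β → combine-error A k (query its ys a) β)
            (queries-xor n k (suc s₂) m (half n) e<k n≤M Rd.Tb ts)
            (≤-trans (≤-reflexive (R.reflexive (≡.cong (λ N → E (iid (c D n) N) (λ bits → errorAt A k (fromBits (choose n s) bits))) (items-N ts))))
                     (≤-reflexive (R.sym (averageError≈ A k n)))) β)
          (≤-reflexive (R.reflexive (≡.cong₂ (λ N d → ι N *ʳ φ n +ʳ ι (L ℕ.^ d) *ʳ ((ρ n ^ʳ N) *ʳ averageError A k n))
            (items-N ts) (length-map (hcode Rd.μ 0) Js))))
          where
          its = Ph.itemsOf ts

        phases-error : ∀ tss β → E (Ph.phasesTree {memOf} total tss (b2n β)) (wrong (b2n (β xor xorList (rainbowSum k n s m X) tss)))
                                 ≤ʳ ι (length tss) *ʳ phaseError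
        phases-error []         β rewrite Bool.xor-identityʳ β | ≡ᵇ-refl (b2n β) = ≤-reflexive (R.sym (R.zeroˡ phaseError))
        phases-error (ts ∷ tss) β = ≤-trans
          (E->>=-wrong (Ph.phaseTree {memOf} total ts (b2n β)) (Ph.phasesTree {memOf} total tss) (b2n (β xor Q)) _)
          (≤-trans (+-mono-≤ (phase-error ts β)
            (≡.subst (λ z → E (Ph.phasesTree {memOf} total tss (b2n (β xor Q))) (wrong (b2n z)) ≤ʳ ι (length tss) *ʳ phaseError)
              (Bool.xor-assoc β Q (xorList (rainbowSum k n s m X) tss)) (phases-error tss (β xor Q))))
            (≤-reflexive (R.trans (R.+-congʳ (R.sym (R.*-identityˡ phaseError))) (R.sym (R.distribʳ phaseError _ _)))))
          where
          Q = rainbowSum k n s m X ts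

        tree-error : E tree (wrong (cliqueParity k G)) ≤ʳ ι ((k ℕ.+ k) ℕ.^ k) *ʳ phaseError
        tree-error = ≤-trans
          (≤-reflexive (R.reflexive (≡.cong (λ t → E tree (wrong t)) (≡.trans (cliqueParity≡ k G)
            (≡.cong b2n (≡.sym (rainbow-total n k s₂ m s<k km≤n n≤M G)))))))
          (≤-trans (phases-error tss false)
            (≤-reflexive (R.reflexive (≡.cong (λ l → ι l *ʳ phaseError)
              (≡.trans (length-map _ (tuples k (k ℕ.+ k))) (length-tuples k (k ℕ.+ k)))))))

    tree : ∀ n → Hypergraph n s → Dist ℕ
    tree n G with k ℕ.≤? n
    ... | yes k≤n = At.OnGraph.tree n k≤n G
    ... | no _    = return 0

    commandTimeAt : ∀ n → Hypergraph n s → Dec (k ≤ n) → ℕ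
    commandTimeAt n G (yes k≤n) = 31 ℕ.+ At.OnGraph.time n k≤n G
    commandTimeAt n G (no _)    = 38

    commandTime : ∀ n → Hypergraph n s → ℕ
    commandTime n G = commandTimeAt n G (k ℕ.≤? n)

    commandT : ∀ n (G : Hypergraph n s) → Compiler.Triple ℝ (c D n) command
      (Preparation.startState ℝ (c D n) n (scale D n) (Config.mem (initial D G))) (commandTime n G) (tree n G) (λ x σ′ → reg σ′ 15 ≡ x)
    commandT n G with k ℕ.≤? n
    ... | yes k≤n = seqT (blkT (set 0 k ∷ set 1 1 ∷ add 2 8 1 ∷ sub 2 2 0 ∷ []) _) λ { _ σ₁ ≡.refl _ →
            ifnzT (≡.trans (≡.cong (ℕ._∸ k) (ℕ.+-comm n 1)) (ℕ.+-∸-assoc 1 k≤n)) (At.OnGraph.reduction n k≤n G) }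
      where open Main ℝ (c D n)
    ... | no k≰n  = seqT (blkT (set 0 k ∷ set 1 1 ∷ add 2 8 1 ∷ sub 2 2 0 ∷ []) _) λ { _ σ₁ ≡.refl _ →
            ifzT (ℕ.m≤n⇒m∸n≡0 (ℕ.≤-trans (ℕ.≤-reflexive (ℕ.+-comm n 1)) (ℕ.≰⇒> k≰n)))
              (postT (mapT (λ _ → 0) (blkT (set 15 0 ∷ []) σ₁)) λ { _ _ (_ , ≡.refl , ≡.refl) _ → ≡.refl }) }
      where open Main ℝ (c D n)

-- Running times

module Timing (ℝ : Reals) (p : Model.Prob ℝ) where
  open import Data.Nat.Base
  open import Data.Nat.Properties
  open import Data.Nat.Tactic.RingSolver using (solve-∀)
  open ≡ using (refl; cong; cong₂; sym; trans)
  open Main ℝ p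
  open Preparation ℝ p

  sumTo-≤ : ∀ s (f : ℕ → ℕ) x → (∀ j → j < s → f j ≤ x) → sumTo s f ≤ s * x
  sumTo-≤ zero    f x h = z≤n
  sumTo-≤ (suc s) f x h = +-mono-≤ (h s ≤-refl) (sumTo-≤ s f x λ j j< → h j (≤-trans j< (n≤1+n s)))

  module _ (n k e : ℕ) (1≤e : 1 ≤ e) (s<k : suc e < k) (k≤n : k ≤ n) where
    private
      s = suc e
    open Budget n k s (s≤s 1≤e) s<k k≤n

    powTime≤ : ∀ b e → e ≤ s → b ≤ 2 * n → powTime b e ≤ 53 * B
    powTime≤ b e e≤ b≤ = ≤-trans (+-monoʳ-≤ 7 (sumTo-≤ e _ (22 + 2 * n * 12) λ _ _ → +-monoʳ-≤ 22 (*-monoˡ-≤ 12 b≤)))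
      (≤-trans (+-monoʳ-≤ 7 (*-monoˡ-≤ (22 + 2 * n * 12) e≤)) (≤-trans (≤-reflexive (lem s n))
        (≤-trans (+-mono-≤ (+-mono-≤ (*-monoʳ-≤ 7 1≤B) (*-monoʳ-≤ 22 s≤B)) (*-monoʳ-≤ 24 sn≤B)) (≤-reflexive (lem₂ B)))))
      where
      lem : ∀ s n → 7 + s * (22 + 2 * n * 12) ≡ 7 * 1 + 22 * s + 24 * (s * n)
      lem = solve-∀
      lem₂ : ∀ B → 7 * B + 22 * B + 24 * B ≡ 53 * B
      lem₂ = solve-∀

    n≤2n : n ≤ 2 * n
    n≤2n = m≤m+n n (n + 0)

    copyTime≤ : copyTime n s ≤ 115 * B
    copyTime≤ = ≤-trans (+-mono-≤ (+-mono-≤ (*-monoʳ-≤ 22 1≤B) (powTime≤ n s ≤-refl n≤2n)) (≤-trans (≤-reflexive (*-comm (n ^ s) 40)) (*-monoʳ-≤ 40 n^s≤B)))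
      (≤-reflexive (lem B))
      where
      lem : ∀ B → 22 * B + 53 * B + 40 * B ≡ 115 * B
      lem = solve-∀

    mulTableTime≤ : ∀ {M} → M ≤ 2 * n → mulTableTime M e ≤ 147 * B
    mulTableTime≤ {M} M≤ = ≤-trans (+-mono-≤ (*-monoʳ-≤ 7 1≤B) (+-mono-≤ (powTime≤ M e (n≤1+n e) M≤)
        (+-mono-≤ (*-monoʳ-≤ 7 1≤B) (+-mono-≤ (powTime≤ M s ≤-refl M≤) (+-mono-≤ (*-monoʳ-≤ 7 1≤B)
          (+-mono-≤ (≤-trans (≤-reflexive (*-comm (M ^ e) 19)) (*-monoʳ-≤ 19 M^e≤)) 1≤B))))))
      (≤-reflexive (lem B))
      where
      lem : ∀ B → 7 * B + (53 * B + (7 * B + (53 * B + (7 * B + (19 * B + B))))) ≡ 147 * B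
      lem = solve-∀
      M^e≤ : M ^ e ≤ B
      M^e≤ = ≤-trans (^-monoˡ-≤ e (≤-trans M≤ (≤-trans (*-monoˡ-≤ n (≤-trans (s≤s 1≤e) (<⇒≤ s<k))) (≤-reflexive (*-comm k n)))))
        (^-monoʳ-≤ (n * k) {{m*n≢0 n k {{>-nonZero (≤-trans (s≤s z≤n) (≤-trans s<k k≤n))}} {{>-nonZero (≤-trans (s≤s z≤n) s<k)}}}} (n≤1+n e))

    bfsTime≤ : bfsTime s n ≤ 201 * B
    bfsTime≤ = ≤-trans (+-mono-≤ (*-monoʳ-≤ 49 1≤B) (sumTo-≤ s _ (29 + 123 * n ^ s) λ j j< →
        +-monoʳ-≤ 29 (term (n ^ (s ∸ suc j)) (≤-trans (≤-reflexive (power j j<)) (^-monoʳ-≤ n {{n≢0}} (m∸n≤m s j))))))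
      (≤-trans (≤-reflexive (lem s (n ^ s) B)) (≤-trans (+-monoʳ-≤ (49 * B) (+-mono-≤ (*-monoʳ-≤ 29 s≤B) (*-monoʳ-≤ 123 sn^s≤B))) (≤-reflexive (lem₂ B))))
      where
      n≢0 : NonZero n
      n≢0 = >-nonZero (≤-trans (s≤s z≤n) (≤-trans s<k k≤n))
      power : ∀ j → j < s → n ^ (s ∸ suc j) * n ≡ n ^ (s ∸ j)
      power j j< = trans (*-comm _ n) (cong (n ^_) (sym (+-∸-assoc 1 j<)))
      term : ∀ x → x * n ≤ n ^ s → x * (55 + n * 68) ≤ 123 * n ^ s
      term x h = ≤-trans (≤-reflexive (lem₁ x n)) (≤-trans (+-mono-≤ (*-monoʳ-≤ 55 (≤-trans (m≤m*n x n {{n≢0}}) h)) (*-monoʳ-≤ 68 h)) (≤-reflexive (lem₃ (n ^ s))))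
        where
        lem₁ : ∀ x n → x * (55 + n * 68) ≡ 55 * x + 68 * (x * n)
        lem₁ = solve-∀
        lem₃ : ∀ y → 55 * y + 68 * y ≡ 123 * y
        lem₃ = solve-∀
      lem : ∀ s y B → 49 * B + s * (29 + 123 * y) ≡ 49 * B + (29 * s + 123 * (s * y))
      lem = solve-∀
      lem₂ : ∀ B → 49 * B + (29 * B + 123 * B) ≡ 201 * B
      lem₂ = solve-∀

    partsTime≤ : ∀ {m} ts → k * m ≤ n → All (_≤ k + k) ts → length ts ≡ k + k → partsTime m ts ≤ 188 * B
    partsTime≤ {m} ts km≤ entries len = ≤-trans (each ts entries) (≤-trans (≤-reflexive (trans (cong (_* (37 + 24 * k + m * 33)) len) (lem k m)))
      (≤-trans (+-mono-≤ (+-mono-≤ (*-monoʳ-≤ 74 k≤B) (*-monoʳ-≤ 48 kk≤B)) (*-monoʳ-≤ 66 (≤-trans km≤ n≤B))) (≤-reflexive (lem₂ B))))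
      where
      each : ∀ ts → All (_≤ k + k) ts → partsTime m ts ≤ length ts * (37 + 24 * k + m * 33)
      each []       []       = z≤n
      each (t ∷ ts) (b ∷ bs) = +-mono-≤ (+-monoˡ-≤ (m * 33) (+-monoʳ-≤ 37 (≤-trans (*-monoˡ-≤ 12 b) (≤-reflexive (lem₃ k))))) (each ts bs)
        where
        lem₃ : ∀ k → (k + k) * 12 ≡ 24 * k
        lem₃ = solve-∀
      lem : ∀ k m → (k + k) * (37 + 24 * k + m * 33) ≡ 74 * k + 48 * (k * k) + 66 * (k * m)
      lem = solve-∀
      lem₂ : ∀ B → 74 * B + 48 * B + 66 * B ≡ 188 * B
      lem₂ = solve-∀

  queries-time : (queriesTime : ℕ → ℕ → ℕ → ℕ) (L s t : ℕ) → 2 ≤ L → (∀ d → queriesTime s t (suc d) ≡ 7 + (L * (33 + s * 42 + queriesTime s t d) + 1)) →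
    queriesTime s t 0 ≡ t → ∀ d → queriesTime s t d + 2 * (41 + s * 42) ≤ L ^ d * (t + 2 * (41 + s * 42))
  queries-time qT L s t 2≤L h₁ h₀ zero    = ≤-reflexive (trans (cong (_+ 2 * (41 + s * 42)) h₀) (sym (+-identityʳ _)))
  queries-time qT L s t 2≤L h₁ h₀ (suc d) = begin
    qT s t (suc d) + 2 * u                        ≡⟨ cong (_+ 2 * u) (h₁ d) ⟩
    7 + (L * (33 + s * 42 + q) + 1) + 2 * u       ≡⟨ lem₁ (L * (33 + s * 42 + q)) u ⟩
    8 * 1 + L * (33 + s * 42 + q) + 2 * u         ≤⟨ +-mono-≤ (+-monoˡ-≤ (L * (33 + s * 42 + q)) (*-monoʳ-≤ 8 (≤-trans (s≤s z≤n) 2≤L))) (*-monoˡ-≤ u 2≤L) ⟩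
    8 * L + L * (33 + s * 42 + q) + L * u         ≡⟨ lem₂ L (s * 42) q ⟩
    L * (q + 2 * u)                               ≤⟨ *-monoʳ-≤ L (queries-time qT L s t 2≤L h₁ h₀ d) ⟩
    L * (L ^ d * (t + 2 * u))                     ≡⟨ *-assoc L (L ^ d) _ ⟨
    L ^ suc d * (t + 2 * u)                       ∎
    where
    open ≤-Reasoning
    u = 41 + s * 42
    q = qT s t d
    lem₁ : ∀ x u → 7 + (x + 1) + 2 * u ≡ 8 * 1 + x + 2 * u
    lem₁ = solve-∀
    lem₂ : ∀ L v q → 8 * L + L * (33 + v + q) + L * (41 + v) ≡ L * (q + 2 * (41 + v))
    lem₂ = solve-∀

module SchemeTime (ℝ : Reals) where
  open import Data.Nat.Base
  open import Data.Nat.Properties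
  open ≡
  open Algorithms ℝ
  open Model ℝ using (Density; Algorithm; T)

  module _ {D : Density} (S : Scheme D) (s₂ k : ℕ) (s<k : 2 + s₂ < k) (A : Algorithm D (2 + s₂)) (n : ℕ) (k≤n : k ≤ n) where
    open Scheme S
    open FromScheme S s₂ k s<k A
    open At n k≤n
    open Timing ℝ (Model.c D n)
    open Preparation ℝ (Model.c D n) using (copyTime; mulTableTime)
    open Main ℝ (Model.c D n) using (partsTime; bfsTime)
    private
      s = 2 + s₂
    open Budget n k s (s≤s (s≤s z≤n)) s<k k≤n

    module _ (2≤L : 2 ≤ L) (sampler≤ : n ^ s * samplerTime n ≤ 829 * (L * L) * B) (prepare≤ : prepareTime n ≤ 134 * (L * B)) where
      private
        t X Y : ℕ
        t = T A n
        X = L ^ (k C s)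
        Y = X * (t + B)

      3≤kCs : 3 ≤ k C s
      3≤kCs = ≤-trans (≤-trans (s≤s (s≤s (s≤s z≤n))) s<k) (k≤kCs k s s<k (s≤s z≤n))

      LL≤X : L * L ≤ X
      LL≤X = ≤-trans (≤-reflexive (cong (L *_) (sym (*-identityʳ L)))) (^-monoʳ-≤ L {{>-nonZero (<⇒≤ 2≤L)}} (≤-trans (n≤1+n 2) 3≤kCs))

      L≤X : L ≤ X
      L≤X = ≤-trans (m≤m*n L L {{>-nonZero (<⇒≤ 2≤L)}}) LL≤X

      1≤X : 1 ≤ X
      1≤X = ≤-trans (<⇒≤ 2≤L) L≤X

      B≤XB : B ≤ X * B
      B≤XB = m≤n*m B X {{>-nonZero 1≤X}}

      length-Js : length Js ≡ k C s
      length-Js = trans (length-sublists s (downFrom k)) (cong (_C s) (length-downFrom k))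

      phase≤ : ∀ ts (q : ℕ) → q ≤ X * (113 + n ^ s * 68 + t * 110 + 2 * (41 + s * 42)) → All (_≤ k + k) ts → length ts ≡ k + k →
        7 + partsTime m ts + (bfsTime s n + (21 + (n ^ s * (40 + samplerTime n) + 1) + q)) ≤ 1634 * Y
      phase≤ ts q q≤ entries len = ≤-trans
        (+-mono-≤ (+-mono-≤ (*-monoʳ-≤ 7 1≤B) (partsTime≤ n k (suc s₂) (s≤s z≤n) s<k k≤n ts km≤n entries len))
          (+-mono-≤ (bfsTime≤ n k (suc s₂) (s≤s z≤n) s<k k≤n)
            (+-mono-≤ (+-mono-≤ (*-monoʳ-≤ 21 1≤B) (+-mono-≤ sampling 1≤B)) (≤-trans q≤ (*-monoʳ-≤ X query)))))
        (≤-trans (≤-reflexive (lem₁ B (L * L) X t)) (≤-trans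
          (+-mono-≤ (+-mono-≤ (*-monoʳ-≤ 458 B≤XB) (*-monoʳ-≤ 829 (*-monoˡ-≤ B LL≤X))) (*-monoʳ-≤ X (+-monoʳ-≤ (347 * B) (*-monoˡ-≤ t (m≤m+n 110 1524)))))
          (≤-reflexive (lem₂ X B t))))
        where
        lem₀ : ∀ a b → a * (40 + b) ≡ 40 * a + a * b
        lem₀ = solve-∀
        lem₁ : ∀ B v X t → 7 * B + 188 * B + (201 * B + (21 * B + (40 * B + 829 * v * B + B) + X * (113 * B + 68 * B + 110 * t + 2 * (41 * B + 42 * B)))) ≡
          458 * B + 829 * (v * B) + X * (347 * B + 110 * t)
        lem₁ = solve-∀
        lem₂ : ∀ X B t → 458 * (X * B) + 829 * (X * B) + X * (347 * B + 1634 * t) ≡ 1634 * (X * (t + B))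
        lem₂ = solve-∀
        sampling : n ^ s * (40 + samplerTime n) ≤ 40 * B + 829 * (L * L) * B
        sampling = ≤-trans (≤-reflexive (lem₀ (n ^ s) (samplerTime n))) (+-mono-≤ (*-monoʳ-≤ 40 n^s≤B) sampler≤)
        query : 113 + n ^ s * 68 + t * 110 + 2 * (41 + s * 42) ≤ 113 * B + 68 * B + 110 * t + 2 * (41 * B + 42 * B)
        query = +-mono-≤ (+-mono-≤ (+-mono-≤ (*-monoʳ-≤ 113 1≤B) (≤-trans (≤-reflexive (*-comm (n ^ s) 68)) (*-monoʳ-≤ 68 n^s≤B)))
            (≤-reflexive (*-comm t 110)))
          (*-monoʳ-≤ 2 (+-mono-≤ (*-monoʳ-≤ 41 1≤B) (≤-trans (≤-reflexive (*-comm s 42)) (*-monoʳ-≤ 42 s≤B))))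

      M≤2n : M ≤ 2 * n
      M≤2n = ≤-trans (≤-reflexive (lem k m)) (*-monoʳ-≤ 2 km≤n)
        where
        lem : ∀ k m → (k + k) * m ≡ 2 * (k * m)
        lem = solve-∀

      time≤ : ∀ (G : Hypergraph n s) → 36 + OnGraph.time G ≤ 2500 * ((k + k) ^ k * Y)
      time≤ G = ≤-trans
        (+-mono-≤ (*-monoʳ-≤ 36 1≤B) (+-mono-≤ (copyTime≤ n k (suc s₂) (s≤s z≤n) s<k k≤n)
          (+-mono-≤ (+-mono-≤ (*-monoʳ-≤ 36 1≤B) (≤-trans (≤-reflexive (*-comm n 36)) (*-monoʳ-≤ 36 n≤B)))
          (+-mono-≤ (+-mono-≤ (*-monoʳ-≤ 22 1≤B) (≤-trans (≤-reflexive (*-comm (k + k) 12)) (*-monoʳ-≤ 12 (+-mono-≤ k≤B k≤B))))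
          (+-mono-≤ (mulTableTime≤ n k (suc s₂) (s≤s z≤n) s<k k≤n M≤2n)
          (+-mono-≤ prepare≤
          (+-mono-≤ (+-mono-≤ (+-mono-≤ (+-mono-≤ (+-mono-≤ (*-monoʳ-≤ 29 1≤B) (≤-trans (≤-reflexive (*-comm n 12)) (*-monoʳ-≤ 12 n≤B)))
              (bfsTime≤ n k (suc s₂) (s≤s z≤n) s<k k≤n)) (≤-trans (≤-reflexive (*-comm (length (OnGraph.bs G)) 47)) (*-monoʳ-≤ 47 bs≤))) 1≤B)
            phases)))))))
        (≤-trans (≤-reflexive (lem₁ B L (τ * (1634 * Y)))) (≤-trans
          (+-mono-≤ (+-mono-≤ (*-monoʳ-≤ 706 B≤) (*-monoʳ-≤ 134 LB≤)) (≤-reflexive (lem₂ τ Y)))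
          (≤-trans (≤-reflexive (lem₃ (τ * Y))) (*-monoˡ-≤ (τ * Y) (m≤m+n 2474 26)))))
        where
        τ = (k + k) ^ k
        open OnGraph G using (module Ph; module Rd; bs; total; memOf)
        bs≤ : length bs ≤ B
        bs≤ = ≤-trans (≤-reflexive (length-map G (choose n s))) (≤-trans (length-choose n s) n^s≤B)
        phase-time : ∀ ts → All (_≤ k + k) ts → length ts ≡ k + k → Ph.phaseTime {memOf} total ts ≤ 1634 * Y
        phase-time ts entries len = phase≤ ts _ (≤-trans (m≤m+n _ _)
          (subst (λ d → Rd.Ph.queriesTime s t₀ (length Js) + 2 * (41 + s * 42) ≤ L ^ d * (t₀ + 2 * (41 + s * 42))) length-Js
            (queries-time Rd.Ph.queriesTime L s t₀ 2≤L (λ _ → refl) refl (length Js)))) entries len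
          where
          t₀ = 113 + n ^ s * 68 + t * 110
        phases : Ph.phasesTime {memOf} total tss ≤ τ * (1634 * Y)
        phases = ≤-trans (sum-phases (Ph.phaseTime {memOf} total) (Ph.phasesTime {memOf} total) refl (λ _ _ → refl) tss
            (All.zipWith (λ { {ts} (es , len) → phase-time ts es len }) (padded-entries k , padded-length k)))
          (≤-reflexive (cong (_* (1634 * Y)) (trans (length-map _ (tuples k (k + k))) (length-tuples k (k + k)))))
        instance
          τ≢0 : NonZero τ
          τ≢0 = m^n≢0 (k + k) k {{>-nonZero (≤-trans (s≤s z≤n) (≤-trans s<k (m≤m+n k k)))}}
        B≤ : B ≤ τ * Y
        B≤ = ≤-trans B≤XB (≤-trans (*-monoʳ-≤ X (m≤n+m B t)) (m≤n*m Y τ))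
        LB≤ : L * B ≤ τ * Y
        LB≤ = ≤-trans (*-mono-≤ L≤X (m≤n+m B t)) (m≤n*m Y τ)
        lem₁ : ∀ B L z → 36 * B + (115 * B + (36 * B + 36 * B + (22 * B + 12 * (B + B) + (147 * B + (134 * (L * B) +
          (29 * B + 12 * B + 201 * B + 47 * B + B + z)))))) ≡ 706 * B + 134 * (L * B) + z
        lem₁ = solve-∀
        lem₂ : ∀ τ Y → τ * (1634 * Y) ≡ 1634 * (τ * Y)
        lem₂ = solve-∀
        lem₃ : ∀ y → 706 * y + 134 * y + 1634 * y ≡ 2474 * y
        lem₃ = solve-∀

module Conclusion (ℝ : Reals) where
  open import Data.Nat.Base using (_+_; _*_; _^_; _<_)
  open Model ℝ hiding (_+_; _-_; _*_; _^_; _<_)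
  open Model ℝ using () renaming (_+_ to _+ʳ_; _*_ to _*ʳ_; _^_ to _^ʳ_; _<_ to _<ʳ_)
  open RealFacts ℝ
  open RealOrder ℝ
  open Bounds ℝ
  open Expectation ℝ
  open Algorithms ℝ
  open SchemeTime ℝ

  1≤T : ∀ {D s} (A : Algorithm D s) n → 1 ≤ T A n
  1≤T A n with T A n | Algorithm.halts A n
  ... | zero  | h = contradiction ≡.refl (h λ _ → false)
  ... | suc _ | _ = s≤s z≤n

  averageError-nonneg : ∀ {D s} (A : Algorithm D s) k n → 0# ≤ʳ averageError A k n
  averageError-nonneg {D} {s} A k n = ≤-trans
    (E-nonneg (iid (c D n) (length (choose n s))) λ bits → E-nonneg (output A (fromBits (choose n s) bits)) λ _ → indicator-nonneg _)
    (≤-reflexive (R.sym (averageError≈ A k n)))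

  small-error : ∀ {e ε Z} z → e ≤ʳ Z → ι 6 *ʳ Z ≤ʳ 1# +ʳ ι z *ʳ ε → ε *ʳ ι z <ʳ 1# → e *ʳ ι 3 <ʳ 1#
  small-error {e} {ε} {Z} z e≤ h₁ h₂ = *-cancelˡ-< (0<ι 1) (≤-<-trans
    (≤-trans (≤-reflexive (solve 1 (λ e → num 2 :* (e :* num 3) := num 6 :* e) R.refl e)) (≤-trans (*-monoˡ-≤ (ι-nonneg 6) e≤) h₁))
    (<-respʳ (solve 0 (con 1 :+ con 1 := num 2 :* con 1) R.refl)
      (<-respˡ (R.+-comm (ι z *ʳ ε) 1#) (+-monoˡ-< 1# (<-respˡ (R.*-comm ε (ι z)) h₂)))))

  error-budget : ∀ τ {N y} X {z f r ε} → N ≤ y → ι (6 * τ * y) *ʳ f ≤ʳ 1# → 0# ≤ʳ r → r ≤ʳ ι 2 → 12 * (τ * X) ≤ z → 0# ≤ʳ f → 0# ≤ʳ ε →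
    ι 6 *ʳ (ι τ *ʳ (ι N *ʳ f +ʳ ι X *ʳ (r *ʳ ε))) ≤ʳ 1# +ʳ ι z *ʳ ε
  error-budget τ {N} {y} X {z} {f} {r} {ε} N≤y fails 0≤r r≤2 12≤ 0≤f 0≤ε = begin
    ι 6 *ʳ (ι τ *ʳ (ι N *ʳ f +ʳ ι X *ʳ (r *ʳ ε)))
      ≈⟨ solve 6 (λ t n f x r e → num 6 :* (t :* (n :* f :+ x :* (r :* e))) := num 6 :* t :* n :* f :+ num 6 :* (t :* x) :* (r :* e)) R.refl
           (ι τ) (ι N) f (ι X) r ε ⟩
    ι 6 *ʳ ι τ *ʳ ι N *ʳ f +ʳ ι 6 *ʳ (ι τ *ʳ ι X) *ʳ (r *ʳ ε)
      ≲⟨ +-mono-≤ (≤-trans (*-mono-≤ 0≤6τN 0≤f (≤-trans (*-monoˡ-≤ 0≤6τ (ι-mono N≤y))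
             (≤-reflexive (R.sym (R.trans (ι-* (6 * τ) y) (R.*-congʳ (ι-* 6 τ)))))) ≤-refl) fails)
           (*-mono-≤ 0≤6τX (*-nonneg (ι-nonneg 2) 0≤ε) ≤-refl (*-mono-≤ 0≤r 0≤ε r≤2 ≤-refl)) ⟩
    1# +ʳ ι 6 *ʳ (ι τ *ʳ ι X) *ʳ (ι 2 *ʳ ε)
      ≈⟨ R.+-congˡ (R.trans (solve 3 (λ t x e → num 6 :* (t :* x) :* (num 2 :* e) := num 12 :* (t :* x) :* e) R.refl (ι τ) (ι X) ε)
           (R.*-congʳ (R.sym (R.trans (ι-* 12 (τ * X)) (R.*-congˡ (ι-* τ X)))))) ⟩
    1# +ʳ ι (12 * (τ * X)) *ʳ ε
      ≲⟨ +-mono-≤ ≤-refl (*-mono-≤ (ι-nonneg (12 * (τ * X))) 0≤ε (ι-mono 12≤) ≤-refl) ⟩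
    1# +ʳ ι z *ʳ ε ∎
    where
    0≤6τ : 0# ≤ʳ ι 6 *ʳ ι τ
    0≤6τ = *-nonneg (ι-nonneg 6) (ι-nonneg τ)
    0≤6τN : 0# ≤ʳ ι 6 *ʳ ι τ *ʳ ι N
    0≤6τN = *-nonneg 0≤6τ (ι-nonneg N)
    0≤6τX : 0# ≤ʳ ι 6 *ʳ (ι τ *ʳ ι X)
    0≤6τX = *-nonneg (ι-nonneg 6) (*-nonneg (ι-nonneg τ) (ι-nonneg X))

  choose-bound : ∀ {X : Set} → Dec X → ℕ → ℕ
  choose-bound (yes _) t = t
  choose-bound (no  _) t = 43

  choose-bound-≤ : ∀ {X : Set} (d : Dec X) t y → (X → t ≤ y) → 43 ≤ y → choose-bound d t ≤ y
  choose-bound-≤ (yes x) t y h h′ = h x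
  choose-bound-≤ (no  _) t y h h′ = h′

  12≤2500 : ∀ x → 12 * x ≤ 2500 * x
  12≤2500 x = ℕ.*-monoˡ-≤ x (ℕ.m≤m+n 12 2488)

  rearrange : ∀ a b c d → a * (b * (c * d)) ≡ a * (b * c) * d
  rearrange = solve-∀

  module Reduce {D : Density} (S : Scheme D) (s₂ k : ℕ) (s<k : 2 + s₂ < k) (A : Algorithm D (2 + s₂)) where
    open Scheme S
    open FromScheme S s₂ k s<k A
    private
      s = 2 + s₂
      τ = (k + k) ^ k
      L : ℕ → ℕ
      L n = half n + half n

    2≤L : ∀ n → 2 ≤ L n
    2≤L n = ℕ.+-mono-≤ (0<half n) (0<half n)

    module Within (sampler≤ : ∀ n → k ≤ n → n ^ s * samplerTime n ≤ 829 * (L n * L n) * (n * k) ^ s)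
                  (prepare≤ : ∀ n → k ≤ n → prepareTime n ≤ 134 * (L n * (n * k) ^ s)) where
      bound : ℕ → ℕ
      bound n = choose-bound (k ℕ.≤? n) (2500 * (τ * (L n ^ (k C s) * (T A n + (n * k) ^ s))))

      time≤bound : ∀ n (G : Hypergraph n s) → 2 + (commandTime n G + 3) ≤ bound n
      time≤bound n G = go (k ℕ.≤? n)
        where
        lem : ∀ t → 2 + (31 + t + 3) ≡ 36 + t
        lem = solve-∀
        go : ∀ d → 2 + (commandTimeAt n G d + 3) ≤ choose-bound d (2500 * (τ * (L n ^ (k C s) * (T A n + (n * k) ^ s))))
        go (yes k≤n) = ℕ.≤-trans (ℕ.≤-reflexive (lem _)) (time≤ S s₂ k s<k A n k≤n (2≤L n) (sampler≤ n k≤n) (prepare≤ n k≤n) G)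
        go (no  _)   = ℕ.≤-refl

      exec≡tree : ∀ n (G : Hypergraph n s) u →
        exec (c D n) (SetupCommands.program ℝ command) (bound n + u) (initial D G) ≡ (tree n G >>= λ x → return (just x))
      exec≡tree n G = Compiler.exec≡ (Compiler.Halts-weaken ℝ (c D n) (time≤bound n G) (Preparation.programT ℝ (c D n) (commandT n G)))

      B : Algorithm D s
      B = algorithm D k (SetupCommands.program ℝ command) bound tree exec≡tree

      budget : ∀ n → k ≤ n → ∀ z → 40000 * s * L n ≤ z → 2500 * (τ * L n ^ (k C s)) ≤ z ^ (k C s)
      budget n k≤n z h = ℕ.≤-trans
        (ℕ.*-mono-≤ pow (ℕ.*-monoˡ-≤ (L n ^ b) (tuples-few s k (s≤s (s≤s z≤n)) s<k)))
        (ℕ.≤-trans (ℕ.≤-reflexive (≡.trans (≡.cong (2500 ^ b *_) (≡.sym (^-distrib (16 * s) (L n) b))) (≡.sym (^-distrib 2500 (16 * s * L n) b))))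
          (ℕ.^-monoˡ-≤ b (ℕ.≤-trans (ℕ.≤-reflexive (lem s (L n))) h)))
        where
        b = k C s
        pow : 2500 ≤ 2500 ^ b
        pow = ℕ.≤-trans (ℕ.≤-reflexive (≡.sym (ℕ.^-identityʳ 2500))) (ℕ.^-monoʳ-≤ 2500 (ℕ.≤-trans (ℕ.≤-trans (s≤s z≤n) s<k) (k≤kCs k s s<k (s≤s z≤n))))
        lem : ∀ s l → 2500 * (16 * s * l) ≡ 40000 * s * l
        lem = solve-∀

      large-binomial : 1 ≤ k C s
      large-binomial = ℕ.≤-trans (ℕ.≤-trans (s≤s z≤n) s<k) (k≤kCs k s s<k (s≤s z≤n))

      tree-elim : ∀ n (G : Hypergraph n s) (P : Dist ℕ → Set) → (∀ k≤n → P (At.OnGraph.tree n k≤n G)) → (n < k → P (return 0)) → P (tree n G)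
      tree-elim n G P h h′ with k ℕ.≤? n
      ... | yes k≤n = h k≤n
      ... | no  k≰n = h′ (ℕ.≰⇒> k≰n)

      B-time : NonDecreasing (T A) → ∀ n z → (k ≤ n → 40000 * s * L n ≤ z) → 43 ≤ z → T B n ≤ z ^ (k C s) * (T A (n * k) + (n * k) ^ s)
      B-time mono n z h 43≤z = ℕ.≤-trans (algorithm-time D k (SetupCommands.program ℝ command) bound tree exec≡tree n)
        (choose-bound-≤ (k ℕ.≤? n) _ _
          (λ k≤n → ℕ.≤-trans (ℕ.≤-reflexive (rearrange 2500 τ (L n ^ (k C s)) _))
            (ℕ.*-mono-≤ (budget n k≤n z (h k≤n)) (ℕ.+-monoˡ-≤ ((n * k) ^ s) (mono (ℕ.m≤m*n n k {{ℕ.>-nonZero (ℕ.≤-trans (s≤s z≤n) s<k)}})))))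
          (ℕ.≤-trans 43≤z (ℕ.≤-trans (ℕ.≤-trans (ℕ.≤-reflexive (≡.sym (ℕ.*-identityʳ z)))
              (ℕ.^-monoʳ-≤ z {{ℕ.>-nonZero (ℕ.≤-trans (s≤s z≤n) 43≤z)}} large-binomial))
            (ℕ.m≤m*n _ _ {{ℕ.>-nonZero (ℕ.≤-trans (1≤T A (n * k)) (ℕ.m≤m+n _ _))}}))))

      B-error : ∀ n (G : Hypergraph n s) → 0# ≤ʳ φ n → (k ≤ n → ∃ λ z → 40000 * s * L n ≤ z × averageError A k n *ʳ ι (z ^ (k C s)) <ʳ 1# ×
          ρ n ^ʳ length (choose n s) ≤ʳ ι 2 × ι (6 * τ * n ^ s) *ʳ φ n ≤ʳ 1#) → errorOn B k G <1/ ι 3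
      B-error n G 0≤φ h = <-respˡ (R.*-congʳ (R.sym (algorithm-error D k (SetupCommands.program ℝ command) bound tree exec≡tree n G)))
        (tree-elim n G (λ d → E d (wrong (cliqueParity k G)) *ʳ ι 3 <ʳ 1#) (λ k≤n → large k≤n (h k≤n)) small)
        where
        small : n < k → E (return 0) (wrong (cliqueParity k G)) *ʳ ι 3 <ʳ 1#
        small n<k = <-respˡ (R.sym (R.trans (R.*-congʳ (R.reflexive (≡.cong (λ t → wrong t 0)
          (≡.trans (cliqueParity≡ k G) (≡.cong b2n (sumSub-empty k n _ n<k)))))) (R.zeroˡ (ι 3)))) 0<1
        ε = averageError A k n
        X≡ : ∀ k≤n → L n ^ length Js ≡ L n ^ (k C s)
        X≡ k≤n = ≡.cong (L n ^_) (length-Js S s₂ k s<k A n k≤n (2≤L n) (sampler≤ n k≤n) (prepare≤ n k≤n))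
        X≤ : ∀ k≤n z → 40000 * s * L n ≤ z → 12 * (τ * L n ^ length Js) ≤ z ^ (k C s)
        X≤ k≤n z L≤z = ℕ.≤-trans (12≤2500 (τ * L n ^ length Js)) (ℕ.≤-trans (ℕ.≤-reflexive (≡.cong (λ x → 2500 * (τ * x)) (X≡ k≤n))) (budget n k≤n z L≤z))
        allowed : ∀ k≤n z → 40000 * s * L n ≤ z → ρ n ^ʳ length (choose n s) ≤ʳ ι 2 → ι (6 * τ * n ^ s) *ʳ φ n ≤ʳ 1# →
          ι 6 *ʳ (ι τ *ʳ At.OnGraph.phaseError n k≤n G) ≤ʳ 1# +ʳ ι (z ^ (k C s)) *ʳ ε
        allowed k≤n z L≤z ρ≤ φ≤ = error-budget τ {length (choose n s)} {n ^ s} (L n ^ length Js) {z ^ (k C s)} {φ n} {ρ n ^ʳ length (choose n s)} {ε}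
            (length-choose n s) φ≤ (^-nonneg (length (choose n s)) (0≤ρ n)) ρ≤ (X≤ k≤n z L≤z) 0≤φ (averageError-nonneg A k n)
        large : ∀ k≤n → (∃ λ z → 40000 * s * L n ≤ z × ε *ʳ ι (z ^ (k C s)) <ʳ 1# ×
            ρ n ^ʳ length (choose n s) ≤ʳ ι 2 × ι (6 * τ * n ^ s) *ʳ φ n ≤ʳ 1#) →
          E (At.OnGraph.tree n k≤n G) (wrong (cliqueParity k G)) *ʳ ι 3 <ʳ 1#
        large k≤n (z , L≤z , small , ρ≤ , φ≤) =
          small-error {E (At.OnGraph.tree n k≤n G) (wrong (cliqueParity k G))} {ε} {ι τ *ʳ At.OnGraph.phaseError n k≤n G} (z ^ (k C s))
            (At.OnGraph.tree-error n k≤n G) (allowed k≤n z L≤z ρ≤ φ≤) small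

-- The two samplers as schemes

module SchemeInstances (ℝ : Reals) where
  open import Data.Nat.Base using (_+_; _*_; _^_; _<_)
  open Model ℝ hiding (_+_; _-_; _*_; _^_; _<_)
  open Model ℝ using () renaming (_+_ to _+ʳ_; _*_ to _*ʳ_; _^_ to _^ʳ_; _<_ to _<ʳ_)
  open RealFacts ℝ
  open RealOrder ℝ
  open Bounds ℝ
  open Expectation ℝ
  open Algorithms ℝ
  open SamplerCommands ℝ
  open Language ℝ

  pairScheme : ∀ D → (∀ n → value (c D n) +ʳ value (c D n) ≈ 1#) → Scheme D
  pairScheme D fair = record
    { sampler = pairC ; prepare = pairPrepC
    ; sampler-reg = λ _ → ≡.refl
    ; sampler-arr = λ i i≢ → arr-free i i≢
    ; prepare-reg = ≡.refl ∷ ≡.refl ∷ ≡.refl ∷ ≡.refl ∷ ≡.refl ∷ ≡.refl ∷ []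
    ; prepare-arr = λ _ → ≡.refl
    ; half = λ _ → 1 ; retries = λ _ → 0 ; samplerTime = λ _ → 50 ; prepareTime = λ _ → 14
    ; 0<half = λ _ → s≤s z≤n
    ; sample = λ n → Samplers.pair ℝ (c D n)
    ; samplerT = λ n σ x v _ _ x≡ v≡ → Samplers.pairT ℝ (c D n) {2} {v} σ x x≡ v≡
    ; prepareT = λ n σ _ _ → Samplers.pairPrepT ℝ (c D n) σ
    ; ρ = λ _ → 1# ; φ = λ _ → 0#
    ; 0≤ρ = λ _ → 0≤1
    ; marginal = λ n x i i< F _ → ≤-reflexive (SamplerProb.pair-marginal ℝ (c D n) (fair n) x i i< F)
    ; failure = λ n x → ≤-reflexive (SamplerProb.pair-failure ℝ (c D n) x) }
    where
    arr-free : ∀ i → (i ℕ.≡ᵇ 10) ≡ false → writesArr pairC i ≡ false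
    arr-free i eq rewrite eq = ≡.refl

  module RejectScheme (D : Density) (s k : ℕ) where
    -- Then retries n = 2 w with 2 ^ w ≥ 6 (2 k) ^ k n ^ s, and 9 ^ w ≥ 4 ^ w 2 ^ w.
    R₀ : ℕ
    R₀ = 2 * (3 + k * k)

    open Density D using (scale-lower)
    private
      σ : ℕ → ℕ
      σ = scale D

    exponent half₀ half L retries Z : ℕ → ℕ
    exponent n = s * ceilLog n + 2
    half₀ n    = exponent n * σ n
    half n     = suc (half₀ n)
    L n        = half n + half n
    retries n  = L n + R₀
    Z n        = suc (n ^ s)

    n^s≤ : ∀ n → n ^ s ≤ 2 ^ (s * ceilLog n)
    n^s≤ n = ℕ.≤-trans (ℕ.^-monoˡ-≤ s (n≤2^ceilLog n)) (ℕ.≤-reflexive (≡.trans (ℕ.^-*-assoc 2 (ceilLog n) s) (≡.cong (2 ^_) (ℕ.*-comm (ceilLog n) s))))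

    6Z≤ : ∀ n → 6 * Z n ≤ 5 ^ exponent n
    6Z≤ n = ℕ.≤-trans (ℕ.*-monoʳ-≤ 6 (ℕ.+-mono-≤ 1≤w (ℕ.≤-trans (n^s≤ n) (ℕ.^-monoˡ-≤ (s * ceilLog n) (ℕ.m≤m+n 2 3)))))
      (ℕ.≤-trans (ℕ.≤-reflexive (lem w)) (ℕ.≤-trans (ℕ.*-monoʳ-≤ w (ℕ.m≤m+n 12 13)) (ℕ.≤-reflexive (≡.sym (ℕ.^-distribˡ-+-* 5 (s * ceilLog n) 2)))))
      where
      w = 5 ^ (s * ceilLog n)
      1≤w : 1 ≤ w
      1≤w = ℕ.m^n>0 5 (s * ceilLog n)
      lem : ∀ w → 6 * (w + w) ≡ w * 12
      lem = solve-∀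

    module Rates (n : ℕ) where
      open SamplerProb ℝ (c D n) public

      0≤η : 0# ≤ʳ κ ^ʳ half₀ n
      0≤η = ^-nonneg (half₀ n) 0≤κ

      small : ι (6 * Z n) *ʳ κ ^ʳ half₀ n ≤ʳ 1#
      small = ≤-trans (*-mono-≤ (ι-nonneg (6 * Z n)) 0≤η (ι-mono (6Z≤ n)) ≤-refl) (5κ^≤1 {σ n} (scale-lower n) (exponent n))

      open Rejection (Z n) 0≤η small public using (ρ; g; 2g≈; 1≤ρ; 0≤g; g≤1; fixpoint; ρ^≤2; g^-small)

      parity≤g : ∀ b → parityPr (half₀ n + suc (half₀ n)) b ≤ʳ g
      parity≤g b = ≡.subst (λ j → parityPr j b ≤ʳ g) (≡.sym (ℕ.+-suc (half₀ n) (half₀ n)))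
        (parityPr-+ (half₀ n + half₀ n) 1 (λ b → *-cancelˡ-≤ (0<ι 1) (≤-trans (double-parity (half₀ n) b) (≤-reflexive (R.sym 2g≈)))) b)

    prepareC : Cmd
    prepareC = rejectPrepC s 2 R₀

    scheme : Scheme D
    scheme = record
      { sampler = rejectC ; prepare = prepareC
      ; sampler-reg = λ _ → ≡.refl
      ; sampler-arr = arr-free
      ; prepare-reg = reg-free 8 ≡.refl ≡.refl ∷ reg-free 9 ≡.refl ≡.refl ∷ reg-free 10 ≡.refl ≡.refl ∷
                      reg-free 13 ≡.refl ≡.refl ∷ reg-free 14 ≡.refl ≡.refl ∷ reg-free 15 ≡.refl ≡.refl ∷ []
      ; prepare-arr = prepare-free
      ; half = half ; retries = retries
      ; samplerTime = λ n → Samplers.rejectTime ℝ (c D n) {L n} {0} (retries n)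
      ; prepareTime = λ n → Samplers.rejectPrepTime ℝ (c D n) s 2 R₀ n
      ; 0<half = λ _ → s≤s z≤n
      ; sample = λ n → Samplers.reject ℝ (c D n) (L n) (retries n)
      ; samplerT = λ n σ x v L≡ R≡ x≡ v≡ → Samplers.rejectT ℝ (c D n) {L n} {v} {retries n} σ x L≡ R≡ x≡ v≡
      ; prepareT = λ n σ n≡ sc≡ → Compiler.postT ℝ (c D n) (Samplers.rejectPrepT ℝ (c D n) s 2 R₀ {n} {scale D n} σ n≡ sc≡)
          λ { _ _ (L≡ , R≡) _ → ≡.trans L≡ (lem (half₀ n)) , ≡.trans R≡ (≡.cong (_+ R₀) (lem (half₀ n))) }
      ; ρ = λ n → Rates.ρ n ; φ = λ n → Rates.g n ^ʳ retries n
      ; 0≤ρ = λ n → ≤-trans 0≤1 (Rates.1≤ρ n)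
      ; marginal = λ n x i i< F 0≤F → Rates.reject-marginal n {half₀ n + half n} (Rates.parity≤g n) x (Rates.1≤ρ n) (Rates.fixpoint n) (retries n) i i< F 0≤F
      ; failure = λ n x → Rates.reject-failure n {half₀ n + half n} (Rates.parity≤g n) x (Rates.g≤1 n) (retries n) }
      where
      lem : ∀ h → (h + h) + 2 ≡ suc h + suc h
      lem = solve-∀
      arr-free : ∀ i → (i ℕ.≡ᵇ 10) ≡ false → writesArr rejectC i ≡ false
      arr-free i eq rewrite eq = ≡.refl
      addC = blk (add 3 3 0 ∷ [])
        where open import Data.List.Base using ([]; _∷_)
      reg-free : ∀ i → writesReg addC i ≡ false → writesReg (rejectPrepC 0 2 R₀) i ≡ false → writesReg prepareC i ≡ false
      reg-free i h h′ rewrite repC-reg s addC i h = h′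
      prepare-free : ∀ i → writesArr prepareC i ≡ false
      prepare-free i rewrite repC-arr s addC i ≡.refl = ≡.refl

    open Scheme scheme using (samplerTime; prepareTime)

    module Costs (n : ℕ) (2≤s : 2 ≤ s) (s<k : s < k) (k≤n : k ≤ n) (1≤σ : 1 ≤ σ n) where
      open Budget n k s 2≤s s<k k≤n

      2≤L : 2 ≤ L n
      2≤L = ℕ.+-mono-≤ {1} {half n} (s≤s z≤n) (s≤s z≤n)

      sampler≤ : n ^ s * samplerTime n ≤ 829 * (L n * L n) * B
      sampler≤ = bounded (L n) (n ^ s) 2≤L n^s≤B kkn^s≤B
        where
        bounded : ∀ l y → 2 ≤ l → y ≤ B → k * k * y ≤ B → y * (15 + l * 41 + (7 + ((l + R₀) * (44 + l * 41) + 1))) ≤ 829 * (l * l) * B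
        bounded l y 2≤l y≤ ky≤ = ℕ.≤-trans (ℕ.*-monoʳ-≤ y one) (ℕ.≤-trans (ℕ.≤-reflexive (lem₂ y (l * l) k))
            (ℕ.≤-trans (ℕ.*-monoʳ-≤ (l * l) (ℕ.+-mono-≤ (ℕ.*-monoʳ-≤ 659 y≤) (ℕ.*-monoʳ-≤ 126 ky≤)))
              (ℕ.≤-trans (ℕ.≤-reflexive (lem₃ (l * l) B)) (ℕ.*-monoˡ-≤ B (ℕ.*-monoˡ-≤ (l * l) (ℕ.m≤m+n 785 44))))))
          where
          1≤l : 1 ≤ l
          1≤l = ℕ.≤-trans (s≤s z≤n) 2≤l
          l≤ll : l ≤ l * l
          l≤ll = ℕ.m≤m*n l l {{ℕ.>-nonZero 1≤l}}
          1≤ll : 1 ≤ l * l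
          1≤ll = ℕ.≤-trans 1≤l l≤ll
          lem₁ : ∀ l k → 15 + l * 41 + (7 + ((l + 2 * (3 + k * k)) * (44 + l * 41) + 1)) ≡
            287 * 1 + 331 * l + 41 * (l * l) + (k * k) * (88 * 1 + 82 * l)
          lem₁ = solve-∀
          one : 15 + l * 41 + (7 + ((l + R₀) * (44 + l * 41) + 1)) ≤ 287 * (l * l) + 331 * (l * l) + 41 * (l * l) + (k * k) * (44 * (l * l) + 82 * (l * l))
          one = ℕ.≤-trans (ℕ.≤-reflexive (lem₁ l k)) (ℕ.+-mono-≤
            (ℕ.+-monoˡ-≤ (41 * (l * l)) (ℕ.+-mono-≤ (ℕ.*-monoʳ-≤ 287 1≤ll) (ℕ.*-monoʳ-≤ 331 l≤ll)))
            (ℕ.*-monoʳ-≤ (k * k) (ℕ.+-mono-≤ (ℕ.≤-trans (ℕ.≤-trans (ℕ.*-monoʳ-≤ 44 2≤l) (ℕ.*-monoʳ-≤ 44 l≤ll)) ℕ.≤-refl) (ℕ.*-monoʳ-≤ 82 l≤ll))))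
          lem₂ : ∀ y w k → y * (287 * w + 331 * w + 41 * w + (k * k) * (44 * w + 82 * w)) ≡ w * (659 * y + 126 * (k * k * y))
          lem₂ = solve-∀
          lem₃ : ∀ w B → w * (659 * B + 126 * B) ≡ 785 * w * B
          lem₃ = solve-∀

      exponent≤L : exponent n ≤ L n
      exponent≤L = ℕ.≤-trans (ℕ.m≤m*n (exponent n) (σ n) {{ℕ.>-nonZero 1≤σ}}) (ℕ.≤-trans (ℕ.n≤1+n (half₀ n)) (ℕ.m≤m+n (half n) (half n)))

      prepare≤ : prepareTime n ≤ 134 * (L n * B)
      prepare≤ = ℕ.≤-trans (ℕ.+-mono-≤ (ℕ.+-mono-≤ (ℕ.+-mono-≤ (ℕ.*-monoʳ-≤ 86 1≤LB)
          (ℕ.≤-trans (ℕ.≤-reflexive (ℕ.*-comm n 29)) (ℕ.*-monoʳ-≤ 29 (ℕ.≤-trans n≤B B≤LB))))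
          (ℕ.≤-trans (ℕ.≤-reflexive (ℕ.*-comm s 7)) (ℕ.*-monoʳ-≤ 7 (ℕ.≤-trans s≤B B≤LB))))
          (ℕ.≤-trans (ℕ.≤-reflexive (ℕ.*-comm (exponent n) 12)) (ℕ.*-monoʳ-≤ 12 (ℕ.≤-trans exponent≤L (ℕ.m≤m*n (L n) B {{B≢0}})))))
        (ℕ.≤-reflexive (lem (L n * B)))
        where
        B≤LB : B ≤ L n * B
        B≤LB = ℕ.m≤n*m B (L n) {{ℕ.>-nonZero (ℕ.<⇒≤ 2≤L)}}
        1≤LB : 1 ≤ L n * B
        1≤LB = ℕ.≤-trans 1≤B B≤LB
        lem : ∀ y → 86 * y + 29 * y + 7 * y + 12 * y ≡ 134 * y
        lem = solve-∀

      retries-enough : 2 ^ retries n * (6 * (k + k) ^ k * n ^ s) ≤ 3 ^ retries n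
      retries-enough = ℕ.≤-trans (ℕ.≤-reflexive (≡.cong (λ r → 2 ^ r * (6 * (k + k) ^ k * n ^ s)) R≡))
        (ℕ.≤-trans (ℕ.≤-trans (ℕ.*-mono-≤ (ℕ.≤-reflexive (≡.sym (ℕ.^-*-assoc 2 2 w))) few)
            (ℕ.≤-trans (ℕ.≤-reflexive (≡.sym (^-distrib 4 2 w))) (ℕ.^-monoˡ-≤ w (ℕ.n≤1+n 8))))
          (ℕ.≤-reflexive (≡.trans (ℕ.^-*-assoc 3 2 w) (≡.cong (3 ^_) (≡.sym R≡)))))
        where
        w = half n + (3 + k * k)
        R≡ : retries n ≡ 2 * w
        R≡ = lem (half n) (3 + k * k)
          where
          lem : ∀ h r → h + h + 2 * r ≡ 2 * (h + r)
          lem = solve-∀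
        few : 6 * (k + k) ^ k * n ^ s ≤ 2 ^ w
        few = ℕ.≤-trans (ℕ.*-mono-≤ (ℕ.*-mono-≤ (ℕ.m≤m+n 6 2) (ℕ.≤-trans (ℕ.^-monoˡ-≤ k (2k≤2^k k (ℕ.≤-trans (s≤s z≤n) s<k))) (ℕ.≤-reflexive (ℕ.^-*-assoc 2 k k)))) (n^s≤ n))
          (ℕ.≤-trans (ℕ.≤-reflexive (≡.trans (≡.cong (_* 2 ^ (s * ceilLog n)) (≡.sym (ℕ.^-distribˡ-+-* 2 3 (k * k))))
              (≡.trans (≡.sym (ℕ.^-distribˡ-+-* 2 (3 + k * k) (s * ceilLog n))) (≡.cong (2 ^_) (ℕ.+-comm (3 + k * k) _)))))
            (ℕ.^-monoʳ-≤ 2 (ℕ.+-monoˡ-≤ (3 + k * k) (ℕ.≤-trans (ℕ.m≤m+n _ 2) (ℕ.≤-trans (ℕ.m≤m*n (exponent n) (σ n) {{ℕ.>-nonZero 1≤σ}}) (ℕ.n≤1+n _))))))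

module EdgeParity (ℝ : Reals) where
  open import Data.Nat.Base using (_+_; _*_; _^_; _<_)
  open Model ℝ hiding (_+_; _-_; _*_; _^_; _<_; program)
  open Model ℝ using () renaming (_*_ to _*ʳ_; _<_ to _<ʳ_)
  open RealFacts ℝ
  open Expectation ℝ
  open Algorithms ℝ
  open SetupCommands ℝ
  open Language ℝ using (sumTo)

  module _ {D : Density} (s : ℕ) where
    tree : ∀ n → Hypergraph n s → Dist ℕ
    tree n G = return (b2n (topXor (n ^ s) (bitAt (map G (choose n s)))))

    tree≡ : ∀ n (G : Hypergraph n s) → b2n (topXor (n ^ s) (bitAt (map G (choose n s)))) ≡ cliqueParity s G
    tree≡ n G = ≡.sym (≡.trans (cliqueParity≡ s G) (≡.cong b2n (≡.trans (parity-of-edges G)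
      (≡.trans (≡.sym (xors-map G (choose n s))) (≡.trans (≡.sym (topXor-bits bs))
        (≡.trans (≡.sym (topXor-beyond bs (n ^ s ℕ.∸ length bs)))
          (≡.cong (λ j → topXor j (bitAt bs)) (ℕ.m∸n+n≡m (ℕ.≤-trans (ℕ.≤-reflexive (length-map G (choose n s))) (length-choose n s))))))))))
      where
      bs = map G (choose n s)

    bound : ℕ → ℕ
    bound n = 2 + ((22 + (7 + sumTo s (λ _ → 22 + n * 12)) + n ^ s * 33) + 3)

    exec≡tree : ∀ n (G : Hypergraph n s) u →
      exec (c D n) (program (countEdgesC s)) (bound n + u) (initial D G) ≡ (tree n G >>= λ x → return (just x))
    exec≡tree n G = Compiler.exec≡ (Preparation.programT ℝ (c D n) (postT (mapT (λ _ → b2n (topXor (n ^ s) (bitAt bs)))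
        (Preparation.countEdgesT ℝ (c D n) {n} {bitAt bs} s _ ≡.refl λ i y _ → initial-mem D G (y * 16 + i)))
      λ { _ _ (_ , ≡.refl , q) _ → q }))
      where
      open Main ℝ (c D n)
      bs = map G (choose n s)

    B : Algorithm D s
    B = algorithm D s (program (countEdgesC s)) bound tree exec≡tree

    B-error : ∀ n (G : Hypergraph n s) → errorOn B s G <1/ ι 3
    B-error n G = <-respˡ (R.sym (R.trans (R.*-congʳ (R.trans (algorithm-error D s (program (countEdgesC s)) bound tree exec≡tree n G)
        (R.reflexive (≡.trans (≡.cong (wrong (cliqueParity s G)) (tree≡ n G)) (never (cliqueParity s G)))))) (R.zeroˡ (ι 3)))) 0<1
      where
      never : ∀ v → wrong v v ≡ 0#
      never v rewrite ≡ᵇ-refl v = ≡.refl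

    B-time : ∀ n t → 2 ≤ s → 1 ≤ t → T B n ≤ 101 * s * (t + (n * s) ^ s)
    B-time n t 2≤s 1≤t = ℕ.≤-trans (algorithm-time D s (program (countEdgesC s)) bound tree exec≡tree n) (ℕ.≤-trans
        (ℕ.≤-reflexive (≡.trans (≡.cong (λ x → 2 + ((22 + (7 + x) + n ^ s * 33) + 3)) (sum-const s)) (lem₁ s n (n ^ s))))
      (ℕ.≤-trans (ℕ.+-mono-≤ (ℕ.+-mono-≤ (ℕ.+-mono-≤ (ℕ.*-monoʳ-≤ 34 1≤sX) (ℕ.*-monoʳ-≤ 22 (ℕ.m≤m*n s X {{X≢0}})))
          (ℕ.*-monoʳ-≤ 12 (ℕ.*-monoʳ-≤ s (ℕ.≤-trans (n≤ n) (ℕ.m≤n+m _ t)))))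
          (ℕ.*-monoʳ-≤ 33 (ℕ.≤-trans (ℕ.^-monoˡ-≤ s (ℕ.m≤m*n n s)) (ℕ.≤-trans (ℕ.m≤n+m _ t) (ℕ.m≤n*m X s)))))
        (ℕ.≤-reflexive (lem₂ s X))))
      where
      X = t + (n * s) ^ s
      X≢0 : NonZero X
      X≢0 = ℕ.>-nonZero (ℕ.≤-trans 1≤t (ℕ.m≤m+n t _))
      instance
        s≢0 : NonZero s
        s≢0 = ℕ.>-nonZero (ℕ.<⇒≤ 2≤s)
      1≤sX : 1 ≤ s * X
      1≤sX = ℕ.≤-trans (ℕ.≤-trans 1≤t (ℕ.m≤m+n t _)) (ℕ.m≤n*m X s)
      n≤ : ∀ n → n ≤ (n * s) ^ s
      n≤ zero      = z≤n
      n≤ n@(suc _) = ℕ.≤-trans (ℕ.m≤m*n n s) (ℕ.≤-trans (ℕ.≤-reflexive (≡.sym (ℕ.^-identityʳ (n * s))))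
        (ℕ.^-monoʳ-≤ (n * s) {{ℕ.m*n≢0 n s}} (ℕ.<⇒≤ 2≤s)))
      sum-const : ∀ j → sumTo j (λ _ → 22 + n * 12) ≡ j * (22 + n * 12)
      sum-const zero    = ≡.refl
      sum-const (suc j) = ≡.cong (22 + n * 12 +_) (sum-const j)
      lem₁ : ∀ s n y → 2 + ((22 + (7 + s * (22 + n * 12)) + y * 33) + 3) ≡ 34 * 1 + 22 * s + 12 * (s * n) + 33 * y
      lem₁ = solve-∀
      lem₂ : ∀ s x → 34 * (s * x) + 22 * (s * x) + 12 * (s * x) + 33 * (s * x) ≡ 101 * s * x
      lem₂ = solve-∀

-- The bounds of the theorem

module Statements (ℝ : Reals) where
  open import Data.Nat.Base using (_+_; _*_; _^_; _<_)
  open Model ℝ hiding (_+_; _-_; _*_; _^_; _<_)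
  open Model ℝ using () renaming (_+_ to _+ʳ_; _-_ to _-ʳ_; _*_ to _*ʳ_; _^_ to _^ʳ_; _<_ to _<ʳ_)
  open RealFacts ℝ
  open RealOrder ℝ
  open Bounds ℝ
  open Expectation ℝ
  open Algorithms ℝ
  open Conclusion ℝ
  open SchemeInstances ℝ

  ceilLog≤4log : ∀ n → 2 ≤ n → ι (ceilLog n) ≤ʳ ι 4 *ʳ logℕ n
  ceilLog≤4log n 2≤n with ceilLog n in eq
  ... | zero  = ≤-trans (<⇒≤ 0<1) (≤-trans (1≤2log n 2≤n) (≤-trans (≤-reflexive (R.sym (R.+-identityʳ _)))
          (≤-trans (+-mono-≤ ≤-refl (≤-trans (<⇒≤ 0<1) (1≤2log n 2≤n)))
            (≤-reflexive (solve 1 (λ x → num 2 :* x :+ num 2 :* x := num 4 :* x) R.refl (logℕ n))))))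
  ... | suc l = begin
    1# +ʳ ι l                              ≲⟨ +-mono-≤ (1≤2log n 2≤n) l≤ ⟩
    ι 2 *ʳ logℕ n +ʳ ι 2 *ʳ logℕ n         ≈⟨ solve 1 (λ x → num 2 :* x :+ num 2 :* x := num 4 :* x) R.refl (logℕ n) ⟩
    ι 4 *ʳ logℕ n                          ∎
    where
    l≤ : ι l ≤ʳ ι 2 *ʳ logℕ n
    l≤ = begin
      ι l                          ≈⟨ R.*-identityʳ (ι l) ⟨
      ι l *ʳ 1#                    ≲⟨ *-monoˡ-≤ (ι-nonneg l) (1≤2log 2 ℕ.≤-refl) ⟩
      ι l *ʳ (ι 2 *ʳ logℕ 2)       ≈⟨ solve 2 (λ l x → l :* (num 2 :* x) := num 2 :* (l :* x)) R.refl (ι l) (logℕ 2) ⟩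
      ι 2 *ʳ (ι l *ʳ logℕ 2)       ≈⟨ R.*-congˡ (logℕ-^ 2 l) ⟨
      ι 2 *ʳ logℕ (2 ^ l)          ≲⟨ *-monoˡ-≤ (ι-nonneg 2) (logℕ-mono (2 ^ l) n {{ℕ.m^n≢0 2 l}} (ℕ.<⇒≤ (2^<n n l eq))) ⟩
      ι 2 *ʳ logℕ n                ∎

  module _ (D : Density) (n : ℕ) where
    private
      q = c D n
      σ = scale D n

    1≤scale : 1 ≤ σ
    1≤scale with scale D n | Density.scale-lower D n
    ... | zero  | h = contradiction (<-trans 0<1 (<-respʳ (R.zeroˡ _) h)) ≤-refl
    ... | suc _ | _ = s≤s z≤n

    scale≤ : ι σ ≤ʳ ι 3 *ʳ (1/ q *ʳ 1/1- q)
    scale≤ = begin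
      ι σ                                                 ≈⟨ R.trans (R.*-congˡ (R.*-cong (*-inv _ (0<p q)) (*-inv _ 0<co))) (R.trans (R.*-congˡ (R.*-identityˡ 1#)) (R.*-identityʳ (ι σ))) ⟨
      ι σ *ʳ ((value q *ʳ 1/ q) *ʳ (co q *ʳ 1/1- q))      ≈⟨ solve 5 (λ s p i c j → s :* ((p :* i) :* (c :* j)) := (s :* (p :* c)) :* (i :* j)) R.refl
                                                               (ι σ) (value q) (1/ q) (co q) (1/1- q) ⟩
      (ι σ *ʳ spread) *ʳ (1/ q *ʳ 1/1- q)                 ≲⟨ *-mono-≤ (*-nonneg (ι-nonneg σ) 0≤spread) (*-nonneg 0≤i 0≤j) upper ≤-refl ⟩
      ι 3 *ʳ (1/ q *ʳ 1/1- q)                             ∎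
      where
      0<co : 0# <ʳ co q
      0<co = x<y⇒0<y-x (p<1 q)
      spread = value q *ʳ co q
      0≤i : 0# ≤ʳ 1/ q
      0≤i = <⇒≤ (inv-pos _ (0<p q))
      0≤j : 0# ≤ʳ 1/1- q
      0≤j = <⇒≤ (inv-pos _ 0<co)
      0≤spread : 0# ≤ʳ spread
      0≤spread = <⇒≤ (*-pos (0<p q) 0<co)
      co≤1 : co q ≤ʳ 1#
      co≤1 = ≤-trans (≤-reflexive (R.sym (R.+-identityˡ _))) (≤-trans (+-monoˡ-≤ (co q) (<⇒≤ (0<p q))) (≤-reflexive (p+co q)))
      upper : ι σ *ʳ spread ≤ʳ ι 3
      upper = ≤-trans (<⇒≤ (Density.scale-upper D n)) (≤-trans
        (+-mono-≤ ≤-refl (*-monoˡ-≤ (ι-nonneg 2) (*-mono-≤ (<⇒≤ (0<p q)) 0≤1 (<⇒≤ (p<1 q)) co≤1)))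
        (≤-reflexive (solve 0 (con 1 :+ num 2 :* (con 1 :* con 1) := num 3) R.refl)))

    loglog-binomial : ∀ s k → 2 ≤ s → s ≤ k → 0# ≤ʳ loglogℕ (k C s)
    loglog-binomial s k 2≤s s≤k with s ℕ.≟ k
    ... | yes ≡.refl = ≤-reflexive (R.sym (R.reflexive (≡.cong loglogℕ (nCn≡1 s))))
    ... | no s≢k = loglog-nonneg (k C s) (ℕ.≤-trans (ℕ.≤-trans (s≤s 2≤s) s<k) (k≤kCs k s s<k (ℕ.<⇒≤ 2≤s)))
      where
      s<k : s < k
      s<k = ℕ.≤∧≢⇒< s≤k s≢k

    Υ₁-base : ∀ K₀ s k → 2 ≤ s → s ≤ k → 2 ≤ n → ι (K₀ * (s * (s * (ceilLog n * σ)))) ≤ʳ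
      ι 24 *ʳ ι K₀ *ʳ 1/ q *ʳ 1/1- q *ʳ (ι s *ʳ logℕ k) *ʳ (ι s *ʳ logℕ n +ʳ ι (k C s) *ʳ loglogℕ (k C s))
    Υ₁-base K₀ s k 2≤s s≤k 2≤n = begin
      ι (K₀ * (s * (s * (l * σ))))
        ≈⟨ R.trans (ι-* K₀ _) (R.*-congˡ (R.trans (ι-* s _) (R.*-congˡ (R.trans (ι-* s _) (R.*-congˡ (ι-* l σ)))))) ⟩
      ι K₀ *ʳ (ι s *ʳ (ι s *ʳ (ι l *ʳ ι σ)))
        ≈⟨ solve 4 (λ K₀ s l σ → K₀ :* (s :* (s :* (l :* σ))) := (K₀ :* (s :* s)) :* ((l :* σ) :* con 1)) R.refl (ι K₀) (ι s) (ι l) (ι σ) ⟩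
      ι K₀ *ʳ (ι s *ʳ ι s) *ʳ ((ι l *ʳ ι σ) *ʳ 1#)
        ≲⟨ *-monoˡ-≤ (*-nonneg (ι-nonneg K₀) (*-nonneg (ι-nonneg s) (ι-nonneg s)))
             (*-mono-≤ (*-nonneg (ι-nonneg l) (ι-nonneg σ)) (*-nonneg (ι-nonneg 2) 0≤logk)
               (*-mono-≤ (ι-nonneg l) (*-nonneg (ι-nonneg 3) 0≤ij) (ceilLog≤4log n 2≤n) scale≤) (1≤2log k 2≤k)) ⟩
      ι K₀ *ʳ (ι s *ʳ ι s) *ʳ ((ι 4 *ʳ logℕ n *ʳ (ι 3 *ʳ (1/ q *ʳ 1/1- q))) *ʳ (ι 2 *ʳ logℕ k))
        ≈⟨ solve 6 (λ K₀ s x i j y → K₀ :* (s :* s) :* ((num 4 :* x :* (num 3 :* (i :* j))) :* (num 2 :* y)) :=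
             num 24 :* K₀ :* i :* j :* (s :* y) :* (s :* x :+ con 0)) R.refl (ι K₀) (ι s) (logℕ n) (1/ q) (1/1- q) (logℕ k) ⟩
      ι 24 *ʳ ι K₀ *ʳ 1/ q *ʳ 1/1- q *ʳ (ι s *ʳ logℕ k) *ʳ (ι s *ʳ logℕ n +ʳ 0#)
        ≲⟨ *-monoˡ-≤ (*-nonneg (*-nonneg (*-nonneg (*-nonneg (ι-nonneg 24) (ι-nonneg K₀)) 0≤i) 0≤j) (*-nonneg (ι-nonneg s) 0≤logk))
             (+-mono-≤ ≤-refl (*-nonneg (ι-nonneg (k C s)) (loglog-binomial s k 2≤s s≤k))) ⟩
      ι 24 *ʳ ι K₀ *ʳ 1/ q *ʳ 1/1- q *ʳ (ι s *ʳ logℕ k) *ʳ (ι s *ʳ logℕ n +ʳ ι (k C s) *ʳ loglogℕ (k C s)) ∎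
      where
      l = ceilLog n
      2≤k : 2 ≤ k
      2≤k = ℕ.≤-trans 2≤s s≤k
      0≤i : 0# ≤ʳ 1/ q
      0≤i = <⇒≤ (inv-pos _ (0<p q))
      0≤j : 0# ≤ʳ 1/1- q
      0≤j = <⇒≤ (inv-pos _ (x<y⇒0<y-x (p<1 q)))
      0≤ij : 0# ≤ʳ 1/ q *ʳ 1/1- q
      0≤ij = *-nonneg 0≤i 0≤j
      0≤logk : 0# ≤ʳ logℕ k
      0≤logk = log-nonneg k 2≤k
        where
        log-nonneg : ∀ k → 2 ≤ k → 0# ≤ʳ logℕ k
        log-nonneg k 2≤k = *-cancelˡ-≤ (0<ι 1) (≤-trans (≤-reflexive (R.zeroʳ _)) (≤-trans 0≤1 (1≤2log k 2≤k)))

  Υ₂-base : ∀ K₀ s k → 2 ≤ k → ι (K₀ * s) ≤ʳ ι 2 *ʳ ι K₀ *ʳ ι s *ʳ logℕ k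
  Υ₂-base K₀ s k 2≤k = begin
    ι (K₀ * s)                         ≈⟨ R.trans (ι-* K₀ s) (R.sym (R.*-identityʳ _)) ⟩
    ι K₀ *ʳ ι s *ʳ 1#                  ≲⟨ *-monoˡ-≤ (*-nonneg (ι-nonneg K₀) (ι-nonneg s)) (1≤2log k 2≤k) ⟩
    ι K₀ *ʳ ι s *ʳ (ι 2 *ʳ logℕ k)     ≈⟨ solve 3 (λ K₀ s y → K₀ :* s :* (num 2 :* y) := num 2 :* K₀ :* s :* y) R.refl (ι K₀) (ι s) (logℕ k) ⟩
    ι 2 *ʳ ι K₀ *ʳ ι s *ʳ logℕ k       ∎

  power-≤ : ∀ z b {x} → ι z ≤ʳ x → ι (z ^ b) ≤ʳ x ^ʳ b
  power-≤ z b h = ≤-trans (≤-reflexive (ι-^ z b)) (^-mono b (ι-nonneg z) h)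

  time-≤ : ∀ {t} z X {Υ} → t ≤ z * X → ι z ≤ʳ Υ → ι t ≤ʳ Υ *ʳ ι X
  time-≤ z X h h′ = ≤-trans (ι-mono h) (≤-trans (≤-reflexive (ι-* z X))
    (*-mono-≤ (ι-nonneg z) (ι-nonneg X) h′ ≤-refl))

  error-≤ : ∀ {D s} (A : Algorithm D s) k n z {Υ} → ι z ≤ʳ Υ → averageError A k n *ʳ Υ <ʳ 1# → averageError A k n *ʳ ι z <ʳ 1#
  error-≤ A k n z h = ≤-<-trans (*-monoˡ-≤ (averageError-nonneg A k n) h)

  edges-time : ∀ s z t X → 101 * s ≤ z → t ≤ 101 * s * X → t ≤ z ^ (s C s) * X
  edges-time s z t X h t≤ = ℕ.≤-trans t≤ (ℕ.*-monoˡ-≤ X (ℕ.≤-trans h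
    (ℕ.≤-reflexive (≡.trans (≡.sym (ℕ.^-identityʳ z)) (≡.cong (z ^_) (≡.sym (nCn≡1 s)))))))

  module Part₁ (K₀ : ℕ) (large : 200000 ≤ K₀) where
    K : Carrier
    K = ι 24 *ʳ ι K₀

    0<K : 0# <ʳ K
    0<K = *-pos (0<ι 23) (ι-pos K₀ {{ℕ.>-nonZero (ℕ.≤-trans (s≤s z≤n) large)}})

    module _ (D : Density) (s k : ℕ) where
      Conclusion₁ : Algorithm D s → Set
      Conclusion₁ A = ∃ λ (B : Algorithm D s) → (∀ n (G : Hypergraph n s) → errorOn B k G <1/ ι 3) ×
        (∀ n → 2 ≤ n → ι (T B n) ≤ʳ Υ₁ K n (c D n) s k *ʳ ι (T A (n * k) + (n * k) ^ s))

    module _ (D : Density) (s k : ℕ) (2≤s : 2 ≤ s) (s≤k : s ≤ k) where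
      z : ℕ → ℕ
      z n = K₀ * (s * (s * (ceilLog n * scale D n)))

      z≤Υ : ∀ n → 2 ≤ n → ι (z n ^ (k C s)) ≤ʳ Υ₁ K n (c D n) s k
      z≤Υ n 2≤n = power-≤ (z n) (k C s) (Υ₁-base D n K₀ s k 2≤s s≤k 2≤n)

      1≤lσ : ∀ n → 2 ≤ n → 1 ≤ ceilLog n * scale D n
      1≤lσ n 2≤n = ℕ.*-mono-≤ {1} {ceilLog n} (0<ceilLog n 2≤n) (1≤scale D n)

      s≤z : ∀ n → 2 ≤ n → 200000 * s ≤ z n
      s≤z n 2≤n = ℕ.*-mono-≤ large (ℕ.m≤m*n s _ {{ℕ.>-nonZero (ℕ.*-mono-≤ {1} {s} (ℕ.<⇒≤ 2≤s) (1≤lσ n 2≤n))}})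

      edges≤z : ∀ n → 2 ≤ n → 101 * s ≤ z n
      edges≤z n 2≤n = ℕ.≤-trans (ℕ.*-monoˡ-≤ s (ℕ.≤ᵇ⇒≤ 101 200000 _)) (s≤z n 2≤n)

      43≤z : ∀ n → 2 ≤ n → 43 ≤ z n
      43≤z n 2≤n = ℕ.≤-trans (ℕ.≤-trans (ℕ.≤ᵇ⇒≤ 43 101 _) (ℕ.m≤m*n 101 s {{ℕ.>-nonZero (ℕ.<⇒≤ 2≤s)}})) (edges≤z n 2≤n)

      L≤z : ∀ n → 2 ≤ n → 40000 * s * RejectScheme.L D s k n ≤ z n
      L≤z n 2≤n = ℕ.≤-trans (ℕ.*-monoʳ-≤ (40000 * s) (ℕ.≤-trans (ℕ.≤-reflexive (lem₁ s l σ)) (ℕ.≤-trans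
          (ℕ.+-mono-≤ (ℕ.+-monoˡ-≤ (2 * (s * (l * σ))) 2≤slσ) (ℕ.*-monoʳ-≤ 2 2σ≤)) (ℕ.≤-reflexive (lem₂ (s * (l * σ)))))))
        (ℕ.≤-trans (ℕ.≤-reflexive (lem₃ 40000 s (s * (l * σ)))) (ℕ.*-monoˡ-≤ (s * (s * (l * σ))) large))
        where
        l = ceilLog n
        σ = scale D n
        2≤slσ : 2 ≤ s * (l * σ)
        2≤slσ = ℕ.*-mono-≤ {2} {s} {1} 2≤s (1≤lσ n 2≤n)
        2σ≤ : 2 * σ ≤ s * (l * σ)
        2σ≤ = ℕ.*-mono-≤ 2≤s (ℕ.m≤n*m σ l {{ℕ.>-nonZero (0<ceilLog n 2≤n)}})
        lem₁ : ∀ s l σ → suc ((s * l + 2) * σ) + suc ((s * l + 2) * σ) ≡ 2 + 2 * (s * (l * σ)) + 2 * (2 * σ)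
        lem₁ = solve-∀
        lem₂ : ∀ x → x + 2 * x + 2 * x ≡ 5 * x
        lem₂ = solve-∀
        lem₃ : ∀ a s x → a * s * (5 * x) ≡ a * 5 * (s * x)
        lem₃ = solve-∀

    edges : ∀ D s (2≤s : 2 ≤ s) (A : Algorithm D s) → Conclusion₁ D s s A
    edges D s 2≤s A = EdgeParity.B ℝ s , EdgeParity.B-error ℝ s , λ n 2≤n →
      time-≤ {T (EdgeParity.B ℝ {D} s) n} (z D s s 2≤s ℕ.≤-refl n ^ (s C s)) (T A (n * s) + (n * s) ^ s) {Υ₁ K n (c D n) s s}
        (edges-time s (z D s s 2≤s ℕ.≤-refl n) (T (EdgeParity.B ℝ {D} s) n) (T A (n * s) + (n * s) ^ s) (edges≤z D s s 2≤s ℕ.≤-refl n 2≤n)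
          (EdgeParity.B-time ℝ {D} s n (T A (n * s)) 2≤s (1≤T A (n * s))))
        (z≤Υ D s s 2≤s ℕ.≤-refl n 2≤n)

    module _ (D : Density) (s₂ k : ℕ) (s<k : 2 + s₂ < k) (A : Algorithm D (2 + s₂)) where
      private
        s = 2 + s₂
        2≤s : 2 ≤ s
        2≤s = s≤s (s≤s z≤n)
        2≤ : ∀ {n} → k ≤ n → 2 ≤ n
        2≤ k≤n = ℕ.≤-trans 2≤s (ℕ.≤-trans (ℕ.<⇒≤ s<k) k≤n)
        module S = RejectScheme D s k
        module Costs n k≤n = S.Costs n 2≤s s<k k≤n (1≤scale D n)
        module W = Reduce.Within S.scheme s₂ k s<k A Costs.sampler≤ Costs.prepare≤

      cliques : NonDecreasing (T A) → (∀ n → 2 ≤ n → averageError A k n <1/ Υ₁ K n (c D n) s k) → Conclusion₁ D s k A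
      cliques mono accurate = W.B ,
        (λ n G → W.B-error n G (^-nonneg (S.retries n) (S.Rates.0≤g n)) λ k≤n →
          Z n , L≤z D s k 2≤s (ℕ.<⇒≤ s<k) n (2≤ k≤n) ,
          error-≤ A k n (Z n ^ (k C s)) (z≤Υ D s k 2≤s (ℕ.<⇒≤ s<k) n (2≤ k≤n)) (accurate n (2≤ k≤n)) ,
          S.Rates.ρ^≤2 n (ℕ.≤-trans (length-choose n s) (ℕ.n≤1+n (n ^ s))) ,
          S.Rates.g^-small n (S.retries n) (6 * (k + k) ^ k * n ^ s) (Costs.retries-enough n k≤n)) ,
        λ n 2≤n → time-≤ (Z n ^ (k C s)) _
          (W.B-time mono n (Z n) (λ _ → L≤z D s k 2≤s (ℕ.<⇒≤ s<k) n 2≤n) (43≤z D s k 2≤s (ℕ.<⇒≤ s<k) n 2≤n))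
          (z≤Υ D s k 2≤s (ℕ.<⇒≤ s<k) n 2≤n)
        where
        Z : ℕ → ℕ
        Z = z D s k 2≤s (ℕ.<⇒≤ s<k)

    statement : ∀ s k → 2 ≤ s → s ≤ k → ∀ D (A : Algorithm D s) → NonDecreasing (T A) →
      (∀ n → 2 ≤ n → averageError A k n <1/ Υ₁ K n (c D n) s k) → Conclusion₁ D s k A
    statement s k 2≤s s≤k D A mono accurate with s ℕ.≟ k
    ... | yes ≡.refl = edges D s 2≤s A
    statement (suc zero) k (s≤s ()) s≤k D A mono accurate | no s≢k
    statement (suc (suc s₂)) k 2≤s s≤k D A mono accurate | no s≢k = cliques D s₂ k (ℕ.≤∧≢⇒< s≤k s≢k) A mono accurate

  module Part₂ (K₀ : ℕ) (large : 200000 ≤ K₀) where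
    K : Carrier
    K = ι 2 *ʳ ι K₀

    0<K : 0# <ʳ K
    0<K = *-pos (0<ι 1) (ι-pos K₀ {{ℕ.>-nonZero (ℕ.≤-trans (s≤s z≤n) large)}})

    z≤Υ : ∀ s k → 2 ≤ k → ι ((K₀ * s) ^ (k C s)) ≤ʳ Υ₂ K s k
    z≤Υ s k 2≤k = power-≤ (K₀ * s) (k C s) (Υ₂-base K₀ s k 2≤k)

    edges≤z : ∀ s → 101 * s ≤ K₀ * s
    edges≤z s = ℕ.*-monoˡ-≤ s (ℕ.≤-trans (ℕ.≤ᵇ⇒≤ 101 200000 _) large)

    43≤z : ∀ s → 2 ≤ s → 43 ≤ K₀ * s
    43≤z s 2≤s = ℕ.≤-trans (ℕ.≤-trans (ℕ.≤ᵇ⇒≤ 43 101 _) (ℕ.m≤m*n 101 s {{ℕ.>-nonZero (ℕ.<⇒≤ 2≤s)}})) (edges≤z s)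

    L≤z : ∀ s → 40000 * s * 2 ≤ K₀ * s
    L≤z s = ℕ.≤-trans (ℕ.≤-reflexive (lem 40000 s)) (ℕ.*-monoˡ-≤ s (ℕ.≤-trans (ℕ.≤ᵇ⇒≤ 80000 200000 _) large))
      where
      lem : ∀ a s → a * s * 2 ≡ a * 2 * s
      lem = solve-∀

    module _ (D : Density) (s k : ℕ) where
      Conclusion₂ : Algorithm D s → Set
      Conclusion₂ A = ∃ λ (B : Algorithm D s) → (∀ n (G : Hypergraph n s) → errorOn B k G <1/ ι 3) ×
        (∀ n → ι (T B n) ≤ʳ Υ₂ K s k *ʳ ι (T A (n * k) + (n * k) ^ s))

    edges : ∀ D s → 2 ≤ s → (A : Algorithm D s) → Conclusion₂ D s s A
    edges D s 2≤s A = EdgeParity.B ℝ s , EdgeParity.B-error ℝ s , λ n →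
      time-≤ {T (EdgeParity.B ℝ {D} s) n} ((K₀ * s) ^ (s C s)) (T A (n * s) + (n * s) ^ s) {Υ₂ K s s}
        (edges-time s (K₀ * s) (T (EdgeParity.B ℝ {D} s) n) (T A (n * s) + (n * s) ^ s) (edges≤z s)
          (EdgeParity.B-time ℝ {D} s n (T A (n * s)) 2≤s (1≤T A (n * s))))
        (z≤Υ s s 2≤s)

    module _ (D : Density) (fair : ∀ n → value (c D n) +ʳ value (c D n) ≈ 1#) (s₂ k : ℕ) (s<k : 2 + s₂ < k) (A : Algorithm D (2 + s₂)) where
      private
        s = 2 + s₂
        2≤k : 2 ≤ k
        2≤k = ℕ.≤-trans (s≤s (s≤s z≤n)) (ℕ.<⇒≤ s<k)

      sampler≤ : ∀ n → k ≤ n → n ^ s * 50 ≤ 829 * (2 * 2) * (n * k) ^ s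
      sampler≤ n k≤n = ℕ.≤-trans (ℕ.≤-reflexive (ℕ.*-comm (n ^ s) 50))
        (ℕ.*-mono-≤ (ℕ.≤ᵇ⇒≤ 50 (829 * (2 * 2)) _) (Budget.n^s≤B n k s (s≤s (s≤s z≤n)) s<k k≤n))

      prepare≤ : ∀ n → k ≤ n → 14 ≤ 134 * (2 * (n * k) ^ s)
      prepare≤ n k≤n = ℕ.*-mono-≤ {14} {134} {1} (ℕ.≤ᵇ⇒≤ 14 134 _) (ℕ.*-mono-≤ {1} {2} (s≤s z≤n) (Budget.1≤B n k s (s≤s (s≤s z≤n)) s<k k≤n))

      private
        module W = Reduce.Within (pairScheme D fair) s₂ k s<k A sampler≤ prepare≤

      cliques : NonDecreasing (T A) → (∀ n → averageError A k n <1/ Υ₂ K s k) → Conclusion₂ D s k A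
      cliques mono accurate = W.B ,
        (λ n G → W.B-error n G ≤-refl λ _ →
          K₀ * s , L≤z s , error-≤ A k n ((K₀ * s) ^ (k C s)) (z≤Υ s k 2≤k) (accurate n) ,
          ≤-trans (≤-reflexive (one^ (length (choose n s)))) (≤-trans (≤-reflexive (R.sym ι1)) (ι-mono {1} {2} (s≤s z≤n))) ,
          ≤-trans (≤-reflexive (R.zeroʳ _)) 0≤1) ,
        λ n → time-≤ ((K₀ * s) ^ (k C s)) _
          (W.B-time mono n (K₀ * s) (λ _ → L≤z s) (43≤z s (s≤s (s≤s z≤n))))
          (z≤Υ s k 2≤k)
        where
        one^ : ∀ j → 1# ^ʳ j ≈ 1#
        one^ zero    = R.refl
        one^ (suc j) = R.trans (R.*-identityˡ _) (one^ j)

    statement : ∀ s k → 2 ≤ s → s ≤ k → ∀ D → (∀ n → value (c D n) +ʳ value (c D n) ≈ 1#) → (A : Algorithm D s) → NonDecreasing (T A) →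
      (∀ n → averageError A k n <1/ Υ₂ K s k) → Conclusion₂ D s k A
    statement s k 2≤s s≤k D fair A mono accurate with s ℕ.≟ k
    ... | yes ≡.refl = edges D s 2≤s A
    statement (suc zero) k (s≤s ()) s≤k D fair A mono accurate | no s≢k
    statement (suc (suc s₂)) k 2≤s s≤k D fair A mono accurate | no s≢k = cliques D fair s₂ k (ℕ.≤∧≢⇒< s≤k s≢k) A mono accurate

theorem2p9 : (ℝ : Reals) →
    let open Model ℝ in
    (∃ λ K → 0# < K ×
    (∀ (s k : ℕ) → 2 ≤ s → s ≤ k → (D : Density) (A : Algorithm D s) →
    NonDecreasing (T A) →
    (∀ n → 2 ≤ n → averageError A k n <1/ Υ₁ K n (c D n) s k) →
    ∃ λ (B : Algorithm D s) →
    (∀ n (G : Hypergraph n s) → errorOn B k G <1/ ι 3) ×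
    (∀ n → 2 ≤ n →
    ι (T B n) ≤ʳ Υ₁ K n (c D n) s k * ι (T A (n ℕ.* k) ℕ.+ (n ℕ.* k) ℕ.^ s))))
    ×
    (∃ λ K → 0# < K ×
    (∀ (s k : ℕ) → 2 ≤ s → s ≤ k → (D : Density) →
    (∀ n → value (c D n) + value (c D n) ≈ 1#) →
    (A : Algorithm D s) →
    NonDecreasing (T A) →
    (∀ n → averageError A k n <1/ Υ₂ K s k) →
    ∃ λ (B : Algorithm D s) →
    (∀ n (G : Hypergraph n s) → errorOn B k G <1/ ι 3) ×
    (∀ n →
    ι (T B n) ≤ʳ Υ₂ K s k * ι (T A (n ℕ.* k) ℕ.+ (n ℕ.* k) ℕ.^ s))))
theorem2p9 ℝ = (First.K , First.0<K , First.statement) , (Second.K , Second.0<K , Second.statement)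
  where
  module First  = Statements.Part₁ ℝ 200000 ℕ.≤-refl
  module Second = Statements.Part₂ ℝ 200000 ℕ.≤-refl
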